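{- Let $i$ be a positive integer. A polygon $P\subseteq\mathbb{R}^2$ is a pseudo-integral polygon with $\mathrm{denom}(P)=2$, $i(P)=i$ and $b(P)=2i+7$ if and only if one of the following holds: (a) $P$ is affine unimodular equivalent to \[P_{2,(i,2i+7),a}:=\mathrm{conv}\left(\left(0,\tfrac32\right),\left(0,\tfrac12\right),(a,0),(a+2i+4,0),\left(2i+2,\tfrac12\right)\right)\] for some $a\in\mathbb{Z}$ with $0\le a\le\frac{i-1}{2}$; or (b) $i>1$ and $P$ is affine unimodular equivalent to \[P_{2,(i,2i+7),s}:=\mathrm{conv}\left(\left(0,\tfrac32\right),(0,1),\left(\tfrac12,0\right),(2i+5,0),\left(2i+2,\tfrac12\right)\right);\] or (c) $i=3$ and $P$ is affine unimodular equivalent to \[P_{2,(3,13),s_3}:=\mathrm{conv}\left(\left(0,\tfrac32\right),(0,1),\left(\tfrac12,0\right),\left(\tfrac{23}{2},0\right),(4,1)\right).\]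
   Context: A rational polygon is the convex hull of finitely many points of $\mathbb{Q}^2$ with nonempty interior; $\mathrm{denom}(P)$ is the smallest positive integer $d$ such that $dP$ has all vertices in $\mathbb{Z}^2$. $P$ is pseudo-integral if its Ehrhart quasi-polynomial ($L_P(k)=|kP\cap\mathbb{Z}^2|$ for positive integers $k$) is a polynomial. $i(P)$, $b(P)$ are the numbers of interior and boundary lattice points. Two polygons are affine unimodular equivalent if one is mapped to the other by $x\mapsto Ax+c$ with $A\in\mathrm{GL}(2,\mathbb{Z})$, $c\in\mathbb{Z}^2$. -}

module Defs where

open import Data.Nat as ℕ using (ℕ; suc)
open import Data.Integer as ℤ using (ℤ; +_)
open import Data.Rational as ℚ using (ℚ; _/_; 0ℚ; 1ℚ; ½; _≤_; _<_)
open import Data.Product using (Σ; ∃; _×_; _,_; proj₁; proj₂)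
open import Data.Sum using (_⊎_)
open import Data.List using (List; []; _∷_; map; length)
open import Data.List.Membership.Propositional using (_∈_)
open import Data.List.Relation.Unary.All using (All)
open import Data.List.Relation.Unary.Unique.Propositional using (Unique)
open import Relation.Binary.PropositionalEquality using (_≡_)
open import Relation.Nullary using (¬_)
open import Function.Bundles using (_⇔_)

Pt : Set
Pt = ℚ × ℚ

ZPt : Set
ZPt = ℤ × ℤ

ofℤ : ℤ → ℚ
ofℤ z = z / 1

ofℕ : ℕ → ℚ
ofℕ n = + n / 1

toPt : ZPt → Pt
toPt (a , b) = ofℤ a , ofℤ b

_⊕_ : Pt → Pt → Pt
(a , b) ⊕ (c , d) = (a ℚ.+ c) , (b ℚ.+ d)

_⊙_ : ℚ → Pt → Pt
r ⊙ (a , b) = (r ℚ.* a) , (r ℚ.* b)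

origin : Pt
origin = 0ℚ , 0ℚ

wsum : List (ℚ × Pt) → Pt
wsum [] = origin
wsum ((w , p) ∷ l) = (w ⊙ p) ⊕ wsum l

wtotal : List (ℚ × Pt) → ℚ
wtotal [] = 0ℚ
wtotal ((w , _) ∷ l) = w ℚ.+ wtotal l

-- A rational polygon is given by a finite list S of generating points in ℚ²;
-- the polygon is conv(S).  Membership of a rational point in conv(S):
-- x is a convex combination (nonnegative weights summing to 1) of points of S.
InConv : List Pt → Pt → Set
InConv S x = Σ (List (ℚ × Pt)) λ L →
  All (λ wp → (0ℚ ≤ proj₁ wp) × (proj₂ wp ∈ S)) L × (wtotal L ≡ 1ℚ) × (wsum L ≡ x)

-- x is an interior point of conv(S): some small axis-parallel square
-- around x (with rational half-side ε > 0) is contained in conv(S)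
-- (it suffices to test its four corners, conv(S) being convex).
IsInteriorPt : List Pt → Pt → Set
IsInteriorPt S (a , b) = Σ ℚ λ ε → (0ℚ < ε) ×
  (InConv S ((a ℚ.+ ε) , (b ℚ.+ ε)) × InConv S ((a ℚ.+ ε) , (b ℚ.- ε)) ×
   InConv S ((a ℚ.- ε) , (b ℚ.+ ε)) × InConv S ((a ℚ.- ε) , (b ℚ.- ε)))

IsPolygon : List Pt → Set
IsPolygon S = Σ Pt λ x → IsInteriorPt S x

dilate : ℚ → List Pt → List Pt
dilate k S = map (k ⊙_) S

midpoint : Pt → Pt → Pt
midpoint x y = ½ ⊙ (x ⊕ y)

IsVertex : List Pt → Pt → Set
IsVertex S v = InConv S v ×
  (∀ x y → InConv S x → InConv S y → v ≡ midpoint x y → x ≡ y)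

IsIntegral : Pt → Set
IsIntegral p = Σ ZPt λ z → toPt z ≡ p

IntegralVertices : List Pt → Set
IntegralVertices S = ∀ v → IsVertex S v → IsIntegral v

Denom2 : List Pt → Set
Denom2 S = IntegralVertices (dilate (ofℕ 2) S) × ¬ IntegralVertices S

HasCount : (ZPt → Set) → ℕ → Set
HasCount Q n = Σ (List ZPt) λ L → (length L ≡ n) × Unique L × (∀ z → (z ∈ L) ⇔ Q z)

Ehrhart : List Pt → ℕ → ℕ → Set
Ehrhart S k n = HasCount (λ z → InConv (dilate (ofℕ k) S) (toPt z)) n

-- P is pseudo-integral: L_P(k) agrees with a polynomial for all k ≥ 1
-- (degree ≤ 2 suffices in dimension 2; any polynomial in k)
-- We allow an arbitrary rational polynomial given by a coefficient list.
evalPoly : List ℚ → ℚ → ℚ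
evalPoly [] x = 0ℚ
evalPoly (c ∷ cs) x = c ℚ.+ (x ℚ.* evalPoly cs x)

PseudoIntegral : List Pt → Set
PseudoIntegral S = Σ (List ℚ) λ cs →
  ∀ (k : ℕ) → Σ ℕ λ n → Ehrhart S (suc k) n × (ofℕ n ≡ evalPoly cs (ofℕ (suc k)))

InteriorLattice : List Pt → ZPt → Set
InteriorLattice S z = IsInteriorPt S (toPt z)

BoundaryLattice : List Pt → ZPt → Set
BoundaryLattice S z = InConv S (toPt z) × ¬ IsInteriorPt S (toPt z)

record AffUnimod : Set where
  constructor affU
  field
    a11 a12 a21 a22 c1 c2 : ℤ
    unimod : (a11 ℤ.* a22 ℤ.- a12 ℤ.* a21 ≡ ℤ.+ 1) ⊎ (a11 ℤ.* a22 ℤ.- a12 ℤ.* a21 ≡ ℤ.- ℤ.+ 1)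

applyAU : AffUnimod → Pt → Pt
applyAU f (x , y) =
  (ofℤ a11 ℚ.* x ℚ.+ ofℤ a12 ℚ.* y ℚ.+ ofℤ c1) ,
  (ofℤ a21 ℚ.* x ℚ.+ ofℤ a22 ℚ.* y ℚ.+ ofℤ c2)
  where open AffUnimod f

AffEquiv : List Pt → List Pt → Set
AffEquiv S T = Σ AffUnimod λ f →
  (∀ x → InConv S x → InConv T (applyAU f x)) ×
  (∀ y → InConv T y → Σ Pt λ x → InConv S x × (applyAU f x ≡ y))

P-a : ℕ → ℤ → List Pt
P-a i a =
  (0ℚ , (+ 3 / 2)) ∷ (0ℚ , ½) ∷ (ofℤ a , 0ℚ) ∷
  ((ofℤ a ℚ.+ ofℕ (2 ℕ.* i ℕ.+ 4)) , 0ℚ) ∷ (ofℕ (2 ℕ.* i ℕ.+ 2) , ½) ∷ []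

P-s : ℕ → List Pt
P-s i =
  (0ℚ , (+ 3 / 2)) ∷ (0ℚ , 1ℚ) ∷ (½ , 0ℚ) ∷
  (ofℕ (2 ℕ.* i ℕ.+ 5) , 0ℚ) ∷ (ofℕ (2 ℕ.* i ℕ.+ 2) , ½) ∷ []

P-s3 : List Pt
P-s3 =
  (0ℚ , (+ 3 / 2)) ∷ (0ℚ , 1ℚ) ∷ (½ , 0ℚ) ∷
  ((+ 23 / 2) , 0ℚ) ∷ (ofℕ 4 , 1ℚ) ∷ []

-- Work with the doubled polygon 2P, whose vertices are integral.  Its boundary consists of a right and a left chain of primitive
-- edges between two horizontal sides, and counting lattice points row by row along the chains gives the Ehrhart function as one
-- quadratic polynomial for even and another for odd dilates.  They agree exactly when every edge has one endpoint that is a lattice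
-- point of P and the horizontal sides lie on lattice rows or degenerate; i(P) and b(P) then determine the area.  As for Scott's
-- inequality, the area bounds the width of 2P in a suitable direction: after a unimodular map 2P has height 3, the only other case
-- being P equal to three times the unimodular triangle, which is integral.  Starting on an even row, a chain of height 3 has one of three
-- shapes, and the linear equations for area, boundary and interior points leave only the polygons of the theorem.
module Submission where

-- Even dilates of `P` are dilates of the integral polygon `2P`, so their counts involve the number
-- of boundary lattice points of `2P`; in odd dilates twice the number of boundary lattice points of
-- `P` takes its place. The second number never exceeds the first, edge by edge, because a primitive
-- edge of `2P` cannot have two ends in the even lattice. Pseudo-integrality is the case of
-- equality, and so a parity condition on each edge. Pick's formula then gives `16i + 20` for eight
-- times the area of `P`, which is four times the number `4i + 14` of boundary points of `2P`, less
-- 36. If `2P` has height `H` and horizontal sides of total length `s`, this number is at most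
-- `2H + s`, while twice the area of `2P` is at least `H * s`. Eliminating `i` leaves
-- `(H - 4)(s - 8) <= -4`, which does not bound `H`. A second direction does: its slope is rounded
-- so that the two diagonals of the hull are nearly balanced, and either the width there is below
-- `H`, so that a unimodular turn lowers the height, or the area forces `H = s = 6`.

open import Defs
open import Data.Nat as N using (ℕ; zero; suc; z≤n; s≤s)
import Data.Nat.Properties as ℕP
open import Data.Integer as Z using (ℤ; +_; -[1+_]; 0ℤ; 1ℤ)
import Data.Integer.Properties as ℤP
open import Data.Rational as Q using (ℚ; 0ℚ; 1ℚ; ½; mkℚ)
import Data.Rational.Properties as ℚP
import Data.Nat.Coprimality as Cop
import Algebra.Solver.Ring.Simple as SolverRing
import Algebra.Solver.Ring.AlmostCommutativeRing as ACR
import Data.Vec as Vec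
open import Data.Vec.N-ary using (N-ary; Eq; curryⁿ; curryⁿ-cong; _$ⁿ_)
open import Data.Bool using (Bool; true; false; if_then_else_)
open import Data.List using (List; []; _∷_; map; length; _++_; replicate; filter; applyUpTo)
import Data.List.Properties as LP
open import Data.List.Membership.Propositional using (_∈_)
open import Data.List.Membership.Propositional.Properties using (∈-map⁺; ∈-map⁻; ∈-++⁺ˡ; ∈-++⁺ʳ; ∈-++⁻; ∈-filter⁺; ∈-filter⁻; ∈-applyUpTo⁺; ∈-applyUpTo⁻)
open import Data.List.Relation.Unary.Any using (here; there)
open import Data.List.Relation.Unary.All as All using (All)
open import Data.List.Relation.Unary.Unique.Propositional using (Unique)
import Data.List.Relation.Unary.Unique.Propositional.Properties as UniqueP
open import Data.Maybe using (just; is-just)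
open import Data.Empty using (⊥; ⊥-elim)
open import Data.Product using (Σ; _×_; _,_; proj₁; proj₂)
open import Data.Product.Properties using (≡-dec)
open import Data.Sum using (_⊎_; inj₁; inj₂; [_,_]′)
open import Function using (_∘_; id; case_of_)
open import Function.Bundles using (_⇔_; mk⇔; Equivalence)
open import Level using (0ℓ)
open import Relation.Nullary using (¬_; Dec; yes; no)
open import Relation.Nullary.Decidable using (¬?)
open import Relation.Binary.Definitions using (Decidable)
open import Relation.Binary.PropositionalEquality hiding (J)
import Data.Nat.Divisibility as Div
import Data.Nat.GCD as GCD
import Data.Integer.DivMod as ZDM
import Data.List.Relation.Unary.All.Properties as AllP
import Data.List.Relation.Unary.AllPairs as AP

-- Comparing normal forms is a closed computation, unlike the library's comparison of their denotations.
module Identities (R : ACR.AlmostCommutativeRing 0ℓ 0ℓ) (_≟_ : Decidable (ACR.AlmostCommutativeRing._≈_ R)) where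
  open ACR.AlmostCommutativeRing R using (_≈_)
  open import Data.Bool using (T)
  open SolverRing R _≟_ hiding (solve) public

  check : ∀ {n} (p q : Polynomial n) → T (is-just (normalise p ≟N normalise q)) → ∀ ρ → ⟦ p ⟧ ρ ≈ ⟦ q ⟧ ρ
  check p q t ρ with normalise p ≟N normalise q
  ... | just e = prove ρ p q (⟦ e ⟧N-cong ρ)

  close : ∀ n → N-ary n (Polynomial n) (Polynomial n × Polynomial n) → Polynomial n × Polynomial n
  close n f = f $ⁿ Vec.map var (Vec.allFin n)

  ring : ∀ n (f : N-ary n (Polynomial n) (Polynomial n × Polynomial n)) (let p = proj₁ (close n f); q = proj₂ (close n f)) →
    {T (is-just (normalise p ≟N normalise q))} → Eq n _≈_ (curryⁿ ⟦ p ⟧) (curryⁿ ⟦ q ⟧)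
  ring n f {t} = curryⁿ-cong _≈_ ⟦ proj₁ (close n f) ⟧ ⟦ proj₂ (close n f) ⟧ (check (proj₁ (close n f)) (proj₂ (close n f)) t)

module ℤIdentities = Identities (ACR.fromCommutativeRing ℤP.+-*-commutativeRing) ℤP._≟_
module ℚIdentities = Identities (ACR.fromCommutativeRing ℚP.+-*-commutativeRing) ℚP._≟_
open ℤIdentities using (Polynomial; _:+_; _:*_; _:-_; :-_; _:=_; con) renaming (ring to ℤring) public
open ℚIdentities using () renaming (_:+_ to infixl 7 _+:_; _:*_ to infixl 8 _*:_; _:-_ to infixl 7 _-:_; :-_ to infix 9 -:_; _:=_ to infix 4 _=:_; con to con:; ring to ℚring) public

#_ : ∀ {n} → ℕ → Polynomial n
# k = con (+ k)

infix 4 _↔_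
_↔_ : Set → Set → Set
A ↔ B = (A → B) × (B → A)

-- Integer inequalities by certificates

module ℤArith where
  open Z using (_≤_; _<_; _+_; _*_; _-_; -_)

  diff : ∀ {a b} → a ≤ b → 0ℤ ≤ b - a
  diff = ℤP.i≤j⇒0≤j-i

  infixl 6 _⊹_
  _⊹_ : ∀ {a b} → 0ℤ ≤ a → 0ℤ ≤ b → 0ℤ ≤ a + b
  p ⊹ q = ℤP.+-mono-≤ p q

  infixl 7 _⊠_
  _⊠_ : ∀ {a b} → 0ℤ ≤ a → 0ℤ ≤ b → 0ℤ ≤ a * b
  _⊠_ {+ a} {+ b} _ _ = subst (0ℤ ≤_) (ℤP.pos-* a b) (Z.+≤+ z≤n)

  infixr 8 _·_
  _·_ : ∀ {a} n → 0ℤ ≤ a → 0ℤ ≤ + n * a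
  _·_ {a} n p = _⊠_ {+ n} {a} (Z.+≤+ z≤n) p

  -- Inequalities are proved by certificates: a ring identity writes the difference of the two sides
  -- as a combination of quantities known to be nonnegative, which `_⊹_`, `_⊠_` and `_·_` assemble.
  -- `absurd` refutes hypotheses whose combination is a negative constant.
  bound : ∀ {a b d} → 0ℤ ≤ d → b - a ≡ d → a ≤ b
  bound p e = ℤP.0≤i-j⇒j≤i (subst (0ℤ ≤_) (sym e) p)

  eqdiff : ∀ {a b} → a ≡ b → 0ℤ ≤ b - a
  eqdiff e = diff (ℤP.≤-reflexive e)

  absurd : ∀ {d} n → 0ℤ ≤ d → d ≡ -[1+ n ] → ⊥
  absurd n p e with subst (0ℤ ≤_) e p
  ... | ()

  <→≤ : ∀ {a b} → a < b → a + 1ℤ ≤ b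
  <→≤ {a} p = subst (_≤ _) (ℤP.+-comm 1ℤ a) (ℤP.i<j⇒suc[i]≤j p)

  ≤→< : ∀ {a b} → a + 1ℤ ≤ b → a < b
  ≤→< {a} p = ℤP.suc[i]≤j⇒i<j (subst (_≤ _) (ℤP.+-comm a 1ℤ) p)

  eqZ : ∀ {a b} → a - b ≡ 0ℤ → a ≡ b
  eqZ {a} {b} = ℤP.i-j≡0⇒i≡j a b

  *-cancel : ∀ n {a b} → + suc n * a ≡ + suc n * b → a ≡ b
  *-cancel n {a} {b} = ℤP.*-cancelˡ-≡ (+ suc n) a b

-- Rational inequalities and the embedding of the integers

module ℚArith where
  open Q using (_≤_; _<_; _+_; _*_; _-_; -_)

  diff : ∀ {a b} → a ≤ b → 0ℚ ≤ b - a
  diff {a} {b} p = subst (_≤ b - a) (ℚP.+-inverseʳ a) (ℚP.+-monoˡ-≤ (- a) p)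

  sdiff : ∀ {a b} → a < b → 0ℚ < b - a
  sdiff {a} {b} p = subst (_< b - a) (ℚP.+-inverseʳ a) (ℚP.+-monoˡ-< (- a) p)

  infixl 6 _⊹_ _⊹<_ _<⊹_
  _⊹_ : ∀ {a b} → 0ℚ ≤ a → 0ℚ ≤ b → 0ℚ ≤ a + b
  p ⊹ q = ℚP.+-mono-≤ p q

  _⊹<_ : ∀ {a b} → 0ℚ ≤ a → 0ℚ < b → 0ℚ < a + b
  p ⊹< q = ℚP.+-mono-≤-< p q

  _<⊹_ : ∀ {a b} → 0ℚ < a → 0ℚ ≤ b → 0ℚ < a + b
  p <⊹ q = ℚP.+-mono-<-≤ p q

  infixl 7 _⊠_ _<⊠_
  _⊠_ : ∀ {a b} → 0ℚ ≤ a → 0ℚ ≤ b → 0ℚ ≤ a * b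
  _⊠_ {a} {b} p q = ℚP.nonNegative⁻¹ (a * b) ⦃ ℚP.nonNeg*nonNeg⇒nonNeg a ⦃ Q.nonNegative p ⦄ b ⦃ Q.nonNegative q ⦄ ⦄

  _<⊠_ : ∀ {a b} → 0ℚ < a → 0ℚ < b → 0ℚ < a * b
  _<⊠_ {a} {b} p q = ℚP.positive⁻¹ (a * b) ⦃ ℚP.pos*pos⇒pos a ⦃ Q.positive p ⦄ b ⦃ Q.positive q ⦄ ⦄

  bound : ∀ {a b d} → 0ℚ ≤ d → b - a ≡ d → a ≤ b
  bound {a} {b} p e = subst₂ _≤_ (ℚP.+-identityˡ a) lem (ℚP.+-monoˡ-≤ a (subst (0ℚ ≤_) (sym e) p))
    where lem : b - a + a ≡ b
          lem = ℚring 2 (λ a b → b -: a +: a =: b) a b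

  sbound : ∀ {a b d} → 0ℚ < d → b - a ≡ d → a < b
  sbound {a} {b} p e = subst₂ _<_ (ℚP.+-identityˡ a) lem (ℚP.+-monoˡ-< a (subst (0ℚ <_) (sym e) p))
    where lem : b - a + a ≡ b
          lem = ℚring 2 (λ a b → b -: a +: a =: b) a b

  eqdiff : ∀ {a b} → a ≡ b → 0ℚ ≤ b - a
  eqdiff e = diff (ℚP.≤-reflexive e)

  eqQ : ∀ {a b} → a - b ≡ 0ℚ → a ≡ b
  eqQ {a} {b} e = trans lem (trans (cong (λ q → q + b) e) (ℚP.+-identityˡ b))
    where lem : a ≡ a - b + b
          lem = ℚring 2 (λ a b → a =: a -: b +: b) a b

  cancel≤ : ∀ {r a b} → 0ℚ < r → r * a ≤ r * b → a ≤ b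
  cancel≤ {r} p = ℚP.*-cancelˡ-≤-pos r ⦃ Q.positive p ⦄

  cancel< : ∀ {r a b} → 0ℚ < r → r * a < r * b → a < b
  cancel< {r} p = ℚP.*-cancelˡ-<-nonNeg r ⦃ ℚP.pos⇒nonNeg r ⦃ Q.positive p ⦄ ⦄

  cancel≡ : ∀ {r a b} → 0ℚ < r → r * a ≡ r * b → a ≡ b
  cancel≡ p e = ℚP.≤-antisym (cancel≤ p (ℚP.≤-reflexive e)) (cancel≤ p (ℚP.≤-reflexive (sym e)))

  0<½ : 0ℚ < ½
  0<½ = Q.*<* (Z.+<+ (s≤s z≤n))

  0<1 : 0ℚ < 1ℚ
  0<1 = Q.*<* (Z.+<+ (s≤s z≤n))

  recip : ∀ r → 0ℚ < r → Σ ℚ λ s → 0ℚ < s × (r * s ≡ 1ℚ)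
  recip r p = s , ℚP.positive⁻¹ s ⦃ ℚP.1/pos⇒pos r ⦃ pr ⦄ ⦄ , ℚP.*-inverseʳ r ⦃ nz ⦄
    where pr : Q.Positive r
          pr = Q.positive p
          nz : Q.NonZero r
          nz = ℚP.pos⇒nonZero r ⦃ pr ⦄
          s : ℚ
          s = Q.1/_ r ⦃ nz ⦄

  -- `z / 1` is normalised through a gcd, which is stuck for a variable `z`. In the explicit reduced
  -- form sums, products and comparisons unfold to those of integers.
  ofℤ≡mk : ∀ z → ofℤ z ≡ mkℚ z 0 (Cop.sym (Cop.1-coprimeTo Z.∣ z ∣))
  ofℤ≡mk z = ℚP.↥p/↧p≡p (mkℚ z 0 (Cop.sym (Cop.1-coprimeTo Z.∣ z ∣)))

  ofℤ-+ : ∀ a b → ofℤ (a Z.+ b) ≡ ofℤ a + ofℤ b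
  ofℤ-+ a b = trans (cong ofℤ (sym (cong₂ Z._+_ (ℤP.*-identityʳ a) (ℤP.*-identityʳ b))))
                    (sym (cong₂ _+_ (ofℤ≡mk a) (ofℤ≡mk b)))

  ofℤ-* : ∀ a b → ofℤ (a Z.* b) ≡ ofℤ a * ofℤ b
  ofℤ-* a b = sym (cong₂ _*_ (ofℤ≡mk a) (ofℤ≡mk b))

  ofℤ-neg : ∀ a → ofℤ (Z.- a) ≡ - ofℤ a
  ofℤ-neg a = eqQ (trans (cong (λ q → ofℤ (Z.- a) + q) (ofneg (ofℤ a))) (trans (sym (ofℤ-+ (Z.- a) a)) (cong ofℤ (ℤP.+-inverseˡ a))))
    where ofneg : ∀ q → - (- q) ≡ q
          ofneg = ℚring 1 (λ q → -: (-: q) =: q)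

  ofℤ-- : ∀ a b → ofℤ (a Z.- b) ≡ ofℤ a - ofℤ b
  ofℤ-- a b = trans (ofℤ-+ a (Z.- b)) (cong (λ q → ofℤ a + q) (ofℤ-neg b))

  ofℤ-≤ : ∀ {a b} → a Z.≤ b → ofℤ a ≤ ofℤ b
  ofℤ-≤ {a} {b} p = subst₂ _≤_ (sym (ofℤ≡mk a)) (sym (ofℤ≡mk b))
    (Q.*≤* (subst₂ Z._≤_ (sym (ℤP.*-identityʳ a)) (sym (ℤP.*-identityʳ b)) p))

  ofℤ-< : ∀ {a b} → a Z.< b → ofℤ a < ofℤ b
  ofℤ-< {a} {b} p = subst₂ _<_ (sym (ofℤ≡mk a)) (sym (ofℤ≡mk b))
    (Q.*<* (subst₂ Z._<_ (sym (ℤP.*-identityʳ a)) (sym (ℤP.*-identityʳ b)) p))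

  ofℤ-≤⁻ : ∀ {a b} → ofℤ a ≤ ofℤ b → a Z.≤ b
  ofℤ-≤⁻ {a} {b} p with a Z.≤? b
  ... | yes q = q
  ... | no q = ⊥-elim (ℚP.<-irrefl refl (ℚP.<-≤-trans (ofℤ-< (ℤP.≰⇒> q)) p))

  ofℤ-<⁻ : ∀ {a b} → ofℤ a < ofℤ b → a Z.< b
  ofℤ-<⁻ {a} {b} p with a Z.<? b
  ... | yes q = q
  ... | no q = ⊥-elim (ℚP.<-irrefl refl (ℚP.<-≤-trans p (ofℤ-≤ (ℤP.≮⇒≥ q))))

  ofℤ-inj : ∀ {a b} → ofℤ a ≡ ofℤ b → a ≡ b
  ofℤ-inj e = ℤP.≤-antisym (ofℤ-≤⁻ (ℚP.≤-reflexive e)) (ofℤ-≤⁻ (ℚP.≤-reflexive (sym e)))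

  0<ofℤsuc : ∀ n → 0ℚ < ofℤ (+ suc n)
  0<ofℤsuc n = ofℤ-< {+ 0} {+ suc n} (Z.+<+ (s≤s z≤n))

  0≤ofℤ+ : ∀ n → 0ℚ ≤ ofℤ (+ n)
  0≤ofℤ+ n = ofℤ-≤ {+ 0} {+ n} (Z.+≤+ z≤n)

-- Convex combinations, affine images, faces and vertices

module Convexity where
  open Q using (_≤_; _<_; _+_; _*_; _-_; -_)
  open ℚArith

  -- Combinations of arbitrary total weight are closed under addition and nonnegative scaling, which
  -- convex combinations are not; `InConv S` is the case of weight 1.
  Cone : List Pt → ℚ → Pt → Set
  Cone S w x = Σ (List (ℚ × Pt)) λ L →
    All (λ wp → (0ℚ ≤ proj₁ wp) × (proj₂ wp ∈ S)) L × (wtotal L ≡ w) × (wsum L ≡ x)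

  pt≡ : ∀ {a b c d : ℚ} → a ≡ c → b ≡ d → (a , b) ≡ (c , d)
  pt≡ = cong₂ _,_

  Cone-subst : ∀ {S w w′ x x′} → w ≡ w′ → x ≡ x′ → Cone S w x → Cone S w′ x′
  Cone-subst refl refl c = c

  cone-gen : ∀ {S s w} → s ∈ S → 0ℚ ≤ w → Cone S w (w ⊙ s)
  cone-gen {s = a , b} {w} i p = (w , (a , b)) ∷ [] , (p , i) All.∷ All.[] , ℚP.+-identityʳ w ,
    pt≡ (ℚP.+-identityʳ (w * a)) (ℚP.+-identityʳ (w * b))

  wtotal-++ : ∀ L M → wtotal (L ++ M) ≡ wtotal L + wtotal M
  wtotal-++ [] M = sym (ℚP.+-identityˡ (wtotal M))
  wtotal-++ ((w , p) ∷ L) M = trans (cong (λ q → w + q) (wtotal-++ L M)) (sym (ℚP.+-assoc w (wtotal L) (wtotal M)))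

  wsum-++ : ∀ L M → wsum (L ++ M) ≡ wsum L ⊕ wsum M
  wsum-++ [] M = sym (pt≡ (ℚP.+-identityˡ _) (ℚP.+-identityˡ _))
  wsum-++ ((w , a , b) ∷ L) M = trans (cong (λ q → (w * a , w * b) ⊕ q) (wsum-++ L M))
    (pt≡ (sym (ℚP.+-assoc (w * a) _ _)) (sym (ℚP.+-assoc (w * b) _ _)))

  cone-⊕ : ∀ {S u v x y} → Cone S u x → Cone S v y → Cone S (u + v) (x ⊕ y)
  cone-⊕ (L , a , t , s) (M , a′ , t′ , s′) = L ++ M , AllP.++⁺ a a′ ,
    trans (wtotal-++ L M) (cong₂ _+_ t t′) , trans (wsum-++ L M) (cong₂ _⊕_ s s′)

  cone-scale : ∀ {S t w x} → 0ℚ ≤ t → Cone S w x → Cone S (t * w) (t ⊙ x)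
  cone-scale {S} {t} p (L , a , refl , refl) = go L a
    where
    go : ∀ L → All _ L → Cone S (t * wtotal L) (t ⊙ wsum L)
    go [] _ = [] , All.[] , sym (ℚP.*-zeroʳ t) , sym (pt≡ (ℚP.*-zeroʳ t) (ℚP.*-zeroʳ t))
    go ((w , q) ∷ L) ((w≥0 , q∈) All.∷ a) = Cone-subst (e w (wtotal L)) (pt≡ (f (proj₁ q) (proj₁ (wsum L))) (f (proj₂ q) (proj₂ (wsum L))))
      (cone-⊕ (cone-gen q∈ (p ⊠ w≥0)) (go L a))
      where
      e : ∀ u v → t * u + t * v ≡ t * (u + v)
      e u v = ℚring 3 (λ t u v → t *: u +: t *: v =: t *: (u +: v)) t u v
      f : ∀ u v → t * w * u + t * v ≡ t * (w * u + v)
      f u v = ℚring 4 (λ t w u v → t *: w *: u +: t *: v =: t *: (w *: u +: v)) t w u v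

  record Affine (F : Pt → Pt) : Set where
    constructor affine
    field
      a b c d e g : ℚ
      law : ∀ x y → F (x , y) ≡ (a * x + b * y + c , d * x + e * y + g)

  -- A combination of total weight `w` picks up the constant part of the map `w` times. In this
  -- homogeneous form the induction over the list of weights goes through; weight 1 gives
  -- `conv-image`.
  affine-cone : ∀ {S T F} (α : Affine F) → (∀ {s} → s ∈ S → InConv T (F s)) → let open Affine α in
    ∀ {w x y} → Cone S w (x , y) → Cone T w (a * x + b * y + w * c , d * x + e * y + w * g)
  affine-cone {S} {T} {F} (affine a b c d e g law) im (L , al , refl , refl) = go L al
    where
    z : ∀ u v k → 0ℚ ≡ u * 0ℚ + v * 0ℚ + 0ℚ * k
    z = ℚring 3 (λ u v k → con: 0ℚ =: u *: con: 0ℚ +: v *: con: 0ℚ +: con: 0ℚ *: k)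
    f : ∀ u v k w p q x y W → w * (u * p + v * q + k) + (u * x + v * y + W * k)
        ≡ u * (w * p + x) + v * (w * q + y) + (w + W) * k
    f = ℚring 9 (λ u v k w p q x y W → w *: (u *: p +: v *: q +: k) +: (u *: x +: v *: y +: W *: k) =: u *: (w *: p +: x) +: v *: (w *: q +: y) +: (w +: W) *: k)
    go : ∀ L → All (λ wp → (0ℚ ≤ proj₁ wp) × (proj₂ wp ∈ S)) L → Cone T (wtotal L)
      (a * proj₁ (wsum L) + b * proj₂ (wsum L) + wtotal L * c , d * proj₁ (wsum L) + e * proj₂ (wsum L) + wtotal L * g)
    go [] _ = [] , All.[] , refl , pt≡ (z a b c) (z d e g)
    go ((w , p , q) ∷ L) ((w≥0 , i) All.∷ al) = Cone-subst (cong (λ r → r + wtotal L) (ℚP.*-identityʳ w))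
      (pt≡ (f a b c w p q _ _ _) (f d e g w p q _ _ _))
      (cone-⊕ (subst (λ r → Cone T (w * 1ℚ) (w ⊙ r)) (law p q) (cone-scale w≥0 (im i))) (go L al))

  conv-image : ∀ {S T F} → Affine F → (∀ {s} → s ∈ S → InConv T (F s)) → ∀ {x} → InConv S x → InConv T (F x)
  conv-image {F = F} α@(affine a b c d e g law) im {x , y} p =
    Cone-subst refl (trans (pt≡ (cong (λ r → a * x + b * y + r) (ℚP.*-identityˡ c)) (cong (λ r → d * x + e * y + r) (ℚP.*-identityˡ g))) (sym (law x y)))
      (affine-cone α im p)

  id-affine : Affine id
  id-affine = affine 1ℚ 0ℚ 0ℚ 0ℚ 1ℚ 0ℚ λ x y → pt≡ (l x y) (l′ x y)
    where
    l : ∀ x y → x ≡ 1ℚ * x + 0ℚ * y + 0ℚ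
    l = ℚring 2 (λ x y → x =: con: 1ℚ *: x +: con: 0ℚ *: y +: con: 0ℚ)
    l′ : ∀ x y → y ≡ 0ℚ * x + 1ℚ * y + 0ℚ
    l′ = ℚring 2 (λ x y → y =: con: 0ℚ *: x +: con: 1ℚ *: y +: con: 0ℚ)

  conv-sub : ∀ {S T} → (∀ {s} → s ∈ S → InConv T s) → ∀ {x} → InConv S x → InConv T x
  conv-sub = conv-image id-affine

  conv-gen : ∀ {S s} → s ∈ S → InConv S s
  conv-gen {s = a , b} i = Cone-subst refl (pt≡ (ℚP.*-identityˡ a) (ℚP.*-identityˡ b)) (cone-gen i (ℚP.<⇒≤ 0<1))

  mix2 : ∀ {S p q t u} → InConv S p → InConv S q → 0ℚ ≤ t → 0ℚ ≤ u → t + u ≡ 1ℚ → InConv S ((t ⊙ p) ⊕ (u ⊙ q))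
  mix2 {t = t} {u} p q t≥0 u≥0 e = Cone-subst (trans (cong₂ _+_ (ℚP.*-identityʳ t) (ℚP.*-identityʳ u)) e) refl
    (cone-⊕ (cone-scale t≥0 p) (cone-scale u≥0 q))

  mix3 : ∀ {S p q r t u v} → InConv S p → InConv S q → InConv S r → 0ℚ ≤ t → 0ℚ ≤ u → 0ℚ ≤ v → t + u + v ≡ 1ℚ →
    InConv S (((t ⊙ p) ⊕ (u ⊙ q)) ⊕ (v ⊙ r))
  mix3 {t = t} {u} {v} p q r t≥0 u≥0 v≥0 e =
    Cone-subst (trans (cong₂ _+_ (cong₂ _+_ (ℚP.*-identityʳ t) (ℚP.*-identityʳ u)) (ℚP.*-identityʳ v)) e) refl
    (cone-⊕ (cone-⊕ (cone-scale t≥0 p) (cone-scale u≥0 q)) (cone-scale v≥0 r))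

  mid-conv : ∀ {S p q} → InConv S p → InConv S q → InConv S (midpoint p q)
  mid-conv {p = a , b} {c , d} i j = Cone-subst refl (pt≡ (l a c) (l b d)) (mix2 i j (ℚP.<⇒≤ 0<½) (ℚP.<⇒≤ 0<½) refl)
    where
    l : ∀ x y → ½ * x + ½ * y ≡ ½ * (x + y)
    l = ℚring 2 (λ x y → con: ½ *: x +: con: ½ *: y =: con: ½ *: (x +: y))

  dot : ℚ → ℚ → Pt → ℚ
  dot α β (x , y) = α * x + β * y

  Weights : List Pt → List (ℚ × Pt) → Set
  Weights S = All (λ wp → (0ℚ ≤ proj₁ wp) × (proj₂ wp ∈ S))

  wtotal-≥0 : ∀ {S} L → Weights S L → 0ℚ ≤ wtotal L
  wtotal-≥0 [] _ = ℚP.≤-refl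
  wtotal-≥0 (_ ∷ L) ((p , _) All.∷ a) = p ⊹ wtotal-≥0 L a

  wsum-bound : ∀ {S} α β c → (∀ {s} → s ∈ S → dot α β s ≤ c) → ∀ L → Weights S L → dot α β (wsum L) ≤ wtotal L * c
  wsum-bound α β c h [] _ = ℚP.≤-reflexive l
    where
    l : α * 0ℚ + β * 0ℚ ≡ 0ℚ * c
    l = ℚring 3 (λ α β c → α *: con: 0ℚ +: β *: con: 0ℚ =: con: 0ℚ *: c) α β c
  wsum-bound α β c h ((w , p , q) ∷ L) ((w≥0 , i) All.∷ a) =
    bound (w≥0 ⊠ diff (h i) ⊹ diff (wsum-bound α β c h L a)) (l w p q (wtotal L) (proj₁ (wsum L)) (proj₂ (wsum L)))
    where
    l : ∀ w p q W x y → (w + W) * c - (α * (w * p + x) + β * (w * q + y)) ≡ w * (c - (α * p + β * q)) + (W * c - (α * x + β * y))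
    l w p q W x y = ℚring 9 (λ α β c w p q W x y → (w +: W) *: c -: (α *: (w *: p +: x) +: β *: (w *: q +: y)) =: w *: (c -: (α *: p +: β *: q)) +: (W *: c -: (α *: x +: β *: y))) α β c w p q W x y

  conv-bound : ∀ {S} α β c → (∀ {s} → s ∈ S → dot α β s ≤ c) → ∀ {x} → InConv S x → dot α β x ≤ c
  conv-bound α β c h (L , a , t , refl) = subst (λ r → dot α β (wsum L) ≤ r) (trans (cong (λ r → r * c) t) (ℚP.*-identityˡ c)) (wsum-bound α β c h L a)

  -- The slacks of all terms are nonnegative and add up to zero, so each vanishes: generators of
  -- positive weight lie on the face where the first functional is maximal, and there the second
  -- bound applies.
  wsum-face : ∀ {S} α β c γ δ d → (∀ {s} → s ∈ S → dot α β s ≤ c) → (∀ {s} → s ∈ S → dot α β s ≡ c → dot γ δ s ≤ d) →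
    ∀ L → Weights S L → dot α β (wsum L) ≡ wtotal L * c → dot γ δ (wsum L) ≤ wtotal L * d
  wsum-face α β c γ δ d h k [] _ _ = ℚP.≤-reflexive l
    where
    l : γ * 0ℚ + δ * 0ℚ ≡ 0ℚ * d
    l = ℚring 3 (λ γ δ d → γ *: con: 0ℚ +: δ *: con: 0ℚ =: con: 0ℚ *: d) γ δ d
  wsum-face α β c γ δ d h k ((w , p , q) ∷ L) ((w≥0 , i) All.∷ a) e =
    bound (head ⊹ diff (wsum-face α β c γ δ d h k L a (eqQ (trans (l′ (wtotal L) (dot α β (wsum L))) (trans (cong -_ tail0) refl))))) (l w p q (wtotal L) (proj₁ (wsum L)) (proj₂ (wsum L)))
    where
    x = proj₁ (wsum L)
    y = proj₂ (wsum L)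
    W = wtotal L
    l : ∀ w p q W x y → (w + W) * d - (γ * (w * p + x) + δ * (w * q + y)) ≡ w * (d - (γ * p + δ * q)) + (W * d - (γ * x + δ * y))
    l w p q W x y = ℚring 9 (λ γ δ d w p q W x y → (w +: W) *: d -: (γ *: (w *: p +: x) +: δ *: (w *: q +: y)) =: w *: (d -: (γ *: p +: δ *: q)) +: (W *: d -: (γ *: x +: δ *: y))) γ δ d w p q W x y
    l′ : ∀ W v → v - W * c ≡ - (W * c - v)
    l′ W v = ℚring 3 (λ W c v → v -: W *: c =: -: (W *: c -: v)) W c v
    A = w * (c - dot α β (p , q))
    B = W * c - dot α β (wsum L)
    A≥0 : 0ℚ ≤ A
    A≥0 = w≥0 ⊠ diff (h i)
    B≥0 : 0ℚ ≤ B
    B≥0 = diff (wsum-bound α β c h L a)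
    m : ∀ w p q W x y → (w + W) * c - (α * (w * p + x) + β * (w * q + y)) ≡ w * (c - (α * p + β * q)) + (W * c - (α * x + β * y))
    m w p q W x y = ℚring 9 (λ α β c w p q W x y → (w +: W) *: c -: (α *: (w *: p +: x) +: β *: (w *: q +: y)) =: w *: (c -: (α *: p +: β *: q)) +: (W *: c -: (α *: x +: β *: y))) α β c w p q W x y
    A+B : A + B ≡ 0ℚ
    A+B = trans (sym (m w p q W x y)) (trans (cong (λ r → r - (α * (w * p + x) + β * (w * q + y))) (sym e)) (ℚP.+-inverseʳ (α * (w * p + x) + β * (w * q + y))))
    sum0 : ∀ u v → u + v ≡ 0ℚ → 0ℚ - u ≡ v
    sum0 u v e = trans (cong (λ r → r - u) (sym e)) r
      where r : u + v - u ≡ v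
            r = ℚring 2 (λ u v → u +: v -: u =: v) u v
    sum0′ : ∀ u v → u + v ≡ 0ℚ → 0ℚ - v ≡ u
    sum0′ u v e = sum0 v u (trans (ℚP.+-comm v u) e)
    tail0 : B ≡ 0ℚ
    tail0 = ℚP.≤-antisym (bound A≥0 (sum0′ A B A+B)) B≥0
    head0 : A ≡ 0ℚ
    head0 = ℚP.≤-antisym (bound B≥0 (sum0 A B A+B)) A≥0
    -- A generator of weight zero may lie off the face, but contributes nothing.
    head : 0ℚ ≤ w * (d - (γ * p + δ * q))
    head with 0ℚ Q.<? w
    ... | yes w>0 = w≥0 ⊠ diff (k i (sym (eqQ (cancel≡ {w} w>0 (trans head0 (sym (ℚP.*-zeroʳ w)))))))
    ... | no w≤0 rewrite ℚP.≤-antisym (ℚP.≮⇒≥ w≤0) w≥0 = ℚP.≤-reflexive (sym (ℚP.*-zeroˡ (d - (γ * p + δ * q))))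

  conv-face : ∀ {S} α β c γ δ d → (∀ {s} → s ∈ S → dot α β s ≤ c) → (∀ {s} → s ∈ S → dot α β s ≡ c → dot γ δ s ≤ d) →
    ∀ {x} → InConv S x → dot α β x ≡ c → dot γ δ x ≤ d
  conv-face α β c γ δ d h k (L , a , t , refl) e =
    subst (λ r → dot γ δ (wsum L) ≤ r) (trans (cong (λ r → r * d) t) (ℚP.*-identityˡ d))
      (wsum-face α β c γ δ d h k L a (trans e (sym (trans (cong (λ r → r * c) t) (ℚP.*-identityˡ c)))))

  -- A point of S that maximises a functional u and, among the maximisers, a second functional v independent of u, is a vertex.
  exposed : ∀ {S} α β γ δ {w} → 0ℚ < α * δ - β * γ → w ∈ S → (∀ {s} → s ∈ S → dot α β s ≤ dot α β w) →
    (∀ {s} → s ∈ S → dot α β s ≡ dot α β w → dot γ δ s ≤ dot γ δ w) → IsVertex S w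
  exposed {S} α β γ δ {w@(wx , wy)} det i h k = conv-gen i , λ x y cx cy e →
    trans (same x cx (proj₁ (uv x y cx cy e)) (proj₁ (proj₂ (uv x y cx cy e))))
          (sym (same y cy (proj₁ (proj₂ (proj₂ (uv x y cx cy e)))) (proj₂ (proj₂ (proj₂ (uv x y cx cy e))))))
    where
    half-eq : ∀ u v c → u ≤ c → v ≤ c → ½ * (u + v) ≡ c → u ≡ c
    half-eq u v c p q e = ℚP.≤-antisym p (bound (diff q) (trans (l (½ * (u + v)) c (sym e)) (r u v)))
      where
      l : ∀ m c → c ≡ m → u - c ≡ u + c - (m + m)
      l m .m refl = ℚring 2 (λ u m → u -: m =: u +: m -: (m +: m)) u m
      r : ∀ u v → u + c - (½ * (u + v) + ½ * (u + v)) ≡ c - v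
      r u v = ℚring 3 (λ u v c → u +: c -: (con: ½ *: (u +: v) +: con: ½ *: (u +: v)) =: c -: v) u v c
    dotmid : ∀ μ ν x y → w ≡ midpoint x y → ½ * (dot μ ν x + dot μ ν y) ≡ dot μ ν w
    dotmid μ ν (a , b) (c , d) refl = l
      where
      l : ½ * (μ * a + ν * b + (μ * c + ν * d)) ≡ μ * (½ * (a + c)) + ν * (½ * (b + d))
      l = ℚring 6 (λ μ ν a b c d → con: ½ *: (μ *: a +: ν *: b +: (μ *: c +: ν *: d)) =: μ *: (con: ½ *: (a +: c)) +: ν *: (con: ½ *: (b +: d))) μ ν a b c d
    -- Both ends of a segment centred at `w` attain the maximum of the first functional, hence lie
    -- on its face, and there they attain the maximum of the second.
    uv : ∀ x y → InConv S x → InConv S y → w ≡ midpoint x y →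
      dot α β x ≡ dot α β w × dot γ δ x ≡ dot γ δ w × dot α β y ≡ dot α β w × dot γ δ y ≡ dot γ δ w
    uv x y cx cy e = ux , half-eq _ _ _ vx vy (dotmid γ δ x y e) , uy ,
                     half-eq _ _ _ vy vx (trans (cong (λ r → ½ * r) (ℚP.+-comm (dot γ δ y) (dot γ δ x))) (dotmid γ δ x y e))
      where
      ux : dot α β x ≡ dot α β w
      ux = half-eq _ _ _ (conv-bound α β _ h cx) (conv-bound α β _ h cy) (dotmid α β x y e)
      uy : dot α β y ≡ dot α β w
      uy = half-eq _ _ _ (conv-bound α β _ h cy) (conv-bound α β _ h cx) (trans (cong (λ r → ½ * r) (ℚP.+-comm (dot α β y) (dot α β x))) (dotmid α β x y e))
      vx = conv-face α β _ γ δ _ h k cx ux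
      vy = conv-face α β _ γ δ _ h k cy uy
    same : ∀ x → InConv S x → dot α β x ≡ dot α β w → dot γ δ x ≡ dot γ δ w → x ≡ w
    -- Cramer's rule: the values of two independent functionals determine the point.
    same (a , b) _ e f = pt≡
      (cancel≡ det (trans (l₁ a b) (trans (cong₂ (λ u v → δ * u - β * v) e f) (sym (l₁ wx wy)))))
      (cancel≡ det (trans (l₂ a b) (trans (cong₂ (λ u v → α * v - γ * u) e f) (sym (l₂ wx wy)))))
      where
      l₁ : ∀ a b → (α * δ - β * γ) * a ≡ δ * (α * a + β * b) - β * (γ * a + δ * b)
      l₁ a b = ℚring 6 (λ α β γ δ a b → (α *: δ -: β *: γ) *: a =: δ *: (α *: a +: β *: b) -: β *: (γ *: a +: δ *: b)) α β γ δ a b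
      l₂ : ∀ a b → (α * δ - β * γ) * b ≡ α * (γ * a + δ * b) - γ * (α * a + β * b)
      l₂ a b = ℚring 6 (λ α β γ δ a b → (α *: δ -: β *: γ) *: b =: α *: (γ *: a +: δ *: b) -: γ *: (α *: a +: β *: b)) α β γ δ a b

  -- Splitting off a positive weight exhibits a generator that really occurs in the combination.
  -- This serves `vertex∈` and also shows that a polygon has a generator at all.
  positive-weight : ∀ {S} L → Weights S L → 0ℚ < wtotal L →
    Σ ℚ λ w → Σ Pt λ p → Σ ℚ λ r → Σ Pt λ y → 0ℚ < w × p ∈ S × 0ℚ ≤ r × Cone S r y × (w + r ≡ wtotal L) × ((w ⊙ p) ⊕ y ≡ wsum L)
  positive-weight [] _ p = ⊥-elim (ℚP.<-irrefl refl p)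
  positive-weight ((w , p) ∷ L) ((w≥0 , i) All.∷ a) t with 0ℚ Q.<? w
  ... | yes w>0 = w , p , wtotal L , wsum L , w>0 , i , wtotal-≥0 L a , (L , a , refl , refl) , refl , refl
  ... | no w≯0 with ℚP.≤-antisym (ℚP.≮⇒≥ w≯0) w≥0
  ... | refl with positive-weight L a (subst (0ℚ <_) (ℚP.+-identityˡ (wtotal L)) t)
  ... | w′ , p′ , r , y , w′>0 , i′ , r≥0 , c , e , f = w′ , p′ , r , y , w′>0 , i′ , r≥0 , c , trans e (sym (ℚP.+-identityˡ _)) ,
        trans f (sym (pt≡ (z (proj₁ p) _) (z (proj₂ p) _)))
    where
    z : ∀ u v → 0ℚ * u + v ≡ v
    z = ℚring 2 (λ u v → con: 0ℚ *: u +: v =: v)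

  -- If `v = w p + y` with `w > 0` and `y` of weight `r = 1 - w`, then `v` is the midpoint of
  -- `r v + w p` and `w v + y`. Extremality makes these equal, which forces `p = v`. The two points
  -- are chosen so that no division by `r`, which may be zero, occurs.
  vertex∈ : ∀ {S v} → IsVertex S v → v ∈ S
  vertex∈ {S} {v@(vx , vy)} ((L , a , t , refl) , ext) with positive-weight L a (subst (0ℚ <_) (sym t) 0<1)
  ... | w , (px , py) , r , (yx , yy) , w>0 , i , r≥0 , c , e , f =
        subst (_∈ S) (pt≡ (fin px yx _ (cong proj₁ f) (cong proj₁ eq)) (fin py yy _ (cong proj₂ f) (cong proj₂ eq))) i
    where
    e₁ : w + r ≡ 1ℚ
    e₁ = trans e t
    X Y : Pt
    X = (r ⊙ wsum L) ⊕ (w ⊙ (px , py))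
    Y = (w ⊙ wsum L) ⊕ (yx , yy)
    inX : InConv S X
    inX = mix2 (L , a , t , refl) (conv-gen i) r≥0 (ℚP.<⇒≤ w>0) (trans (ℚP.+-comm r w) e₁)
    inY : InConv S Y
    inY = Cone-subst (trans (cong (λ q → q + r) (ℚP.*-identityʳ w)) e₁) refl (cone-⊕ (cone-scale (ℚP.<⇒≤ w>0) (L , a , t , refl)) c)
    mid : ∀ v p y → w * p + y ≡ v → v ≡ ½ * (r * v + w * p + (w * v + y))
    mid v p y g = sym (trans (l (w * p)) (trans (cong₂ (λ q q′ → ½ * (q * v + q′)) e₁ g) (l₂ v)))
      where
      l : ∀ z → ½ * (r * v + z + (w * v + y)) ≡ ½ * ((w + r) * v + (z + y))
      l z = ℚring 5 (λ r v w y z → con: ½ *: (r *: v +: z +: (w *: v +: y)) =: con: ½ *: ((w +: r) *: v +: (z +: y))) r v w y z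
      l₂ : ∀ v → ½ * (1ℚ * v + v) ≡ v
      l₂ = ℚring 1 (λ v → con: ½ *: (con: 1ℚ *: v +: v) =: v)
    eq : X ≡ Y
    eq = ext X Y inX inY (pt≡ (mid _ px yx (cong proj₁ f)) (mid _ py yy (cong proj₂ f)))
    fin : ∀ p y v → w * p + y ≡ v → r * v + w * p ≡ w * v + y → p ≡ v
    fin p y v g h = cancel≡ {w + w} (w>0 <⊹ ℚP.<⇒≤ w>0) (eqQ (trans (l p y v)
      (trans (cong (λ q → q + (1ℚ - (w + r)) * v + (w * p + y - v)) (trans (cong (λ q → q - (w * v + y)) h) (ℚP.+-inverseʳ (w * v + y))))
      (trans (cong (λ q → 0ℚ + (1ℚ - q) * v + (w * p + y - v)) e₁)
      (trans (cong (λ q → 0ℚ + 0ℚ * v + (q - v)) g) (l₃ v))))))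
      where
      l : ∀ p y v → (w + w) * p - (w + w) * v ≡ (r * v + w * p - (w * v + y)) + (1ℚ - (w + r)) * v + (w * p + y - v)
      l p y v = ℚring 5 (λ w r p y v → (w +: w) *: p -: (w +: w) *: v =: (r *: v +: w *: p -: (w *: v +: y)) +: (con: 1ℚ -: (w +: r)) *: v +: (w *: p +: y -: v)) w r p y v
      l₃ : ∀ v → 0ℚ + 0ℚ * v + (v - v) ≡ 0ℚ
      l₃ = ℚring 1 (λ v → con: 0ℚ +: con: 0ℚ *: v +: (v -: v) =: con: 0ℚ)
open Convexity public

-- Unimodular maps and dilations: invariance of interior points, vertices and counts

module Transport where
  open Q using (_≤_; _<_; _+_; _*_; _-_; -_)
  open ℚArith

  -- Bilinear interpolation: the corners give points of the top and bottom sides with the right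
  -- abscissa, and these give the point.
  move-corner : ∀ {S a b ε} → 0ℚ < ε →
    InConv S (a + ε , b + ε) → InConv S (a + ε , b - ε) → InConv S (a - ε , b + ε) → InConv S (a - ε , b - ε) →
    ∀ {d e} → - ε ≤ d → d ≤ ε → - ε ≤ e → e ≤ ε → InConv S (a + d , b + e)
  move-corner {S} {a} {b} {ε} ε>0 c₁ c₂ c₃ c₄ {d} {e} d₁ d₂ e₁ e₂ with recip (ε + ε) (ε>0 <⊹ ℚP.<⇒≤ ε>0)
  ... | σ , σ>0 , eq = Cone-subst refl (pt≡ fx fy) (mix2 top bot (le e e₁) (le′ e e₂) (one e))
    where
    σ≥0 = ℚP.<⇒≤ σ>0
    le : ∀ d → - ε ≤ d → 0ℚ ≤ (ε + d) * σ
    le d p = subst (λ q → 0ℚ ≤ q * σ) l (diff p ⊠ σ≥0)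
      where
      l : d - - ε ≡ ε + d
      l = ℚring 2 (λ d ε → d -: -: ε =: ε +: d) d ε
    le′ : ∀ d → d ≤ ε → 0ℚ ≤ (ε - d) * σ
    le′ d p = diff p ⊠ σ≥0
    one : ∀ d → (ε + d) * σ + (ε - d) * σ ≡ 1ℚ
    one d = trans l eq
      where
      l : (ε + d) * σ + (ε - d) * σ ≡ (ε + ε) * σ
      l = ℚring 3 (λ ε d σ → (ε +: d) *: σ +: (ε -: d) *: σ =: (ε +: ε) *: σ) ε d σ
    avg : ∀ u d → (ε + d) * σ * (u + ε) + (ε - d) * σ * (u - ε) ≡ u + d
    avg u d = trans l (trans (cong (λ q → q * (u + d)) eq) (ℚP.*-identityˡ (u + d)))
      where
      l : (ε + d) * σ * (u + ε) + (ε - d) * σ * (u - ε) ≡ (ε + ε) * σ * (u + d)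
      l = ℚring 4 (λ ε d σ u → (ε +: d) *: σ *: (u +: ε) +: (ε -: d) *: σ *: (u -: ε) =: (ε +: ε) *: σ *: (u +: d)) ε d σ u
    const : ∀ u d → (ε + d) * σ * u + (ε - d) * σ * u ≡ u
    const u d = trans (sym (ℚP.*-distribʳ-+ u ((ε + d) * σ) ((ε - d) * σ))) (trans (cong (λ q → q * u) (one d)) (ℚP.*-identityˡ u))
    top : InConv S (a + d , b + ε)
    top = Cone-subst refl (pt≡ (avg a d) (const (b + ε) d)) (mix2 c₁ c₃ (le d d₁) (le′ d d₂) (one d))
    bot : InConv S (a + d , b - ε)
    bot = Cone-subst refl (pt≡ (avg a d) (const (b - ε) d)) (mix2 c₂ c₄ (le d d₁) (le′ d d₂) (one d))
    fx : (ε + e) * σ * (a + d) + (ε - e) * σ * (a + d) ≡ a + d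
    fx = const (a + d) e
    fy : (ε + e) * σ * (b + ε) + (ε - e) * σ * (b - ε) ≡ b + e
    fy = avg b e

  sq≥0 : ∀ u → 0ℚ ≤ u * u
  sq≥0 u with ℚP.≤-total 0ℚ u
  ... | inj₁ p = p ⊠ p
  ... | inj₂ p = subst (0ℚ ≤_) l (diff p ⊠ diff p)
    where
    l : (0ℚ - u) * (0ℚ - u) ≡ u * u
    l = ℚring 1 (λ u → (con: 0ℚ -: u) *: (con: 0ℚ -: u) =: u *: u) u

  -- An affine map sends a sufficiently small square around `y` into the given square around `g y`,
  -- so the corners can be pulled back one by one.
  interior-pull : ∀ {S T g} → Affine g → (∀ y → InConv S (g y) → InConv T y) → ∀ y → IsInteriorPt S (g y) → IsInteriorPt T y
  interior-pull {S} {T} {g} (affine a b c d e h law) imp (x , y) i with subst (IsInteriorPt S) (law x y) i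
  ... | ε , ε>0 , c₁ , c₂ , c₃ , c₄ = η , η>0 , corner 1ℚ 1ℚ (plus η x) (plus η y) refl refl , corner 1ℚ (- 1ℚ) (plus η x) (minus η y) refl refl ,
                                       corner (- 1ℚ) 1ℚ (minus η x) (plus η y) refl refl , corner (- 1ℚ) (- 1ℚ) (minus η x) (minus η y) refl refl
    where
    -- `M` dominates both row sums of the linear part without absolute values:
    -- `|a| + |b| <= a² + b² + 1/2` by completing squares. Hence the half-side `ε / M` is small
    -- enough.
    M = a * a + b * b + d * d + e * e + 1ℚ
    M>0 : 0ℚ < M
    M>0 = sq≥0 a ⊹ sq≥0 b ⊹ sq≥0 d ⊹ sq≥0 e ⊹< 0<1
    m = proj₁ (recip M M>0)
    Mm : M * m ≡ 1ℚ
    Mm = proj₂ (proj₂ (recip M M>0))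
    η = ε * m
    η>0 : 0ℚ < η
    η>0 = ε>0 <⊠ proj₁ (proj₂ (recip M M>0))
    plus : ∀ η x → 1ℚ * η + x ≡ x + η
    plus = ℚring 2 (λ η x → con: 1ℚ *: η +: x =: x +: η)
    minus : ∀ η x → - 1ℚ * η + x ≡ x - η
    minus = ℚring 2 (λ η x → -: con: 1ℚ *: η +: x =: x -: η)
    up : ∀ p q r s u v → u * u ≡ 1ℚ → v * v ≡ 1ℚ → p * p + q * q + (r * r + s * s) + 1ℚ ≡ M → (p * u + q * v) * η ≤ ε
    up p q r s u v uu vv eM = bound (ℚP.<⇒≤ η>0 ⊠ (sq≥0 (p - ½ * u) ⊹ sq≥0 (q - ½ * v) ⊹ (sq≥0 r ⊹ sq≥0 s) ⊹ ℚP.<⇒≤ 0<½))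
      (trans (cong (λ z → z - (p * u + q * v) * η) (trans (sym (ℚP.*-identityʳ ε)) (trans (cong (λ z → ε * z) (trans (sym Mm) (cong (λ z → z * m) (sym eM)))) refl)))
      (trans (l p q r s u v ε m) (cong₂ (λ z w → ε * m * ((p - ½ * u) * (p - ½ * u) + (q - ½ * v) * (q - ½ * v) + (r * r + s * s) + ½ + (½ * ½ - ½ * ½ * z) + (½ * ½ - ½ * ½ * w))) uu vv ⟩ fin ε m ((p - ½ * u) * (p - ½ * u) + (q - ½ * v) * (q - ½ * v) + (r * r + s * s)))))
      where
      _⟩_ : ∀ {x y z : ℚ} → x ≡ y → y ≡ z → x ≡ z
      _⟩_ = trans
      fin : ∀ ε m t → ε * m * (t + ½ + (½ * ½ - ½ * ½ * 1ℚ) + (½ * ½ - ½ * ½ * 1ℚ)) ≡ ε * m * (t + ½)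
      fin = ℚring 3 (λ ε m t → ε *: m *: (t +: con: ½ +: (con: ½ *: con: ½ -: con: ½ *: con: ½ *: con: 1ℚ) +: (con: ½ *: con: ½ -: con: ½ *: con: ½ *: con: 1ℚ)) =: ε *: m *: (t +: con: ½))
      l : ∀ p q r s u v ε m → ε * ((p * p + q * q + (r * r + s * s) + 1ℚ) * m) - (p * u + q * v) * (ε * m) ≡
        ε * m * ((p - ½ * u) * (p - ½ * u) + (q - ½ * v) * (q - ½ * v) + (r * r + s * s) + ½ + (½ * ½ - ½ * ½ * (u * u)) + (½ * ½ - ½ * ½ * (v * v)))
      l = ℚring 8 (λ p q r s u v ε m → ε *: ((p *: p +: q *: q +: (r *: r +: s *: s) +: con: 1ℚ) *: m) -: (p *: u +: q *: v) *: (ε *: m) =: ε *: m *: ((p -: con: ½ *: u) *: (p -: con: ½ *: u) +: (q -: con: ½ *: v) *: (q -: con: ½ *: v) +: (r *: r +: s *: s) +: con: ½ +: (con: ½ *: con: ½ -: con: ½ *: con: ½ *: (u *: u)) +: (con: ½ *: con: ½ -: con: ½ *: con: ½ *: (v *: v))))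
    dn : ∀ p q r s u v → u * u ≡ 1ℚ → v * v ≡ 1ℚ → p * p + q * q + (r * r + s * s) + 1ℚ ≡ M → - ε ≤ (p * u + q * v) * η
    dn p q r s u v uu vv eM = bound (diff (up (- p) (- q) r s u v uu vv (trans (l₁ p q (r * r + s * s)) eM))) (l₂ p q u v ε η)
      where
      l₁ : ∀ p q z → - p * - p + - q * - q + z + 1ℚ ≡ p * p + q * q + z + 1ℚ
      l₁ = ℚring 3 (λ p q z → -: p *: -: p +: -: q *: -: q +: z +: con: 1ℚ =: p *: p +: q *: q +: z +: con: 1ℚ)
      l₂ : ∀ p q u v ε η → (p * u + q * v) * η - - ε ≡ ε - (- p * u + - q * v) * η
      l₂ = ℚring 6 (λ p q u v ε η → (p *: u +: q *: v) *: η -: -: ε =: ε -: (-: p *: u +: -: q *: v) *: η)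
    M₁ : a * a + b * b + (d * d + e * e) + 1ℚ ≡ a * a + b * b + d * d + e * e + 1ℚ
    M₁ = ℚring 4 (λ a b d e → a *: a +: b *: b +: (d *: d +: e *: e) +: con: 1ℚ =: a *: a +: b *: b +: d *: d +: e *: e +: con: 1ℚ) a b d e
    M₂ : d * d + e * e + (a * a + b * b) + 1ℚ ≡ a * a + b * b + d * d + e * e + 1ℚ
    M₂ = ℚring 4 (λ a b d e → d *: d +: e *: e +: (a *: a +: b *: b) +: con: 1ℚ =: a *: a +: b *: b +: d *: d +: e *: e +: con: 1ℚ) a b d e
    corner : ∀ u v {p q} → u * η + x ≡ p → v * η + y ≡ q → u * u ≡ 1ℚ → v * v ≡ 1ℚ → InConv T (p , q)
    corner u v refl refl uu vv = imp _ (subst (InConv S) (sym (trans (law _ _) (pt≡ (l a b c u v x y η) (l d e h u v x y η))))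
      (move-corner {S} {a * x + b * y + c} {d * x + e * y + h} {ε} ε>0 c₁ c₂ c₃ c₄ (dn a b d e u v uu vv M₁) (up a b d e u v uu vv M₁) (dn d e a b u v uu vv M₂) (up d e a b u v uu vv M₂)))
      where
      l : ∀ a b c u v x y η → a * (u * η + x) + b * (v * η + y) + c ≡ a * x + b * y + c + (a * u + b * v) * η
      l = ℚring 8 (λ a b c u v x y η → a *: (u *: η +: x) +: b *: (v *: η +: y) +: c =: a *: x +: b *: y +: c +: (a *: u +: b *: v) *: η)

  affine-mid : ∀ {F} → Affine F → ∀ x y → F (midpoint x y) ≡ midpoint (F x) (F y)
  affine-mid (affine a b c d e g law) (x , y) (x′ , y′) = trans (law _ _) (trans (pt≡ (l a b c) (l d e g)) (sym (cong₂ midpoint (law x y) (law x′ y′))))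
    where
    l : ∀ a b c → a * (½ * (x + x′)) + b * (½ * (y + y′)) + c ≡ ½ * (a * x + b * y + c + (a * x′ + b * y′ + c))
    l a b c = ℚring 7 (λ a b c x x′ y y′ → a *: (con: ½ *: (x +: x′)) +: b *: (con: ½ *: (y +: y′)) +: c =: con: ½ *: (a *: x +: b *: y +: c +: (a *: x′ +: b *: y′ +: c))) a b c x x′ y y′

  vertex-push : ∀ {S T F G} → Affine G → (∀ x → G (F x) ≡ x) → (∀ y → F (G y) ≡ y) →
    (∀ {x} → InConv S x → InConv T (F x)) → (∀ {y} → InConv T y → InConv S (G y)) → ∀ {v} → IsVertex S v → IsVertex T (F v)
  vertex-push {F = F} {G} α GF FG to from {v} (c , ext) = to c , λ x y cx cy e →
    trans (sym (FG x)) (trans (cong F (ext (G x) (G y) (from cx) (from cy) (trans (sym (GF v)) (trans (cong G e) (affine-mid α x y))))) (FG y))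

  ⊙-affine : ∀ k → Affine (k ⊙_)
  ⊙-affine k = affine k 0ℚ 0ℚ 0ℚ k 0ℚ λ x y → pt≡ (l x y) (l′ x y)
    where
    l : ∀ x y → k * x ≡ k * x + 0ℚ * y + 0ℚ
    l x y = ℚring 3 (λ k x y → k *: x =: k *: x +: con: 0ℚ *: y +: con: 0ℚ) k x y
    l′ : ∀ x y → k * y ≡ 0ℚ * x + k * y + 0ℚ
    l′ x y = ℚring 3 (λ k x y → k *: y =: con: 0ℚ *: x +: k *: y +: con: 0ℚ) k x y

  ⊙⊙ : ∀ {k κ} → k * κ ≡ 1ℚ → ∀ x → k ⊙ (κ ⊙ x) ≡ x
  ⊙⊙ {k} {κ} e (x , y) = pt≡ (l x) (l y)
    where
    l : ∀ x → k * (κ * x) ≡ x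
    l x = trans (sym (ℚP.*-assoc k κ x)) (trans (cong (λ q → q * x) e) (ℚP.*-identityˡ x))

  conv-dilate : ∀ {k κ} → k * κ ≡ 1ℚ → ∀ S x → InConv (dilate k S) x ↔ InConv S (κ ⊙ x)
  conv-dilate {k} {κ} e S x = conv-image {F = κ ⊙_} (⊙-affine κ) back ,
      (λ c → subst (InConv (dilate k S)) (⊙⊙ {k} {κ} e x) (conv-image {F = k ⊙_} (⊙-affine k) (λ i → conv-gen (∈-map⁺ (k ⊙_) i)) c))
    where
    back : ∀ {s} → s ∈ dilate k S → InConv S (κ ⊙ s)
    back i with ∈-map⁻ (k ⊙_) i
    ... | s , i′ , refl = conv-gen (subst (_∈ S) (sym (⊙⊙ {κ} {k} (trans (ℚP.*-comm κ k) e) s)) i′)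

  au-affine : ∀ f → Affine (applyAU f)
  au-affine f = affine (ofℤ a11) (ofℤ a12) (ofℤ c1) (ofℤ a21) (ofℤ a22) (ofℤ c2) λ _ _ → refl
    where open AffUnimod f

  det : AffUnimod → ℤ
  det f = a11 Z.* a22 Z.- a12 Z.* a21
    where open AffUnimod f

  det² : ∀ f → det f Z.* det f ≡ 1ℤ
  det² f with AffUnimod.unimod f
  ... | inj₁ e = cong₂ Z._*_ e e
  ... | inj₂ e = cong₂ Z._*_ e e

  -- The determinant is `1` or `-1`, hence its own inverse, so `δ` times the adjugate is an integral
  -- inverse of the linear part.
  inverse : AffUnimod → AffUnimod
  inverse f = affU (δ Z.* a22) (Z.- (δ Z.* a12)) (Z.- (δ Z.* a21)) (δ Z.* a11)
      (Z.- (δ Z.* a22 Z.* c1 Z.- δ Z.* a12 Z.* c2)) (Z.- (δ Z.* a11 Z.* c2 Z.- δ Z.* a21 Z.* c1)) (um (AffUnimod.unimod f))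
    where
    open AffUnimod f hiding (unimod)
    δ = det f
    l : ∀ δ a b c d → δ Z.* d Z.* (δ Z.* a) Z.- Z.- (δ Z.* b) Z.* (Z.- (δ Z.* c)) ≡ δ Z.* δ Z.* (a Z.* d Z.- b Z.* c)
    l = ℤring 5 (λ δ a b c d → δ :* d :* (δ :* a) :- :- (δ :* b) :* (:- (δ :* c)) := δ :* δ :* (a :* d :- b :* c))
    um : det f ≡ + 1 ⊎ det f ≡ Z.- (+ 1) → δ Z.* a22 Z.* (δ Z.* a11) Z.- Z.- (δ Z.* a12) Z.* (Z.- (δ Z.* a21)) ≡ + 1 ⊎ δ Z.* a22 Z.* (δ Z.* a11) Z.- Z.- (δ Z.* a12) Z.* (Z.- (δ Z.* a21)) ≡ Z.- (+ 1)
    um (inj₁ e) = inj₁ (trans (l δ a11 a12 a21 a22) (cong₂ Z._*_ (det² f) e))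
    um (inj₂ e) = inj₂ (trans (l δ a11 a12 a21 a22) (cong₂ Z._*_ (det² f) e))

  ofℤ-*- : ∀ a b c d e → ofℤ (a Z.* b Z.* c Z.- a Z.* d Z.* e) ≡ ofℤ a * ofℤ b * ofℤ c - ofℤ a * ofℤ d * ofℤ e
  ofℤ-*- a b c d e = trans (ofℤ-- (a Z.* b Z.* c) (a Z.* d Z.* e)) (cong₂ _-_ (t a b c) (t a d e))
    where
    t : ∀ a b c → ofℤ (a Z.* b Z.* c) ≡ ofℤ a * ofℤ b * ofℤ c
    t a b c = trans (ofℤ-* (a Z.* b) c) (cong (λ q → q * ofℤ c) (ofℤ-* a b))

  module _ (f : AffUnimod) where
    open AffUnimod f hiding (unimod)
    private
      δ = det f
      A = ofℤ a11
      B = ofℤ a12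
      C = ofℤ a21
      D = ofℤ a22
      E = ofℤ c1
      F = ofℤ c2
      Δ = ofℤ δ
    ΔΔ : Δ * (A * D - B * C) ≡ 1ℚ
    ΔΔ = trans (cong (λ q → Δ * q) (sym (trans (ofℤ-- (a11 Z.* a22) (a12 Z.* a21)) (cong₂ _-_ (ofℤ-* a11 a22) (ofℤ-* a12 a21)))))
         (trans (sym (ofℤ-* δ δ)) (cong ofℤ (det² f)))

    inverse-law : ∀ x y → applyAU (inverse f) (x , y) ≡
      (Δ * D * x + - (Δ * B) * y + - (Δ * D * E - Δ * B * F) , - (Δ * C) * x + Δ * A * y + - (Δ * A * F - Δ * C * E))
    inverse-law x y = pt≡
      (cong₃ (λ p q r → p * x + q * y + r) (ofℤ-* δ a22) (n δ a12) (trans (ofℤ-neg (δ Z.* a22 Z.* c1 Z.- δ Z.* a12 Z.* c2)) (cong -_ (ofℤ-*- δ a22 c1 a12 c2))))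
      (cong₃ (λ p q r → p * x + q * y + r) (n δ a21) (ofℤ-* δ a11) (trans (ofℤ-neg (δ Z.* a11 Z.* c2 Z.- δ Z.* a21 Z.* c1)) (cong -_ (ofℤ-*- δ a11 c2 a21 c1))))
      where
      cong₃ : ∀ (h : ℚ → ℚ → ℚ → ℚ) {p p′ q q′ r r′} → p ≡ p′ → q ≡ q′ → r ≡ r′ → h p q r ≡ h p′ q′ r′
      cong₃ h refl refl refl = refl
      n : ∀ a b → ofℤ (Z.- (a Z.* b)) ≡ - (ofℤ a * ofℤ b)
      n a b = trans (ofℤ-neg (a Z.* b)) (cong -_ (ofℤ-* a b))

    private
      unit : ∀ u v → u ≡ Δ * (A * D - B * C) * v → u ≡ v
      unit u v e = trans e (trans (cong (λ q → q * v) ΔΔ) (ℚP.*-identityˡ v))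

    inverseˡ : ∀ p → applyAU (inverse f) (applyAU f p) ≡ p
    inverseˡ (x , y) = trans (inverse-law _ _) (pt≡ (unit _ _ (l Δ A B C D E F x y)) (unit _ _ (l′ Δ A B C D E F x y)))
      where
      l : ∀ Δ A B C D E F x y → Δ * D * (A * x + B * y + E) + - (Δ * B) * (C * x + D * y + F) + - (Δ * D * E - Δ * B * F) ≡ Δ * (A * D - B * C) * x
      l = ℚring 9 (λ Δ A B C D E F x y → Δ *: D *: (A *: x +: B *: y +: E) +: -: (Δ *: B) *: (C *: x +: D *: y +: F) +: -: (Δ *: D *: E -: Δ *: B *: F) =: Δ *: (A *: D -: B *: C) *: x)
      l′ : ∀ Δ A B C D E F x y → - (Δ * C) * (A * x + B * y + E) + Δ * A * (C * x + D * y + F) + - (Δ * A * F - Δ * C * E) ≡ Δ * (A * D - B * C) * y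
      l′ = ℚring 9 (λ Δ A B C D E F x y → -: (Δ *: C) *: (A *: x +: B *: y +: E) +: Δ *: A *: (C *: x +: D *: y +: F) +: -: (Δ *: A *: F -: Δ *: C *: E) =: Δ *: (A *: D -: B *: C) *: y)

    inverseʳ : ∀ p → applyAU f (applyAU (inverse f) p) ≡ p
    inverseʳ (x , y) = trans (cong (applyAU f) (inverse-law x y)) (pt≡ (fin _ x E (l Δ A B C D E F x y)) (fin _ y F (l′ Δ A B C D E F x y)))
      where
      fin : ∀ u v e → u ≡ Δ * (A * D - B * C) * (v - e) + e → u ≡ v
      fin u v e p = trans p (trans (cong (λ q → q * (v - e) + e) ΔΔ) k)
        where
        k : 1ℚ * (v - e) + e ≡ v
        k = ℚring 2 (λ v e → con: 1ℚ *: (v -: e) +: e =: v) v e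
      l : ∀ Δ A B C D E F x y → A * (Δ * D * x + - (Δ * B) * y + - (Δ * D * E - Δ * B * F)) + B * (- (Δ * C) * x + Δ * A * y + - (Δ * A * F - Δ * C * E)) + E ≡ Δ * (A * D - B * C) * (x - E) + E
      l = ℚring 9 (λ Δ A B C D E F x y → A *: (Δ *: D *: x +: -: (Δ *: B) *: y +: -: (Δ *: D *: E -: Δ *: B *: F)) +: B *: (-: (Δ *: C) *: x +: Δ *: A *: y +: -: (Δ *: A *: F -: Δ *: C *: E)) +: E =: Δ *: (A *: D -: B *: C) *: (x -: E) +: E)
      l′ : ∀ Δ A B C D E F x y → C * (Δ * D * x + - (Δ * B) * y + - (Δ * D * E - Δ * B * F)) + D * (- (Δ * C) * x + Δ * A * y + - (Δ * A * F - Δ * C * E)) + F ≡ Δ * (A * D - B * C) * (y - F) + F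
      l′ = ℚring 9 (λ Δ A B C D E F x y → C *: (Δ *: D *: x +: -: (Δ *: B) *: y +: -: (Δ *: D *: E -: Δ *: B *: F)) +: D *: (-: (Δ *: C) *: x +: Δ *: A *: y +: -: (Δ *: A *: F -: Δ *: C *: E)) +: F =: Δ *: (A *: D -: B *: C) *: (y -: F) +: F)

  compose : AffUnimod → AffUnimod → AffUnimod
  compose g f = affU (g.a11 Z.* f.a11 Z.+ g.a12 Z.* f.a21) (g.a11 Z.* f.a12 Z.+ g.a12 Z.* f.a22)
      (g.a21 Z.* f.a11 Z.+ g.a22 Z.* f.a21) (g.a21 Z.* f.a12 Z.+ g.a22 Z.* f.a22)
      (g.a11 Z.* f.c1 Z.+ g.a12 Z.* f.c2 Z.+ g.c1) (g.a21 Z.* f.c1 Z.+ g.a22 Z.* f.c2 Z.+ g.c2) (um g.unimod f.unimod)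
    where
    module g = AffUnimod g
    module f = AffUnimod f
    l : ∀ a b c d p q r s → (a Z.* p Z.+ b Z.* r) Z.* (c Z.* q Z.+ d Z.* s) Z.- (a Z.* q Z.+ b Z.* s) Z.* (c Z.* p Z.+ d Z.* r) ≡ (a Z.* d Z.- b Z.* c) Z.* (p Z.* s Z.- q Z.* r)
    l = ℤring 8 (λ a b c d p q r s → (a :* p :+ b :* r) :* (c :* q :+ d :* s) :- (a :* q :+ b :* s) :* (c :* p :+ d :* r) := (a :* d :- b :* c) :* (p :* s :- q :* r))
    L = l g.a11 g.a12 g.a21 g.a22 f.a11 f.a12 f.a21 f.a22
    um : _ → _ → _
    um (inj₁ e) (inj₁ e′) = inj₁ (trans L (cong₂ Z._*_ e e′))
    um (inj₁ e) (inj₂ e′) = inj₂ (trans L (cong₂ Z._*_ e e′))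
    um (inj₂ e) (inj₁ e′) = inj₂ (trans L (cong₂ Z._*_ e e′))
    um (inj₂ e) (inj₂ e′) = inj₁ (trans L (cong₂ Z._*_ e e′))

  ofℤ-lin : ∀ a b c d → ofℤ (a Z.* b Z.+ c Z.* d) ≡ ofℤ a * ofℤ b + ofℤ c * ofℤ d
  ofℤ-lin a b c d = trans (ofℤ-+ (a Z.* b) (c Z.* d)) (cong₂ _+_ (ofℤ-* a b) (ofℤ-* c d))

  ofℤ-lin+ : ∀ a b c d e → ofℤ (a Z.* b Z.+ c Z.* d Z.+ e) ≡ ofℤ a * ofℤ b + ofℤ c * ofℤ d + ofℤ e
  ofℤ-lin+ a b c d e = trans (ofℤ-+ (a Z.* b Z.+ c Z.* d) e) (cong (λ q → q + ofℤ e) (ofℤ-lin a b c d))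

  compose-law : ∀ g f p → applyAU (compose g f) p ≡ applyAU g (applyAU f p)
  compose-law g f (x , y) = pt≡ (h g.a11 g.a12 g.c1) (h g.a21 g.a22 g.c2)
    where
    module g = AffUnimod g
    module f = AffUnimod f
    l : ∀ a b p q r s t u c x y → (a * p + b * r) * x + (a * q + b * s) * y + (a * t + b * u + c) ≡ a * (p * x + q * y + t) + b * (r * x + s * y + u) + c
    l = ℚring 11 (λ a b p q r s t u c x y → (a *: p +: b *: r) *: x +: (a *: q +: b *: s) *: y +: (a *: t +: b *: u +: c) =: a *: (p *: x +: q *: y +: t) +: b *: (r *: x +: s *: y +: u) +: c)
    h : ∀ a b c → _ ≡ _
    h a b c = trans (cong₂ _+_ (cong₂ (λ u v → u * x + v * y) (ofℤ-lin a f.a11 b f.a21) (ofℤ-lin a f.a12 b f.a22)) (ofℤ-lin+ a f.c1 b f.c2 c))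
      (l (ofℤ a) (ofℤ b) (ofℤ f.a11) (ofℤ f.a12) (ofℤ f.a21) (ofℤ f.a22) (ofℤ f.c1) (ofℤ f.c2) (ofℤ c) x y)

  applyℤ : AffUnimod → ZPt → ZPt
  applyℤ f (x , y) = a11 Z.* x Z.+ a12 Z.* y Z.+ c1 , a21 Z.* x Z.+ a22 Z.* y Z.+ c2
    where open AffUnimod f

  toPt-applyℤ : ∀ f z → toPt (applyℤ f z) ≡ applyAU f (toPt z)
  toPt-applyℤ f (x , y) = pt≡ (ofℤ-lin+ a11 x a12 y c1) (ofℤ-lin+ a21 x a22 y c2)
    where open AffUnimod f

  toPt-inj : ∀ {z w} → toPt z ≡ toPt w → z ≡ w
  toPt-inj {a , b} {c , d} e = cong₂ _,_ (ofℤ-inj (cong proj₁ e)) (ofℤ-inj (cong proj₂ e))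

  applyℤ-inverseˡ : ∀ f z → applyℤ (inverse f) (applyℤ f z) ≡ z
  applyℤ-inverseˡ f z = toPt-inj (trans (toPt-applyℤ (inverse f) (applyℤ f z)) (trans (cong (applyAU (inverse f)) (toPt-applyℤ f z)) (inverseˡ f (toPt z))))

  applyℤ-inverseʳ : ∀ f z → applyℤ f (applyℤ (inverse f) z) ≡ z
  applyℤ-inverseʳ f z = toPt-inj (trans (toPt-applyℤ f (applyℤ (inverse f) z)) (trans (cong (applyAU f) (toPt-applyℤ (inverse f) z)) (inverseʳ f (toPt z))))

  -- Unimodular maps are bijective, so the preimages demanded by `AffEquiv` amount to a pointwise
  -- equivalence, a form that inverts and composes at once.
  Eqv : AffUnimod → List Pt → List Pt → Set
  Eqv f S T = ∀ x → InConv S x ↔ InConv T (applyAU f x)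

  fromEquiv : ∀ {S T} → AffEquiv S T → Σ AffUnimod λ f → Eqv f S T
  fromEquiv {S} {T} (f , to , onto) = f , λ x → to x , λ c → let (x′ , c′ , e) = onto _ c in
    subst (InConv S) (trans (sym (inverseˡ f x′)) (trans (cong (applyAU (inverse f)) e) (inverseˡ f x))) c′

  toEquiv : ∀ {S T} f → Eqv f S T → AffEquiv S T
  toEquiv {S} {T} f q = f , (λ x → proj₁ (q x)) , λ y c → applyAU (inverse f) y ,
    proj₂ (q _) (subst (InConv T) (sym (inverseʳ f y)) c) , inverseʳ f y

  eqv-sym : ∀ {S T} f → Eqv f S T → Eqv (inverse f) T S
  eqv-sym {S} {T} f q y = (λ c → proj₂ (q _) (subst (InConv T) (sym (inverseʳ f y)) c)) ,
                          (λ c → subst (InConv T) (inverseʳ f y) (proj₁ (q _) c))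

  eqv-trans : ∀ {S T U} g f → Eqv f S T → Eqv g T U → Eqv (compose g f) S U
  eqv-trans {U = U} g f p q x = (λ c → subst (InConv U) (sym (compose-law g f x)) (proj₁ (q _) (proj₁ (p x) c))) ,
                        (λ c → proj₂ (p x) (proj₂ (q _) (subst (InConv U) (compose-law g f x) c)))

  eqv-map : ∀ f S → Eqv f S (map (applyAU f) S)
  eqv-map f S x = conv-image (au-affine f) (λ i → conv-gen (∈-map⁺ (applyAU f) i)) ,
      λ c → subst (InConv S) (inverseˡ f x) (conv-image (au-affine (inverse f)) back c)
    where
    back : ∀ {t} → t ∈ map (applyAU f) S → InConv S (applyAU (inverse f) t)
    back i with ∈-map⁻ (applyAU f) i
    ... | s , j , refl = conv-gen (subst (_∈ S) (sym (inverseˡ f s)) j)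

  AffEquiv-trans : ∀ {S T U} → AffEquiv S T → AffEquiv T U → AffEquiv S U
  AffEquiv-trans p q = let (f , a) = fromEquiv p ; (g , b) = fromEquiv q in toEquiv (compose g f) (eqv-trans g f a b)

  -- The conjugate of `f` by the dilation by `k`: if `f` maps `P` to `Q`, this maps `kP` to `kQ`.
  scaleAU : ℤ → AffUnimod → AffUnimod
  scaleAU k f = affU a11 a12 a21 a22 (k Z.* c1) (k Z.* c2) unimod
    where open AffUnimod f

  scaleAU-law : ∀ f k {κ} → ofℤ k * κ ≡ 1ℚ → ∀ x → applyAU f (κ ⊙ x) ≡ κ ⊙ applyAU (scaleAU k f) x
  scaleAU-law f k {κ} e (a , b) = pt≡ (l a11 a12 c1) (l a21 a22 c2)
    where
    open AffUnimod f
    one : ∀ u → u ≡ κ * (ofℤ k * u)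
    one u = sym (trans (sym (ℚP.*-assoc κ (ofℤ k) u)) (trans (cong (λ q → q * u) (trans (ℚP.*-comm κ (ofℤ k)) e)) (ℚP.*-identityˡ u)))
    m : ∀ p q κ a b t → p * (κ * a) + q * (κ * b) + κ * t ≡ κ * (p * a + q * b + t)
    m = ℚring 6 (λ p q κ a b t → p *: (κ *: a) +: q *: (κ *: b) +: κ *: t =: κ *: (p *: a +: q *: b +: t))
    l : ∀ p q t → ofℤ p * (κ * a) + ofℤ q * (κ * b) + ofℤ t ≡ κ * (ofℤ p * a + ofℤ q * b + ofℤ (k Z.* t))
    l p q t = trans (cong (λ z → ofℤ p * (κ * a) + ofℤ q * (κ * b) + z) (trans (one (ofℤ t)) (cong (λ z → κ * z) (sym (ofℤ-* k t)))))
      (m (ofℤ p) (ofℤ q) κ a b (ofℤ (k Z.* t)))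

  eqv-scale : ∀ {S T} f k {κ} → ofℤ k * κ ≡ 1ℚ → Eqv f S T → Eqv (scaleAU k f) (dilate (ofℤ k) S) (dilate (ofℤ k) T)
  eqv-scale {S} {T} f k {κ} e q x =
      (λ c → proj₂ (conv-dilate {ofℤ k} {κ} e T (applyAU (scaleAU k f) x)) (subst (InConv T) (scaleAU-law f k {κ} e x) (proj₁ (q (κ ⊙ x)) (proj₁ (conv-dilate {ofℤ k} {κ} e S x) c)))) ,
      (λ c → proj₂ (conv-dilate {ofℤ k} {κ} e S x) (proj₂ (q (κ ⊙ x)) (subst (InConv T) (sym (scaleAU-law f k {κ} e x)) (proj₁ (conv-dilate {ofℤ k} {κ} e T (applyAU (scaleAU k f) x)) c))))

  eqv-dilate : ∀ {S T} f n → Eqv f S T → Eqv (scaleAU (+ suc n) f) (dilate (ofℕ (suc n)) S) (dilate (ofℕ (suc n)) T)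
  eqv-dilate f n q = eqv-scale f (+ suc n) {proj₁ (recip (ofℤ (+ suc n)) (0<ofℤsuc n))} (proj₂ (proj₂ (recip (ofℤ (+ suc n)) (0<ofℤsuc n)))) q

  count-map : ∀ {P R : ZPt → Set} {n} f → (∀ z → P z ↔ R (applyℤ f z)) → HasCount R n → HasCount P n
  count-map {P} {R} f h (L , len , uniq , mem) = map g L , trans (LP.length-map g L) len , UniqueP.map⁺ inj uniq ,
      λ z → mk⇔ (λ i → let (w , j , e) = ∈-map⁻ g i in
                   proj₂ (h z) (subst R (trans (sym (applyℤ-inverseʳ f w)) (cong (applyℤ f) (sym e))) (Equivalence.to (mem w) j)))
                (λ p → subst (_∈ map g L) (applyℤ-inverseˡ f z) (∈-map⁺ g (Equivalence.from (mem _) (proj₁ (h z) p))))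
    where
    g = applyℤ (inverse f)
    inj : ∀ {x y} → g x ≡ g y → x ≡ y
    inj {x} {y} e = trans (sym (applyℤ-inverseʳ f x)) (trans (cong (applyℤ f) e) (applyℤ-inverseʳ f y))

  eqv-interior : ∀ {S T} f → Eqv f S T → ∀ x → IsInteriorPt S x ↔ IsInteriorPt T (applyAU f x)
  eqv-interior {S} {T} f q x =
    (λ i → interior-pull (au-affine (inverse f)) (λ y → proj₂ (eqv-sym f q y)) (applyAU f x) (subst (IsInteriorPt S) (sym (inverseˡ f x)) i)) ,
    interior-pull (au-affine f) (λ y → proj₂ (q y)) x

  eqv-vertices : ∀ {S T} f → Eqv f S T → IntegralVertices T → IntegralVertices S
  eqv-vertices {S} {T} f q h v iv =
    let (z , e) = h (applyAU f v) (vertex-push (au-affine (inverse f)) (inverseˡ f) (inverseʳ f) (λ {x} → proj₁ (q x)) (λ {y} → proj₁ (eqv-sym f q y)) iv)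
    in applyℤ (inverse f) z , trans (toPt-applyℤ (inverse f) z) (trans (cong (applyAU (inverse f)) e) (inverseˡ f v))

  record Special (i : ℕ) (S : List Pt) : Set where
    constructor special
    field
      polygon : IsPolygon S
      pseudo : PseudoIntegral S
      denom : Denom2 S
      inner : HasCount (InteriorLattice S) i
      boundary : HasCount (BoundaryLattice S) (2 N.* i N.+ 7)

  -- Every part of the specification speaks of lattice points, vertices or interior points, and `f`
  -- permutes the lattice and preserves the other two; for the `k`-th dilate `f` is replaced by
  -- `scaleAU k f`.
  special-eqv : ∀ {i S T} f → Eqv f S T → Special i T → Special i S
  special-eqv {i} {S} {T} f q (special (x , ix) (cs , ehr) (d₁ , d₂) inn bd) = special
      (applyAU (inverse f) x , proj₁ (eqv-interior (inverse f) (eqv-sym f q) x) ix)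
      (cs , λ k → let (n , c , e) = ehr k in n , count-map (scaleAU (+ suc k) f) (λ z → conv k z) c , e)
      (eqv-vertices (scaleAU (+ 2) f) (eqv-dilate f 1 q) d₁ , λ h → d₂ (eqv-vertices (inverse f) (eqv-sym f q) h))
      (count-map f int inn)
      (count-map f (λ z → (λ (c , n) → proj₁ (inC z) c , λ i → n (proj₂ (int z) i)) , (λ (c , n) → proj₂ (inC z) c , λ i → n (proj₁ (int z) i))) bd)
    where
    sub : ∀ (P : Pt → Set) (A : Set) f z → A ↔ P (applyAU f (toPt z)) → A ↔ P (toPt (applyℤ f z))
    sub P A f z (a , b) = (λ x → subst P (sym (toPt-applyℤ f z)) (a x)) , (λ x → b (subst P (toPt-applyℤ f z) x))
    conv : ∀ k z → InConv (dilate (ofℕ (suc k)) S) (toPt z) ↔ InConv (dilate (ofℕ (suc k)) T) (toPt (applyℤ (scaleAU (+ suc k) f) z))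
    conv k z = sub (InConv (dilate (ofℕ (suc k)) T)) (InConv (dilate (ofℕ (suc k)) S) (toPt z)) (scaleAU (+ suc k) f) z (eqv-dilate f k q (toPt z))
    inC : ∀ z → InConv S (toPt z) ↔ InConv T (toPt (applyℤ f z))
    inC z = sub (InConv T) (InConv S (toPt z)) f z (q (toPt z))
    int : ∀ z → IsInteriorPt S (toPt z) ↔ IsInteriorPt T (toPt (applyℤ f z))
    int z = sub (IsInteriorPt T) (IsInteriorPt S (toPt z)) f z (eqv-interior f q (toPt z))
open Transport public

-- Floor sums along copies of a primitive edge

module FloorSums where
  open Z using (_≤_; _<_; _+_; _*_; _-_; -_)
  open ℤArith

  -- The floor of `n / (d + 1)`. The argument `h N.+ suc h` below thus stands for the denominator
  -- `2(h + 1)`.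
  fdiv : ℤ → ℕ → ℤ
  fdiv n d = n Z./ℕ suc d

  fdiv-rem : ∀ n d → Σ ℕ λ r → r N.< suc d × n ≡ + r + fdiv n d * + suc d
  fdiv-rem n d = n Z.%ℕ suc d , ZDM.n%ℕd<d n (suc d) , ZDM.a≡a%ℕn+[a/ℕn]*n n (suc d)

  fdiv-≤ : ∀ n d → fdiv n d * + suc d ≤ n
  fdiv-≤ n d = let (r , _ , e) = fdiv-rem n d in subst (fdiv n d * + suc d ≤_) (sym e) (ℤP.≤-trans (ℤP.≤-reflexive (sym (ℤP.+-identityˡ (fdiv n d * + suc d)))) (ℤP.+-monoˡ-≤ (fdiv n d * + suc d) (Z.+≤+ {0} {r} z≤n)))

  fdiv-< : ∀ n d → n < (fdiv n d + 1ℤ) * + suc d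
  fdiv-< n d = let (r , r< , e) = fdiv-rem n d in subst (_< (fdiv n d + 1ℤ) * + suc d) (sym e)
    (subst (+ r + fdiv n d * + suc d <_) (l (fdiv n d) (+ suc d)) (ℤP.+-monoˡ-< (fdiv n d * + suc d) (Z.+<+ r<)))
    where
    l : ∀ q D → D + q * D ≡ (q + 1ℤ) * D
    l = ℤring 2 (λ q D → D :+ q :* D := (q :+ # 1) :* D)

  fdiv-gal : ∀ n d z → (z ≤ fdiv n d) ↔ (z * + suc d ≤ n)
  fdiv-gal n d z = (λ p → ℤP.≤-trans (ℤP.*-monoʳ-≤-nonNeg (+ suc d) p) (fdiv-≤ n d)) ,
    (λ p → lt→le (ℤP.*-cancelʳ-<-nonNeg {z} {fdiv n d + 1ℤ} (+ suc d) (ℤP.≤-<-trans p (fdiv-< n d))))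
    where
    lt→le : ∀ {q} → z < q + 1ℤ → z ≤ q
    lt→le {q} p = bound (diff (<→≤ p)) (l q z)
      where
      l : ∀ q z → q - z ≡ q + 1ℤ - (z + 1ℤ)
      l = ℤring 2 (λ q z → q :- z := q :+ # 1 :- (z :+ # 1))

  fdiv-unique : ∀ n d q → q * + suc d ≤ n → n + 1ℤ ≤ (q + 1ℤ) * + suc d → fdiv n d ≡ q
  fdiv-unique n d q p r = ℤP.≤-antisym up (proj₂ (fdiv-gal n d q) p)
    where
    up : fdiv n d ≤ q
    up = subst₂ _≤_ (l (fdiv n d)) (l q) (ℤP.+-monoˡ-≤ -[1+ 0 ] (<→≤ (ℤP.*-cancelʳ-<-nonNeg {fdiv n d} {q + 1ℤ} (+ suc d) (ℤP.≤-<-trans (fdiv-≤ n d) (≤→< r)))))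
      where
      l : ∀ q → q + 1ℤ + -[1+ 0 ] ≡ q
      l = ℤring 1 (λ q → q :+ # 1 :+ con -[1+ 0 ] := q)

  -- The indicator of even integers as an arithmetic expression: `z - 2⌊z/2⌋` is the remainder
  -- modulo 2. In doubled coordinates the rows of even height are the lattice rows, and `evpt` is
  -- the indicator of lattice points.
  ev : ℤ → ℤ
  ev z = 1ℤ - z + + 2 * fdiv z 1

  data Parity (z : ℤ) : Set where
    even : ∀ w → z ≡ w + w → Parity z
    odd  : ∀ w → z ≡ w + w + 1ℤ → Parity z

  parity : ∀ z → Parity z
  parity z with fdiv-rem z 1
  ... | 0 , _ , e = even (fdiv z 1) (trans e (l (fdiv z 1)))
    where
    l : ∀ w → + 0 + w * + 2 ≡ w + w
    l = ℤring 1 (λ w → # 0 :+ w :* # 2 := w :+ w)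
  ... | 1 , _ , e = odd (fdiv z 1) (trans e (l (fdiv z 1)))
    where
    l : ∀ w → + 1 + w * + 2 ≡ w + w + 1ℤ
    l = ℤring 1 (λ w → # 1 :+ w :* # 2 := w :+ w :+ # 1)
  ... | suc (suc _) , s≤s (s≤s ()) , _

  ev-even : ∀ w → ev (w + w) ≡ 1ℤ
  ev-even w = trans (cong (λ q → 1ℤ - (w + w) + + 2 * q) (fdiv-unique (w + w) 1 w (bound (Z.+≤+ {0} z≤n) (l₁ w)) (bound (Z.+≤+ {0} {1} z≤n) (l₂ w)))) (l₃ w)
    where
    l₁ : ∀ w → w + w - w * + 2 ≡ 0ℤ
    l₁ = ℤring 1 (λ w → w :+ w :- w :* # 2 := # 0)
    l₂ : ∀ w → (w + 1ℤ) * + 2 - (w + w + 1ℤ) ≡ + 1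
    l₂ = ℤring 1 (λ w → (w :+ # 1) :* # 2 :- (w :+ w :+ # 1) := # 1)
    l₃ : ∀ w → 1ℤ - (w + w) + + 2 * w ≡ 1ℤ
    l₃ = ℤring 1 (λ w → # 1 :- (w :+ w) :+ # 2 :* w := # 1)

  ev-odd : ∀ w → ev (w + w + 1ℤ) ≡ 0ℤ
  ev-odd w = trans (cong (λ q → 1ℤ - (w + w + 1ℤ) + + 2 * q) (fdiv-unique (w + w + 1ℤ) 1 w (bound (Z.+≤+ {0} {1} z≤n) (l₁ w)) (bound (Z.+≤+ {0} z≤n) (l₂ w)))) (l₃ w)
    where
    l₁ : ∀ w → w + w + 1ℤ - w * + 2 ≡ + 1
    l₁ = ℤring 1 (λ w → w :+ w :+ # 1 :- w :* # 2 := # 1)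
    l₂ : ∀ w → (w + 1ℤ) * + 2 - (w + w + 1ℤ + 1ℤ) ≡ 0ℤ
    l₂ = ℤring 1 (λ w → (w :+ # 1) :* # 2 :- (w :+ w :+ # 1 :+ # 1) := # 0)
    l₃ : ∀ w → 1ℤ - (w + w + 1ℤ) + + 2 * w ≡ 0ℤ
    l₃ = ℤring 1 (λ w → # 1 :- (w :+ w :+ # 1) :+ # 2 :* w := # 0)

  ev-shift : ∀ z w → ev (z + (w + w)) ≡ ev z
  ev-shift z w with parity z
  ... | even v refl = trans (cong ev (l v w)) (trans (ev-even (v + w)) (sym (ev-even v)))
    where
    l : ∀ v w → v + v + (w + w) ≡ v + w + (v + w)
    l = ℤring 2 (λ v w → v :+ v :+ (w :+ w) := v :+ w :+ (v :+ w))
  ... | odd v refl = trans (cong ev (l v w)) (trans (ev-odd (v + w)) (sym (ev-odd v)))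
    where
    l : ∀ v w → v + v + 1ℤ + (w + w) ≡ v + w + (v + w) + 1ℤ
    l = ℤring 2 (λ v w → v :+ v :+ # 1 :+ (w :+ w) := v :+ w :+ (v :+ w) :+ # 1)

  ev-suc : ∀ z → ev (z + 1ℤ) ≡ 1ℤ - ev z
  ev-suc z with parity z
  ... | even v refl = trans (ev-odd v) (cong (λ q → 1ℤ - q) (sym (ev-even v)))
  ... | odd v refl = trans (trans (cong ev (l v)) (ev-even (v + 1ℤ))) (cong (λ q → 1ℤ - q) (sym (ev-odd v)))
    where
    l : ∀ v → v + v + 1ℤ + 1ℤ ≡ v + 1ℤ + (v + 1ℤ)
    l = ℤring 1 (λ v → v :+ v :+ # 1 :+ # 1 := v :+ # 1 :+ (v :+ # 1))

  ev-01 : ∀ z → ev z ≡ 0ℤ ⊎ ev z ≡ 1ℤ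
  ev-01 z with parity z
  ... | even v refl = inj₂ (ev-even v)
  ... | odd v refl = inj₁ (ev-odd v)

  ev≡1 : ∀ z → ev z ≡ 1ℤ → Σ ℤ λ w → z ≡ w + w
  ev≡1 z e with parity z
  ... | even v p = v , p
  ... | odd v refl with trans (sym (ev-odd v)) e
  ... | ()

  ev≡0 : ∀ z → ev z ≡ 0ℤ → Σ ℤ λ w → z ≡ w + w + 1ℤ
  ev≡0 z e with parity z
  ... | odd v p = v , p
  ... | even v refl with trans (sym (ev-even v)) e
  ... | ()

  evpt : ℤ → ℤ → ℤ
  evpt x y = ev x * ev y

  -- 2⌊w/2⌋ + 1 with numerator and denominator multiplied by h
  fdiv-mid : ∀ w h → + 2 * fdiv (w * + suc h) (h N.+ suc h) + 1ℤ ≡ w + ev w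
  fdiv-mid w h with parity w
  ... | even v refl = trans (cong (λ q → + 2 * q + 1ℤ) (fdiv-unique ((v + v) * + suc h) (h N.+ suc h) v (bound (Z.+≤+ {0} z≤n) (l₁ v (+ suc h))) (bound (Z.+≤+ {0} {h N.+ suc h} z≤n) (l₂ v (+ h)))))
        (trans (l₃ v) (cong (λ q → v + v + q) (sym (ev-even v))))
    where
    l₁ : ∀ v H → (v + v) * H - v * (H + H) ≡ 0ℤ
    l₁ = ℤring 2 (λ v H → (v :+ v) :* H :- v :* (H :+ H) := # 0)
    l₂ : ∀ v H → (v + 1ℤ) * (1ℤ + H + (1ℤ + H)) - ((v + v) * (1ℤ + H) + 1ℤ) ≡ H + (1ℤ + H)
    l₂ = ℤring 2 (λ v H → (v :+ # 1) :* (# 1 :+ H :+ (# 1 :+ H)) :- ((v :+ v) :* (# 1 :+ H) :+ # 1) := H :+ (# 1 :+ H))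
    l₃ : ∀ v → + 2 * v + 1ℤ ≡ v + v + 1ℤ
    l₃ = ℤring 1 (λ v → # 2 :* v :+ # 1 := v :+ v :+ # 1)
  ... | odd v refl = trans (cong (λ q → + 2 * q + 1ℤ) (fdiv-unique ((v + v + 1ℤ) * + suc h) (h N.+ suc h) v (bound (Z.+≤+ {0} {suc h} z≤n) (l₁ v (+ suc h))) (bound (Z.+≤+ {0} {h} z≤n) (l₂ v (+ h)))))
        (trans (l₃ v) (cong (λ q → v + v + 1ℤ + q) (sym (ev-odd v))))
    where
    l₁ : ∀ v H → (v + v + 1ℤ) * H - v * (H + H) ≡ H
    l₁ = ℤring 2 (λ v H → (v :+ v :+ # 1) :* H :- v :* (H :+ H) := H)
    l₂ : ∀ v H → (v + 1ℤ) * (1ℤ + H + (1ℤ + H)) - ((v + v + 1ℤ) * (1ℤ + H) + 1ℤ) ≡ H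
    l₂ = ℤring 2 (λ v H → (v :+ # 1) :* (# 1 :+ H :+ (# 1 :+ H)) :- ((v :+ v :+ # 1) :* (# 1 :+ H) :+ # 1) := H)
    l₃ : ∀ v → + 2 * v + 1ℤ ≡ v + v + 1ℤ + 0ℤ
    l₃ = ℤring 1 (λ v → # 2 :* v :+ # 1 := v :+ v :+ # 1 :+ # 0)

  sum : ℕ → (ℕ → ℤ) → ℤ
  sum zero f = 0ℤ
  sum (suc n) f = f 0 + sum n (f ∘ suc)

  sum-cong : ∀ n {f g} → (∀ j → j N.< n → f j ≡ g j) → sum n f ≡ sum n g
  sum-cong zero e = refl
  sum-cong (suc n) e = cong₂ _+_ (e 0 (s≤s z≤n)) (sum-cong n (λ j p → e (suc j) (s≤s p)))

  sum-split : ∀ a b f → sum (a N.+ b) f ≡ sum a f + sum b (λ j → f (a N.+ j))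
  sum-split zero b f = sym (ℤP.+-identityˡ _)
  sum-split (suc a) b f = trans (cong (λ q → f 0 + q) (sum-split a b (f ∘ suc))) (sym (ℤP.+-assoc (f 0) _ _))

  sum-+ : ∀ n f g → sum n (λ j → f j + g j) ≡ sum n f + sum n g
  sum-+ zero f g = refl
  sum-+ (suc n) f g = trans (cong (λ q → f 0 + g 0 + q) (sum-+ n (f ∘ suc) (g ∘ suc))) (l (f 0) (g 0) (sum n (f ∘ suc)) (sum n (g ∘ suc)))
    where
    l : ∀ a b c d → a + b + (c + d) ≡ a + c + (b + d)
    l = ℤring 4 (λ a b c d → a :+ b :+ (c :+ d) := a :+ c :+ (b :+ d))

  sum-* : ∀ n c f → sum n (λ j → f j * c) ≡ sum n f * c
  sum-* zero c f = refl
  sum-* (suc n) c f = trans (cong (λ q → f 0 * c + q) (sum-* n c (f ∘ suc))) (sym (ℤP.*-distribʳ-+ c (f 0) (sum n (f ∘ suc))))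

  sum-last : ∀ n f → sum (suc n) f ≡ sum n f + f n
  sum-last zero f = trans (ℤP.+-identityʳ (f 0)) (sym (ℤP.+-identityˡ (f 0)))
  sum-last (suc n) f = trans (cong (λ q → f 0 + q) (sum-last n (f ∘ suc))) (sym (ℤP.+-assoc (f 0) _ _))

  sum-rev : ∀ n f → sum n f ≡ sum n (λ j → f (n N.∸ suc j))
  sum-rev zero f = refl
  sum-rev (suc n) f = trans (sum-last n f) (trans (ℤP.+-comm (sum n f) (f n)) (cong (λ q → f n + q) (sum-rev n f)))

  -- Consecutive indicators add up to 1, so twice the sum is `n` up to a correction from the two
  -- ends.
  sum-ev : ∀ n z → + 2 * sum n (λ j → ev (z + + j)) ≡ + n + ev z - ev (z + + n)
  sum-ev zero z = trans (l (ev z)) (cong (λ q → 0ℤ + ev z - ev q) (sym (ℤP.+-identityʳ z)))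
    where
    l : ∀ q → + 2 * 0ℤ ≡ 0ℤ + q - q
    l = ℤring 1 (λ q → # 2 :* # 0 := # 0 :+ q :- q)
  sum-ev (suc n) z = trans (ℤP.*-distribˡ-+ (+ 2) (ev (z + 0ℤ)) _) (trans (cong₂ (λ p q → + 2 * ev p + q) (ℤP.+-identityʳ z) step) (fin (ev z) (ev (z + + suc n)) (+ n)))
    where
    step : + 2 * sum n (λ j → ev (z + + suc j)) ≡ + n + (1ℤ - ev z) - ev (z + + suc n)
    step = trans (cong (λ q → + 2 * q) (sum-cong n (λ j _ → cong ev (sym (ℤP.+-assoc z 1ℤ (+ j))))))
      (trans (sum-ev n (z + 1ℤ)) (cong₂ (λ p q → + n + p - ev q) (ev-suc z) (ℤP.+-assoc z 1ℤ (+ n))))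
    fin : ∀ p q n → + 2 * p + (n + (1ℤ - p) - q) ≡ 1ℤ + n + p - q
    fin = ℤring 3 (λ p q n → # 2 :* p :+ (n :+ (# 1 :- p) :- q) := # 1 :+ n :+ p :- q)

  -- The doubled contribution of an edge to row `J`. The edge leaves the doubled point `(ux , uy)`
  -- in direction `(D , suc h)`, so the row ends at abscissa `(ux * suc h + D * J) / (2 * suc h)`.
  -- If the right end has floor `r` and the mirrored left end floor `l`, the row has `r + l + 1`
  -- points, half of `(2r + 1) + (2l + 1)`; this separates the two sides. `o = 0` gives the floor,
  -- `o = 1` the largest integer strictly below.
  row : ℕ → ℤ → ℤ → ℤ → ℕ → ℕ → ℤ
  row o ux uy D h J = ev (uy + + J) * (+ 2 * fdiv (ux * + suc h + D * + J - + o) (h N.+ suc h) + 1ℤ)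

  coprime-≢ : ∀ {D h} → Cop.Coprime Z.∣ D ∣ (suc h) → ∀ t → t N.< h → ∀ q → D * + suc t ≢ q * + suc h
  coprime-≢ {D} {h} c t t<h q e = ℕP.<⇒≱ (s≤s t<h) (Div.∣⇒≤ (Cop.coprime-divisor (Cop.sym c) (Div.divides Z.∣ q ∣
    (trans (sym (ℤP.abs-* D (+ suc t))) (trans (cong Z.∣_∣ e) (ℤP.abs-* q (+ suc h)))))))

  -- The point reflection pairs row `t + 1` with row `2(h + 1) - (t + 1)`, of the same parity. Their
  -- abscissas add up to `ux + D`, and neither is an integer because `D` and `h + 1` are coprime, so
  -- the floors add up to one less.
  row-pair : ∀ {D h} → Cop.Coprime Z.∣ D ∣ (suc h) → ∀ ux uy t → t N.< h →
    row 0 ux uy D h (suc t) + row 0 ux uy D h (suc (h N.+ suc (h N.∸ suc t))) ≡ ev (uy + 1ℤ + + t) * (+ 2 * (ux + D))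
  row-pair {D} {h} c ux uy t t<h = trans (cong₂ (λ p q → ev p * (+ 2 * a + 1ℤ) + q) (sym (ℤP.+-assoc uy 1ℤ (+ t))) second) (l₀ (ev (uy + 1ℤ + + t)) a (ux + D))
    where
    s = h N.∸ suc t
    hs : + h ≡ + suc t + + s
    hs = cong +_ (sym (ℕP.m+[n∸m]≡n t<h))
    H = + suc h
    num = ux * H + D * + suc t - 0ℤ
    num′ = ux * H + D * + suc (h N.+ suc s) - 0ℤ
    a = fdiv num (h N.+ suc h)
    sumnum : ∀ S → + h ≡ + suc t + S → ux * H + D * (1ℤ + + h + (1ℤ + S)) - 0ℤ ≡ (ux + D) * (H + H) - (ux * H + D * + suc t - 0ℤ)
    sumnum S e = trans (l₁ ux D (+ t) S (+ h)) (trans (cong (λ q → (ux + D) * (1ℤ + + h + (1ℤ + + h)) - (ux * (1ℤ + + h) + D * (1ℤ + + t) - 0ℤ) + D * (1ℤ + + t + S - q)) e) (l₂ ((ux + D) * (1ℤ + + h + (1ℤ + + h)) - (ux * (1ℤ + + h) + D * (1ℤ + + t) - 0ℤ)) D (1ℤ + + t + S)))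
      where
      l₁ : ∀ ux D t S h → ux * (1ℤ + h) + D * (1ℤ + h + (1ℤ + S)) - 0ℤ ≡ (ux + D) * (1ℤ + h + (1ℤ + h)) - (ux * (1ℤ + h) + D * (1ℤ + t) - 0ℤ) + D * (1ℤ + t + S - h)
      l₁ = ℤring 5 (λ ux D t S h → ux :* (# 1 :+ h) :+ D :* (# 1 :+ h :+ (# 1 :+ S)) :- # 0 := (ux :+ D) :* (# 1 :+ h :+ (# 1 :+ h)) :- (ux :* (# 1 :+ h) :+ D :* (# 1 :+ t) :- # 0) :+ D :* (# 1 :+ t :+ S :- h))
      l₂ : ∀ A D q → A + D * (q - q) ≡ A
      l₂ = ℤring 3 (λ A D q → A :+ D :* (q :- q) := A)
    a≤ : a * (H + H) ≤ num
    a≤ = fdiv-≤ num (h N.+ suc h)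
    a< : a * (H + H) < num
    a< = ℤP.≤∧≢⇒< a≤ λ e → coprime-≢ {D} {h} c t t<h (+ 2 * a - ux) (trans (l₃ (D * + suc t) ux H) (trans (cong (λ q → q - ux * H) (sym e)) (l₄ a ux H)))
      where
      l₃ : ∀ d ux H → d ≡ ux * H + d - 0ℤ - ux * H
      l₃ = ℤring 3 (λ d ux H → d := ux :* H :+ d :- # 0 :- ux :* H)
      l₄ : ∀ a ux H → a * (H + H) - ux * H ≡ (+ 2 * a - ux) * H
      l₄ = ℤring 3 (λ a ux H → a :* (H :+ H) :- ux :* H := (# 2 :* a :- ux) :* H)
    second-f : fdiv num′ (h N.+ suc h) ≡ ux + D - a - 1ℤ
    second-f = fdiv-unique num′ (h N.+ suc h) (ux + D - a - 1ℤ)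
        (bound (diff (<→≤ (fdiv-< num (h N.+ suc h))) ⊹ Z.+≤+ {0} {1} z≤n) (trans (cong (λ q → q - (ux + D - a - 1ℤ) * (H + H)) (sumnum (+ s) hs)) (l₅ (ux + D) a H num)))
        (bound (diff (<→≤ a<)) (trans (cong (λ q → (ux + D - a - 1ℤ + 1ℤ) * (H + H) - (q + 1ℤ)) (sumnum (+ s) hs)) (l₆ (ux + D) a H num)))
      where
      l₅ : ∀ w a H n → w * (H + H) - n - (w - a - 1ℤ) * (H + H) ≡ (a + 1ℤ) * (H + H) - (n + 1ℤ) + 1ℤ
      l₅ = ℤring 4 (λ w a H n → w :* (H :+ H) :- n :- (w :- a :- # 1) :* (H :+ H) := (a :+ # 1) :* (H :+ H) :- (n :+ # 1) :+ # 1)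
      l₆ : ∀ w a H n → (w - a - 1ℤ + 1ℤ) * (H + H) - (w * (H + H) - n + 1ℤ) ≡ n - (a * (H + H) + 1ℤ)
      l₆ = ℤring 4 (λ w a H n → (w :- a :- # 1 :+ # 1) :* (H :+ H) :- (w :* (H :+ H) :- n :+ # 1) := n :- (a :* (H :+ H) :+ # 1))
    second : row 0 ux uy D h (suc (h N.+ suc s)) ≡ ev (uy + 1ℤ + + t) * (+ 2 * (ux + D - a - 1ℤ) + 1ℤ)
    second = cong₂ (λ p q → p * (+ 2 * q + 1ℤ)) (trans (cong ev (l₇ uy (+ t) (+ s) (+ h) hs)) (ev-shift (uy + 1ℤ + + t) (1ℤ + + s))) second-f
      where
      l₇ : ∀ uy t s h → h ≡ 1ℤ + t + s → uy + (1ℤ + h + (1ℤ + s)) ≡ uy + 1ℤ + t + (1ℤ + s + (1ℤ + s))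
      l₇ uy t s .(1ℤ + t + s) refl = ℤring 3 (λ uy t s → uy :+ (# 1 :+ (# 1 :+ t :+ s) :+ (# 1 :+ s)) := uy :+ # 1 :+ t :+ (# 1 :+ s :+ (# 1 :+ s))) uy t s
    l₀ : ∀ e a w → e * (+ 2 * a + 1ℤ) + e * (+ 2 * (w - a - 1ℤ) + 1ℤ) ≡ e * (+ 2 * w)
    l₀ = ℤring 3 (λ e a w → e :* (# 2 :* a :+ # 1) :+ e :* (# 2 :* (w :- a :- # 1) :+ # 1) := e :* (# 2 :* w))

  -- The rows of two consecutive copies of a primitive edge are matched by the point reflection in their common endpoint.
  block : ∀ {D h} → Cop.Coprime Z.∣ D ∣ (suc h) → ∀ ux uy →
    sum (suc h N.+ suc h) (row 0 ux uy D h) ≡ + suc h * (ux + D) - D * ev uy + (evpt ux uy + evpt (ux + D) (uy + + suc h))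
  block {D} {h} c ux uy = trans (sum-split (suc h) (suc h) F) (trans (cong₂ _+_ (cong (λ q → q + sum h (F ∘ suc)) F0) (cong₂ _+_ Fh back))
      (trans (regroup (ev uy * (ux + ev ux)) (sum h (F ∘ suc)) (ev (uy + + suc h) * (ux + D + ev (ux + D))) (sum h (λ j → F (suc h N.+ suc (h N.∸ suc j)))))
      (trans (cong (λ q → q + (ev uy * (ux + ev ux) + ev (uy + + suc h) * (ux + D + ev (ux + D)))) pairs) fin)))
    where
    F = row 0 ux uy D h
    -- Row `h + 1` is its own partner and row `0` has its partner outside the sum. Both pass through
    -- ends of the first copy and give the parity terms.
    F0 : F 0 ≡ ev uy * (ux + ev ux)
    F0 = cong₂ (λ p q → ev p * q) (ℤP.+-identityʳ uy) (trans (cong (λ q → + 2 * fdiv q (h N.+ suc h) + 1ℤ) (l (ux * + suc h) D)) (fdiv-mid ux h))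
      where
      l : ∀ a D → a + D * 0ℤ - 0ℤ ≡ a
      l = ℤring 2 (λ a D → a :+ D :* # 0 :- # 0 := a)
    Fh : F (suc h N.+ 0) ≡ ev (uy + + suc h) * (ux + D + ev (ux + D))
    Fh = trans (cong F (ℕP.+-identityʳ (suc h))) (cong (λ q → ev (uy + + suc h) * q) (trans (cong (λ q → + 2 * fdiv q (h N.+ suc h) + 1ℤ) (l ux D (+ suc h))) (fdiv-mid (ux + D) h)))
      where
      l : ∀ a D H → a * H + D * H - 0ℤ ≡ (a + D) * H
      l = ℤring 3 (λ a D H → a :* H :+ D :* H :- # 0 := (a :+ D) :* H)
    back : sum h (λ j → F (suc h N.+ suc j)) ≡ sum h (λ j → F (suc h N.+ suc (h N.∸ suc j)))
    back = sum-rev h (λ j → F (suc h N.+ suc j))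
    regroup : ∀ a b c d → a + b + (c + d) ≡ b + d + (a + c)
    regroup = ℤring 4 (λ a b c d → a :+ b :+ (c :+ d) := b :+ d :+ (a :+ c))
    E = sum h (λ j → ev (uy + 1ℤ + + j))
    pairs : sum h (F ∘ suc) + sum h (λ j → F (suc h N.+ suc (h N.∸ suc j))) ≡ E * (+ 2 * (ux + D))
    pairs = trans (sym (sum-+ h _ _)) (trans (sum-cong h (λ t t<h → row-pair c ux uy t t<h)) (sum-* h (+ 2 * (ux + D)) (λ j → ev (uy + 1ℤ + + j))))
    fin : E * (+ 2 * (ux + D)) + (ev uy * (ux + ev ux) + ev (uy + + suc h) * (ux + D + ev (ux + D))) ≡
      + suc h * (ux + D) - D * ev uy + (evpt ux uy + evpt (ux + D) (uy + + suc h))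
    fin = trans (l₁ E ux D (ev uy * (ux + ev ux) + ev (uy + + suc h) * (ux + D + ev (ux + D))))
      (trans (cong (λ q → q * (ux + D) + (ev uy * (ux + ev ux) + ev (uy + + suc h) * (ux + D + ev (ux + D)))) 2E) (l₂ ux D (ev uy) (ev ux) (ev (uy + + suc h)) (ev (ux + D)) (+ h)))
      where
      2E : + 2 * E ≡ + h + (1ℤ - ev uy) - ev (uy + + suc h)
      2E = trans (sum-ev h (uy + 1ℤ)) (cong₂ (λ p q → + h + p - ev q) (ev-suc uy) (ℤP.+-assoc uy 1ℤ (+ h)))
      l₁ : ∀ E u D w → E * (+ 2 * (u + D)) + w ≡ + 2 * E * (u + D) + w
      l₁ = ℤring 4 (λ E u D w → E :* (# 2 :* (u :+ D)) :+ w := # 2 :* E :* (u :+ D) :+ w)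
      l₂ : ∀ u D p q r s h → (h + (1ℤ - p) - r) * (u + D) + (p * (u + q) + r * (u + D + s)) ≡ (1ℤ + h) * (u + D) - D * p + (q * p + s * r)
      l₂ = ℤring 7 (λ u D p q r s h → (h :+ (# 1 :- p) :- r) :* (u :+ D) :+ (p :* (u :+ q) :+ r :* (u :+ D :+ s)) := (# 1 :+ h) :* (u :+ D) :- D :* p :+ (q :* p :+ s :* r))

  row-shift : ∀ o ux uy D h a J → row o ux uy D h (a N.* suc h N.+ J) ≡ row o (ux + + a * D) (uy + + a * + suc h) D h J
  row-shift o ux uy D h a J = cong₂ (λ p q → ev p * (+ 2 * fdiv (q - + o) (h N.+ suc h) + 1ℤ))
    (trans (cong (λ q → uy + (q + + J)) (ℤP.pos-* a (suc h))) (sym (ℤP.+-assoc uy (+ a * + suc h) (+ J))))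
    (trans (cong (λ q → ux * + suc h + D * (q + + J)) (ℤP.pos-* a (suc h))) (l ux D (+ suc h) (+ a) (+ J)))
    where
    l : ∀ ux D H a J → ux * H + D * (a * H + J) ≡ (ux + a * D) * H + D * J
    l = ℤring 5 (λ ux D H a J → ux :* H :+ D :* (a :* H :+ J) := (ux :+ a :* D) :* H :+ D :* J)

  copies : ∀ a b {ux uy D h} → sum ((a N.+ b) N.* suc h) (row 0 ux uy D h) ≡
    sum (a N.* suc h) (row 0 ux uy D h) + sum (b N.* suc h) (row 0 (ux + + a * D) (uy + + a * + suc h) D h)
  copies a b {ux} {uy} {D} {h} = trans (cong (λ n → sum n (row 0 ux uy D h)) (ℕP.*-distribʳ-+ (suc h) a b))
    (trans (sum-split (a N.* suc h) (b N.* suc h) (row 0 ux uy D h)) (cong (λ q → sum (a N.* suc h) (row 0 ux uy D h) + q) (sum-cong (b N.* suc h) (λ J _ → row-shift 0 ux uy D h a J))))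

  -- The number of endpoints of the edge in the even lattice, that is, of endpoints that are lattice
  -- points before doubling.
  η : ℤ → ℤ → ℤ → ℕ → ℤ
  η x y D h = evpt x y + evpt (x + D) (y + + suc h)

  -- Consecutive blocks differ by a translation by `(2D , 2(h + 1))`, which changes no parity. So
  -- every block has the same correction `η`, and the sum is quadratic in `m`.
  blocks : ∀ {D h} → Cop.Coprime Z.∣ D ∣ (suc h) → ∀ m ux uy → sum ((m N.* 2) N.* suc h) (row 0 ux uy D h) ≡
    + m * + suc h * ux + + suc h * D * + m * + m - + m * D * ev uy + + m * η ux uy D h
  blocks {D} {h} c zero ux uy = l (+ suc h) ux D (ev uy) (η ux uy D h)
    where
    l : ∀ H ux D e n → 0ℤ ≡ 0ℤ * H * ux + H * D * 0ℤ * 0ℤ - 0ℤ * D * e + 0ℤ * n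
    l = ℤring 5 (λ H ux D e n → # 0 := # 0 :* H :* ux :+ H :* D :* # 0 :* # 0 :- # 0 :* D :* e :+ # 0 :* n)
  blocks {D} {h} c (suc m) ux uy = trans (copies 2 (m N.* 2) {ux} {uy} {D} {h}) (trans (cong₂ _+_ first rest) (l (+ m) (+ suc h) ux D (ev uy) (η ux uy D h)))
    where
    first : sum (2 N.* suc h) (row 0 ux uy D h) ≡ + suc h * (ux + D) - D * ev uy + η ux uy D h
    first = trans (cong (λ n → sum n (row 0 ux uy D h)) (cong (λ n → suc h N.+ n) (ℕP.+-identityʳ (suc h)))) (block c ux uy)
    two : ∀ z → + 2 * z ≡ z + z
    two = ℤring 1 (λ z → # 2 :* z := z :+ z)
    ev2 : ∀ z w → ev (z + + 2 * w) ≡ ev z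
    ev2 z w = trans (cong (λ q → ev (z + q)) (two w)) (ev-shift z w)
    com : ∀ a b c → a + b + c ≡ a + c + b
    com = ℤring 3 (λ a b c → a :+ b :+ c := a :+ c :+ b)
    H = + suc h
    ηeq : η (ux + + 2 * D) (uy + + 2 * H) D h ≡ η ux uy D h
    ηeq = cong₂ _+_ (cong₂ _*_ (ev2 ux D) (ev2 uy H))
      (cong₂ _*_ (trans (cong ev (com ux (+ 2 * D) D)) (ev2 (ux + D) D)) (trans (cong ev (com uy (+ 2 * H) H)) (ev2 (uy + H) H)))
    rest : sum ((m N.* 2) N.* suc h) (row 0 (ux + + 2 * D) (uy + + 2 * H) D h) ≡
      + m * H * (ux + + 2 * D) + H * D * + m * + m - + m * D * ev uy + + m * η ux uy D h
    rest = trans (blocks c m (ux + + 2 * D) (uy + + 2 * H))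
      (cong₂ (λ p q → + m * H * (ux + + 2 * D) + H * D * + m * + m - + m * D * p + + m * q) (ev2 uy H) ηeq)
    l : ∀ m H ux D e n → H * (ux + D) - D * e + n + (m * H * (ux + + 2 * D) + H * D * m * m - m * D * e + m * n)
      ≡ (1ℤ + m) * H * ux + H * D * (1ℤ + m) * (1ℤ + m) - (1ℤ + m) * D * e + (1ℤ + m) * n
    l = ℤring 6 (λ m H ux D e n → H :* (ux :+ D) :- D :* e :+ n :+ (m :* H :* (ux :+ # 2 :* D) :+ H :* D :* m :* m :- m :* D :* e :+ m :* n) := (# 1 :+ m) :* H :* ux :+ H :* D :* (# 1 :+ m) :* (# 1 :+ m) :- (# 1 :+ m) :* D :* e :+ (# 1 :+ m) :* n)
open FloorSums public

-- Chains of edges: row sums in even and odd dilates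

module Chains where
  open Z using (_≤_; _<_; _+_; _*_; _-_; -_)
  open ℤArith

  -- An edge (D , h) is the vector (D , suc h); a chain is a list of edges, read upwards from a starting point.
  Edge : Set
  Edge = ℤ × ℕ

  Primitive : List Edge → Set
  Primitive = All (λ e → Cop.Coprime Z.∣ proj₁ e ∣ (suc (proj₂ e)))

  height : List Edge → ℕ
  height [] = 0
  height ((D , h) ∷ es) = suc h N.+ height es

  endX : List Edge → ℤ → ℤ
  endX [] x = x
  endX ((D , h) ∷ es) x = endX es (x + D)

  -- twice the signed area between the chain and the y-axis
  area : List Edge → ℤ → ℤ
  area [] x = 0ℤ
  area ((D , h) ∷ es) x = + suc h * (x + (x + D)) + area es (x + D)

  ηs : List Edge → ℤ → ℤ → ℤ
  ηs [] x y = 0ℤ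
  ηs ((D , h) ∷ es) x y = η x y D h + ηs es (x + D) (y + + suc h)

  -- The `k`-th dilate contains `k` copies of every edge. An edge accounts for its rows up to, but
  -- not including, that of its upper end; the empty chain adds the top row.
  rows : ℕ → List Edge → ℤ → ℤ → ℤ
  rows k [] x y = ev (+ k * y) * (+ 2 * fdiv (+ k * x - 0ℤ) 1 + 1ℤ)
  rows k ((D , h) ∷ es) x y = sum (k N.* suc h) (row 0 (+ k * x) (+ k * y) D h) + rows k es (x + D) (y + + suc h)

  -- Strict inequalities at `k = 1`, without the top row: the starting point for counting interior
  -- points.
  openRows : List Edge → ℤ → ℤ → ℤ
  openRows [] x y = 0ℤ
  openRows ((D , h) ∷ es) x y = sum (suc h) (row 1 (+ 1 * x) (+ 1 * y) D h) + openRows es (x + D) (y + + suc h)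

  -- Counting lattice points needs the end of each single row, while the summation formulas go edge
  -- by edge; `floorSum-rows` and `floorSum-open` reconcile the two views.
  floorAt : ℕ → ℕ → List Edge → ℤ → ℕ → ℤ
  floorAt o k [] x J = fdiv (+ k * x - + o) 1
  floorAt o k ((D , h) ∷ es) x J =
    if J N.<ᵇ k N.* suc h then fdiv (+ k * x * + suc h + D * + J - + o) (h N.+ suc h) else floorAt o k es (x + D) (J N.∸ k N.* suc h)

  floorAt-< : ∀ o k D h es x {J} → J N.< k N.* suc h →
    floorAt o k ((D , h) ∷ es) x J ≡ fdiv (+ k * x * + suc h + D * + J - + o) (h N.+ suc h)
  floorAt-< o k D h es x {J} p with J N.<ᵇ k N.* suc h | ℕP.<⇒<ᵇ p
  ... | true | _ = refl

  floorAt-≥ : ∀ o k D h es x {J} → k N.* suc h N.≤ J →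
    floorAt o k ((D , h) ∷ es) x J ≡ floorAt o k es (x + D) (J N.∸ k N.* suc h)
  floorAt-≥ o k D h es x {J} p with J N.<ᵇ k N.* suc h in eq
  ... | false = refl
  ... | true = ⊥-elim (ℕP.<⇒≱ (ℕP.<ᵇ⇒< J (k N.* suc h) (subst T (sym eq) _)) p)
    where open import Data.Bool using (T)

  floorSum : ℕ → ℕ → List Edge → ℤ → ℤ → ℕ → ℤ
  floorSum o k es x y n = sum n (λ J → ev (+ k * y + + J) * (+ 2 * floorAt o k es x J + 1ℤ))

  floorSum-edge : ∀ o k D h es x y n → floorSum o k ((D , h) ∷ es) x y (k N.* suc h N.+ n) ≡
    sum (k N.* suc h) (row o (+ k * x) (+ k * y) D h) + floorSum o k es (x + D) (y + + suc h) n
  floorSum-edge o k D h es x y n = trans (sum-split (k N.* suc h) n _) (cong₂ _+_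
    (sum-cong (k N.* suc h) (λ J p → cong (λ q → ev (+ k * y + + J) * (+ 2 * q + 1ℤ)) (floorAt-< o k D h es x p)))
    (sum-cong n (λ J p → cong₂ (λ p q → ev p * (+ 2 * q + 1ℤ)) (yy J) (trans (floorAt-≥ o k D h es x (ℕP.m≤m+n (k N.* suc h) J)) (cong (floorAt o k es (x + D)) (ℕP.m+n∸m≡n (k N.* suc h) J))))))
    where
    l : ∀ k y H J → k * y + (k * H + J) ≡ k * (y + H) + J
    l = ℤring 4 (λ k y H J → k :* y :+ (k :* H :+ J) := k :* (y :+ H) :+ J)
    yy : ∀ J → + k * y + + (k N.* suc h N.+ J) ≡ + k * (y + + suc h) + + J
    yy J = trans (cong (λ q → + k * y + (q + + J)) (ℤP.pos-* k (suc h))) (l (+ k) y (+ suc h) (+ J))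

  floorSum-rows : ∀ k es x y → floorSum 0 k es x y (k N.* height es N.+ 1) ≡ rows k es x y
  floorSum-rows k [] x y = trans (cong (floorSum 0 k [] x y) (cong (N._+ 1) (ℕP.*-zeroʳ k)))
    (trans (ℤP.+-identityʳ _) (cong (λ q → ev q * (+ 2 * fdiv (+ k * x - 0ℤ) 1 + 1ℤ)) (ℤP.+-identityʳ (+ k * y))))
  floorSum-rows k ((D , h) ∷ es) x y = trans (cong (floorSum 0 k ((D , h) ∷ es) x y) (trans (cong (N._+ 1) (ℕP.*-distribˡ-+ k (suc h) (height es))) (ℕP.+-assoc (k N.* suc h) (k N.* height es) 1)))
    (trans (floorSum-edge 0 k D h es x y (k N.* height es N.+ 1)) (cong (λ q → sum (k N.* suc h) (row 0 (+ k * x) (+ k * y) D h) + q) (floorSum-rows k es (x + D) (y + + suc h))))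

  floorSum-open : ∀ es x y → floorSum 1 1 es x y (height es) ≡ openRows es x y
  floorSum-open [] x y = refl
  floorSum-open ((D , h) ∷ es) x y = trans (cong (λ n → floorSum 1 1 ((D , h) ∷ es) x y (n N.+ height es)) (sym (ℕP.+-identityʳ (suc h))))
    (trans (floorSum-edge 1 1 D h es x y (height es)) (cong₂ _+_ (cong (λ n → sum n (row 1 (+ 1 * x) (+ 1 * y) D h)) (ℕP.+-identityʳ (suc h))) (floorSum-open es (x + D) (y + + suc h))))

  ev-double : ∀ m z → ev (+ (m N.* 2) * z) ≡ 1ℤ
  ev-double m z = trans (cong ev (trans (cong (λ q → q * z) (ℤP.pos-* m 2)) (l (+ m) z))) (ev-even (+ m * z))
    where
    l : ∀ m z → m * + 2 * z ≡ m * z + m * z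
    l = ℤring 2 (λ m z → m :* # 2 :* z := m :* z :+ m :* z)

  coprime-not-both-even : ∀ {D h} → Cop.Coprime Z.∣ D ∣ (suc h) → ev D ≡ 1ℤ → ev (+ suc h) ≡ 1ℤ → ⊥
  coprime-not-both-even {D} {h} c e f with ev≡1 D e | ev≡1 (+ suc h) f
  ... | u , p | v , q with c {2} (dbl u p , dbl v q)
    where
    dbl : ∀ {z} w → z ≡ w + w → 2 Div.∣ Z.∣ z ∣
    dbl w refl = Div.divides Z.∣ w ∣ (trans (cong Z.∣_∣ (l w)) (ℤP.abs-* w (+ 2)))
      where
      l : ∀ w → w + w ≡ w * + 2
      l = ℤring 1 (λ w → w :+ w := w :* # 2)
  ... | ()

  evpt-coprime : ∀ {D h} → Cop.Coprime Z.∣ D ∣ (suc h) → evpt D (+ suc h) ≡ 0ℤ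
  evpt-coprime {D} {h} c with ev-01 D | ev-01 (+ suc h)
  ... | inj₁ e | _ = cong (λ q → q * ev (+ suc h)) e
  ... | inj₂ e | inj₁ f = trans (cong (λ q → ev D * q) f) (ℤP.*-zeroʳ (ev D))
  ... | inj₂ e | inj₂ f = ⊥-elim (coprime-not-both-even {D} {h} c e f)

  floor-half : ∀ w → + 2 * fdiv (w - 0ℤ) 1 + 1ℤ ≡ w + ev w
  floor-half w = trans (cong (λ q → + 2 * fdiv q 1 + 1ℤ) (l w)) (fdiv-mid w 0)
    where
    l : ∀ w → w - 0ℤ ≡ w * 1ℤ
    l = ℤring 1 (λ w → w :- # 0 := w :* # 1)

  -- In an even dilate all vertices of the chain are lattice points and, as `D` and `suc h` are not
  -- both even, the middle of a block never is. So `η` is 1 on every edge, and the linear term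
  -- counts edges without regard to parity.
  rows-even : ∀ m es x y → Primitive es →
    rows (m N.* 2) es x y ≡ + m * + m * area es x + + m * (+ length es + endX es x + x) + 1ℤ
  rows-even m [] x y _ = trans (cong₂ _*_ (ev-double m y) (trans (floor-half (+ (m N.* 2) * x)) (cong₂ _+_ (cong (λ q → q * x) (ℤP.pos-* m 2)) (ev-double m x)))) (l (+ m) x)
    where
    l : ∀ m x → 1ℤ * (m * + 2 * x + 1ℤ) ≡ m * m * 0ℤ + m * (0ℤ + x + x) + 1ℤ
    l = ℤring 2 (λ m x → # 1 :* (m :* # 2 :* x :+ # 1) := m :* m :* # 0 :+ m :* (# 0 :+ x :+ x) :+ # 1)
  rows-even m ((D , h) ∷ es) x y (c All.∷ cs) = trans (cong₂ _+_ edge (rows-even m es (x + D) (y + + suc h) cs)) (l (+ m) (+ suc h) x D (area es (x + D)) (+ length es) (endX es (x + D)))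
    where
    K = + (m N.* 2)
    ηeq : η (K * x) (K * y) D h ≡ 1ℤ
    ηeq = cong₂ _+_ (cong₂ _*_ (ev-double m x) (ev-double m y))
      (trans (cong₂ _*_ (sh x D) (sh y (+ suc h))) (evpt-coprime {D} {h} c))
      where
      sh : ∀ x D → ev (K * x + D) ≡ ev D
      sh x D = trans (cong ev (trans (cong (λ q → q * x + D) (ℤP.pos-* m 2)) (l′ (+ m) x D))) (ev-shift D (+ m * x))
        where
        l′ : ∀ m x D → m * + 2 * x + D ≡ D + (m * x + m * x)
        l′ = ℤring 3 (λ m x D → m :* # 2 :* x :+ D := D :+ (m :* x :+ m :* x))
    edge : sum ((m N.* 2) N.* suc h) (row 0 (K * x) (K * y) D h) ≡ + m * + suc h * (+ m * + 2 * x) + + suc h * D * + m * + m - + m * D * 1ℤ + + m * 1ℤ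
    edge = trans (blocks {D} {h} c m (K * x) (K * y)) (trans (cong₂ (λ p q → + m * + suc h * (K * x) + + suc h * D * + m * + m - + m * D * p + + m * q) (ev-double m y) ηeq)
      (cong (λ q → + m * + suc h * (q * x) + + suc h * D * + m * + m - + m * D * 1ℤ + + m * 1ℤ) (ℤP.pos-* m 2)))
    l : ∀ m H x D A n X → m * H * (m * + 2 * x) + H * D * m * m - m * D * 1ℤ + m * 1ℤ + (m * m * A + m * (n + X + (x + D)) + 1ℤ)
      ≡ m * m * (H * (x + (x + D)) + A) + m * (1ℤ + n + X + x) + 1ℤ
    l = ℤring 7 (λ m H x D A n X → m :* H :* (m :* # 2 :* x) :+ H :* D :* m :* m :- m :* D :* # 1 :+ m :* # 1 :+ (m :* m :* A :+ m :* (n :+ X :+ (x :+ D)) :+ # 1) := m :* m :* (H :* (x :+ (x :+ D)) :+ A) :+ m :* (# 1 :+ n :+ X :+ x) :+ # 1)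

  odd-scale : ∀ m z → + (1 N.+ m N.* 2) * z ≡ z + (+ m * z + + m * z)
  odd-scale m z = trans (cong (λ q → (1ℤ + q) * z) (ℤP.pos-* m 2)) (l (+ m) z)
    where
    l : ∀ m z → (1ℤ + m * + 2) * z ≡ z + (m * z + m * z)
    l = ℤring 2 (λ m z → (# 1 :+ m :* # 2) :* z := z :+ (m :* z :+ m :* z))

  -- Translation by an even vector is a lattice translation before doubling; it moves each floor by
  -- the integer `a`.
  row-translate : ∀ ux uy D h a b J → row 0 (ux + (a + a)) (uy + (b + b)) D h J ≡ row 0 ux uy D h J + + 2 * a * ev (uy + + J)
  row-translate ux uy D h a b J = trans (cong₂ (λ p q → p * (+ 2 * q + 1ℤ)) evs fl) (l (ev (uy + + J)) q a)
    where
    H = + suc h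
    q = fdiv (ux * H + D * + J - 0ℤ) (h N.+ suc h)
    evs : ev (uy + (b + b) + + J) ≡ ev (uy + + J)
    evs = trans (cong ev (c uy b (+ J))) (ev-shift (uy + + J) b)
      where
      c : ∀ u b J → u + (b + b) + J ≡ u + J + (b + b)
      c = ℤring 3 (λ u b J → u :+ (b :+ b) :+ J := u :+ J :+ (b :+ b))
    n = ux * H + D * + J - 0ℤ
    fl : fdiv ((ux + (a + a)) * H + D * + J - 0ℤ) (h N.+ suc h) ≡ q + a
    fl = fdiv-unique ((ux + (a + a)) * H + D * + J - 0ℤ) (h N.+ suc h) (q + a) (bound (diff (fdiv-≤ n (h N.+ suc h))) (l₁ ux a H D (+ J) q))
           (bound (diff (<→≤ (fdiv-< n (h N.+ suc h)))) (l₂ ux a H D (+ J) q))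
      where
      l₁ : ∀ ux a H D J q → (ux + (a + a)) * H + D * J - 0ℤ - (q + a) * (H + H) ≡ ux * H + D * J - 0ℤ - q * (H + H)
      l₁ = ℤring 6 (λ ux a H D J q → (ux :+ (a :+ a)) :* H :+ D :* J :- # 0 :- (q :+ a) :* (H :+ H) := ux :* H :+ D :* J :- # 0 :- q :* (H :+ H))
      l₂ : ∀ ux a H D J q → (q + a + 1ℤ) * (H + H) - ((ux + (a + a)) * H + D * J - 0ℤ + 1ℤ) ≡ (q + 1ℤ) * (H + H) - (ux * H + D * J - 0ℤ + 1ℤ)
      l₂ = ℤring 6 (λ ux a H D J q → (q :+ a :+ # 1) :* (H :+ H) :- ((ux :+ (a :+ a)) :* H :+ D :* J :- # 0 :+ # 1) := (q :+ # 1) :* (H :+ H) :- (ux :* H :+ D :* J :- # 0 :+ # 1))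
    l : ∀ e q a → e * (+ 2 * (q + a) + 1ℤ) ≡ e * (+ 2 * q + 1ℤ) + + 2 * a * e
    l = ℤring 3 (λ e q a → e :* (# 2 :* (q :+ a) :+ # 1) := e :* (# 2 :* q :+ # 1) :+ # 2 :* a :* e)

  -- The odd dilate splits off one copy, a lattice translate of the undilated edge; the other `2m`
  -- copies form `m` blocks. The terms at the two ends of the edge are arranged to telescope along a
  -- chain.
  edge-odd : ∀ {D h} → Cop.Coprime Z.∣ D ∣ (suc h) → ∀ m x y → let K = + (1 N.+ m N.* 2) ; H = + suc h in
    sum ((1 N.+ m N.* 2) N.* suc h) (row 0 (K * x) (K * y) D h) ≡
    sum (1 N.* suc h) (row 0 (+ 1 * x) (+ 1 * y) D h) + ((+ m * + m + + m) * (H * (x + (x + D))) + + m * (η x y D h + x * ev y - (x + D) * ev (y + H)))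
  edge-odd {D} {h} c m x y = trans (copies 1 (m N.* 2) {K * x} {K * y} {D} {h}) (trans (cong₂ _+_ first rest) (fin S (+ m) x D H (ev y) (ev (y + H)) (η x y D h)))
    where
    K = + (1 N.+ m N.* 2)
    H = + suc h
    S = sum (1 N.* suc h) (row 0 (+ 1 * x) (+ 1 * y) D h)
    one : ∀ z → z ≡ + 1 * z
    one z = sym (ℤP.*-identityˡ z)
    Σev : + 2 * sum (1 N.* suc h) (λ J → ev (+ 1 * y + + J)) ≡ H + ev y - ev (y + H)
    Σev = trans (cong (λ n → + 2 * sum n (λ J → ev (+ 1 * y + + J))) (ℕP.+-identityʳ (suc h))) (trans (sum-ev (suc h) (+ 1 * y)) (cong (λ q → H + ev q - ev (q + H)) (sym (one y))))
    first : sum (1 N.* suc h) (row 0 (K * x) (K * y) D h) ≡ S + + m * x * (H + ev y - ev (y + H))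
    first = trans (sum-cong (1 N.* suc h) (λ J _ → trans (cong₂ (λ p q → row 0 p q D h J) (trans (odd-scale m x) (cong (λ q → q + (+ m * x + + m * x)) (one x))) (trans (odd-scale m y) (cong (λ q → q + (+ m * y + + m * y)) (one y)))) (trans (row-translate (+ 1 * x) (+ 1 * y) D h (+ m * x) (+ m * y) J) (cong (λ q → row 0 (+ 1 * x) (+ 1 * y) D h J + q) (com (+ m * x) (ev (+ 1 * y + + J)))))))
      (trans (sum-+ (1 N.* suc h) (row 0 (+ 1 * x) (+ 1 * y) D h) (λ J → ev (+ 1 * y + + J) * (+ 2 * (+ m * x)))) (cong (λ q → S + q) (trans (sum-* (1 N.* suc h) (+ 2 * (+ m * x)) (λ J → ev (+ 1 * y + + J))) (trans (com′ (sum (1 N.* suc h) (λ J → ev (+ 1 * y + + J))) (+ m * x)) (cong (λ q → + m * x * q) Σev)))))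
      where
      com : ∀ a e → + 2 * a * e ≡ e * (+ 2 * a)
      com = ℤring 2 (λ a e → # 2 :* a :* e := e :* (# 2 :* a))
      com′ : ∀ s a → s * (+ 2 * a) ≡ a * (+ 2 * s)
      com′ = ℤring 2 (λ s a → s :* (# 2 :* a) := a :* (# 2 :* s))
    sh : ∀ x D → ev (K * x + + 1 * D) ≡ ev (x + D)
    sh x D = trans (cong ev (trans (cong₂ _+_ (odd-scale m x) (ℤP.*-identityˡ D)) (l x (+ m * x) D))) (ev-shift (x + D) (+ m * x))
      where
      l : ∀ x a D → x + (a + a) + D ≡ x + D + (a + a)
      l = ℤring 3 (λ x a D → x :+ (a :+ a) :+ D := x :+ D :+ (a :+ a))
    sh2 : ∀ x D → ev (K * x + + 1 * D + D) ≡ ev x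
    sh2 x D = trans (cong ev (trans (cong₂ (λ p q → p + q + D) (odd-scale m x) (ℤP.*-identityˡ D)) (l x (+ m * x) D))) (ev-shift x (+ m * x + D))
      where
      l : ∀ x a D → x + (a + a) + D + D ≡ x + (a + D + (a + D))
      l = ℤring 3 (λ x a D → x :+ (a :+ a) :+ D :+ D := x :+ (a :+ D :+ (a :+ D)))
    ηeq : η (K * x + + 1 * D) (K * y + + 1 * H) D h ≡ η x y D h
    ηeq = trans (cong₂ _+_ (cong₂ _*_ (sh x D) (sh y H)) (cong₂ _*_ (sh2 x D) (sh2 y H))) (ℤP.+-comm (evpt (x + D) (y + H)) (evpt x y))
    rest : sum ((m N.* 2) N.* suc h) (row 0 (K * x + + 1 * D) (K * y + + 1 * H) D h) ≡
      + m * H * (x + (+ m * x + + m * x) + + 1 * D) + H * D * + m * + m - + m * D * ev (y + H) + + m * η x y D h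
    rest = trans (blocks {D} {h} c m (K * x + + 1 * D) (K * y + + 1 * H))
      (cong₃ (λ p q r → + m * H * (p + + 1 * D) + H * D * + m * + m - + m * D * q + + m * r) (odd-scale m x) (sh y H) ηeq)
      where
      cong₃ : ∀ (h : ℤ → ℤ → ℤ → ℤ) {p p′ q q′ r r′} → p ≡ p′ → q ≡ q′ → r ≡ r′ → h p q r ≡ h p′ q′ r′
      cong₃ h refl refl refl = refl
    fin : ∀ S m x D H e f n → S + m * x * (H + e - f) + (m * H * (x + (m * x + m * x) + + 1 * D) + H * D * m * m - m * D * f + m * n)
      ≡ S + ((m * m + m) * (H * (x + (x + D))) + m * (n + x * e - (x + D) * f))
    fin = ℤring 8 (λ S m x D H e f n → S :+ m :* x :* (H :+ e :- f) :+ (m :* H :* (x :+ (m :* x :+ m :* x) :+ # 1 :* D) :+ H :* D :* m :* m :- m :* D :* f :+ m :* n) := S :+ ((m :* m :+ m) :* (H :* (x :+ (x :+ D))) :+ m :* (n :+ x :* e :- (x :+ D) :* f)))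

  topY : List Edge → ℤ → ℤ
  topY [] y = y
  topY ((D , h) ∷ es) y = topY es (y + + suc h)

  topY-height : ∀ es y → topY es y ≡ y + + height es
  topY-height [] y = sym (ℤP.+-identityʳ y)
  topY-height ((D , h) ∷ es) y = trans (topY-height es (y + + suc h)) (ℤP.+-assoc y (+ suc h) (+ height es))

  -- Compared with `rows-even`, the linear coefficient has `ηs` in place of the number of edges, and
  -- the end abscissas count only in even rows. The sum for `k = 1` stays as it is; the numbers of
  -- interior and boundary points determine it later.
  rows-odd : ∀ m es x y → Primitive es → rows (1 N.+ m N.* 2) es x y ≡
    rows 1 es x y + ((+ m * + m + + m) * area es x + + m * (ηs es x y + x * ev y + endX es x * ev (topY es y)))
  rows-odd m [] x y _ = trans (cong₂ _*_ (trans (cong ev (odd-scale m y)) (ev-shift y (+ m * y))) (trans (floor-half (+ (1 N.+ m N.* 2) * x)) (cong₂ _+_ (odd-scale m x) (trans (cong ev (odd-scale m x)) (ev-shift x (+ m * x))))))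
    (trans (l (+ m) x (ev y) (ev x)) (cong (λ q → q + ((+ m * + m + + m) * 0ℤ + + m * (0ℤ + x * ev y + x * ev y))) (sym (cong₂ _*_ (cong ev (ℤP.*-identityˡ y)) (trans (floor-half (+ 1 * x)) (cong (λ q → q + ev q) (ℤP.*-identityˡ x)))))))
    where
    l : ∀ m x e f → e * (x + (m * x + m * x) + f) ≡ e * (x + f) + ((m * m + m) * 0ℤ + m * (0ℤ + x * e + x * e))
    l = ℤring 4 (λ m x e f → e :* (x :+ (m :* x :+ m :* x) :+ f) := e :* (x :+ f) :+ ((m :* m :+ m) :* # 0 :+ m :* (# 0 :+ x :* e :+ x :* e)))
  rows-odd m ((D , h) ∷ es) x y (c All.∷ cs) = trans (cong₂ _+_ (edge-odd {D} {h} c m x y) (rows-odd m es (x + D) (y + + suc h) cs))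
    (l (sum (1 N.* suc h) (row 0 (+ 1 * x) (+ 1 * y) D h)) (rows 1 es (x + D) (y + + suc h)) (+ m) (+ suc h * (x + (x + D))) (area es (x + D)) (η x y D h) (ηs es (x + D) (y + + suc h)) (x * ev y) ((x + D) * ev (y + + suc h)) (endX es (x + D) * ev (topY es (y + + suc h))))
    where
    l : ∀ S R m a A n N p q r → S + ((m * m + m) * a + m * (n + p - q)) + (R + ((m * m + m) * A + m * (N + q + r))) ≡ S + R + ((m * m + m) * (a + A) + m * (n + N + p + r))
    l = ℤring 10 (λ S R m a A n N p q r → S :+ ((m :* m :+ m) :* a :+ m :* (n :+ p :- q)) :+ (R :+ ((m :* m :+ m) :* A :+ m :* (N :+ q :+ r))) := S :+ R :+ ((m :* m :+ m) :* (a :+ A) :+ m :* (n :+ N :+ p :+ r)))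

  fdiv-mid-open : ∀ w h → + 2 * fdiv (w * + suc h - 1ℤ) (h N.+ suc h) + 1ℤ ≡ w - ev w
  fdiv-mid-open w h with parity w
  ... | even v refl = trans (cong (λ q → + 2 * q + 1ℤ) (fdiv-unique ((v + v) * + suc h - 1ℤ) (h N.+ suc h) (v - 1ℤ) (bound (Z.+≤+ {0} {h N.+ suc h} z≤n) (l₁ v (+ h))) (bound (Z.+≤+ {0} z≤n) (l₂ v (+ h)))))
        (trans (l₃ v) (cong (λ q → v + v - q) (sym (ev-even v))))
    where
    l₁ : ∀ v H → (v + v) * (1ℤ + H) - 1ℤ - (v - 1ℤ) * (1ℤ + H + (1ℤ + H)) ≡ H + (1ℤ + H)
    l₁ = ℤring 2 (λ v H → (v :+ v) :* (# 1 :+ H) :- # 1 :- (v :- # 1) :* (# 1 :+ H :+ (# 1 :+ H)) := H :+ (# 1 :+ H))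
    l₂ : ∀ v H → (v - 1ℤ + 1ℤ) * (1ℤ + H + (1ℤ + H)) - ((v + v) * (1ℤ + H) - 1ℤ + 1ℤ) ≡ 0ℤ
    l₂ = ℤring 2 (λ v H → (v :- # 1 :+ # 1) :* (# 1 :+ H :+ (# 1 :+ H)) :- ((v :+ v) :* (# 1 :+ H) :- # 1 :+ # 1) := # 0)
    l₃ : ∀ v → + 2 * (v - 1ℤ) + 1ℤ ≡ v + v - 1ℤ
    l₃ = ℤring 1 (λ v → # 2 :* (v :- # 1) :+ # 1 := v :+ v :- # 1)
  ... | odd v refl = trans (cong (λ q → + 2 * q + 1ℤ) (fdiv-unique ((v + v + 1ℤ) * + suc h - 1ℤ) (h N.+ suc h) v (bound (Z.+≤+ {0} {h} z≤n) (l₁ v (+ h))) (bound (Z.+≤+ {0} {suc h} z≤n) (l₂ v (+ h)))))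
        (trans (l₃ v) (cong (λ q → v + v + 1ℤ - q) (sym (ev-odd v))))
    where
    l₁ : ∀ v H → (v + v + 1ℤ) * (1ℤ + H) - 1ℤ - v * (1ℤ + H + (1ℤ + H)) ≡ H
    l₁ = ℤring 2 (λ v H → (v :+ v :+ # 1) :* (# 1 :+ H) :- # 1 :- v :* (# 1 :+ H :+ (# 1 :+ H)) := H)
    l₂ : ∀ v H → (v + 1ℤ) * (1ℤ + H + (1ℤ + H)) - ((v + v + 1ℤ) * (1ℤ + H) - 1ℤ + 1ℤ) ≡ 1ℤ + H
    l₂ = ℤring 2 (λ v H → (v :+ # 1) :* (# 1 :+ H :+ (# 1 :+ H)) :- ((v :+ v :+ # 1) :* (# 1 :+ H) :- # 1 :+ # 1) := # 1 :+ H)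
    l₃ : ∀ v → + 2 * v + 1ℤ ≡ v + v + 1ℤ - 0ℤ
    l₃ = ℤring 1 (λ v → # 2 :* v :+ # 1 := v :+ v :+ # 1 :- # 0)

  row-start : ∀ x y D h → row 1 x y D h 0 ≡ ev y * (x - ev x)
  row-start x y D h = cong₂ (λ p q → ev p * q) (ℤP.+-identityʳ y) (trans (cong (λ q → + 2 * fdiv q (h N.+ suc h) + 1ℤ) (l (x * + suc h) D)) (fdiv-mid-open x h))
    where
    l : ∀ a D → a + D * 0ℤ - 1ℤ ≡ a - 1ℤ
    l = ℤring 2 (λ a D → a :+ D :* # 0 :- # 1 := a :- # 1)

  -- Only the starting point of a primitive edge can lie in the even lattice, so only there do the open and closed floors differ.
  edge-open : ∀ {D h} → Cop.Coprime Z.∣ D ∣ (suc h) → ∀ x y → sum (suc h) (row 0 x y D h) ≡ sum (suc h) (row 1 x y D h) + + 2 * evpt x y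
  edge-open {D} {h} c x y = trans (cong₂ _+_ first (sum-cong h (λ t p → later t p))) (l (ev y) x (ev x) (row 1 x y D h 0) (sum h (row 1 x y D h ∘ suc)) (row-start x y D h))
    where
    first : row 0 x y D h 0 ≡ ev y * (x + ev x)
    first = cong₂ (λ p q → ev p * q) (ℤP.+-identityʳ y) (trans (cong (λ q → + 2 * fdiv q (h N.+ suc h) + 1ℤ) (k (x * + suc h) D)) (fdiv-mid x h))
      where
      k : ∀ a D → a + D * 0ℤ - 0ℤ ≡ a
      k = ℤring 2 (λ a D → a :+ D :* # 0 :- # 0 := a)
    later : ∀ t → t N.< h → row 0 x y D h (suc t) ≡ row 1 x y D h (suc t)
    later t t<h = cong (λ q → ev (y + + suc t) * (+ 2 * q + 1ℤ)) (sym (fdiv-unique (n - 1ℤ) (h N.+ suc h) q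
        (bound (diff (<→≤ strict)) (l₁ n (q * (H + H)))) (bound (diff (<→≤ (fdiv-< (n - 0ℤ) (h N.+ suc h))) ⊹ Z.+≤+ {0} {1} z≤n) (l₂ n ((q + 1ℤ) * (H + H))))))
      where
      H = + suc h
      n = x * H + D * + suc t
      q = fdiv (n - 0ℤ) (h N.+ suc h)
      strict : q * (H + H) < n - 0ℤ
      strict = ℤP.≤∧≢⇒< (fdiv-≤ (n - 0ℤ) (h N.+ suc h)) λ e → coprime-≢ {D} {h} c t t<h (+ 2 * q - x)
        (trans (l₃ (D * + suc t) x H) (trans (cong (λ q → q - x * H) (sym e)) (l₄ q x H)))
        where
        l₃ : ∀ d ux H → d ≡ ux * H + d - 0ℤ - ux * H
        l₃ = ℤring 3 (λ d ux H → d := ux :* H :+ d :- # 0 :- ux :* H)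
        l₄ : ∀ a ux H → a * (H + H) - ux * H ≡ (+ 2 * a - ux) * H
        l₄ = ℤring 3 (λ a ux H → a :* (H :+ H) :- ux :* H := (# 2 :* a :- ux) :* H)
      l₁ : ∀ n m → n - 1ℤ - m ≡ n - 0ℤ - (m + 1ℤ)
      l₁ = ℤring 2 (λ n m → n :- # 1 :- m := n :- # 0 :- (m :+ # 1))
      l₂ : ∀ n m → m - (n - 1ℤ + 1ℤ) ≡ m - (n - 0ℤ + 1ℤ) + 1ℤ
      l₂ = ℤring 2 (λ n m → m :- (n :- # 1 :+ # 1) := m :- (n :- # 0 :+ # 1) :+ # 1)
    l : ∀ e x f r s → r ≡ e * (x - f) → e * (x + f) + s ≡ r + s + + 2 * (f * e)
    l e x f _ s refl = ℤring 4 (λ e x f s → e :* (x :+ f) :+ s := e :* (x :- f) :+ s :+ # 2 :* (f :* e)) e x f s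

  -- By `edge-open` a lattice point among the vertices below the top is worth 2, whereas `ηs` counts
  -- inner vertices twice but both ends once; hence the extra `evpt x y`. The last term is the rest
  -- of the top row.
  rows-open : ∀ es x y → Primitive es → rows 1 es x y ≡ openRows es x y + evpt x y + ηs es x y + endX es x * ev (topY es y)
  rows-open [] x y _ = trans (cong₂ _*_ (cong ev (ℤP.*-identityˡ y)) (trans (floor-half (+ 1 * x)) (cong (λ q → q + ev q) (ℤP.*-identityˡ x)))) (l (ev y) x (ev x))
    where
    l : ∀ e x f → e * (x + f) ≡ 0ℤ + f * e + 0ℤ + x * e
    l = ℤring 3 (λ e x f → e :* (x :+ f) := # 0 :+ f :* e :+ # 0 :+ x :* e)
  rows-open ((D , h) ∷ es) x y (c All.∷ cs) = trans (cong₂ _+_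
      (trans (cong (λ n → sum n (row 0 (+ 1 * x) (+ 1 * y) D h)) (ℕP.+-identityʳ (suc h))) (trans (edge-open {D} {h} c (+ 1 * x) (+ 1 * y)) (cong (λ q → sum (suc h) (row 1 (+ 1 * x) (+ 1 * y) D h) + + 2 * q) (cong₂ evpt (ℤP.*-identityˡ x) (ℤP.*-identityˡ y)))))
      (rows-open es (x + D) (y + + suc h) cs))
      (l (sum (suc h) (row 1 (+ 1 * x) (+ 1 * y) D h)) (evpt x y) (openRows es (x + D) (y + + suc h)) (evpt (x + D) (y + + suc h)) (ηs es (x + D) (y + + suc h)) (endX es (x + D) * ev (topY es (y + + suc h))))
    where
    l : ∀ S e O f n t → S + + 2 * e + (O + f + n + t) ≡ S + O + e + (e + f + n) + t
    l = ℤring 6 (λ S e O f n t → S :+ # 2 :* e :+ (O :+ f :+ n :+ t) := S :+ O :+ e :+ (e :+ f :+ n) :+ t)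

  -- Two endpoints in the even lattice would make `D` and `suc h` both even.
  η≤1 : ∀ {D h} → Cop.Coprime Z.∣ D ∣ (suc h) → ∀ x y → η x y D h ≤ 1ℤ
  η≤1 {D} {h} c x y with ev-01 x | ev-01 y | ev-01 (x + D) | ev-01 (y + + suc h)
  ... | inj₁ a | _ | inj₁ b | _ rewrite a | b = Z.+≤+ z≤n
  ... | inj₁ a | _ | inj₂ b | inj₁ d rewrite a | b | d = Z.+≤+ z≤n
  ... | inj₁ a | _ | inj₂ b | inj₂ d rewrite a | b | d = Z.+≤+ (s≤s z≤n)
  ... | inj₂ a | inj₁ b | inj₁ d | _ rewrite a | b | d = Z.+≤+ z≤n
  ... | inj₂ a | inj₁ b | inj₂ d | inj₁ e rewrite a | b | d | e = Z.+≤+ z≤n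
  ... | inj₂ a | inj₁ b | inj₂ d | inj₂ e rewrite a | b | d | e = Z.+≤+ (s≤s z≤n)
  ... | inj₂ a | inj₂ b | inj₁ d | _ rewrite a | b | d = Z.+≤+ (s≤s z≤n)
  ... | inj₂ a | inj₂ b | inj₂ d | inj₁ e rewrite a | b | d | e = Z.+≤+ (s≤s z≤n)
  ... | inj₂ a | inj₂ b | inj₂ d | inj₂ e = ⊥-elim (coprime-not-both-even {D} {h} c (dif x D a d) (dif y (+ suc h) b e))
    where
    dif : ∀ z w → ev z ≡ 1ℤ → ev (z + w) ≡ 1ℤ → ev w ≡ 1ℤ
    dif z w p q with ev≡1 z p
    ... | v , refl = trans (trans (sym (ev-shift w v)) (cong ev (ℤP.+-comm w (v + v)))) q

  ηs≤length : ∀ es x y → Primitive es → ηs es x y ≤ + length es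
  ηs≤length [] x y _ = ℤP.≤-refl
  ηs≤length ((D , h) ∷ es) x y (c All.∷ cs) = ℤP.+-mono-≤ (η≤1 {D} {h} c x y) (ηs≤length es (x + D) (y + + suc h) cs)
open Chains public

-- Counting lattice points row by row

module Counting where
  open Z using (_≤_; _<_; _+_; _*_; _-_; -_)
  open ℤArith
  import Data.List.Membership.Propositional.Properties.WithK as WithK
  import Data.List.Relation.Binary.BagAndSetEquality as Bag
  import Data.List.Relation.Binary.Permutation.Propositional.Properties as Perm
  import Data.List.Membership.DecPropositional as DecMem
  open DecMem {A = ZPt} (≡-dec Z._≟_ Z._≟_) using (_∈?_)

  -- Two lists without repetitions and with the same elements are permutations of each other.
  count-unique : ∀ {R : ZPt → Set} {n m} → HasCount R n → HasCount R m → n ≡ m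
  count-unique (L , refl , u , p) (M , refl , v , q) =
    Perm.↭-length (Bag.∼bag⇒↭ (WithK.unique∧set⇒bag u v (λ {z} → mk⇔
      (λ i → Equivalence.from (q z) (Equivalence.to (p z) i)) (λ i → Equivalence.from (p z) (Equivalence.to (q z) i)))))

  count-cong : ∀ {R R′ : ZPt → Set} {n} → (∀ z → R z ↔ R′ z) → HasCount R n → HasCount R′ n
  count-cong e (L , l , u , p) = L , l , u , λ z → mk⇔ (λ i → proj₁ (e z) (Equivalence.to (p z) i)) (λ r → Equivalence.from (p z) (proj₂ (e z) r))

  count-⊎ : ∀ {R R′ : ZPt → Set} {n m} → (∀ z → R z → R′ z → ⊥) → HasCount R n → HasCount R′ m → HasCount (λ z → R z ⊎ R′ z) (n N.+ m)
  count-⊎ d (L , l , u , p) (M , k , v , q) = L ++ M , trans (LP.length-++ L) (cong₂ N._+_ l k) ,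
    UniqueP.++⁺ u v (λ (i , j) → d _ (Equivalence.to (p _) i) (Equivalence.to (q _) j)) ,
    λ z → mk⇔ (λ i → [ (λ j → inj₁ (Equivalence.to (p z) j)) , (λ j → inj₂ (Equivalence.to (q z) j)) ]′ (∈-++⁻ L i))
              [ (λ r → ∈-++⁺ˡ (Equivalence.from (p z) r)) , (λ r → ∈-++⁺ʳ L (Equivalence.from (q z) r)) ]′

  count-∅ : ∀ {R : ZPt → Set} → (∀ z → ¬ R z) → HasCount R 0
  count-∅ h = [] , refl , AP.[] , λ z → mk⇔ (λ ()) (λ r → ⊥-elim (h z r))

  count-minus : ∀ {R R′ : ZPt → Set} {n m} → HasCount R n → HasCount R′ m → (∀ z → R′ z → R z) →
    Σ ℕ λ p → (n ≡ m N.+ p) × HasCount (λ z → R z × ¬ R′ z) p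
  count-minus {R} {R′} {n} {m} c@(L , l , u , p) c′@(M , _ , _ , q) sub = length rest ,
      count-unique c (count-cong (λ z → both z) (count-⊎ (λ z r′ (_ , nr) → nr r′) c′ cr)) , cr
    where
    rest = filter (λ z → ¬? (z ∈? M)) L
    cr : HasCount (λ z → R z × ¬ R′ z) (length rest)
    cr = rest , refl , UniqueP.filter⁺ (λ z → ¬? (z ∈? M)) u , λ z → mk⇔
      (λ i → let (j , k) = ∈-filter⁻ (λ z → ¬? (z ∈? M)) {xs = L} i in Equivalence.to (p z) j , λ r′ → k (Equivalence.from (q z) r′))
      (λ (r , nr) → ∈-filter⁺ (λ z → ¬? (z ∈? M)) (Equivalence.from (p z) r) (λ i → nr (Equivalence.to (q z) i)))
    both : ∀ z → (R′ z ⊎ (R z × ¬ R′ z)) ↔ R z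
    both z = [ sub z , proj₁ ]′ , λ r → case z ∈? M of λ where
      (yes i) → inj₁ (Equivalence.to (q z) i)
      (no k) → inj₂ (r , λ r′ → k (Equivalence.from (q z) r′))

  -- `Y` is a doubled height, so a row with odd `Y` is empty.
  InRow : ℤ → ℤ → ℤ → ZPt → Set
  InRow Y lo hi (x , y) = y + y ≡ Y × lo ≤ x × x ≤ hi

  -- The hypothesis admits the empty row `lo ≡ hi + 1`, where the formula gives 0; beyond that it
  -- would become negative.
  count-row : ∀ Y lo hi → (ev Y ≡ 1ℤ → lo ≤ hi + 1ℤ) → Σ ℕ λ n → HasCount (InRow Y lo hi) n × + n ≡ ev Y * (hi - lo + 1ℤ)
  count-row Y lo hi ok with parity Y
  ... | odd w refl = 0 , count-∅ no-row , sym (cong (λ q → q * (hi - lo + 1ℤ)) (ev-odd w))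
    where
    no-row : ∀ z → ¬ InRow (w + w + 1ℤ) lo hi z
    no-row (x , y) (e , _) with trans (sym (ev-even y)) (trans (cong ev e) (ev-odd w))
    ... | ()
  ... | even w refl = c , (applyUpTo pt c , LP.length-applyUpTo pt c , UniqueP.applyUpTo⁺₁ pt c (λ i<j _ e → ℕP.<-irrefl (ptinj e) i<j) , mem) ,
        trans ceq (trans (sym (ℤP.*-identityˡ _)) (cong (λ q → q * (hi - lo + 1ℤ)) (sym (ev-even w))))
    where
    c = Z.∣ hi - lo + 1ℤ ∣
    pt : ℕ → ZPt
    pt t = lo + + t , w
    ceq : + c ≡ hi - lo + 1ℤ
    ceq = ℤP.0≤i⇒+∣i∣≡i (subst (0ℤ ≤_) (l hi lo) (diff (ok (ev-even w))))
      where
      l : ∀ hi lo → hi + 1ℤ - lo ≡ hi - lo + 1ℤ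
      l = ℤring 2 (λ hi lo → hi :+ # 1 :- lo := hi :- lo :+ # 1)
    ptinj : ∀ {i j} → pt i ≡ pt j → i ≡ j
    ptinj {i} {j} e = ℤP.+-injective (trans (l lo (+ i)) (trans (cong (λ q → q - lo) (cong proj₁ e)) (sym (l lo (+ j)))))
      where
      l : ∀ lo i → i ≡ lo + i - lo
      l = ℤring 2 (λ lo i → i := lo :+ i :- lo)
    dbl : ∀ y → y + y ≡ w + w → y ≡ w
    dbl y e = *-cancel 1 (trans (l y) (trans e (sym (l w))))
      where
      l : ∀ y → + 2 * y ≡ y + y
      l = ℤring 1 (λ y → # 2 :* y := y :+ y)
    mem : ∀ z → (z ∈ applyUpTo pt c) ⇔ InRow (w + w) lo hi z
    mem (x , y) = mk⇔ to from
      where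
      to : (x , y) ∈ applyUpTo pt c → InRow (w + w) lo hi (x , y)
      to i with ∈-applyUpTo⁻ pt i
      ... | t , t<c , refl = refl , ℤP.i≤i+j lo (+ t) , bound (diff (<→≤ (Z.+<+ t<c))) (trans (l₁ hi lo (+ t)) (cong (λ q → q - (+ t + 1ℤ)) (sym ceq)))
        where
        l₁ : ∀ hi lo t → hi - (lo + t) ≡ hi - lo + 1ℤ - (t + 1ℤ)
        l₁ = ℤring 3 (λ hi lo t → hi :- (lo :+ t) := hi :- lo :+ # 1 :- (t :+ # 1))
      from : InRow (w + w) lo hi (x , y) → (x , y) ∈ applyUpTo pt c
      from (e , p , q) = subst (_∈ applyUpTo pt c) (cong₂ _,_ xeq (sym (dbl y e))) (∈-applyUpTo⁺ pt (ℤP.drop‿+<+ t<c))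
        where
        t = Z.∣ x - lo ∣
        teq : + t ≡ x - lo
        teq = ℤP.0≤i⇒+∣i∣≡i (diff p)
        xeq : lo + + t ≡ x
        xeq = trans (cong (λ q → lo + q) teq) (l₂ lo x)
          where
          l₂ : ∀ lo x → lo + (x - lo) ≡ x
          l₂ = ℤring 2 (λ lo x → lo :+ (x :- lo) := x)
        t<c : + t < + c
        t<c = ≤→< (subst₂ (λ a b → a + 1ℤ ≤ b) (sym teq) (sym ceq) (bound (diff q) (l₃ x lo hi)))
          where
          l₃ : ∀ x lo hi → hi - lo + 1ℤ - (x - lo + 1ℤ) ≡ hi - x
          l₃ = ℤring 3 (λ x lo hi → hi :- lo :+ # 1 :- (x :- lo :+ # 1) := hi :- x)

  InRows : ℤ → ℕ → (ℕ → ℤ) → (ℕ → ℤ) → ZPt → Set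
  InRows Y n lo hi z = Σ ℕ λ J → J N.< n × InRow (Y + + J) (lo J) (hi J) z

  count-rows : ∀ Y n lo hi → (∀ J → J N.< n → ev (Y + + J) ≡ 1ℤ → lo J ≤ hi J + 1ℤ) →
    Σ ℕ λ c → HasCount (InRows Y n lo hi) c × + c ≡ sum n (λ J → ev (Y + + J) * (hi J - lo J + 1ℤ))
  count-rows Y zero lo hi ok = 0 , count-∅ (λ { z (_ , () , _) }) , refl
  count-rows Y (suc n) lo hi ok =
    let (a , ca , ea) = count-row (Y + 0ℤ) (lo 0) (hi 0) (ok 0 (s≤s z≤n))
        (b , cb , eb) = count-rows (Y + 1ℤ) n (lo ∘ suc) (hi ∘ suc) (λ J p e → ok (suc J) (s≤s p) (trans (cong ev (sym (ℤP.+-assoc Y 1ℤ (+ J)))) e))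
    in a N.+ b , count-cong iff (count-⊎ dis ca cb) ,
       cong₂ _+_ ea (trans eb (sum-cong n (λ J _ → cong (λ q → ev q * (hi (suc J) - lo (suc J) + 1ℤ)) (ℤP.+-assoc Y 1ℤ (+ J)))))
    where
    dis : ∀ z → InRow (Y + 0ℤ) (lo 0) (hi 0) z → InRows (Y + 1ℤ) n (lo ∘ suc) (hi ∘ suc) z → ⊥
    dis z (e , _) (J , _ , e′ , _) with ℤP.+-injective (trans (l Y (+ 0)) (trans (cong (λ q → q - Y) (trans (sym e) (trans e′ (ℤP.+-assoc Y 1ℤ (+ J))))) (sym (l Y (+ suc J)))))
      where
      l : ∀ Y i → i ≡ Y + i - Y
      l = ℤring 2 (λ Y i → i := Y :+ i :- Y)
    ... | ()
    iff : ∀ z → (InRow (Y + 0ℤ) (lo 0) (hi 0) z ⊎ InRows (Y + 1ℤ) n (lo ∘ suc) (hi ∘ suc) z) ↔ InRows Y (suc n) lo hi z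
    iff z = (λ { (inj₁ r) → 0 , s≤s z≤n , r ; (inj₂ (J , p , e , r)) → suc J , s≤s p , trans e (ℤP.+-assoc Y 1ℤ (+ J)) , r }) ,
            (λ { (0 , _ , r) → inj₁ r ; (suc J , s≤s p , e , r) → inj₂ (J , p , trans e (sym (ℤP.+-assoc Y 1ℤ (+ J))) , r) })
open Counting public

-- Geometry of a chain: the right ends of rows

module ChainGeometry where
  open Q using (_≤_; _<_; _+_; _*_; _-_; -_)
  open ℚArith
  open import Data.Unit using (⊤; tt)

  half : ℤ → ℤ → Pt
  half x y = ½ * ofℤ x , ½ * ofℤ y

  -- A nonnegative cross product: the doubled point lies on the left of the upward edge.
  LeftOf : ℤ → ℤ → ℤ → ℕ → Pt → Set
  LeftOf x y D h (a , b) = ofℤ (+ suc h) * (a + a - ofℤ x) ≤ ofℤ D * (b + b - ofℤ y)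

  Supports : List Pt → List Edge → ℤ → ℤ → Set
  Supports S [] x y = ⊤
  Supports S ((D , h) ∷ es) x y = (∀ {s} → s ∈ S → LeftOf x y D h s) × Supports S es (x Z.+ D) (y Z.+ + suc h)

  -- The list `T` is independent of the one in `Supports`: the edges bound one polygon from the
  -- right while their endpoints lie in another, which yields inclusions between polygons
  -- (`conv-vertices`).
  Vertices : List Pt → List Edge → ℤ → ℤ → Set
  Vertices T [] x y = InConv T (half x y)
  Vertices T ((D , h) ∷ es) x y = InConv T (half x y) × Vertices T es (x Z.+ D) (y Z.+ + suc h)

  -- A horizontal side belongs to no chain, so the right end of the starting row is recorded
  -- separately.
  Cap : List Pt → ℤ → ℤ → Set
  Cap S x y = ∀ p → InConv S p → proj₂ p ≡ ½ * ofℤ y → proj₁ p ≤ ½ * ofℤ x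

  ¬lt : ∀ {a b : ℚ} → ¬ (a < b) → b ≤ a
  ¬lt = ℚP.≮⇒≥

  leftOf-conv : ∀ {S} x y D h → (∀ {s} → s ∈ S → LeftOf x y D h s) → ∀ p → InConv S p → LeftOf x y D h p
  leftOf-conv x y D h sup (a , b) c = bound (diff (conv-bound (H + H) (- (d + d)) (H * X - d * Y) (λ {s} i → bound (diff (sup i)) (l₂ X Y H d (proj₁ s) (proj₂ s))) c))
      (l₁ X Y H d a b)
    where
    X = ofℤ x
    Y = ofℤ y
    H = ofℤ (+ suc h)
    d = ofℤ D
    l₁ : ∀ X Y H d a b → d * (b + b - Y) - H * (a + a - X) ≡ H * X - d * Y - ((H + H) * a + (- (d + d)) * b)
    l₁ = ℚring 6 (λ X Y H d a b → d *: (b +: b -: Y) -: H *: (a +: a -: X) =: H *: X -: d *: Y -: ((H +: H) *: a +: (-: (d +: d)) *: b))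
    l₂ : ∀ X Y H d a b → H * X - d * Y - ((H + H) * a + (- (d + d)) * b) ≡ d * (b + b - Y) - H * (a + a - X)
    l₂ = ℚring 6 (λ X Y H d a b → H *: X -: d *: Y -: ((H +: H) *: a +: (-: (d +: d)) *: b) =: d *: (b +: b -: Y) -: H *: (a +: a -: X))

  scale-≤ : ∀ {c u v u′ v′} → 0ℚ < c → c * u ≡ u′ → c * v ≡ v′ → (u ≤ v) ↔ (u′ ≤ v′)
  scale-≤ {c} {u} {v} c>0 refl refl = (λ p → bound (ℚP.<⇒≤ c>0 ⊠ diff p) (l c u v)) , cancel≤ c>0
    where
    l : ∀ c u v → c * v - c * u ≡ c * (v - u)
    l = ℚring 3 (λ c u v → c *: v -: c *: u =: c *: (v -: u))

  scale-< : ∀ {c u v u′ v′} → 0ℚ < c → c * u ≡ u′ → c * v ≡ v′ → (u < v) ↔ (u′ < v′)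
  scale-< {c} {u} {v} c>0 refl refl = (λ p → sbound (c>0 <⊠ sdiff p) (l c u v)) , cancel< c>0
    where
    l : ∀ c u v → c * v - c * u ≡ c * (v - u)
    l = ℚring 3 (λ c u v → c *: v -: c *: u =: c *: (v -: u))

  -- With `κ = 1 / k`, `f` is the floor of `k * a` and `g` the largest integer strictly below
  -- `k * a`, both described by their universal property.
  Floors : ℕ → ℚ → ℚ → ℤ → ℤ → Set
  Floors k κ a f g = ∀ z → ((κ * ofℤ z ≤ a) ↔ (z Z.≤ f)) × ((κ * ofℤ z < a) ↔ (z Z.≤ g))

  floors : ∀ {k κ a c} d n → 0ℚ < c → (∀ z → c * (κ * ofℤ z) ≡ ofℤ (z Z.* + suc d)) → c * a ≡ ofℤ n →
    Floors k κ a (fdiv (n Z.- 0ℤ) d) (fdiv (n Z.- 1ℤ) d)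
  floors {k} {κ} {a} {c} d n c>0 e f z =
      ((λ p → proj₂ (fdiv-gal (n Z.- 0ℤ) d z) (ℤP.≤-trans (ofℤ-≤⁻ {zd} {n} (proj₁ (scale-≤ {c} c>0 (e z) f) p)) (ℤP.≤-reflexive (sym (ℤP.+-identityʳ n))))) ,
       (λ p → proj₂ (scale-≤ {c} c>0 (e z) f) (ofℤ-≤ (ℤP.≤-trans (proj₁ (fdiv-gal (n Z.- 0ℤ) d z) p) (ℤP.≤-reflexive (ℤP.+-identityʳ n)))))) ,
      ((λ p → proj₂ (fdiv-gal (n Z.- 1ℤ) d z) (ℤArith.bound (ℤArith.diff (ℤArith.<→≤ (ofℤ-<⁻ {zd} {n} (proj₁ (scale-< {c} c>0 (e z) f) p)))) (l zd n))) ,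
       (λ p → proj₂ (scale-< {c} c>0 (e z) f) (ofℤ-< {zd} {n} (ℤArith.≤→< (ℤArith.bound (ℤArith.diff (proj₁ (fdiv-gal (n Z.- 1ℤ) d z) p)) (sym (l zd n)))))))
    where
    zd = z Z.* + suc d
    l : ∀ u n → n Z.- 1ℤ Z.- u ≡ n Z.- (u Z.+ 1ℤ)
    l = ℤring 2 (λ u n → n :- # 1 :- u := n :- (u :+ # 1))

  -- The offset `ρ` is an arbitrary rational because membership in the hull concerns all rows;
  -- floors are claimed only for the rows `ρ = J / k` of a dilate.
  record RowEnd (S T : List Pt) (es : List Edge) (x y : ℤ) (ρ : ℚ) : Set where
    constructor rowEnd
    field
      a : ℚ
      inside : InConv T (a , ½ * (ofℤ y + ρ))
      upper : ∀ p → InConv S p → proj₂ p ≡ ½ * (ofℤ y + ρ) → proj₁ p ≤ a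
      floorAt-spec : ∀ k κ J → 0ℚ < ofℤ (+ k) → ofℤ (+ k) * κ ≡ 1ℚ → ρ ≡ κ * ofℤ (+ J) →
        Floors k κ a (floorAt 0 k es x J) (floorAt 1 k es x J)

  -- At its upper end the inequality of the edge is exactly the cap condition for the rest of the
  -- chain.
  edge-top : ∀ {S} x y D h → (∀ {s} → s ∈ S → LeftOf x y D h s) → Cap S (x Z.+ D) (y Z.+ + suc h)
  edge-top {S} x y D h sup (a , b) c e = cancel≤ {H + H} (0<ofℤsuc h <⊹ ℚP.<⇒≤ (0<ofℤsuc h)) (bound (diff (leftOf-conv x y D h sup (a , b) c))
      (trans (cong (λ q → (H + H) * (½ * q) - (H + H) * a) (ofℤ-+ x D)) (trans (l X Y H d a) (cong (λ q → d * (q + q - Y) - H * (a + a - X)) (sym b-eq)))))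
    where
    X = ofℤ x
    Y = ofℤ y
    H = ofℤ (+ suc h)
    d = ofℤ D
    b-eq : b ≡ ½ * (Y + H)
    b-eq = trans e (cong (λ q → ½ * q) (ofℤ-+ y (+ suc h)))
    l : ∀ X Y H d a → (H + H) * (½ * (X + d)) - (H + H) * a ≡ d * (½ * (Y + H) + ½ * (Y + H) - Y) - H * (a + a - X)
    l = ℚring 5 (λ X Y H d a → (H +: H) *: (con: ½ *: (X +: d)) -: (H +: H) *: a =: d *: (con: ½ *: (Y +: H) +: con: ½ *: (Y +: H) -: Y) -: H *: (a +: a -: X))

  edge-row : ∀ {S T} x y D h {ρ} → (∀ {s} → s ∈ S → LeftOf x y D h s) → InConv T (half x y) → InConv T (half (x Z.+ D) (y Z.+ + suc h)) →
    0ℚ ≤ ρ → ρ ≤ ofℤ (+ suc h) → Σ ℚ λ a → InConv T (a , ½ * (ofℤ y + ρ)) × (∀ p → InConv S p → proj₂ p ≡ ½ * (ofℤ y + ρ) → proj₁ p ≤ a) ×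
    (∀ k κ J → 0ℚ < ofℤ (+ k) → ofℤ (+ k) * κ ≡ 1ℚ → ρ ≡ κ * ofℤ (+ J) →
      let n = + k Z.* x Z.* + suc h Z.+ D Z.* + J in Floors k κ a (fdiv (n Z.- 0ℤ) (h N.+ suc h)) (fdiv (n Z.- 1ℤ) (h N.+ suc h)))
  edge-row {S} {T} x y D h {ρ} sup v w ρ≥0 ρ≤ = ½ * (X + d * (ρ * r)) ,
      Cone-subst refl (pt≡ (trans (cong (λ q → (1ℚ - ρ * r) * (½ * X) + ρ * r * (½ * q)) (ofℤ-+ x D)) (lx X d (ρ * r)))
                           (trans (cong (λ q → (1ℚ - ρ * r) * (½ * Y) + ρ * r * (½ * q)) (ofℤ-+ y (+ suc h))) (trans (ly Y H ρ r) (cong (λ q → ½ * (Y + ρ * q)) Hr ⟩ cong (λ q → ½ * (Y + q)) (ℚP.*-identityʳ ρ)))))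
        (mix2 v w le1 (ρ≥0 ⊠ ℚP.<⇒≤ r>0) (one (ρ * r))) ,
      upper , fl
    where
    X = ofℤ x
    Y = ofℤ y
    H = ofℤ (+ suc h)
    d = ofℤ D
    H>0 = 0<ofℤsuc h
    r = proj₁ (recip H H>0)
    r>0 : 0ℚ < r
    r>0 = proj₁ (proj₂ (recip H H>0))
    Hr : H * r ≡ 1ℚ
    Hr = proj₂ (proj₂ (recip H H>0))
    infixr 4 _⟩_
    _⟩_ : ∀ {x y z : ℚ} → x ≡ y → y ≡ z → x ≡ z
    _⟩_ = trans
    one : ∀ t → 1ℚ - t + t ≡ 1ℚ
    one = ℚring 1 (λ t → con: 1ℚ -: t +: t =: con: 1ℚ)
    le1 : 0ℚ ≤ 1ℚ - ρ * r
    le1 = subst (0ℚ ≤_) (trans (l₀ H ρ r) (cong (λ q → q - ρ * r) Hr)) (diff ρ≤ ⊠ ℚP.<⇒≤ r>0)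
      where
      l₀ : ∀ H ρ r → (H - ρ) * r ≡ H * r - ρ * r
      l₀ = ℚring 3 (λ H ρ r → (H -: ρ) *: r =: H *: r -: ρ *: r)
    lx : ∀ X d t → (1ℚ - t) * (½ * X) + t * (½ * (X + d)) ≡ ½ * (X + d * t)
    lx = ℚring 3 (λ X d t → (con: 1ℚ -: t) *: (con: ½ *: X) +: t *: (con: ½ *: (X +: d)) =: con: ½ *: (X +: d *: t))
    ly : ∀ Y H ρ r → (1ℚ - ρ * r) * (½ * Y) + ρ * r * (½ * (Y + H)) ≡ ½ * (Y + ρ * (H * r))
    ly = ℚring 4 (λ Y H ρ r → (con: 1ℚ -: ρ *: r) *: (con: ½ *: Y) +: ρ *: r *: (con: ½ *: (Y +: H)) =: con: ½ *: (Y +: ρ *: (H *: r)))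
    upper : ∀ p → InConv S p → proj₂ p ≡ ½ * (Y + ρ) → proj₁ p ≤ ½ * (X + d * (ρ * r))
    upper (a , b) c refl = cancel≤ {H + H} (H>0 <⊹ ℚP.<⇒≤ H>0) (bound (diff (leftOf-conv x y D h sup (a , b) c))
      (l₁ X d ρ r H a ⟩ cong (λ q → H * X + d * (ρ * q) - (H + H) * a) Hr ⟩ l₂ X Y d ρ H a))
      where
      l₁ : ∀ X d ρ r H a → (H + H) * (½ * (X + d * (ρ * r))) - (H + H) * a ≡ H * X + d * (ρ * (H * r)) - (H + H) * a
      l₁ = ℚring 6 (λ X d ρ r H a → (H +: H) *: (con: ½ *: (X +: d *: (ρ *: r))) -: (H +: H) *: a =: H *: X +: d *: (ρ *: (H *: r)) -: (H +: H) *: a)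
      l₂ : ∀ X Y d ρ H a → H * X + d * (ρ * 1ℚ) - (H + H) * a ≡ d * (½ * (Y + ρ) + ½ * (Y + ρ) - Y) - H * (a + a - X)
      l₂ = ℚring 6 (λ X Y d ρ H a → H *: X +: d *: (ρ *: con: 1ℚ) -: (H +: H) *: a =: d *: (con: ½ *: (Y +: ρ) +: con: ½ *: (Y +: ρ) -: Y) -: H *: (a +: a -: X))
    fl : ∀ k κ J → 0ℚ < ofℤ (+ k) → ofℤ (+ k) * κ ≡ 1ℚ → ρ ≡ κ * ofℤ (+ J) →
      let n = + k Z.* x Z.* + suc h Z.+ D Z.* + J in Floors k κ (½ * (X + d * (ρ * r))) (fdiv (n Z.- 0ℤ) (h N.+ suc h)) (fdiv (n Z.- 1ℤ) (h N.+ suc h))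
    fl k κ J k>0 kκ refl = floors {k} {κ} {½ * (X + d * (ρ * r))} {(H + H) * K} (h N.+ suc h) (+ k Z.* x Z.* + suc h Z.+ D Z.* + J) ((H>0 <⊹ ℚP.<⇒≤ H>0) <⊠ k>0)
      (λ z → l₁ H K κ (ofℤ z) ⟩ cong (λ q → ofℤ z * (H + H) * q) kκ ⟩ ℚP.*-identityʳ (ofℤ z * (H + H)) ⟩ cong (λ q → ofℤ z * q) (sym (ofℤ-+ (+ suc h) (+ suc h))) ⟩ sym (ofℤ-* z (+ suc (h N.+ suc h))))
      (l₂ H K κ X d (ofℤ (+ J)) r ⟩ cong₂ (λ p q → K * X * H + d * ofℤ (+ J) * (p * q)) kκ Hr ⟩ l₃ (K * X * H) (d * ofℤ (+ J)) ⟩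
        sym (trans (ofℤ-+ (+ k Z.* x Z.* + suc h) (D Z.* + J)) (cong₂ _+_ (trans (ofℤ-* (+ k Z.* x) (+ suc h)) (cong (λ q → q * H) (ofℤ-* (+ k) x))) (ofℤ-* D (+ J)))))
      where
      K = ofℤ (+ k)
      l₁ : ∀ H K κ z → (H + H) * K * (κ * z) ≡ z * (H + H) * (K * κ)
      l₁ = ℚring 4 (λ H K κ z → (H +: H) *: K *: (κ *: z) =: z *: (H +: H) *: (K *: κ))
      l₂ : ∀ H K κ X d J r → (H + H) * K * (½ * (X + d * (κ * J * r))) ≡ K * X * H + d * J * (K * κ * (H * r))
      l₂ = ℚring 7 (λ H K κ X d J r → (H +: H) *: K *: (con: ½ *: (X +: d *: (κ *: J *: r))) =: K *: X *: H +: d *: J *: (K *: κ *: (H *: r)))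
      l₃ : ∀ u v → u + v * (1ℚ * 1ℚ) ≡ u + v
      l₃ = ℚring 2 (λ u v → u +: v *: (con: 1ℚ *: con: 1ℚ) =: u +: v)

  row-end : ∀ {S T} es x y → Supports S es x y → Vertices T es x y → Cap S x y → ∀ ρ → 0ℚ ≤ ρ → ρ ≤ ofℤ (+ height es) → RowEnd S T es x y ρ
  row-end {S} {T} [] x y _ v cap ρ ρ≥0 ρ≤ = rowEnd (½ * ofℤ x) (subst (λ q → InConv T (½ * ofℤ x , q)) y-eq v) (λ p c e → cap p c (trans e (sym y-eq)))
      λ k κ J k>0 kκ _ → floors {k} {κ} {½ * ofℤ x} {(1ℚ + 1ℚ) * ofℤ (+ k)} 1 (+ k Z.* x) ((0<1 <⊹ ℚP.<⇒≤ 0<1) <⊠ k>0)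
        (λ z → trans (l₁ (ofℤ (+ k)) κ (ofℤ z)) (trans (cong (λ q → ofℤ z * (1ℚ + 1ℚ) * q) kκ) (trans (ℚP.*-identityʳ (ofℤ z * (1ℚ + 1ℚ))) (sym (ofℤ-* z (+ 2))))))
        (trans (l₂ (ofℤ (+ k)) (ofℤ x)) (sym (ofℤ-* (+ k) x)))
    where
    y-eq : ½ * ofℤ y ≡ ½ * (ofℤ y + ρ)
    y-eq = cong (λ q → ½ * q) (trans (sym (ℚP.+-identityʳ (ofℤ y))) (cong (λ q → ofℤ y + q) (ℚP.≤-antisym ρ≥0 ρ≤)))
    l₁ : ∀ K κ z → (1ℚ + 1ℚ) * K * (κ * z) ≡ z * (1ℚ + 1ℚ) * (K * κ)
    l₁ = ℚring 3 (λ K κ z → (con: 1ℚ +: con: 1ℚ) *: K *: (κ *: z) =: z *: (con: 1ℚ +: con: 1ℚ) *: (K *: κ))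
    l₂ : ∀ K x → (1ℚ + 1ℚ) * K * (½ * x) ≡ K * x
    l₂ = ℚring 2 (λ K x → (con: 1ℚ +: con: 1ℚ) *: K *: (con: ½ *: x) =: K *: x)
  row-end {S} {T} ((D , h) ∷ es) x y (sup , sups) (v , vs) cap ρ ρ≥0 ρ≤ = cases (ρ Q.<? H)
    where
    H = ofℤ (+ suc h)
    head : ∀ es x y → Vertices T es x y → InConv T (half x y)
    head [] x y v = v
    head (_ ∷ _) x y (v , _) = v
    -- The geometric case distinction `ρ < H` and the test `J < k * suc h` inside `floorAt` agree
    -- when `ρ = J / k`.
    cmp : ∀ k κ J → 0ℚ < ofℤ (+ k) → ofℤ (+ k) * κ ≡ 1ℚ → ρ ≡ κ * ofℤ (+ J) → (ρ < H) ↔ (+ J Z.< + (k N.* suc h))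
    cmp k κ J k>0 kκ refl = (λ p → ofℤ-<⁻ {+ J} {+ (k N.* suc h)} (proj₁ (scale-< {K} k>0 e₁ e₂) p)) , (λ p → proj₂ (scale-< {K} k>0 e₁ e₂) (ofℤ-< p))
      where
      K = ofℤ (+ k)
      e₁ : K * (κ * ofℤ (+ J)) ≡ ofℤ (+ J)
      e₁ = trans (sym (ℚP.*-assoc K κ (ofℤ (+ J)))) (trans (cong (λ q → q * ofℤ (+ J)) kκ) (ℚP.*-identityˡ (ofℤ (+ J))))
      e₂ : K * H ≡ ofℤ (+ (k N.* suc h))
      e₂ = trans (sym (ofℤ-* (+ k) (+ suc h))) (cong ofℤ (sym (ℤP.pos-* k (suc h))))
    cases : Dec (ρ < H) → RowEnd S T ((D , h) ∷ es) x y ρ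
    cases (yes p) = let (a , i , u , f) = edge-row x y D h sup v (head es (x Z.+ D) (y Z.+ + suc h) vs) ρ≥0 (ℚP.<⇒≤ p) in
      rowEnd a i u λ k κ J k>0 kκ e → let J< = ℤP.drop‿+<+ (proj₁ (cmp k κ J k>0 kκ e) p) in
        subst₂ (Floors k κ a) (sym (floorAt-< 0 k D h es x J<)) (sym (floorAt-< 1 k D h es x J<)) (f k κ J k>0 kκ e)
    cases (no p) = rowEnd a (subst (λ q → InConv T (a , q)) y-eq inside) (λ q c e → upper q c (trans e (sym y-eq)))
        λ k κ J k>0 kκ e → let J≥ = ℕP.≮⇒≥ (λ q → p (proj₂ (cmp k κ J k>0 kκ e) (Z.+<+ q))) in
          subst₂ (Floors k κ a) (sym (floorAt-≥ 0 k D h es x J≥)) (sym (floorAt-≥ 1 k D h es x J≥)) (floorAt-spec k κ (J N.∸ k N.* suc h) k>0 kκ (shift k κ J kκ e J≥))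
      where
      rest = row-end es (x Z.+ D) (y Z.+ + suc h) sups vs (edge-top x y D h sup) (ρ - H) (diff (¬lt p))
               (bound (diff ρ≤) (trans (l₁ (ofℤ (+ height es)) H ρ) (cong (λ q → q - ρ) (sym (ofℤ-+ (+ suc h) (+ height es))))))
        where
        l₁ : ∀ R H ρ → R - (ρ - H) ≡ H + R - ρ
        l₁ = ℚring 3 (λ R H ρ → R -: (ρ -: H) =: H +: R -: ρ)
      open RowEnd rest
      y-eq : ½ * (ofℤ (y Z.+ + suc h) + (ρ - H)) ≡ ½ * (ofℤ y + ρ)
      y-eq = trans (cong (λ q → ½ * (q + (ρ - H))) (ofℤ-+ y (+ suc h))) (l₂ (ofℤ y) H ρ)
        where
        l₂ : ∀ Y H ρ → ½ * (Y + H + (ρ - H)) ≡ ½ * (Y + ρ)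
        l₂ = ℚring 3 (λ Y H ρ → con: ½ *: (Y +: H +: (ρ -: H)) =: con: ½ *: (Y +: ρ))
      shift : ∀ k κ J → ofℤ (+ k) * κ ≡ 1ℚ → ρ ≡ κ * ofℤ (+ J) → k N.* suc h N.≤ J → ρ - H ≡ κ * ofℤ (+ (J N.∸ k N.* suc h))
      shift k κ J kκ e J≥ = trans (cong₂ _-_ e (trans (sym (ℚP.*-identityˡ H)) (cong (λ q → q * H) (sym kκ)))) (trans (l₃ κ (ofℤ (+ J)) (ofℤ (+ k)) H)
          (cong (λ q → κ * q) (trans (cong (λ q → ofℤ (+ J) - q) (sym (ofℤ-* (+ k) (+ suc h)))) (trans (sym (ofℤ-- (+ J) (+ k Z.* + suc h))) (cong ofℤ int)))))
        where
        l₃ : ∀ κ J K H → κ * J - K * κ * H ≡ κ * (J - K * H)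
        l₃ = ℚring 4 (λ κ J K H → κ *: J -: K *: κ *: H =: κ *: (J -: K *: H))
        int : + J Z.- + k Z.* + suc h ≡ + (J N.∸ k N.* suc h)
        int = trans (cong (λ q → + J Z.- q) (sym (ℤP.pos-* k (suc h)))) (trans (ℤP.[+m]-[+n]≡m⊖n J (k N.* suc h)) (ℤP.⊖-≥ J≥))
open ChainGeometry public

-- Reflection and interior points

module Interior where
  open Q using (_≤_; _<_; _+_; _*_; _-_; -_)
  open ℚArith

  mirror : Pt → Pt
  mirror (x , y) = - x , y

  mirror-mirror : ∀ p → mirror (mirror p) ≡ p
  mirror-mirror (x , y) = pt≡ l refl
    where
    l : - (- x) ≡ x
    l = ℚring 1 (λ x → -: (-: x) =: x) x

  mirror-affine : Affine mirror
  mirror-affine = affine (- 1ℚ) 0ℚ 0ℚ 0ℚ 1ℚ 0ℚ λ x y → pt≡ (l x y) (l′ x y)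
    where
    l : ∀ x y → - x ≡ - 1ℚ * x + 0ℚ * y + 0ℚ
    l = ℚring 2 (λ x y → -: x =: -: con: 1ℚ *: x +: con: 0ℚ *: y +: con: 0ℚ)
    l′ : ∀ x y → y ≡ 0ℚ * x + 1ℚ * y + 0ℚ
    l′ = ℚring 2 (λ x y → y =: con: 0ℚ *: x +: con: 1ℚ *: y +: con: 0ℚ)

  conv-mirror⁺ : ∀ {S p} → InConv S p → InConv (map mirror S) (mirror p)
  conv-mirror⁺ {p = p} c = conv-image {F = mirror} mirror-affine (λ i → conv-gen (∈-map⁺ mirror i)) {p} c

  conv-mirror⁻ : ∀ {S p} → InConv (map mirror S) p → InConv S (mirror p)
  conv-mirror⁻ {S} {p} c = conv-image {F = mirror} mirror-affine back {p} c
    where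
    back : ∀ {s} → s ∈ map mirror S → InConv S (mirror s)
    back i with ∈-map⁻ mirror i
    ... | s , j , refl = conv-gen (subst (_∈ S) (sym (mirror-mirror s)) j)

  between : ∀ {S l r x y} → InConv S (l , y) → InConv S (r , y) → l ≤ x → x ≤ r → InConv S (x , y)
  between {S} {l} {r} {x} {y} cl cr p q = cases (l Q.<? r)
    where
    cases : Dec (l < r) → InConv S (x , y)
    cases (no n) = subst (λ u → InConv S (u , y)) (ℚP.≤-antisym p (ℚP.≤-trans q (ℚP.≮⇒≥ n))) cl
    cases (yes l<r) = Cone-subst refl (pt≡ (trans (f₁ x l r n) (trans (cong (λ q → x * q) e) (ℚP.*-identityʳ x))) (trans (f₂ x l r n y) (trans (cong (λ q → q * y) e) (ℚP.*-identityˡ y))))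
        (mix2 {t = (r - x) * n} {(x - l) * n} cl cr (diff q ⊠ ℚP.<⇒≤ n>0) (diff p ⊠ ℚP.<⇒≤ n>0) (trans (f₃ x l r n) e))
      where
      n = proj₁ (recip (r - l) (sdiff l<r))
      n>0 : 0ℚ < n
      n>0 = proj₁ (proj₂ (recip (r - l) (sdiff l<r)))
      e : (r - l) * n ≡ 1ℚ
      e = proj₂ (proj₂ (recip (r - l) (sdiff l<r)))
      f₁ : ∀ x l r n → (r - x) * n * l + (x - l) * n * r ≡ x * ((r - l) * n)
      f₁ = ℚring 4 (λ x l r n → (r -: x) *: n *: l +: (x -: l) *: n *: r =: x *: ((r -: l) *: n))
      f₂ : ∀ x l r n y → (r - x) * n * y + (x - l) * n * y ≡ (r - l) * n * y
      f₂ = ℚring 5 (λ x l r n y → (r -: x) *: n *: y +: (x -: l) *: n *: y =: (r -: l) *: n *: y)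
      f₃ : ∀ x l r n → (r - x) * n + (x - l) * n ≡ (r - l) * n
      f₃ = ℚring 4 (λ x l r n → (r -: x) *: n +: (x -: l) *: n =: (r -: l) *: n)

  -- The factor `n = 1 / (1 + q²)` satisfies `n ≤ 1` and `n * q ≤ 1` whatever the sign of `q`, and a
  -- positive factor of at most 1 preserves the earlier bounds.
  small : ∀ qs → Σ ℚ λ ε → 0ℚ < ε × ε ≤ 1ℚ × All (λ q → ε * q ≤ 1ℚ) qs
  small [] = 1ℚ , 0<1 , ℚP.≤-refl , All.[]
  small (q ∷ qs) = let (ε , ε>0 , ε≤1 , al) = small qs in ε * n , ε>0 <⊠ n>0 , step ε 1ℚ ε>0 ε≤1 n≤1 ,
      step₂ ε ε>0 ε≤1 All.∷ All.map (λ {r} le → bound (diff n≤1 ⊹ ℚP.<⇒≤ n>0 ⊠ diff le) (l₃ ε n r)) al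
    where
    M = 1ℚ + q * q
    M>0 : 0ℚ < M
    M>0 = 0<1 <⊹ sq≥0 q
    n = proj₁ (recip M M>0)
    n>0 : 0ℚ < n
    n>0 = proj₁ (proj₂ (recip M M>0))
    Mn : (1ℚ + q * q) * n ≡ 1ℚ
    Mn = proj₂ (proj₂ (recip M M>0))
    n≤1 : n ≤ 1ℚ
    n≤1 = bound (sq≥0 q ⊠ ℚP.<⇒≤ n>0) (trans (cong (λ z → z - n) (sym Mn)) (l q n))
      where
      l : ∀ q n → (1ℚ + q * q) * n - n ≡ q * q * n
      l = ℚring 2 (λ q n → (con: 1ℚ +: q *: q) *: n -: n =: q *: q *: n)
    nq≤1 : n * q ≤ 1ℚ
    nq≤1 = bound ((sq≥0 (q - ½) ⊹ ℚP.<⇒≤ 0<½ ⊹ (ℚP.<⇒≤ 0<½ ⊠ ℚP.<⇒≤ 0<½)) ⊠ ℚP.<⇒≤ n>0) (trans (cong (λ z → z - n * q) (sym Mn)) (l q n))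
      where
      l : ∀ q n → (1ℚ + q * q) * n - n * q ≡ ((q - ½) * (q - ½) + ½ + ½ * ½) * n
      l = ℚring 2 (λ q n → (con: 1ℚ +: q *: q) *: n -: n *: q =: ((q -: con: ½) *: (q -: con: ½) +: con: ½ +: con: ½ *: con: ½) *: n)
    step : ∀ ε u → 0ℚ < ε → ε ≤ 1ℚ → n ≤ u → ε * n ≤ u
    step ε u ε>0 ε≤1 n≤u = bound (diff n≤u ⊹ diff ε≤1 ⊠ ℚP.<⇒≤ n>0) (l ε n u)
      where
      l : ∀ ε n u → u - ε * n ≡ u - n + (1ℚ - ε) * n
      l = ℚring 3 (λ ε n u → u -: ε *: n =: u -: n +: (con: 1ℚ -: ε) *: n)
    step₂ : ∀ ε → 0ℚ < ε → ε ≤ 1ℚ → ε * n * q ≤ 1ℚ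
    step₂ ε ε>0 ε≤1 = bound (diff ε≤1 ⊹ ℚP.<⇒≤ ε>0 ⊠ diff nq≤1) (l ε n q)
      where
      l : ∀ ε n q → 1ℚ - ε * n * q ≡ 1ℚ - ε + ε * (1ℚ - n * q)
      l = ℚring 3 (λ ε n q → con: 1ℚ -: ε *: n *: q =: con: 1ℚ -: ε +: ε *: (con: 1ℚ -: n *: q))
    l₃ : ∀ ε n r → 1ℚ - ε * n * r ≡ 1ℚ - n + n * (1ℚ - ε * r)
    l₃ = ℚring 3 (λ ε n r → con: 1ℚ -: ε *: n *: r =: con: 1ℚ -: n +: n *: (con: 1ℚ -: ε *: r))

  -- Each corner of a small square is a combination of the two points of the row and the point above
  -- or below: the latter, with weight `ε * g`, supplies the vertical shift, and the former make up
  -- for the horizontal error.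
  interior-intro : ∀ {S l r x y cx cy dx dy} → InConv S (l , y) → InConv S (r , y) → InConv S (cx , cy) → InConv S (dx , dy) →
    l < x → x < r → dy < y → y < cy → IsInteriorPt S (x , y)
  interior-intro {S} {l} {r} {x} {y} {cx} {cy} {dx} {dy} cl cr cc cd l<x x<r d<y y<c = fin (small qs)
    where
    α = x - l
    β = r - x
    inv : ∀ u → 0ℚ < u → ℚ
    inv u p = proj₁ (recip u p)
    a′ = inv (x - l) (sdiff l<x)
    b′ = inv (r - x) (sdiff x<r)
    width : 0ℚ < x - l + (r - x)
    width = sdiff l<x <⊹ ℚP.<⇒≤ (sdiff x<r)
    n = inv (x - l + (r - x)) width
    g = inv (cy - y) (sdiff y<c)
    g′ = inv (y - dy) (sdiff d<y)
    -- Divided by `x - l` and `r - x`, the nonnegativity of the weights of the two row points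
    -- becomes `ε * q₁ ≤ 1` and `ε * q₂ ≤ 1`, the form that `small` provides.
    q₁ q₂ : ℚ → ℚ → ℚ → ℚ
    q₁ σ g cx = (g * (x - l) - σ - g * (x - cx)) * a′
    q₂ σ g cx = (g * (r - x) + σ + g * (x - cx)) * b′
    qs = g ∷ g′ ∷ q₁ 1ℚ g cx ∷ q₂ 1ℚ g cx ∷ q₁ (- 1ℚ) g cx ∷ q₂ (- 1ℚ) g cx ∷ q₁ 1ℚ g′ dx ∷ q₂ 1ℚ g′ dx ∷ q₁ (- 1ℚ) g′ dx ∷ q₂ (- 1ℚ) g′ dx ∷ []
    corner : ∀ ε σ τ g cx cy → InConv S (cx , cy) → 0ℚ < ε → 0ℚ < g → (cy - y) * g ≡ τ → ε * g ≤ 1ℚ → ε * q₁ σ g cx ≤ 1ℚ → ε * q₂ σ g cx ≤ 1ℚ →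
      InConv S (x + σ * ε , y + τ * ε)
    corner ε σ τ g cx cy cc ε>0 g>0 eg p₀ p₁ p₂ = Cone-subst refl
        (pt≡ (trans (fx ε σ g cx l r x n) (trans (cong (λ q → ((1ℚ - ε * g) * x + ε * (σ + g * (x - cx))) * q + ε * g * cx) nn) (fx′ ε σ g cx x)))
             (trans (fy ε g cy y λ′ μ′) (trans (cong (λ q → q * y + (1ℚ - q) * 0ℚ + ε * ((cy - y) * g)) one) (trans (cong (λ q → 1ℚ * y + (1ℚ - 1ℚ) * 0ℚ + ε * q) eg) (fy′ ε τ y)))))
        (mix3 {t = λ′} {μ′} {ε * g} cr cl cc λ≥0 μ≥0 (ℚP.<⇒≤ ε>0 ⊠ ℚP.<⇒≤ g>0) one)
      where
      λ′ = ((1ℚ - ε * g) * (x - l) + ε * (σ + g * (x - cx))) * n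
      μ′ = ((1ℚ - ε * g) * (r - x) - ε * (σ + g * (x - cx))) * n
      n≥0 : 0ℚ ≤ n
      n≥0 = ℚP.<⇒≤ (proj₁ (proj₂ (recip (x - l + (r - x)) width)))
      nn : (x - l + (r - x)) * n ≡ 1ℚ
      nn = proj₂ (proj₂ (recip (x - l + (r - x)) width))
      aa : (x - l) * a′ ≡ 1ℚ
      aa = proj₂ (proj₂ (recip (x - l) (sdiff l<x)))
      bb : (r - x) * b′ ≡ 1ℚ
      bb = proj₂ (proj₂ (recip (r - x) (sdiff x<r)))
      λ≥0 : 0ℚ ≤ λ′
      λ≥0 = subst (λ q → 0ℚ ≤ q * n) (trans (k α ε Q a′) (trans (cong (λ q → α - ε * Q * q) aa) (k′ ε σ g cx x l))) (ℚP.<⇒≤ (sdiff l<x) ⊠ diff p₁ ⊠ n≥0)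
        where
        Q = g * (x - l) - σ - g * (x - cx)
        k : ∀ α ε Q a′ → α * (1ℚ - ε * (Q * a′)) ≡ α - ε * Q * (α * a′)
        k = ℚring 4 (λ α ε Q a′ → α *: (con: 1ℚ -: ε *: (Q *: a′)) =: α -: ε *: Q *: (α *: a′))
        k′ : ∀ ε σ g cx x l → x - l - ε * (g * (x - l) - σ - g * (x - cx)) * 1ℚ ≡ (1ℚ - ε * g) * (x - l) + ε * (σ + g * (x - cx))
        k′ = ℚring 6 (λ ε σ g cx x l → x -: l -: ε *: (g *: (x -: l) -: σ -: g *: (x -: cx)) *: con: 1ℚ =: (con: 1ℚ -: ε *: g) *: (x -: l) +: ε *: (σ +: g *: (x -: cx)))
      μ≥0 : 0ℚ ≤ μ′
      μ≥0 = subst (λ q → 0ℚ ≤ q * n) (trans (k β ε Q b′) (trans (cong (λ q → β - ε * Q * q) bb) (k′ ε σ g cx x r))) (ℚP.<⇒≤ (sdiff x<r) ⊠ diff p₂ ⊠ n≥0)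
        where
        Q = g * (r - x) + σ + g * (x - cx)
        k : ∀ α ε Q a′ → α * (1ℚ - ε * (Q * a′)) ≡ α - ε * Q * (α * a′)
        k = ℚring 4 (λ α ε Q a′ → α *: (con: 1ℚ -: ε *: (Q *: a′)) =: α -: ε *: Q *: (α *: a′))
        k′ : ∀ ε σ g cx x r → r - x - ε * (g * (r - x) + σ + g * (x - cx)) * 1ℚ ≡ (1ℚ - ε * g) * (r - x) - ε * (σ + g * (x - cx))
        k′ = ℚring 6 (λ ε σ g cx x r → r -: x -: ε *: (g *: (r -: x) +: σ +: g *: (x -: cx)) *: con: 1ℚ =: (con: 1ℚ -: ε *: g) *: (r -: x) -: ε *: (σ +: g *: (x -: cx)))
      one : λ′ + μ′ + ε * g ≡ 1ℚ
      one = trans (k (ε * g) (x - l) (r - x) (ε * (σ + g * (x - cx))) n) (trans (cong (λ q → (1ℚ - ε * g) * q + ε * g) nn) (k′ (ε * g)))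
        where
        k : ∀ t a b w n → ((1ℚ - t) * a + w) * n + ((1ℚ - t) * b - w) * n + t ≡ (1ℚ - t) * ((a + b) * n) + t
        k = ℚring 5 (λ t a b w n → ((con: 1ℚ -: t) *: a +: w) *: n +: ((con: 1ℚ -: t) *: b -: w) *: n +: t =: (con: 1ℚ -: t) *: ((a +: b) *: n) +: t)
        k′ : ∀ t → (1ℚ - t) * 1ℚ + t ≡ 1ℚ
        k′ = ℚring 1 (λ t → (con: 1ℚ -: t) *: con: 1ℚ +: t =: con: 1ℚ)
      fx : ∀ ε σ g cx l r x n → ((1ℚ - ε * g) * (x - l) + ε * (σ + g * (x - cx))) * n * r + ((1ℚ - ε * g) * (r - x) - ε * (σ + g * (x - cx))) * n * l + ε * g * cx
        ≡ ((1ℚ - ε * g) * x + ε * (σ + g * (x - cx))) * ((x - l + (r - x)) * n) + ε * g * cx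
      fx = ℚring 8 (λ ε σ g cx l r x n → ((con: 1ℚ -: ε *: g) *: (x -: l) +: ε *: (σ +: g *: (x -: cx))) *: n *: r +: ((con: 1ℚ -: ε *: g) *: (r -: x) -: ε *: (σ +: g *: (x -: cx))) *: n *: l +: ε *: g *: cx =: ((con: 1ℚ -: ε *: g) *: x +: ε *: (σ +: g *: (x -: cx))) *: ((x -: l +: (r -: x)) *: n) +: ε *: g *: cx)
      fx′ : ∀ ε σ g cx x → ((1ℚ - ε * g) * x + ε * (σ + g * (x - cx))) * 1ℚ + ε * g * cx ≡ x + σ * ε
      fx′ = ℚring 5 (λ ε σ g cx x → ((con: 1ℚ -: ε *: g) *: x +: ε *: (σ +: g *: (x -: cx))) *: con: 1ℚ +: ε *: g *: cx =: x +: σ *: ε)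
      fy : ∀ ε g cy y u v → u * y + v * y + ε * g * cy ≡ (u + v + ε * g) * y + (1ℚ - (u + v + ε * g)) * 0ℚ + ε * ((cy - y) * g)
      fy = ℚring 6 (λ ε g cy y u v → u *: y +: v *: y +: ε *: g *: cy =: (u +: v +: ε *: g) *: y +: (con: 1ℚ -: (u +: v +: ε *: g)) *: con: 0ℚ +: ε *: ((cy -: y) *: g))
      fy′ : ∀ ε τ y → 1ℚ * y + (1ℚ - 1ℚ) * 0ℚ + ε * τ ≡ y + τ * ε
      fy′ = ℚring 3 (λ ε τ y → con: 1ℚ *: y +: (con: 1ℚ -: con: 1ℚ) *: con: 0ℚ +: ε *: τ =: y +: τ *: ε)
    plus : ∀ u ε → u + 1ℚ * ε ≡ u + ε
    plus = ℚring 2 (λ u ε → u +: con: 1ℚ *: ε =: u +: ε)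
    minus : ∀ u ε → u + - 1ℚ * ε ≡ u - ε
    minus = ℚring 2 (λ u ε → u +: -: con: 1ℚ *: ε =: u -: ε)
    fin : (Σ ℚ λ ε → 0ℚ < ε × ε ≤ 1ℚ × All (λ q → ε * q ≤ 1ℚ) qs) → IsInteriorPt S (x , y)
    fin (ε , ε>0 , _ , eg All.∷ eg′ All.∷ e₁ All.∷ e₂ All.∷ e₃ All.∷ e₄ All.∷ e₅ All.∷ e₆ All.∷ e₇ All.∷ e₈ All.∷ All.[]) = ε , ε>0 ,
        Cone-subst refl (pt≡ (plus x ε) (plus y ε)) (corner ε 1ℚ 1ℚ g cx cy cc ε>0 g>0 gg eg e₁ e₂) ,
        Cone-subst refl (pt≡ (plus x ε) (minus y ε)) (corner ε 1ℚ (- 1ℚ) g′ dx dy cd ε>0 g′>0 gg′ eg′ e₅ e₆) ,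
        Cone-subst refl (pt≡ (minus x ε) (plus y ε)) (corner ε (- 1ℚ) 1ℚ g cx cy cc ε>0 g>0 gg eg e₃ e₄) ,
        Cone-subst refl (pt≡ (minus x ε) (minus y ε)) (corner ε (- 1ℚ) (- 1ℚ) g′ dx dy cd ε>0 g′>0 gg′ eg′ e₇ e₈)
      where
      g>0 : 0ℚ < g
      g>0 = proj₁ (proj₂ (recip (cy - y) (sdiff y<c)))
      gg : (cy - y) * g ≡ 1ℚ
      gg = proj₂ (proj₂ (recip (cy - y) (sdiff y<c)))
      g′>0 : 0ℚ < g′
      g′>0 = proj₁ (proj₂ (recip (y - dy) (sdiff d<y)))
      gg′ : (dy - y) * g′ ≡ - 1ℚ
      gg′ = trans (k dy y g′) (cong -_ (proj₂ (proj₂ (recip (y - dy) (sdiff d<y)))))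
        where
        k : ∀ d y g → (d - y) * g ≡ - ((y - d) * g)
        k = ℚring 3 (λ d y g → (d -: y) *: g =: -: ((y -: d) *: g))

  interior-mids : ∀ {S x y ε} → (let open Q in InConv S (x + ε , y + ε) × InConv S (x + ε , y - ε) × InConv S (x - ε , y + ε) × InConv S (x - ε , y - ε)) →
    InConv S (x + ε , y) × InConv S (x - ε , y) × InConv S (x , y + ε) × InConv S (x , y - ε)
  interior-mids {S} {x} {y} {ε} (a , b , c , d) =
      Cone-subst refl (pt≡ (same (x + ε)) (mid y ε)) (mid-conv a b) , Cone-subst refl (pt≡ (same (x - ε)) (mid y ε)) (mid-conv c d) ,
      Cone-subst refl (pt≡ (mid x ε) (same (y + ε))) (mid-conv a c) , Cone-subst refl (pt≡ (mid x ε) (same (y - ε))) (mid-conv b d)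
    where
    same : ∀ u → ½ * (u + u) ≡ u
    same = ℚring 1 (λ u → con: ½ *: (u +: u) =: u)
    mid : ∀ u ε → ½ * (u + ε + (u - ε)) ≡ u
    mid = ℚring 2 (λ u ε → con: ½ *: (u +: ε +: (u -: ε)) =: u)

  -- The join of v with a horizontal segment of positive length meets every later row in a segment of positive length.
  spread : ∀ {S vx vy wx wy ε t} → InConv S (vx , vy) → InConv S (wx + ε , wy) → InConv S (wx - ε , wy) → 0ℚ < ε → 0ℚ < t → t ≤ 1ℚ →
    Σ ℚ λ p → Σ ℚ λ q → q < p × InConv S (p , vy + t * (wy - vy)) × InConv S (q , vy + t * (wy - vy))
  spread {S} {vx} {vy} {wx} {wy} {ε} {t} cv c₁ c₂ ε>0 t>0 t≤1 = (1ℚ - t) * vx + t * (wx + ε) , (1ℚ - t) * vx + t * (wx - ε) ,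
      sbound (t>0 <⊠ (ε>0 <⊹ ℚP.<⇒≤ ε>0)) (l t vx wx ε) ,
      Cone-subst refl (pt≡ refl (f t vy wy)) (mix2 cv c₁ (diff t≤1) (ℚP.<⇒≤ t>0) (one t)) ,
      Cone-subst refl (pt≡ refl (f t vy wy)) (mix2 cv c₂ (diff t≤1) (ℚP.<⇒≤ t>0) (one t))
    where
    one : ∀ t → 1ℚ - t + t ≡ 1ℚ
    one = ℚring 1 (λ t → con: 1ℚ -: t +: t =: con: 1ℚ)
    f : ∀ t v w → (1ℚ - t) * v + t * w ≡ v + t * (w - v)
    f = ℚring 3 (λ t v w → (con: 1ℚ -: t) *: v +: t *: w =: v +: t *: (w -: v))
    l : ∀ t v w ε → (1ℚ - t) * v + t * (w + ε) - ((1ℚ - t) * v + t * (w - ε)) ≡ t * (ε + ε)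
    l = ℚring 4 (λ t v w ε → (con: 1ℚ -: t) *: v +: t *: (w +: ε) -: ((con: 1ℚ -: t) *: v +: t *: (w -: ε)) =: t *: (ε +: ε))
open Interior public

-- Polygons bounded by two chains and the lattice points of their dilates

module HullCounting where
  open Q using (_≤_; _<_; _+_; _*_; _-_; -_)
  open ℚArith
  private module ZA = ℤArith

  -- The boundary of conv S consists of a right chain R, a left chain (the right chain L of the mirror image) and two horizontal
  -- sides.  All coordinates are doubled, so the vertices of S are half (x , y) with x and y integers.
  record Hull (S : List Pt) : Set where
    field
      R L : List Edge
      xR xL y₀ : ℤ
      primR : Primitive R
      primL : Primitive L
      supR : Supports S R xR y₀
      supL : Supports (map mirror S) L xL y₀
      verR : Vertices S R xR y₀
      verL : Vertices (map mirror S) L xL y₀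
      capR : Cap S xR y₀
      capL : Cap (map mirror S) xL y₀
      heights : height L ≡ height R
      low : ∀ {s} → s ∈ S → ½ * ofℤ y₀ ≤ proj₂ s
      high : ∀ {s} → s ∈ S → proj₂ s ≤ ½ * (ofℤ y₀ + ofℤ (+ height R))

  module _ {S : List Pt} (P : Hull S) where
    open Hull P

    row-conv : ∀ {p} → InConv S p → Σ ℚ λ ρ → 0ℚ ≤ ρ × ρ ≤ ofℤ (+ height R) × proj₂ p ≡ ½ * (ofℤ y₀ + ρ)
    row-conv {p = a , b} c = b + b - ofℤ y₀ , bound (diff lo ⊹ diff lo) (l₁ b (ofℤ y₀)) , bound (diff hi ⊹ diff hi) (l₂ b (ofℤ y₀) (ofℤ (+ height R))) , l₃ b (ofℤ y₀)
      where
      lo : - b ≤ - (½ * ofℤ y₀)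
      lo = subst (_≤ - (½ * ofℤ y₀)) (l a b) (conv-bound 0ℚ (- 1ℚ) (- (½ * ofℤ y₀)) (λ {s} i → bound (diff (low i)) (l′ (proj₁ s) (proj₂ s) (½ * ofℤ y₀))) c)
        where
        l : ∀ a b → 0ℚ * a + - 1ℚ * b ≡ - b
        l = ℚring 2 (λ a b → con: 0ℚ *: a +: -: con: 1ℚ *: b =: -: b)
        l′ : ∀ a b y → - y - (0ℚ * a + - 1ℚ * b) ≡ b - y
        l′ = ℚring 3 (λ a b y → -: y -: (con: 0ℚ *: a +: -: con: 1ℚ *: b) =: b -: y)
      hi : b ≤ ½ * (ofℤ y₀ + ofℤ (+ height R))
      hi = subst (_≤ ½ * (ofℤ y₀ + ofℤ (+ height R))) (l a b) (conv-bound 0ℚ 1ℚ (½ * (ofℤ y₀ + ofℤ (+ height R))) (λ {s} i → subst (_≤ _) (sym (l (proj₁ s) (proj₂ s))) (high i)) c)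
        where
        l : ∀ a b → 0ℚ * a + 1ℚ * b ≡ b
        l = ℚring 2 (λ a b → con: 0ℚ *: a +: con: 1ℚ *: b =: b)
      l₁ : ∀ b y → b + b - y - 0ℚ ≡ - (½ * y) - - b + (- (½ * y) - - b)
      l₁ = ℚring 2 (λ b y → b +: b -: y -: con: 0ℚ =: -: (con: ½ *: y) -: -: b +: (-: (con: ½ *: y) -: -: b))
      l₂ : ∀ b y h → h - (b + b - y) ≡ ½ * (y + h) - b + (½ * (y + h) - b)
      l₂ = ℚring 3 (λ b y h → h -: (b +: b -: y) =: con: ½ *: (y +: h) -: b +: (con: ½ *: (y +: h) -: b))
      l₃ : ∀ b y → b ≡ ½ * (y + (b + b - y))
      l₃ = ℚring 2 (λ b y → b =: con: ½ *: (y +: (b +: b -: y)))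

    -- Every row ends on the two chains, hence at combinations of their vertices; so a polygon that
    -- contains the vertices contains `conv S`.
    conv-vertices : ∀ {T} → Vertices T R xR y₀ → Vertices (map mirror T) L xL y₀ → ∀ {p} → InConv S p → InConv T p
    conv-vertices {T} vR vL {p@(x , y)} c = let (ρ , ρ≥0 , ρ≤ , e) = row-conv c
                                                rR = row-end R xR y₀ supR vR capR ρ ρ≥0 ρ≤
                                                rL = row-end L xL y₀ supL vL capL ρ ρ≥0 (subst (λ n → ρ ≤ ofℤ (+ n)) (sym heights) ρ≤)
                                                open RowEnd rR renaming (a to a; inside to inR; upper to upR)
                                                open RowEnd rL renaming (a to a′; inside to inL; upper to upL)
      in between (subst (λ q → InConv T (- a′ , q)) (sym e) (conv-mirror⁻ inL)) (subst (λ q → InConv T (a , q)) (sym e) inR)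
           (bound (diff (upL (mirror p) (conv-mirror⁺ c) e)) (l x a′)) (upR p c e)
      where
      l : ∀ x a → x - - a ≡ a - - x
      l = ℚring 2 (λ x a → x -: -: a =: a -: -: x)

    module AtRow (ρ : ℚ) (ρ≥0 : 0ℚ ≤ ρ) (ρ≤ : ρ ≤ ofℤ (+ height R)) where
      rR : RowEnd S S R xR y₀ ρ
      rR = row-end R xR y₀ supR verR capR ρ ρ≥0 ρ≤
      rL : RowEnd (map mirror S) (map mirror S) L xL y₀ ρ
      rL = row-end L xL y₀ supL verL capL ρ ρ≥0 (subst (λ n → ρ ≤ ofℤ (+ n)) (sym heights) ρ≤)
      open RowEnd rR public renaming (a to right; inside to inR; upper to upR; floorAt-spec to floorR)
      open RowEnd rL public renaming (a to left; inside to inL; upper to upL; floorAt-spec to floorL)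
      left-in : InConv S (- left , ½ * (ofℤ y₀ + ρ))
      left-in = conv-mirror⁻ inL
      wide : 0ℚ ≤ right + left
      wide = bound (diff (upR _ left-in refl)) (l right left)
        where
        l : ∀ r l → r + l - 0ℚ ≡ r - - l
        l = ℚring 2 (λ r l → r +: l -: con: 0ℚ =: r -: -: l)

    -- Doubling the height of a lattice row of kP gives k y₀ + J.
    module Scaled (k : ℕ) (κ : ℚ) (k>0 : 0ℚ < ofℤ (+ k)) (kκ : ofℤ (+ k) * κ ≡ 1ℚ) where
      κ>0 : 0ℚ < κ
      κ>0 = cancel< {ofℤ (+ k)} k>0 (subst₂ _<_ (sym (ℚP.*-zeroʳ (ofℤ (+ k)))) (sym kκ) 0<1)

      row-≥0 : ∀ J → 0ℚ ≤ κ * ofℤ (+ J)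
      row-≥0 J = ℚP.<⇒≤ κ>0 ⊠ 0≤ofℤ+ J

      k-cancel : ∀ u → ofℤ (+ k) * (κ * u) ≡ u
      k-cancel u = trans (sym (ℚP.*-assoc (ofℤ (+ k)) κ u)) (trans (cong (λ q → q * u) kκ) (ℚP.*-identityˡ u))

      row-≤ : ∀ {J} → J N.≤ k N.* height R → κ * ofℤ (+ J) ≤ ofℤ (+ height R)
      row-≤ {J} p = proj₂ (scale-≤ {ofℤ (+ k)} k>0 (k-cancel (ofℤ (+ J))) (sym (trans (cong ofℤ (ℤP.pos-* k (height R))) (ofℤ-* (+ k) (+ height R))))) (ofℤ-≤ (Z.+≤+ p))

      lattice-row : ∀ y J → y Z.+ y ≡ + k Z.* y₀ Z.+ + J → κ * ofℤ y ≡ ½ * (ofℤ y₀ + κ * ofℤ (+ J))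
      lattice-row y J e = cancel≡ {1ℚ + 1ℚ} (0<1 <⊹ ℚP.<⇒≤ 0<1) (trans (l κ (ofℤ y)) (trans (cong (λ q → κ * q) (trans (sym (ofℤ-+ y y)) (trans (cong ofℤ e) (trans (ofℤ-+ (+ k Z.* y₀) (+ J)) (cong (λ q → q + ofℤ (+ J)) (ofℤ-* (+ k) y₀))))))
          (trans (l₂ κ (ofℤ (+ k)) (ofℤ y₀) (ofℤ (+ J))) (trans (cong (λ q → q * ofℤ y₀ + κ * ofℤ (+ J)) kκ) (l₃ (ofℤ y₀) (κ * ofℤ (+ J)))))))
        where
        l : ∀ κ y → (1ℚ + 1ℚ) * (κ * y) ≡ κ * (y + y)
        l = ℚring 2 (λ κ y → (con: 1ℚ +: con: 1ℚ) *: (κ *: y) =: κ *: (y +: y))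
        l₂ : ∀ κ k y J → κ * (k * y + J) ≡ k * κ * y + κ * J
        l₂ = ℚring 4 (λ κ k y J → κ *: (k *: y +: J) =: k *: κ *: y +: κ *: J)
        l₃ : ∀ y J → 1ℚ * y + J ≡ (1ℚ + 1ℚ) * (½ * (y + J))
        l₃ = ℚring 2 (λ y J → con: 1ℚ *: y +: J =: (con: 1ℚ +: con: 1ℚ) *: (con: ½ *: (y +: J)))

      -- The doubled height of a lattice point is an integer, so its offset from the bottom of the
      -- dilate is a natural number `J`.
      row-index : ∀ y ρ → 0ℚ ≤ ρ → ρ ≤ ofℤ (+ height R) → κ * ofℤ y ≡ ½ * (ofℤ y₀ + ρ) → Σ ℕ λ J → J N.≤ k N.* height R × y Z.+ y ≡ + k Z.* y₀ Z.+ + J × ρ ≡ κ * ofℤ (+ J)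
      row-index y ρ ρ≥0 ρ≤ e = J , ℤP.drop‿+≤+ (subst₂ Z._≤_ (sym Jeq) (sym (ℤP.pos-* k (height R))) (ofℤ-≤⁻ {j} {+ k Z.* + height R} (subst₂ _≤_ (sym jq) (sym (ofℤ-* (+ k) (+ height R))) (bound (ℚP.<⇒≤ k>0 ⊠ diff ρ≤) (l′ (ofℤ (+ k)) ρ (ofℤ (+ height R)))))))
            , trans (l₀ (+ k Z.* y₀) (y Z.+ y)) (cong (λ q → + k Z.* y₀ Z.+ q) (sym Jeq)) ,
            cancel≡ {ofℤ (+ k)} k>0 (trans (sym jq) (trans (cong ofℤ (sym Jeq)) (sym (k-cancel (ofℤ (+ J))))))
        where
        j = y Z.+ y Z.- + k Z.* y₀
        jq : ofℤ j ≡ ofℤ (+ k) * ρ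
        jq = trans (ofℤ-- (y Z.+ y) (+ k Z.* y₀)) (trans (cong₂ _-_ (trans (ofℤ-+ y y) (cong₂ _+_ (sym (k-cancel (ofℤ y))) (sym (k-cancel (ofℤ y))))) (ofℤ-* (+ k) y₀)) (trans (cong (λ q → ofℤ (+ k) * q + ofℤ (+ k) * q - ofℤ (+ k) * ofℤ y₀) e) (l (ofℤ (+ k)) (ofℤ y₀) ρ)))
          where
          l : ∀ k y ρ → k * (½ * (y + ρ)) + k * (½ * (y + ρ)) - k * y ≡ k * ρ
          l = ℚring 3 (λ k y ρ → k *: (con: ½ *: (y +: ρ)) +: k *: (con: ½ *: (y +: ρ)) -: k *: y =: k *: ρ)
        j≥0 : 0ℤ Z.≤ j
        j≥0 = ofℤ-≤⁻ {0ℤ} {j} (subst (0ℚ ≤_) (sym jq) (ℚP.<⇒≤ k>0 ⊠ ρ≥0))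
        J = Z.∣ j ∣
        Jeq : + J ≡ j
        Jeq = ℤP.0≤i⇒+∣i∣≡i j≥0
        l₀ : ∀ a b → b ≡ a Z.+ (b Z.- a)
        l₀ = ℤring 2 (λ a b → b := a :+ (b :- a))
        l′ : ∀ k ρ h → k * h - k * ρ ≡ k * (h - ρ)
        l′ = ℚring 3 (λ k ρ h → k *: h -: k *: ρ =: k *: (h -: ρ))

      neg-swap : ∀ x f → (Z.- x Z.≤ f) ↔ (Z.- f Z.≤ x)
      neg-swap x f = (λ p → ZA.bound (ZA.diff p) (l x f)) , (λ p → ZA.bound (ZA.diff p) (sym (l x f)))
        where
        l : ∀ x f → x Z.- Z.- f ≡ f Z.- Z.- x
        l = ℤring 2 (λ x f → x :- :- f := f :- :- x)

      κ-neg : ∀ x → κ * ofℤ (Z.- x) ≡ - (κ * ofℤ x)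
      κ-neg x = trans (cong (λ q → κ * q) (ofℤ-neg x)) (sym (ℚP.neg-distribʳ-* κ (ofℤ x)))

      lo hi : ℕ → ℤ
      lo J = Z.- floorAt 0 k L xL J
      hi J = floorAt 0 k R xR J

      module Row (J : ℕ) (J≤ : J N.≤ k N.* height R) where
        open AtRow (κ * ofℤ (+ J)) (row-≥0 J) (row-≤ J≤) public
        fR : Floors k κ right (floorAt 0 k R xR J) (floorAt 1 k R xR J)
        fR = floorR k κ J k>0 kκ refl
        fL : Floors k κ left (floorAt 0 k L xL J) (floorAt 1 k L xL J)
        fL = floorL k κ J k>0 kκ refl

      lattice-rows : ∀ z → InConv (dilate (ofℤ (+ k)) S) (toPt z) ↔ InRows (+ k Z.* y₀) (k N.* height R N.+ 1) lo hi z
      lattice-rows z@(x , y) = to , from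
        where
        to : InConv (dilate (ofℤ (+ k)) S) (toPt z) → InRows (+ k Z.* y₀) (k N.* height R N.+ 1) lo hi z
        to c = J , subst (J N.<_) (ℕP.+-comm 1 (k N.* height R)) (s≤s J≤) , e′ ,
            proj₁ (neg-swap x (floorAt 0 k L xL J)) (proj₁ (proj₁ (fL (Z.- x))) (subst (_≤ left) (sym (κ-neg x)) (upL _ (conv-mirror⁺ c′) le))) ,
            proj₁ (proj₁ (fR x)) (upR _ c′ le)
          where
          c′ = proj₁ (conv-dilate {ofℤ (+ k)} {κ} kκ S (toPt z)) c
          rc = row-conv c′
          ri = row-index y (proj₁ rc) (proj₁ (proj₂ rc)) (proj₁ (proj₂ (proj₂ rc))) (proj₂ (proj₂ (proj₂ rc)))
          J = proj₁ ri
          J≤ = proj₁ (proj₂ ri)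
          e′ = proj₁ (proj₂ (proj₂ ri))
          le = lattice-row y J e′
          open Row J J≤
        from : InRows (+ k Z.* y₀) (k N.* height R N.+ 1) lo hi z → InConv (dilate (ofℤ (+ k)) S) (toPt z)
        from (J , J< , e , p , q) = proj₂ (conv-dilate {ofℤ (+ k)} {κ} kκ S (toPt z)) (between
            (subst (λ q → InConv S (- left , q)) (sym (lattice-row y J e)) left-in) (subst (λ q → InConv S (right , q)) (sym (lattice-row y J e)) inR)
            (bound (diff (subst (_≤ left) (κ-neg x) (proj₂ (proj₁ (fL (Z.- x))) (proj₂ (neg-swap x (floorAt 0 k L xL J)) p)))) (l (κ * ofℤ x) left))
            (proj₂ (proj₁ (fR x)) q))
          where
          open Row J (ℕP.≤-pred (subst (J N.<_) (ℕP.+-comm (k N.* height R) 1) J<))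
          l : ∀ x a → x - - a ≡ a - - x
          l = ℚring 2 (λ x a → x -: -: a =: a -: -: x)

      -- If the floors were further apart, the integer `g + 1` would lie strictly beyond the right
      -- end and strictly before the left end of the row, against `wide`.
      row-ok : ∀ J → J N.< k N.* height R N.+ 1 → lo J Z.≤ hi J Z.+ 1ℤ
      row-ok J J< = go (Z.- f Z.≤? (g Z.+ 1ℤ))
        where
        open Row J (ℕP.≤-pred (subst (J N.<_) (ℕP.+-comm (k N.* height R) 1) J<))
        f = floorAt 0 k L xL J
        g = floorAt 0 k R xR J
        above : ∀ {a u v} → Floors k κ a u v → ∀ z → ¬ (z Z.≤ u) → a < κ * ofℤ z
        above F z n = ℚP.≰⇒> (λ p → n (proj₁ (proj₁ (F z)) p))
        go : Dec (Z.- f Z.≤ g Z.+ 1ℤ) → Z.- f Z.≤ g Z.+ 1ℤ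
        go (yes p) = p
        go (no n) = ⊥-elim (ℚP.<-irrefl refl (ℚP.≤-<-trans wide (subst (right + left <_) zero0 (ℚP.+-mono-< (above fR (g Z.+ 1ℤ) n₁) (above fL (Z.- (g Z.+ 1ℤ)) n₂)))))
          where
          n₁ : ¬ (g Z.+ 1ℤ Z.≤ g)
          n₁ p = ZA.absurd 0 (ZA.diff p) (l g)
            where
            l : ∀ g → g Z.- (g Z.+ 1ℤ) ≡ -[1+ 0 ]
            l = ℤring 1 (λ g → g :- (g :+ # 1) := con -[1+ 0 ])
          n₂ : ¬ (Z.- (g Z.+ 1ℤ) Z.≤ f)
          n₂ p = n (proj₁ (neg-swap (g Z.+ 1ℤ) f) p)
          zero0 : κ * ofℤ (g Z.+ 1ℤ) + κ * ofℤ (Z.- (g Z.+ 1ℤ)) ≡ 0ℚ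
          zero0 = trans (cong (λ q → κ * ofℤ (g Z.+ 1ℤ) + q) (κ-neg (g Z.+ 1ℤ))) (ℚP.+-inverseʳ (κ * ofℤ (g Z.+ 1ℤ)))

      -- Doubling the count lets each chain contribute `2⌊·⌋ + 1` per lattice row, so the total
      -- splits into one sum per chain.
      ehrhart-count : Σ ℕ λ n → HasCount (λ z → InConv (dilate (ofℤ (+ k)) S) (toPt z)) n × + 2 Z.* + n ≡ rows k R xR y₀ Z.+ rows k L xL y₀
      ehrhart-count = let (n , c , e) = count-rows (+ k Z.* y₀) (k N.* height R N.+ 1) lo hi (λ J p _ → row-ok J p)
        in n , count-cong (λ z → proj₂ (lattice-rows z) , proj₁ (lattice-rows z)) c , trans (cong (λ q → + 2 Z.* q) e) total
        where
        M = k N.* height R N.+ 1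
        e1 : ℕ → ℤ
        e1 J = ev (+ k Z.* y₀ Z.+ + J)
        l : ∀ e f g → e Z.* (g Z.- Z.- f Z.+ 1ℤ) Z.* + 2 ≡ e Z.* (+ 2 Z.* g Z.+ 1ℤ) Z.+ e Z.* (+ 2 Z.* f Z.+ 1ℤ)
        l = ℤring 3 (λ e f g → e :* (g :- :- f :+ # 1) :* # 2 := e :* (# 2 :* g :+ # 1) :+ e :* (# 2 :* f :+ # 1))
        total : + 2 Z.* sum M (λ J → e1 J Z.* (hi J Z.- lo J Z.+ 1ℤ)) ≡ rows k R xR y₀ Z.+ rows k L xL y₀
        total = trans (ℤP.*-comm (+ 2) (sum M (λ J → e1 J Z.* (hi J Z.- lo J Z.+ 1ℤ)))) (trans (sym (sum-* M (+ 2) (λ J → e1 J Z.* (hi J Z.- lo J Z.+ 1ℤ))))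
          (trans (sum-cong M (λ J _ → l (e1 J) (floorAt 0 k L xL J) (floorAt 0 k R xR J)))
          (trans (sum-+ M (λ J → e1 J Z.* (+ 2 Z.* floorAt 0 k R xR J Z.+ 1ℤ)) (λ J → e1 J Z.* (+ 2 Z.* floorAt 0 k L xL J Z.+ 1ℤ)))
          (cong₂ Z._+_ (floorSum-rows k R xR y₀) (trans (cong (λ n → floorSum 0 k L xL y₀ (k N.* n N.+ 1)) (sym heights)) (floorSum-rows k L xL y₀))))))
open HullCounting public

-- Boundary points, interior points and the Ehrhart function

module HullNumbers where
  open Q using (_≤_; _<_; _+_; _*_; _-_; -_)
  open ℚArith
  private module ZA = ℤArith

  openSum-first : ∀ D h es x y n → floorSum 1 1 ((D , h) ∷ es) x y (suc n) ≡
    ev y Z.* (x Z.- ev x) Z.+ sum n (λ J → ev (+ 1 Z.* y Z.+ 1ℤ Z.+ + J) Z.* (+ 2 Z.* floorAt 1 1 ((D , h) ∷ es) x (suc J) Z.+ 1ℤ))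
  openSum-first D h es x y n = cong₂ Z._+_
    (trans (cong (λ q → ev (+ 1 Z.* y Z.+ + 0) Z.* (+ 2 Z.* q Z.+ 1ℤ)) (floorAt-< 1 1 D h es x {0} (s≤s z≤n)))
      (trans (row-start (+ 1 Z.* x) (+ 1 Z.* y) D h) (cong₂ (λ p q → ev q Z.* (p Z.- ev p)) (ℤP.*-identityˡ x) (ℤP.*-identityˡ y))))
    (sum-cong n (λ J _ → cong (λ q → ev q Z.* (+ 2 Z.* floorAt 1 1 ((D , h) ∷ es) x (suc J) Z.+ 1ℤ)) (sym (ℤP.+-assoc (+ 1 Z.* y) 1ℤ (+ J)))))

  -- Twice the contribution of one side to the interior points: open floors, in the rows strictly
  -- between bottom and top, whence `pred` and the shift to `suc J`.
  innerSum : List Edge → ℤ → ℤ → ℤ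
  innerSum es x y = sum (N.pred (height es)) (λ J → ev (+ 1 Z.* y Z.+ 1ℤ Z.+ + J) Z.* (+ 2 Z.* floorAt 1 1 es x (suc J) Z.+ 1ℤ))

  -- The excess of the closed over the open count is the share of the chain in the boundary; the
  -- shares of the two chains add up to `β′`.
  innerSum-rows : ∀ es x y → Primitive es → 0 N.< height es →
    rows 1 es x y ≡ innerSum es x y Z.+ (ηs es x y Z.+ x Z.* ev y Z.+ endX es x Z.* ev (topY es y))
  innerSum-rows ((D , h) ∷ es) x y pr _ = trans (rows-open ((D , h) ∷ es) x y pr)
    (trans (cong (λ q → q Z.+ evpt x y Z.+ ηs ((D , h) ∷ es) x y Z.+ endX ((D , h) ∷ es) x Z.* ev (topY ((D , h) ∷ es) y)) (trans (sym (floorSum-open ((D , h) ∷ es) x y)) (openSum-first D h es x y (h N.+ height es))))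
      (l (ev y) x (ev x) (innerSum ((D , h) ∷ es) x y) (ηs ((D , h) ∷ es) x y) (endX ((D , h) ∷ es) x Z.* ev (topY ((D , h) ∷ es) y))))
    where
    l : ∀ e x f I n t → e Z.* (x Z.- f) Z.+ I Z.+ f Z.* e Z.+ n Z.+ t ≡ I Z.+ (n Z.+ x Z.* e Z.+ t)
    l = ℤring 6 (λ e x f I n t → e :* (x :- f) :+ I :+ f :* e :+ n :+ t := I :+ (n :+ x :* e :+ t))

  module Numbers {S : List Pt} (P : Hull S) where
    open Hull P
    -- `Qb` and `Qt` are the lengths of the horizontal sides of `2P`, and `a₂` is twice its area. As
    -- all edges are primitive, `β` is the number of boundary lattice points of `2P`; `β′` turns out
    -- to be twice that of `P`.
    yₙ Qb Qt a₂ β β′ : ℤ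
    yₙ = y₀ Z.+ + height R
    Qb = xR Z.+ xL
    Qt = endX R xR Z.+ endX L xL
    a₂ = area R xR Z.+ area L xL
    β = + length R Z.+ + length L Z.+ (Qb Z.+ Qt)
    β′ = ηs R xR y₀ Z.+ ηs L xL y₀ Z.+ (Qb Z.* ev y₀ Z.+ Qt Z.* ev yₙ)

    topR : topY R y₀ ≡ yₙ
    topR = topY-height R y₀
    topL : topY L y₀ ≡ yₙ
    topL = trans (topY-height L y₀) (cong (λ n → y₀ Z.+ + n) heights)

    β′-split : ηs R xR y₀ Z.+ xR Z.* ev y₀ Z.+ endX R xR Z.* ev (topY R y₀) Z.+ (ηs L xL y₀ Z.+ xL Z.* ev y₀ Z.+ endX L xL Z.* ev (topY L y₀)) ≡ β′
    β′-split = trans (cong₂ (λ p q → ηs R xR y₀ Z.+ xR Z.* ev y₀ Z.+ endX R xR Z.* ev p Z.+ (ηs L xL y₀ Z.+ xL Z.* ev y₀ Z.+ endX L xL Z.* ev q)) topR topL)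
      (l (ηs R xR y₀) (ηs L xL y₀) xR xL (ev y₀) (endX R xR) (endX L xL) (ev yₙ))
      where
      l : ∀ a b x x′ e t t′ f → a Z.+ x Z.* e Z.+ t Z.* f Z.+ (b Z.+ x′ Z.* e Z.+ t′ Z.* f) ≡ a Z.+ b Z.+ ((x Z.+ x′) Z.* e Z.+ (t Z.+ t′) Z.* f)
      l = ℤring 8 (λ a b x x′ e t t′ f → a :+ x :* e :+ t :* f :+ (b :+ x′ :* e :+ t′ :* f) := a :+ b :+ ((x :+ x′) :* e :+ (t :+ t′) :* f))

    ehrhart : ∀ k → Σ ℕ λ n → Ehrhart S (suc k) n × + 2 Z.* + n ≡ rows (suc k) R xR y₀ Z.+ rows (suc k) L xL y₀
    ehrhart k = Scaled.ehrhart-count P (suc k) (proj₁ r) (0<ofℤsuc k) (proj₂ (proj₂ r))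
      where r = recip (ofℤ (+ suc k)) (0<ofℤsuc k)

    -- Twice the Ehrhart polynomial of the integral polygon `2P` at `m`, with area `a₂ / 2` and `β`
    -- boundary points.
    rows-sum-even : ∀ m → rows (m N.* 2) R xR y₀ Z.+ rows (m N.* 2) L xL y₀ ≡ + m Z.* + m Z.* a₂ Z.+ + m Z.* β Z.+ + 2
    rows-sum-even m = trans (cong₂ Z._+_ (rows-even m R xR y₀ primR) (rows-even m L xL y₀ primL)) (l (+ m) (area R xR) (area L xL) (+ length R) (+ length L) (endX R xR) (endX L xL) xR xL)
      where
      l : ∀ m A B G G′ t t′ x x′ → m Z.* m Z.* A Z.+ m Z.* (G Z.+ t Z.+ x) Z.+ 1ℤ Z.+ (m Z.* m Z.* B Z.+ m Z.* (G′ Z.+ t′ Z.+ x′) Z.+ 1ℤ) ≡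
        m Z.* m Z.* (A Z.+ B) Z.+ m Z.* (G Z.+ G′ Z.+ (x Z.+ x′ Z.+ (t Z.+ t′))) Z.+ + 2
      l = ℤring 9 (λ m A B G G′ t t′ x x′ → m :* m :* A :+ m :* (G :+ t :+ x) :+ # 1 :+ (m :* m :* B :+ m :* (G′ :+ t′ :+ x′) :+ # 1) := m :* m :* (A :+ B) :+ m :* (G :+ G′ :+ (x :+ x′ :+ (t :+ t′))) :+ # 2)

    rows-sum-odd : ∀ m → rows (1 N.+ m N.* 2) R xR y₀ Z.+ rows (1 N.+ m N.* 2) L xL y₀ ≡
      rows 1 R xR y₀ Z.+ rows 1 L xL y₀ Z.+ ((+ m Z.* + m Z.+ + m) Z.* a₂ Z.+ + m Z.* β′)
    rows-sum-odd m = trans (cong₂ Z._+_ (rows-odd m R xR y₀ primR) (rows-odd m L xL y₀ primL)) (trans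
        (l (rows 1 R xR y₀) (rows 1 L xL y₀) (+ m) (area R xR) (area L xL) (ηs R xR y₀ Z.+ xR Z.* ev y₀ Z.+ endX R xR Z.* ev (topY R y₀)) (ηs L xL y₀ Z.+ xL Z.* ev y₀ Z.+ endX L xL Z.* ev (topY L y₀)))
        (cong (λ q → rows 1 R xR y₀ Z.+ rows 1 L xL y₀ Z.+ ((+ m Z.* + m Z.+ + m) Z.* a₂ Z.+ + m Z.* q)) β′-split))
      where
      l : ∀ r r′ m A B s s′ → r Z.+ ((m Z.* m Z.+ m) Z.* A Z.+ m Z.* s) Z.+ (r′ Z.+ ((m Z.* m Z.+ m) Z.* B Z.+ m Z.* s′)) ≡ r Z.+ r′ Z.+ ((m Z.* m Z.+ m) Z.* (A Z.+ B) Z.+ m Z.* (s Z.+ s′))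
      l = ℤring 7 (λ r r′ m A B s s′ → r :+ ((m :* m :+ m) :* A :+ m :* s) :+ (r′ :+ ((m :* m :+ m) :* B :+ m :* s′)) := r :+ r′ :+ ((m :* m :+ m) :* (A :+ B) :+ m :* (s :+ s′)))

    module _ (poly : IsPolygon S) where
      private
        wx = proj₁ (proj₁ poly)
        wy = proj₂ (proj₁ poly)
        ε = proj₁ (proj₂ poly)
        Y = ofℤ y₀
        H = ofℤ (+ height R)
        ε>0 : 0ℚ < ε
        ε>0 = proj₁ (proj₂ (proj₂ poly))
        mids = interior-mids {S} {wx} {wy} {ε} (proj₂ (proj₂ (proj₂ poly)))

      row-strict : ∀ {y e} → 0ℚ < e → InConv S (proj₁ y , proj₂ y + e) → InConv S (proj₁ y , proj₂ y - e) → ½ * (Y + 0ℚ) < proj₂ y × proj₂ y < ½ * (Y + H)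
      row-strict {x , y} {e} e>0 up dn = let (ρ , p , _ , q) = row-conv P dn ; (σ , _ , s , t) = row-conv P up in
          sbound (e>0 <⊹ (ℚP.<⇒≤ 0<½ ⊠ p)) (trans (l₁ y Y e) (trans (cong (λ z → z - ½ * (Y + 0ℚ) + e) q) (l₂ Y ρ e))) ,
          sbound (e>0 <⊹ (ℚP.<⇒≤ 0<½ ⊠ diff s)) (trans (l₃ y Y H e) (trans (cong (λ z → ½ * (Y + H) - z + e) t) (l₄ Y σ H e)))
        where
        l₁ : ∀ y Y e → y - ½ * (Y + 0ℚ) ≡ y - e - ½ * (Y + 0ℚ) + e
        l₁ = ℚring 3 (λ y Y e → y -: con: ½ *: (Y +: con: 0ℚ) =: y -: e -: con: ½ *: (Y +: con: 0ℚ) +: e)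
        l₂ : ∀ Y ρ e → ½ * (Y + ρ) - ½ * (Y + 0ℚ) + e ≡ e + ½ * (ρ)
        l₂ = ℚring 3 (λ Y ρ e → con: ½ *: (Y +: ρ) -: con: ½ *: (Y +: con: 0ℚ) +: e =: e +: con: ½ *: (ρ))
        l₃ : ∀ y Y H e → ½ * (Y + H) - y ≡ ½ * (Y + H) - (y + e) + e
        l₃ = ℚring 4 (λ y Y H e → con: ½ *: (Y +: H) -: y =: con: ½ *: (Y +: H) -: (y +: e) +: e)
        l₄ : ∀ Y σ H e → ½ * (Y + H) - ½ * (Y + σ) + e ≡ e + ½ * (H - σ)
        l₄ = ℚring 4 (λ Y σ H e → con: ½ *: (Y +: H) -: con: ½ *: (Y +: σ) +: e =: e +: con: ½ *: (H -: σ))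

      height>0 : 0 N.< height R
      height>0 = ℕP.≰⇒> λ { h≤0 → ℚP.<-irrefl (cong (λ n → ½ * (Y + ofℤ (+ n))) (sym (ℕP.n≤0⇒n≡0 h≤0)))
          (ℚP.<-trans (proj₁ (row-strict {wx , wy} ε>0 (proj₁ (proj₂ (proj₂ mids))) (proj₂ (proj₂ (proj₂ mids))))) (proj₂ (row-strict {wx , wy} ε>0 (proj₁ (proj₂ (proj₂ mids))) (proj₂ (proj₂ (proj₂ mids)))))) }

      H≥0 : 0ℚ ≤ H
      H≥0 = 0≤ofℤ+ (height R)

      module Bot = AtRow P 0ℚ ℚP.≤-refl H≥0
      module Top = AtRow P H H≥0 ℚP.≤-refl

      -- There is a horizontal segment around the interior point. A row at its height or below meets
      -- the join of this segment with a bottom point, a row above meets the join with a top point,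
      -- each time in a segment of positive length.
      strict-wide : ∀ ρ (ρ≥0 : 0ℚ ≤ ρ) (ρ≤ : ρ ≤ H) → 0ℚ < ρ → ρ < H → 0ℚ < AtRow.right P ρ ρ≥0 ρ≤ + AtRow.left P ρ ρ≥0 ρ≤
      strict-wide ρ ρ≥0 ρ≤ ρ>0 ρ<H = cases (b Q.≤? wy)
        where
        open AtRow P ρ ρ≥0 ρ≤
        b = ½ * (Y + ρ)
        conclude : ∀ {p q b′} → q < p → b′ ≡ b → InConv S (p , b′) → InConv S (q , b′) → 0ℚ < right + left
        conclude {p} {q} q<p refl cp cq = sbound (sdiff q<p <⊹ (diff (upR _ cp refl) ⊹ diff (upL _ (conv-mirror⁺ cq) refl))) (l p q right left)
          where
          l : ∀ p q r l → r + l - 0ℚ ≡ p - q + (r - p + (l - - q))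
          l = ℚring 4 (λ p q r l → r +: l -: con: 0ℚ =: p -: q +: (r -: p +: (l -: -: q)))
        go : ∀ {vx vy} → InConv S (vx , vy) → ∀ t → 0ℚ < t → t ≤ 1ℚ → vy + t * (wy - vy) ≡ b → 0ℚ < right + left
        go cv t t>0 t≤1 e = let (p , q , q<p , cp , cq) = spread {wx = wx} {wy} {ε} {t} cv (proj₁ mids) (proj₁ (proj₂ mids)) ε>0 t>0 t≤1 in conclude q<p e cp cq
        bot< : ½ * (Y + 0ℚ) < b
        bot< = sbound (0<½ <⊠ ρ>0) (l Y ρ)
          where
          l : ∀ Y ρ → ½ * (Y + ρ) - ½ * (Y + 0ℚ) ≡ ½ * ρ
          l = ℚring 2 (λ Y ρ → con: ½ *: (Y +: ρ) -: con: ½ *: (Y +: con: 0ℚ) =: con: ½ *: ρ)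
        <top : b < ½ * (Y + H)
        <top = sbound (0<½ <⊠ sdiff ρ<H) (l Y ρ H)
          where
          l : ∀ Y ρ H → ½ * (Y + H) - ½ * (Y + ρ) ≡ ½ * (H - ρ)
          l = ℚring 3 (λ Y ρ H → con: ½ *: (Y +: H) -: con: ½ *: (Y +: ρ) =: con: ½ *: (H -: ρ))
        cases : Dec (b ≤ wy) → 0ℚ < right + left
        cases (yes p) = go Bot.inR ((b - v) * n) (sdiff bot< <⊠ n>0) (bound (diff p ⊠ ℚP.<⇒≤ n>0) (trans (cong (λ q → q - (b - v) * n) (sym e)) (l₁ wy b v n)))
            (trans (l₂ wy b v n) (trans (cong (λ q → v + (b - v) * q) e) (l₃ v b)))
          where
          v = ½ * (Y + 0ℚ)
          v<w : 0ℚ < wy - v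
          v<w = sdiff (ℚP.<-≤-trans bot< p)
          n = proj₁ (recip (wy - v) v<w)
          n>0 : 0ℚ < n
          n>0 = proj₁ (proj₂ (recip (wy - v) v<w))
          e : (wy - v) * n ≡ 1ℚ
          e = proj₂ (proj₂ (recip (wy - v) v<w))
          l₁ : ∀ w b v n → (w - v) * n - (b - v) * n ≡ (w - b) * n
          l₁ = ℚring 4 (λ w b v n → (w -: v) *: n -: (b -: v) *: n =: (w -: b) *: n)
          l₂ : ∀ w b v n → v + (b - v) * n * (w - v) ≡ v + (b - v) * ((w - v) * n)
          l₂ = ℚring 4 (λ w b v n → v +: (b -: v) *: n *: (w -: v) =: v +: (b -: v) *: ((w -: v) *: n))
          l₃ : ∀ v b → v + (b - v) * 1ℚ ≡ b
          l₃ = ℚring 2 (λ v b → v +: (b -: v) *: con: 1ℚ =: b)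
        cases (no np) = go Top.inR ((v - b) * n) (sdiff <top <⊠ n>0) (bound (ℚP.<⇒≤ (sdiff w<b) ⊠ ℚP.<⇒≤ n>0) (trans (cong (λ q → q - (v - b) * n) (sym e)) (l₁ wy b v n)))
            (trans (l₂ wy b v n) (trans (cong (λ q → v - (v - b) * q) e) (l₃ v b)))
          where
          v = ½ * (Y + H)
          w<b : wy < b
          w<b = ℚP.≰⇒> np
          w<v : 0ℚ < v - wy
          w<v = sdiff (ℚP.<-trans w<b <top)
          n = proj₁ (recip (v - wy) w<v)
          n>0 : 0ℚ < n
          n>0 = proj₁ (proj₂ (recip (v - wy) w<v))
          e : (v - wy) * n ≡ 1ℚ
          e = proj₂ (proj₂ (recip (v - wy) w<v))
          l₁ : ∀ w b v n → (v - w) * n - (v - b) * n ≡ (b - w) * n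
          l₁ = ℚring 4 (λ w b v n → (v -: w) *: n -: (v -: b) *: n =: (b -: w) *: n)
          l₂ : ∀ w b v n → v + (v - b) * n * (w - v) ≡ v - (v - b) * ((v - w) * n)
          l₂ = ℚring 4 (λ w b v n → v +: (v -: b) *: n *: (w -: v) =: v -: (v -: b) *: ((v -: w) *: n))
          l₃ : ∀ v b → v - (v - b) * 1ℚ ≡ b
          l₃ = ℚring 2 (λ v b → v -: (v -: b) *: con: 1ℚ =: b)

      module K = Scaled P 1 1ℚ 0<1 refl

      loI hiI : ℕ → ℤ
      loI J = Z.- floorAt 1 1 L xL (suc J)
      hiI J = floorAt 1 1 R xR (suc J)

      inner-bound : ∀ {J} → J N.< N.pred (height R) → suc J N.< height R
      inner-bound {J} p = go (height R) p
        where
        go : ∀ n → J N.< N.pred n → suc J N.< n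
        go (suc n) q = s≤s q

      module Inner (J : ℕ) (J< : suc J N.< height R) where
        J≤ : suc J N.≤ 1 N.* height R
        J≤ = subst (suc J N.≤_) (sym (ℕP.*-identityˡ (height R))) (ℕP.<⇒≤ J<)
        open K.Row (suc J) J≤ public
        ρ>0 : 0ℚ < 1ℚ * ofℤ (+ suc J)
        ρ>0 = subst (0ℚ <_) (sym (ℚP.*-identityˡ (ofℤ (+ suc J)))) (0<ofℤsuc J)
        ρ<H : 1ℚ * ofℤ (+ suc J) < H
        ρ<H = subst (_< H) (sym (ℚP.*-identityˡ (ofℤ (+ suc J)))) (ofℤ-< (Z.+<+ J<))
        wide< : 0ℚ < right + left
        wide< = strict-wide (1ℚ * ofℤ (+ suc J)) (K.row-≥0 (suc J)) (K.row-≤ J≤) ρ>0 ρ<H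

      inner-ok : ∀ J → J N.< N.pred (height R) → loI J Z.≤ hiI J Z.+ 1ℤ
      inner-ok J J<′ = go (Z.- f Z.≤? (g Z.+ 1ℤ))
        where
        open Inner J (inner-bound J<′)
        f = floorAt 1 1 L xL (suc J)
        g = floorAt 1 1 R xR (suc J)
        above : ∀ {a u v} → Floors 1 1ℚ a u v → ∀ z → ¬ (z Z.≤ v) → a ≤ 1ℚ * ofℤ z
        above F z n = ℚP.≮⇒≥ (λ p → n (proj₁ (proj₂ (F z)) p))
        go : Dec (Z.- f Z.≤ g Z.+ 1ℤ) → Z.- f Z.≤ g Z.+ 1ℤ
        go (yes p) = p
        go (no n) = ⊥-elim (ℚP.<-irrefl refl (ℚP.<-≤-trans wide< (subst (right + left ≤_) zero0 (ℚP.+-mono-≤ (above fR (g Z.+ 1ℤ) n₁) (above fL (Z.- (g Z.+ 1ℤ)) n₂)))))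
          where
          n₁ : ¬ (g Z.+ 1ℤ Z.≤ g)
          n₁ p = ZA.absurd 0 (ZA.diff p) (l g)
            where
            l : ∀ g → g Z.- (g Z.+ 1ℤ) ≡ -[1+ 0 ]
            l = ℤring 1 (λ g → g :- (g :+ # 1) := con -[1+ 0 ])
          n₂ : ¬ (Z.- (g Z.+ 1ℤ) Z.≤ f)
          n₂ p = n (proj₁ (K.neg-swap (g Z.+ 1ℤ) f) p)
          zero0 : 1ℚ * ofℤ (g Z.+ 1ℤ) + 1ℚ * ofℤ (Z.- (g Z.+ 1ℤ)) ≡ 0ℚ
          zero0 = trans (cong (λ q → 1ℚ * ofℤ (g Z.+ 1ℤ) + q) (K.κ-neg (g Z.+ 1ℤ))) (ℚP.+-inverseʳ (1ℚ * ofℤ (g Z.+ 1ℤ)))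

      -- An interior point has room in all four directions, which gives the strict inequalities.
      -- Conversely, the two row ends and one point each of the top and bottom rows surround the
      -- point.
      interior-rows : ∀ z → IsInteriorPt S (toPt z) ↔ InRows (+ 1 Z.* y₀ Z.+ 1ℤ) (N.pred (height R)) loI hiI z
      interior-rows z@(x , y) = to , from
        where
        X = ofℤ x
        Yy = ofℤ y
        to : IsInteriorPt S (toPt z) → InRows (+ 1 Z.* y₀ Z.+ 1ℤ) (N.pred (height R)) loI hiI z
        to (e , e>0 , cs) = finish (proj₁ ri) (proj₂ ri)
          where
          ms = interior-mids {S} {X} {Yy} {e} cs
          here′ : InConv S (X , Yy)
          here′ = Cone-subst refl (pt≡ (l X e) (l′ Yy)) (mid-conv (proj₁ ms) (proj₁ (proj₂ ms)))
            where
            l : ∀ u e → ½ * (u + e + (u - e)) ≡ u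
            l = ℚring 2 (λ u e → con: ½ *: (u +: e +: (u -: e)) =: u)
            l′ : ∀ u → ½ * (u + u) ≡ u
            l′ = ℚring 1 (λ u → con: ½ *: (u +: u) =: u)
          rs = row-strict {X , Yy} e>0 (proj₁ (proj₂ (proj₂ ms))) (proj₂ (proj₂ (proj₂ ms)))
          rc = row-conv P here′
          ri = K.row-index y (proj₁ rc) (proj₁ (proj₂ rc)) (proj₁ (proj₂ (proj₂ rc))) (trans (ℚP.*-identityˡ Yy) (proj₂ (proj₂ (proj₂ rc))))
          finish : ∀ J → J N.≤ 1 N.* height R × y Z.+ y ≡ + 1 Z.* y₀ Z.+ + J × proj₁ rc ≡ 1ℚ * ofℤ (+ J) → InRows (+ 1 Z.* y₀ Z.+ 1ℤ) (N.pred (height R)) loI hiI z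
          -- Row 0 is the bottom row, which contains no interior point.
          finish zero (_ , e′ , eρ) = ⊥-elim (ℚP.<-irrefl refl (subst₂ _<_ (cong (λ q → ½ * (Y + q)) (sym (trans eρ refl))) (proj₂ (proj₂ (proj₂ rc))) (proj₁ rs)))
          finish (suc J) (J≤′ , e′ , eρ) = J , pre (height R) J<H , trans e′ (sym (ℤP.+-assoc (+ 1 Z.* y₀) 1ℤ (+ J))) ,
              proj₁ (K.neg-swap x (floorAt 1 1 L xL (suc J))) (proj₁ (proj₂ (fL (Z.- x))) (subst (_< left) (sym (trans (K.κ-neg x) (cong -_ (ℚP.*-identityˡ X))))
                (sbound (e>0 <⊹ diff (upL _ (conv-mirror⁺ (proj₁ (proj₂ ms))) row-eq)) (l₂ X e left)))) ,
              proj₁ (proj₂ (fR x)) (subst (_< right) (sym (ℚP.*-identityˡ X)) (sbound (e>0 <⊹ diff (upR _ (proj₁ ms) row-eq)) (l₁ X e right)))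
            where
            J<H : suc J N.< height R
            J<H = ℕP.≰⇒> λ q → ℚP.<-irrefl refl (ℚP.<-≤-trans (proj₂ rs) (subst (½ * (Y + H) ≤_) (sym (trans (proj₂ (proj₂ (proj₂ rc))) (cong (λ r → ½ * (Y + r)) (trans eρ (ℚP.*-identityˡ (ofℤ (+ suc J)))))))
                   (bound (ℚP.<⇒≤ 0<½ ⊠ diff (ofℤ-≤ (Z.+≤+ q))) (l₃ Y H (ofℤ (+ suc J))))))
              where
              l₃ : ∀ Y H J → ½ * (Y + J) - ½ * (Y + H) ≡ ½ * (J - H)
              l₃ = ℚring 3 (λ Y H J → con: ½ *: (Y +: J) -: con: ½ *: (Y +: H) =: con: ½ *: (J -: H))
            open Inner J J<H
            pre : ∀ n → suc J N.< n → J N.< N.pred n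
            pre (suc n) (s≤s p) = p
            row-eq : Yy ≡ ½ * (Y + 1ℚ * ofℤ (+ suc J))
            row-eq = trans (proj₂ (proj₂ (proj₂ rc))) (cong (λ r → ½ * (Y + r)) eρ)
            l₁ : ∀ x e r → r - x ≡ e + (r - (x + e))
            l₁ = ℚring 3 (λ x e r → r -: x =: e +: (r -: (x +: e)))
            l₂ : ∀ x e r → r - - x ≡ e + (r - - (x - e))
            l₂ = ℚring 3 (λ x e r → r -: -: x =: e +: (r -: -: (x -: e)))
        from : InRows (+ 1 Z.* y₀ Z.+ 1ℤ) (N.pred (height R)) loI hiI z → IsInteriorPt S (toPt z)
        from (J , J<′ , e , p , q) = interior-intro (subst (λ b → InConv S (- left , b)) (sym row-eq) left-in) (subst (λ b → InConv S (right , b)) (sym row-eq) inR) Top.inR Bot.inR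
            (sbound (sdiff (subst (_< left) (trans (K.κ-neg x) (cong -_ (ℚP.*-identityˡ X))) (proj₂ (proj₂ (fL (Z.- x))) (proj₂ (K.neg-swap x (floorAt 1 1 L xL (suc J))) p)))) (l X left))
            (subst (_< right) (ℚP.*-identityˡ X) (proj₂ (proj₂ (fR x)) q))
            (subst (½ * (Y + 0ℚ) <_) (sym row-eq) (sbound (0<½ <⊠ ρ>0) (l₂ Y (1ℚ * ofℤ (+ suc J)))))
            (subst (_< ½ * (Y + H)) (sym row-eq) (sbound (0<½ <⊠ sdiff ρ<H) (l₃ Y (1ℚ * ofℤ (+ suc J)) H)))
          where
          open Inner J (inner-bound J<′)
          row-eq : Yy ≡ ½ * (Y + 1ℚ * ofℤ (+ suc J))
          row-eq = trans (sym (ℚP.*-identityˡ Yy)) (K.lattice-row y (suc J) (trans e (ℤP.+-assoc (+ 1 Z.* y₀) 1ℤ (+ J))))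
          l : ∀ x l → x - - l ≡ l - - x
          l = ℚring 2 (λ x l′ → x -: -: l′ =: l′ -: -: x)
          l₂ : ∀ Y ρ → ½ * (Y + ρ) - ½ * (Y + 0ℚ) ≡ ½ * ρ
          l₂ = ℚring 2 (λ Y ρ → con: ½ *: (Y +: ρ) -: con: ½ *: (Y +: con: 0ℚ) =: con: ½ *: ρ)
          l₃ : ∀ Y ρ H → ½ * (Y + H) - ½ * (Y + ρ) ≡ ½ * (H - ρ)
          l₃ = ℚring 3 (λ Y ρ H → con: ½ *: (Y +: H) -: con: ½ *: (Y +: ρ) =: con: ½ *: (H -: ρ))

      interior-count : Σ ℕ λ n → HasCount (InteriorLattice S) n × + 2 Z.* + n ≡ innerSum R xR y₀ Z.+ innerSum L xL y₀
      interior-count = let (n , c , e) = count-rows (+ 1 Z.* y₀ Z.+ 1ℤ) M loI hiI (λ J p _ → inner-ok J p)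
        in n , count-cong (λ z → proj₂ (interior-rows z) , proj₁ (interior-rows z)) c , trans (cong (λ q → + 2 Z.* q) e) total
        where
        M = N.pred (height R)
        e1 : ℕ → ℤ
        e1 J = ev (+ 1 Z.* y₀ Z.+ 1ℤ Z.+ + J)
        l : ∀ e f g → e Z.* (g Z.- Z.- f Z.+ 1ℤ) Z.* + 2 ≡ e Z.* (+ 2 Z.* g Z.+ 1ℤ) Z.+ e Z.* (+ 2 Z.* f Z.+ 1ℤ)
        l = ℤring 3 (λ e f g → e :* (g :- :- f :+ # 1) :* # 2 := e :* (# 2 :* g :+ # 1) :+ e :* (# 2 :* f :+ # 1))
        total : + 2 Z.* sum M (λ J → e1 J Z.* (hiI J Z.- loI J Z.+ 1ℤ)) ≡ innerSum R xR y₀ Z.+ innerSum L xL y₀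
        total = trans (ℤP.*-comm (+ 2) (sum M (λ J → e1 J Z.* (hiI J Z.- loI J Z.+ 1ℤ)))) (trans (sym (sum-* M (+ 2) (λ J → e1 J Z.* (hiI J Z.- loI J Z.+ 1ℤ))))
          (trans (sum-cong M (λ J _ → l (e1 J) (floorAt 1 1 L xL (suc J)) (floorAt 1 1 R xR (suc J))))
          (trans (sum-+ M (λ J → e1 J Z.* (+ 2 Z.* floorAt 1 1 R xR (suc J) Z.+ 1ℤ)) (λ J → e1 J Z.* (+ 2 Z.* floorAt 1 1 L xL (suc J) Z.+ 1ℤ)))
          (cong (λ q → innerSum R xR y₀ Z.+ q) (cong (λ n → sum (N.pred n) (λ J → e1 J Z.* (+ 2 Z.* floorAt 1 1 L xL (suc J) Z.+ 1ℤ))) (sym heights))))))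

      -- The left side is twice the number of lattice points and the sum of the `innerSum`s twice
      -- that of interior points, so `β′` must be twice the number of boundary points.
      rows-one : rows 1 R xR y₀ Z.+ rows 1 L xL y₀ ≡ innerSum R xR y₀ Z.+ innerSum L xL y₀ Z.+ β′
      rows-one = trans (cong₂ Z._+_ (innerSum-rows R xR y₀ primR height>0) (innerSum-rows L xL y₀ primL (subst (0 N.<_) (sym heights) height>0)))
        (trans (l (innerSum R xR y₀) (innerSum L xL y₀) _ _) (cong (λ q → innerSum R xR y₀ Z.+ innerSum L xL y₀ Z.+ q) β′-split))
        where
        l : ∀ a b c d → a Z.+ c Z.+ (b Z.+ d) ≡ a Z.+ b Z.+ (c Z.+ d)
        l = ℤring 4 (λ a b c d → a :+ c :+ (b :+ d) := a :+ b :+ (c :+ d))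
open HullNumbers public

-- Polynomials given by coefficient lists

module Polynomials where
  open Q using (_≤_; _<_; _+_; _*_; _-_; -_)
  open ℚArith

  -- Synthetic division by `x - r`: the coefficients of the quotient are the values at `r` of the
  -- tails.
  quotient : ℚ → List ℚ → List ℚ
  quotient r [] = []
  quotient r (c ∷ []) = []
  quotient r (c ∷ cs@(_ ∷ _)) = evalPoly cs r ∷ quotient r cs

  quotient-length : ∀ r c cs → length (quotient r (c ∷ cs)) ≡ length cs
  quotient-length r c [] = refl
  quotient-length r c (d ∷ cs) = cong suc (quotient-length r d cs)

  factor : ∀ r cs x → evalPoly cs x ≡ evalPoly cs r + (x - r) * evalPoly (quotient r cs) x
  factor r [] x = l r x
    where
    l : ∀ r x → 0ℚ ≡ 0ℚ + (x - r) * 0ℚ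
    l = ℚring 2 (λ r x → con: 0ℚ =: con: 0ℚ +: (x -: r) *: con: 0ℚ)
  factor r (c ∷ []) x = l r x c
    where
    l : ∀ r x c → c + x * 0ℚ ≡ c + r * 0ℚ + (x - r) * 0ℚ
    l = ℚring 3 (λ r x c → c +: x *: con: 0ℚ =: c +: r *: con: 0ℚ +: (x -: r) *: con: 0ℚ)
  factor r (c ∷ cs@(_ ∷ _)) x = trans (cong (λ q → c + x * q) (factor r cs x)) (l r x c (evalPoly cs r) (evalPoly (quotient r cs) x))
    where
    l : ∀ r x c p q → c + x * (p + (x - r) * q) ≡ c + r * p + (x - r) * (p + x * q)
    l = ℚring 5 (λ r x c p q → c +: x *: (p +: (x -: r) *: q) =: c +: r *: p +: (x -: r) *: (p +: x *: q))

  -- A polynomial with infinitely many roots vanishes identically: divide out one root and induct on the length.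
  vanish : ∀ n cs → length cs N.≤ n → (root : ℕ → ℚ) → (∀ i j → i N.< j → root i < root j) → (∀ j → evalPoly cs (root j) ≡ 0ℚ) → ∀ x → evalPoly cs x ≡ 0ℚ
  vanish n [] _ root mono z x = refl
  vanish (suc n) (c ∷ cs) (s≤s le) root mono z x = trans (factor (root 0) (c ∷ cs) x) (trans (cong₂ (λ p q → p + (x - root 0) * q) (z 0) zero-quotient) (l x (root 0)))
    where
    l : ∀ x r → 0ℚ + (x - r) * 0ℚ ≡ 0ℚ
    l = ℚring 2 (λ x r → con: 0ℚ +: (x -: r) *: con: 0ℚ =: con: 0ℚ)
    roots : ∀ j → evalPoly (quotient (root 0) (c ∷ cs)) (root (suc j)) ≡ 0ℚ
    roots j = cancel≡ {root (suc j) - root 0} (sdiff (mono 0 (suc j) (s≤s z≤n))) (trans (l₁ (evalPoly (c ∷ cs) (root 0)) ((root (suc j) - root 0) * evalPoly (quotient (root 0) (c ∷ cs)) (root (suc j))))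
      (trans (cong₂ _-_ (trans (sym (factor (root 0) (c ∷ cs) (root (suc j)))) (z (suc j))) (z 0)) (sym (ℚP.*-zeroʳ (root (suc j) - root 0)))))
      where
      l₁ : ∀ p q → q ≡ p + q - p
      l₁ = ℚring 2 (λ p q → q =: p +: q -: p)
    zero-quotient : evalPoly (quotient (root 0) (c ∷ cs)) x ≡ 0ℚ
    zero-quotient = vanish n (quotient (root 0) (c ∷ cs)) (subst (N._≤ n) (sym (quotient-length (root 0) c cs)) le) (root ∘ suc) (λ i j p → mono (suc i) (suc j) (s≤s p)) roots x

  plus : List ℚ → List ℚ → List ℚ
  plus [] ds = ds
  plus cs@(_ ∷ _) [] = cs
  plus (c ∷ cs) (d ∷ ds) = c + d ∷ plus cs ds

  eval-plus : ∀ cs ds x → evalPoly (plus cs ds) x ≡ evalPoly cs x + evalPoly ds x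
  eval-plus [] ds x = sym (ℚP.+-identityˡ (evalPoly ds x))
  eval-plus cs@(_ ∷ _) [] x = sym (ℚP.+-identityʳ (evalPoly cs x))
  eval-plus (c ∷ cs) (d ∷ ds) x = trans (cong (λ q → c + d + x * q) (eval-plus cs ds x)) (l c d x (evalPoly cs x) (evalPoly ds x))
    where
    l : ∀ c d x p q → c + d + x * (p + q) ≡ c + x * p + (d + x * q)
    l = ℚring 5 (λ c d x p q → c +: d +: x *: (p +: q) =: c +: x *: p +: (d +: x *: q))

  ¼ ⅛ : ℚ
  ¼ = ½ * ½
  ⅛ = ½ * ½ * ½

  -- The shape of an Ehrhart polynomial: for `a₂` and `β′` the leading coefficient is the area of
  -- `P`, the middle one is half the number of its boundary points.
  quadratic : ℤ → ℤ → List ℚ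
  quadratic a b = 1ℚ ∷ ¼ * ofℤ b ∷ ⅛ * ofℤ a ∷ []

  eval-quadratic : ∀ a b n k → + 8 Z.* n ≡ a Z.* k Z.* k Z.+ + 2 Z.* b Z.* k Z.+ + 8 → ofℤ n ≡ evalPoly (quadratic a b) (ofℤ k)
  eval-quadratic a b n k e = cancel≡ {ofℤ (+ 8)} (0<ofℤsuc 7) (trans (sym (ofℤ-* (+ 8) n)) (trans (cong ofℤ e) (trans push (l (ofℤ a) (ofℤ b) (ofℤ k)))))
    where
    push : ofℤ (a Z.* k Z.* k Z.+ + 2 Z.* b Z.* k Z.+ + 8) ≡ ofℤ a * ofℤ k * ofℤ k + ofℤ (+ 2) * ofℤ b * ofℤ k + ofℤ (+ 8)
    push = trans (ofℤ-+ (a Z.* k Z.* k Z.+ + 2 Z.* b Z.* k) (+ 8)) (cong (λ q → q + ofℤ (+ 8)) (trans (ofℤ-+ (a Z.* k Z.* k) (+ 2 Z.* b Z.* k))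
      (cong₂ _+_ (trans (ofℤ-* (a Z.* k) k) (cong (λ q → q * ofℤ k) (ofℤ-* a k))) (trans (ofℤ-* (+ 2 Z.* b) k) (cong (λ q → q * ofℤ k) (ofℤ-* (+ 2) b))))))
    l : ∀ a b k → a * k * k + ofℤ (+ 2) * b * k + ofℤ (+ 8) ≡ ofℤ (+ 8) * (1ℚ + k * (½ * ½ * b + k * (½ * ½ * ½ * a + k * 0ℚ)))
    l a b k = l′ a b k
      where
      l′ : ∀ a b k → a * k * k + (1ℚ + 1ℚ) * b * k + (1ℚ + 1ℚ + 1ℚ + 1ℚ + 1ℚ + 1ℚ + 1ℚ + 1ℚ) ≡ (1ℚ + 1ℚ + 1ℚ + 1ℚ + 1ℚ + 1ℚ + 1ℚ + 1ℚ) * (1ℚ + k * (½ * ½ * b + k * (½ * ½ * ½ * a + k * 0ℚ)))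
      l′ = ℚring 3 (λ a b k → a *: k *: k +: (con: 1ℚ +: con: 1ℚ) *: b *: k +: (con: 1ℚ +: con: 1ℚ +: con: 1ℚ +: con: 1ℚ +: con: 1ℚ +: con: 1ℚ +: con: 1ℚ +: con: 1ℚ) =: (con: 1ℚ +: con: 1ℚ +: con: 1ℚ +: con: 1ℚ +: con: 1ℚ +: con: 1ℚ +: con: 1ℚ +: con: 1ℚ) *: (con: 1ℚ +: k *: (con: ½ *: con: ½ *: b +: k *: (con: ½ *: con: ½ *: con: ½ *: a +: k *: con: 0ℚ))))

  eval-quadratic⁻ : ∀ a b n k → ofℤ n ≡ evalPoly (quadratic a b) (ofℤ k) → + 8 Z.* n ≡ a Z.* k Z.* k Z.+ + 2 Z.* b Z.* k Z.+ + 8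
  eval-quadratic⁻ a b n k e = ofℤ-inj (trans (ofℤ-* (+ 8) n) (trans (cong (λ q → ofℤ (+ 8) * q) e) (trans (l (ofℤ a) (ofℤ b) (ofℤ k)) (sym push))))
    where
    push : ofℤ (a Z.* k Z.* k Z.+ + 2 Z.* b Z.* k Z.+ + 8) ≡ ofℤ a * ofℤ k * ofℤ k + ofℤ (+ 2) * ofℤ b * ofℤ k + ofℤ (+ 8)
    push = trans (ofℤ-+ (a Z.* k Z.* k Z.+ + 2 Z.* b Z.* k) (+ 8)) (cong (λ q → q + ofℤ (+ 8)) (trans (ofℤ-+ (a Z.* k Z.* k) (+ 2 Z.* b Z.* k))
      (cong₂ _+_ (trans (ofℤ-* (a Z.* k) k) (cong (λ q → q * ofℤ k) (ofℤ-* a k))) (trans (ofℤ-* (+ 2 Z.* b) k) (cong (λ q → q * ofℤ k) (ofℤ-* (+ 2) b))))))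
    l : ∀ a b k → (1ℚ + 1ℚ + 1ℚ + 1ℚ + 1ℚ + 1ℚ + 1ℚ + 1ℚ) * (1ℚ + k * (½ * ½ * b + k * (½ * ½ * ½ * a + k * 0ℚ))) ≡ a * k * k + (1ℚ + 1ℚ) * b * k + (1ℚ + 1ℚ + 1ℚ + 1ℚ + 1ℚ + 1ℚ + 1ℚ + 1ℚ)
    l = ℚring 3 (λ a b k → (con: 1ℚ +: con: 1ℚ +: con: 1ℚ +: con: 1ℚ +: con: 1ℚ +: con: 1ℚ +: con: 1ℚ +: con: 1ℚ) *: (con: 1ℚ +: k *: (con: ½ *: con: ½ *: b +: k *: (con: ½ *: con: ½ *: con: ½ *: a +: k *: con: 0ℚ))) =: a *: k *: k +: (con: 1ℚ +: con: 1ℚ) *: b *: k +: (con: 1ℚ +: con: 1ℚ +: con: 1ℚ +: con: 1ℚ +: con: 1ℚ +: con: 1ℚ +: con: 1ℚ +: con: 1ℚ))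

  agree : ∀ cs ds (root : ℕ → ℚ) → (∀ i j → i N.< j → root i < root j) → (∀ j → evalPoly cs (root j) ≡ evalPoly ds (root j)) → ∀ x → evalPoly cs x ≡ evalPoly ds x
  agree cs ds root mono e x = eqQ (trans (sym (diff-eval x)) (vanish (length (plus cs (map -_ ds))) (plus cs (map -_ ds)) ℕP.≤-refl root mono
      (λ j → trans (diff-eval (root j)) (trans (cong (λ q → q - evalPoly ds (root j)) (e j)) (ℚP.+-inverseʳ (evalPoly ds (root j))))) x))
    where
    eval-neg : ∀ ds x → evalPoly (map -_ ds) x ≡ - evalPoly ds x
    eval-neg [] x = refl
    eval-neg (d ∷ ds) x = trans (cong (λ q → - d + x * q) (eval-neg ds x)) (l d x (evalPoly ds x))
      where
      l : ∀ d x p → - d + x * - p ≡ - (d + x * p)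
      l = ℚring 3 (λ d x p → -: d +: x *: -: p =: -: (d +: x *: p))
    diff-eval : ∀ x → evalPoly (plus cs (map -_ ds)) x ≡ evalPoly cs x - evalPoly ds x
    diff-eval x = trans (eval-plus cs (map -_ ds) x) (cong (λ q → evalPoly cs x + q) (eval-neg ds x))
open Polynomials public

-- Pseudo-integrality as conditions on the two chains

module EhrhartNumbers where
  open Z using (_≤_; _<_; _+_; _*_; _-_; -_)
  open ℤArith

  -- Between the arguments 1 and 3 the quadratic of the even dilates, doubled, grows by `2a + b`,
  -- while the odd dilates grow by `2a + c`.
  alternate : ∀ n m a b c → + 8 * n ≡ a * 1ℤ * 1ℤ + + 2 * b * 1ℤ + + 8 → + 8 * m ≡ a * + 3 * + 3 + + 2 * b * + 3 + + 8 →
    + 2 * m ≡ + 2 * n + (+ 2 * a + c) → b ≡ c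
  alternate n m a b c e₁ e₂ e₃ = *-cancel 3 (trans (l n m a b c) (trans (cong₂ (λ p q → + 4 * c + (p - (a * 1ℤ * 1ℤ + + 2 * b * 1ℤ + + 8)) - (q - (a * + 3 * + 3 + + 2 * b * + 3 + + 8)) + + 4 * (+ 2 * m - (+ 2 * n + (+ 2 * a + c)))) e₁ e₂)
      (trans (cong (λ q → + 4 * c + (A - A) - (B - B) + + 4 * (q - (+ 2 * n + (+ 2 * a + c)))) e₃) (l′ (+ 4 * c) A B (+ 2 * n + (+ 2 * a + c))))))
    where
    A = a * 1ℤ * 1ℤ + + 2 * b * 1ℤ + + 8
    B = a * + 3 * + 3 + + 2 * b * + 3 + + 8
    l : ∀ n m a b c → + 4 * b ≡ + 4 * c + (+ 8 * n - (a * 1ℤ * 1ℤ + + 2 * b * 1ℤ + + 8)) - (+ 8 * m - (a * + 3 * + 3 + + 2 * b * + 3 + + 8)) + + 4 * (+ 2 * m - (+ 2 * n + (+ 2 * a + c)))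
    l = ℤring 5 (λ n m a b c → # 4 :* b := # 4 :* c :+ (# 8 :* n :- (a :* # 1 :* # 1 :+ # 2 :* b :* # 1 :+ # 8)) :- (# 8 :* m :- (a :* # 3 :* # 3 :+ # 2 :* b :* # 3 :+ # 8)) :+ # 4 :* (# 2 :* m :- (# 2 :* n :+ (# 2 :* a :+ c))))
    l′ : ∀ c A B C → c + (A - A) - (B - B) + + 4 * (C - C) ≡ c
    l′ = ℤring 4 (λ c A B C → c :+ (A :- A) :- (B :- B) :+ # 4 :* (C :- C) := c)

  interior⊂ : ∀ {S} x → IsInteriorPt S x → InConv S x
  interior⊂ {S} (a , b) (ε , _ , cs) = let (p , q , _) = interior-mids {S} {a} {b} {ε} cs in Cone-subst refl (pt≡ (l a ε) (l′ b)) (mid-conv p q)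
    where
    l : ∀ u e → ½ Q.* (u Q.+ e Q.+ (u Q.- e)) ≡ u
    l = ℚring 2 (λ u e → con: ½ *: (u +: e +: (u -: e)) =: u)
    l′ : ∀ u → ½ Q.* (u Q.+ u) ≡ u
    l′ = ℚring 1 (λ u → con: ½ *: (u +: u) =: u)

  module _ {S : List Pt} (P : Hull S) (poly : IsPolygon S) where
    open Hull P
    open Numbers P

    -- the three numerical conditions equivalent to S being pseudo-integral with i interior and 2i+7 boundary lattice points
    record Conditions (i : ℕ) : Set where
      constructor conditions
      field
        alternating : β ≡ β′
        boundary-number : β′ ≡ + 4 * + i + + 14
        area-number : a₂ ≡ + 16 * + i + + 20
        interior-number : innerSum R xR y₀ + innerSum L xL y₀ ≡ + 2 * + i

    private
      N₁ = proj₁ (ehrhart 0)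
      c₁ : HasCount (λ z → InConv S (toPt z)) N₁
      c₁ = count-cong (λ z → (λ c → subst (InConv S) (one z) (proj₁ (conv-dilate {1ℚ} {1ℚ} refl S (toPt z)) c)) ,
                             (λ c → proj₂ (conv-dilate {1ℚ} {1ℚ} refl S (toPt z)) (subst (InConv S) (sym (one z)) c))) (proj₁ (proj₂ (ehrhart 0)))
        where
        one : ∀ z → 1ℚ ⊙ toPt z ≡ toPt z
        one (x , y) = pt≡ (ℚP.*-identityˡ (ofℤ x)) (ℚP.*-identityˡ (ofℤ y))
      I = proj₁ (interior-count poly)
      cI : HasCount (InteriorLattice S) I
      cI = proj₁ (proj₂ (interior-count poly))
      minus = count-minus c₁ cI (λ z → interior⊂ (toPt z))
      B = proj₁ minus
      I+B : N₁ ≡ I N.+ B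
      I+B = proj₁ (proj₂ minus)
      cB : HasCount (BoundaryLattice S) B
      cB = proj₂ (proj₂ minus)
      2B : + 2 * + B ≡ β′
      2B = trans (l₁ (+ I) (+ B)) (trans (cong₂ _-_ (trans (cong (λ n → + 2 * + n) (sym I+B)) (trans (proj₂ (proj₂ (ehrhart 0))) (rows-one poly))) (proj₂ (proj₂ (interior-count poly)))) (l₂ (innerSum R xR y₀ + innerSum L xL y₀) β′))
        where
        l₁ : ∀ i b → + 2 * b ≡ + 2 * (i + b) - + 2 * i
        l₁ = ℤring 2 (λ i b → # 2 :* b := # 2 :* (i :+ b) :- # 2 :* i)
        l₂ : ∀ s b → s + b - s ≡ b
        l₂ = ℤring 2 (λ s b → s :+ b :- s := b)

    -- A polynomial is determined by its values at even arguments, so the Ehrhart polynomial is the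
    -- quadratic of the even dilates. Comparison with the dilates 1 and 3 gives `β ≡ β′`, and the
    -- value at 1 gives the area.
    special→conditions : ∀ {i} → Special i S → Conditions i
    special→conditions {i} sp = conditions alt 2i+7 area-eq (trans (sym (proj₂ (proj₂ (interior-count poly)))) (cong (λ n → + 2 * + n) I≡i))
      where
      open Special sp
      cs = proj₁ pseudo
      I≡i : I ≡ i
      I≡i = count-unique cI inner
      B≡ : B ≡ 2 N.* i N.+ 7
      B≡ = count-unique cB boundary
      +B : + B ≡ + 2 * + i + + 7
      +B = trans (cong +_ B≡) (cong (λ q → q + + 7) (ℤP.pos-* 2 i))
      2i+7 : β′ ≡ + 4 * + i + + 14
      2i+7 = trans (sym 2B) (trans (cong (λ q → + 2 * q) +B) (l (+ i)))
        where
        l : ∀ i → + 2 * (+ 2 * i + + 7) ≡ + 4 * i + + 14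
        l = ℤring 1 (λ i → # 2 :* (# 2 :* i :+ # 7) := # 4 :* i :+ # 14)
      value : ∀ k → ofℤ (+ proj₁ (ehrhart k)) ≡ evalPoly cs (ofℤ (+ suc k))
      value k = let (n , c , e) = proj₂ pseudo k in trans (cong (λ n → ofℤ (+ n)) (count-unique (proj₁ (proj₂ (ehrhart k))) c)) e
      even-value : ∀ m → ofℤ (+ proj₁ (ehrhart (suc (m N.* 2)))) ≡ evalPoly (quadratic a₂ β) (ofℤ (+ (suc m N.* 2)))
      even-value m = eval-quadratic a₂ β (+ proj₁ (ehrhart (suc (m N.* 2)))) (+ (suc m N.* 2))
          (trans (l₁ (+ proj₁ (ehrhart (suc (m N.* 2))))) (trans (cong (λ q → + 4 * q) (trans (proj₂ (proj₂ (ehrhart (suc (m N.* 2))))) (rows-sum-even (suc m))))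
          (trans (l₂ (+ suc m) a₂ β) (cong (λ q → a₂ * q * q + + 2 * β * q + + 8) (sym (ℤP.pos-* (suc m) 2))))))
        where
        l₁ : ∀ n → + 8 * n ≡ + 4 * (+ 2 * n)
        l₁ = ℤring 1 (λ n → # 8 :* n := # 4 :* (# 2 :* n))
        l₂ : ∀ m a b → + 4 * (m * m * a + m * b + + 2) ≡ a * (m * + 2) * (m * + 2) + + 2 * b * (m * + 2) + + 8
        l₂ = ℤring 3 (λ m a b → # 4 :* (m :* m :* a :+ m :* b :+ # 2) := a :* (m :* # 2) :* (m :* # 2) :+ # 2 :* b :* (m :* # 2) :+ # 8)
      same : ∀ x → evalPoly cs x ≡ evalPoly (quadratic a₂ β) x
      same = agree cs (quadratic a₂ β) (λ m → ofℤ (+ (suc m N.* 2))) (λ a b p → ℚArith.ofℤ-< (Z.+<+ (ℕP.*-monoˡ-< 2 (s≤s p)))) (λ m → trans (sym (value (suc (m N.* 2)))) (even-value m))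
      at : ∀ k → + 8 * + proj₁ (ehrhart k) ≡ a₂ * + suc k * + suc k + + 2 * β * + suc k + + 8
      at k = eval-quadratic⁻ a₂ β (+ proj₁ (ehrhart k)) (+ suc k) (trans (value k) (same (ofℤ (+ suc k))))
      three : + 2 * + proj₁ (ehrhart 2) ≡ + 2 * + N₁ + (+ 2 * a₂ + β′)
      three = trans (proj₂ (proj₂ (ehrhart 2))) (trans (rows-sum-odd 1) (cong₂ _+_ (sym (proj₂ (proj₂ (ehrhart 0)))) (l a₂ β′)))
        where
        l : ∀ a b → (1ℤ * 1ℤ + 1ℤ) * a + 1ℤ * b ≡ + 2 * a + b
        l = ℤring 2 (λ a b → (# 1 :* # 1 :+ # 1) :* a :+ # 1 :* b := # 2 :* a :+ b)
      alt : β ≡ β′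
      alt = alternate (+ N₁) (+ proj₁ (ehrhart 2)) a₂ β β′ (at 0) (at 2) three
      -- Pick's formula: the value at 1 is `i + (2i + 7)`, and `a₂` is eight times this value minus
      -- `2β + 8`.
      area-eq : a₂ ≡ + 16 * + i + + 20
      area-eq = trans (l₁ a₂ β) (trans (cong₂ (λ p q → p - + 2 * q - + 8) (sym (at 0)) (trans alt 2i+7)) (trans (cong (λ q → + 8 * q - + 2 * (+ 4 * + i + + 14) - + 8) N₁≡) (l₂ (+ i))))
        where
        N₁≡ : + N₁ ≡ + i + (+ 2 * + i + + 7)
        N₁≡ = trans (cong +_ I+B) (cong₂ _+_ (cong +_ I≡i) +B)
        l₁ : ∀ a b → a ≡ a * 1ℤ * 1ℤ + + 2 * b * 1ℤ + + 8 - + 2 * b - + 8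
        l₁ = ℤring 2 (λ a b → a := a :* # 1 :* # 1 :+ # 2 :* b :* # 1 :+ # 8 :- # 2 :* b :- # 8)
        l₂ : ∀ i → + 8 * (i + (+ 2 * i + + 7)) - + 2 * (+ 4 * i + + 14) - + 8 ≡ + 16 * i + + 20
        l₂ = ℤring 1 (λ i → # 8 :* (i :+ (# 2 :* i :+ # 7)) :- # 2 :* (# 4 :* i :+ # 14) :- # 8 := # 16 :* i :+ # 20)

    conditions→special : ∀ {i} → Denom2 S → Conditions i → Special i S
    conditions→special {i} den cond = special poly (quadratic a₂ β , pseudo) den (subst (HasCount (InteriorLattice S)) I≡i cI) (subst (HasCount (BoundaryLattice S)) B≡ cB)
      where
      open Conditions cond
      halve : ∀ k → Σ ℕ λ m → (k ≡ m N.* 2) ⊎ (k ≡ 1 N.+ m N.* 2)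
      halve zero = 0 , inj₁ refl
      halve (suc k) with halve k
      ... | m , inj₁ e = m , inj₂ (cong suc e)
      ... | m , inj₂ e = suc m , inj₁ (cong suc e)
      I≡i : I ≡ i
      I≡i = ℤP.+-injective (*-cancel 1 (trans (proj₂ (proj₂ (interior-count poly))) interior-number))
      B≡ : B ≡ 2 N.* i N.+ 7
      B≡ = ℤP.+-injective (trans (*-cancel 1 (trans 2B (trans boundary-number (l (+ i))))) (cong (λ q → q + + 7) (sym (ℤP.pos-* 2 i))))
        where
        l : ∀ i → + 4 * i + + 14 ≡ + 2 * (+ 2 * i + + 7)
        l = ℤring 1 (λ i → # 4 :* i :+ # 14 := # 2 :* (# 2 :* i :+ # 7))
      2N₁ : + 2 * + N₁ ≡ + 6 * + i + + 14
      2N₁ = trans (proj₂ (proj₂ (ehrhart 0))) (trans (rows-one poly) (trans (cong₂ _+_ interior-number boundary-number) (l (+ i))))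
        where
        l : ∀ i → + 2 * i + (+ 4 * i + + 14) ≡ + 6 * i + + 14
        l = ℤring 1 (λ i → # 2 :* i :+ (# 4 :* i :+ # 14) := # 6 :* i :+ # 14)
      pseudo : ∀ k → Σ ℕ λ n → Ehrhart S (suc k) n × ofℕ n ≡ evalPoly (quadratic a₂ β) (ofℕ (suc k))
      pseudo k = proj₁ (ehrhart k) , proj₁ (proj₂ (ehrhart k)) , eval-quadratic a₂ β (+ proj₁ (ehrhart k)) (+ suc k) (trans (l₁ (+ proj₁ (ehrhart k)))
          (trans (cong (λ q → + 4 * q) (proj₂ (proj₂ (ehrhart k)))) (cases (halve (suc k)))))
        where
        l₁ : ∀ n → + 8 * n ≡ + 4 * (+ 2 * n)
        l₁ = ℤring 1 (λ n → # 8 :* n := # 4 :* (# 2 :* n))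
        cases : (Σ ℕ λ m → (suc k ≡ m N.* 2) ⊎ (suc k ≡ 1 N.+ m N.* 2)) → + 4 * (rows (suc k) R xR y₀ + rows (suc k) L xL y₀) ≡ a₂ * + suc k * + suc k + + 2 * β * + suc k + + 8
        cases (m , inj₁ e) = trans (cong (λ k → + 4 * (rows k R xR y₀ + rows k L xL y₀)) e) (trans (cong (λ q → + 4 * q) (rows-sum-even m))
          (trans (l₂ (+ m) a₂ β) (cong (λ q → a₂ * q * q + + 2 * β * q + + 8) (trans (sym (ℤP.pos-* m 2)) (cong +_ (sym e))))))
          where
          l₂ : ∀ m a b → + 4 * (m * m * a + m * b + + 2) ≡ a * (m * + 2) * (m * + 2) + + 2 * b * (m * + 2) + + 8
          l₂ = ℤring 3 (λ m a b → # 4 :* (m :* m :* a :+ m :* b :+ # 2) := a :* (m :* # 2) :* (m :* # 2) :+ # 2 :* b :* (m :* # 2) :+ # 8)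
        -- `rows-sum-odd` is relative to the value at 1, which is `3i + 7` by the two counts; the
        -- area condition makes this value lie on the quadratic.
        cases (m , inj₂ e) = trans (cong (λ k → + 4 * (rows k R xR y₀ + rows k L xL y₀)) e) (trans (cong (λ q → + 4 * q) (trans (rows-sum-odd m) (cong₂ (λ p q → p + ((+ m * + m + + m) * a₂ + + m * q)) (trans (sym (proj₂ (proj₂ (ehrhart 0)))) 2N₁) (sym alternating))))
          (trans (l₃ (+ m) a₂ β (+ i) area-number (trans alternating boundary-number)) (cong (λ q → a₂ * q * q + + 2 * β * q + + 8) (trans (cong (λ q → 1ℤ + q) (sym (ℤP.pos-* m 2))) (cong +_ (sym e))))))
          where
          l₃ : ∀ m a b i → a ≡ + 16 * i + + 20 → b ≡ + 4 * i + + 14 → + 4 * (+ 6 * i + + 14 + ((m * m + m) * a + m * b)) ≡ a * (1ℤ + m * + 2) * (1ℤ + m * + 2) + + 2 * b * (1ℤ + m * + 2) + + 8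
          l₃ m _ _ i refl refl = ℤring 2 (λ m i → let a = # 16 :* i :+ # 20 ; b = # 4 :* i :+ # 14 ; k = # 1 :+ m :* # 2 in
            # 4 :* (# 6 :* i :+ # 14 :+ ((m :* m :+ m) :* a :+ m :* b)) := a :* k :* k :+ # 2 :* b :* k :+ # 8) m i
open EhrhartNumbers public

-- Existence of the chains by gift wrapping

module HullExistence where
  open Q using (_≤_; _<_; _+_; _*_; _-_; -_)
  open ℚArith
  open import Data.Unit using (tt)
  private module ZA = ℤArith

  argmax : ∀ (P : Pt → Set) → (∀ s → Dec (P s)) → (f : Pt → ℚ) → ∀ S → (Σ Pt λ s → s ∈ S × P s) →
    Σ Pt λ w → w ∈ S × P w × (∀ {s} → s ∈ S → P s → f s ≤ f w)
  argmax P P? f S (s₀ , i₀ , p₀) = let (w , i , p , h) = go S id in w , i , p , λ j → h (inj₂ j)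
    where
    go : ∀ T → (∀ {s} → s ∈ T → s ∈ S) → Σ Pt λ w → w ∈ S × P w × (∀ {s} → s ≡ s₀ ⊎ s ∈ T → P s → f s ≤ f w)
    -- The given point counts as an element of every tail, so that the recursion starts from an
    -- actual maximum.
    go [] sub = s₀ , i₀ , p₀ , λ { (inj₁ refl) _ → ℚP.≤-refl }
    go (t ∷ T) sub = add (go T (λ i → sub (there i)))
      where
      add : (Σ Pt λ w → w ∈ S × P w × (∀ {s} → s ≡ s₀ ⊎ s ∈ T → P s → f s ≤ f w)) → Σ Pt λ w → w ∈ S × P w × (∀ {s} → s ≡ s₀ ⊎ s ∈ t ∷ T → P s → f s ≤ f w)
      add (w , i , p , h) = pick (P? t) (f t Q.≤? f w)
        where
        keep : (P t → f t ≤ f w) → Σ Pt λ w → w ∈ S × P w × (∀ {s} → s ≡ s₀ ⊎ s ∈ t ∷ T → P s → f s ≤ f w)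
        keep k = w , i , p , λ { (inj₁ e) → h (inj₁ e) ; (inj₂ (here refl)) → k ; (inj₂ (there j)) → h (inj₂ j) }
        pick : Dec (P t) → Dec (f t ≤ f w) → Σ Pt λ w → w ∈ S × P w × (∀ {s} → s ≡ s₀ ⊎ s ∈ t ∷ T → P s → f s ≤ f w)
        pick (no n) _ = keep (λ q → ⊥-elim (n q))
        pick (yes _) (yes le) = keep (λ _ → le)
        pick (yes q) (no n) = t , sub (here refl) , q , λ
          { (inj₁ e) r → ℚP.≤-trans (h (inj₁ e) r) (ℚP.<⇒≤ (ℚP.≰⇒> n))
          ; (inj₂ (here refl)) _ → ℚP.≤-refl
          ; (inj₂ (there j)) r → ℚP.≤-trans (h (inj₂ j) r) (ℚP.<⇒≤ (ℚP.≰⇒> n)) }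

  lexmax : ∀ (P : Pt → Set) → (∀ s → Dec (P s)) → (f g : Pt → ℚ) → ∀ S → (Σ Pt λ s → s ∈ S × P s) →
    Σ Pt λ w → w ∈ S × P w × (∀ {s} → s ∈ S → P s → f s ≤ f w) × (∀ {s} → s ∈ S → P s → f s ≡ f w → g s ≤ g w)
  lexmax P P? f g S ne =
    let (w₁ , i₁ , p₁ , m₁) = argmax P P? f S ne
        (w , i , (p , e) , m) = argmax (λ s → P s × f s ≡ f w₁) (λ s → P? s ×-dec (f s ℚP.≟ f w₁)) g S (w₁ , i₁ , p₁ , refl)
    in w , i , p , (λ {s} j q → subst (λ z → f s ≤ z) (sym e) (m₁ j q)) , λ j q e′ → m j (q , trans e′ e)
    where open import Relation.Nullary.Decidable using (_×-dec_)

  HalfIntegral : List Pt → Set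
  HalfIntegral S = ∀ v → IsVertex S v → Σ ℤ λ x → Σ ℤ λ y → v ≡ half x y

  halfIntegral : ∀ {S} → IntegralVertices (dilate (ofℕ 2) S) → HalfIntegral S
  halfIntegral {S} h v iv = proj₁ (proj₁ found) , proj₂ (proj₁ found) , trans (sym (⊙⊙ {½} {ofℕ 2} refl v)) (cong (½ ⊙_) (sym (proj₂ found)))
    where
    found : IsIntegral (ofℕ 2 ⊙ v)
    found = h (ofℕ 2 ⊙ v) (vertex-push {F = ofℕ 2 ⊙_} {½ ⊙_} (⊙-affine ½) (⊙⊙ {½} {ofℕ 2} refl) (⊙⊙ {ofℕ 2} {½} refl)
        (λ c → conv-image {F = ofℕ 2 ⊙_} (⊙-affine (ofℕ 2)) (λ i → conv-gen (∈-map⁺ (ofℕ 2 ⊙_) i)) c) (λ {y} c → proj₁ (conv-dilate {ofℕ 2} {½} refl S y) c) iv)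

  half-mirror : ∀ x y → mirror (half x y) ≡ half (Z.- x) y
  half-mirror x y = pt≡ (trans (ℚP.neg-distribʳ-* ½ (ofℤ x)) (cong (λ q → ½ * q) (sym (ofℤ-neg x)))) refl

  halfIntegral-mirror : ∀ {S} → HalfIntegral S → HalfIntegral (map mirror S)
  halfIntegral-mirror {S} h v iv = Z.- proj₁ found , proj₁ (proj₂ found) ,
      trans (sym (mirror-mirror v)) (trans (cong mirror (proj₂ (proj₂ found))) (half-mirror (proj₁ found) (proj₁ (proj₂ found))))
    where
    found : Σ ℤ λ x → Σ ℤ λ y → mirror v ≡ half x y
    found = h (mirror v) (vertex-push {F = mirror} {mirror} mirror-affine mirror-mirror mirror-mirror conv-mirror⁻ conv-mirror⁺ iv)

  record Chain (S : List Pt) (x y yₙ : ℤ) : Set where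
    constructor chain
    field
      edges : List Edge
      prim : Primitive edges
      supports : Supports S edges x y
      vertices : Vertices S edges x y
      reaches : y Z.+ + height edges ≡ yₙ

  cons : ∀ {S x y yₙ} D h → Cop.Coprime Z.∣ D ∣ (suc h) → (∀ {s} → s ∈ S → LeftOf x y D h s) → InConv S (half x y) → Chain S (x Z.+ D) (y Z.+ + suc h) yₙ → Chain S x y yₙ
  cons {y = y} D h c sup v (chain es p s vs r) = chain ((D , h) ∷ es) (c All.∷ p) (sup , s) (v , vs) (trans (sym (ℤP.+-assoc y (+ suc h) (+ height es))) r)

  leftOf-shift : ∀ x y D h n p → LeftOf x y D h p → LeftOf (x Z.+ n Z.* D) (y Z.+ n Z.* + suc h) D h p
  leftOf-shift x y D h n (a , b) q = bound (diff q) (trans (cong₂ (λ u v → ofℤ D * (b + b - v) - ofℤ (+ suc h) * (a + a - u)) (lin x D) (lin y (+ suc h))) (l (ofℤ x) (ofℤ y) (ofℤ D) (ofℤ (+ suc h)) (ofℤ n) a b))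
    where
    lin : ∀ x D → ofℤ (x Z.+ n Z.* D) ≡ ofℤ x + ofℤ n * ofℤ D
    lin x D = trans (ofℤ-+ x (n Z.* D)) (cong (λ q → ofℤ x + q) (ofℤ-* n D))
    l : ∀ X Y d H n a b → d * (b + b - (Y + n * H)) - H * (a + a - (X + n * d)) ≡ d * (b + b - Y) - H * (a + a - X)
    l = ℚring 7 (λ X Y d H n a b → d *: (b +: b -: (Y +: n *: H)) -: H *: (a +: a -: (X +: n *: d)) =: d *: (b +: b -: Y) -: H *: (a +: a -: X))

  half-between : ∀ {S} x y D H n → InConv S (half x y) → InConv S (half (x Z.+ + suc n Z.* D) (y Z.+ + suc n Z.* H)) → InConv S (half (x Z.+ D) (y Z.+ H))
  half-between {S} x y D H n c₀ c₁ = Cone-subst refl (pt≡ (coord x D) (coord y H)) (mix2 {t = 1ℚ - r} {r} c₀ c₁ 1-r≥0 (ℚP.<⇒≤ r>0) (one r))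
    where
    N′ = ofℤ (+ suc n)
    r = proj₁ (recip N′ (0<ofℤsuc n))
    r>0 : 0ℚ < r
    r>0 = proj₁ (proj₂ (recip N′ (0<ofℤsuc n)))
    Nr : N′ * r ≡ 1ℚ
    Nr = proj₂ (proj₂ (recip N′ (0<ofℤsuc n)))
    1-r≥0 : 0ℚ ≤ 1ℚ - r
    1-r≥0 = subst (0ℚ ≤_) (trans (l N′ r) (cong (λ q → q - r) Nr)) (diff {1ℚ} {N′} (ofℤ-≤ {+ 1} {+ suc n} (Z.+≤+ (s≤s z≤n))) ⊠ ℚP.<⇒≤ r>0)
      where
      l : ∀ N r → (N - 1ℚ) * r ≡ N * r - r
      l = ℚring 2 (λ N r → (N -: con: 1ℚ) *: r =: N *: r -: r)
    one : ∀ r → 1ℚ - r + r ≡ 1ℚ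
    one = ℚring 1 (λ r → con: 1ℚ -: r +: r =: con: 1ℚ)
    coord : ∀ x D → (1ℚ - r) * (½ * ofℤ x) + r * (½ * ofℤ (x Z.+ + suc n Z.* D)) ≡ ½ * ofℤ (x Z.+ D)
    coord x D = trans (cong (λ q → (1ℚ - r) * (½ * ofℤ x) + r * (½ * q)) (trans (ofℤ-+ x (+ suc n Z.* D)) (cong (λ q → ofℤ x + q) (ofℤ-* (+ suc n) D))))
        (trans (l (ofℤ x) (ofℤ D) N′ r) (trans (cong (λ q → ½ * (ofℤ x + q * ofℤ D)) Nr) (trans (cong (λ q → ½ * (ofℤ x + q)) (ℚP.*-identityˡ (ofℤ D))) (cong (λ q → ½ * q) (sym (ofℤ-+ x D))))))
      where
      l : ∀ x D N r → (1ℚ - r) * (½ * x) + r * (½ * (x + N * D)) ≡ ½ * (x + N * r * D)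
      l = ℚring 4 (λ x D N r → (con: 1ℚ -: r) *: (con: ½ *: x) +: r *: (con: ½ *: (x +: N *: D)) =: con: ½ *: (x +: N *: r *: D))

  -- A vector that is `n` times a primitive one is cut into `n` primitive edges; the cutting points
  -- are convex combinations of its ends (`half-between`).
  repeat-edge : ∀ {S yₙ} n x y D h → Cop.Coprime Z.∣ D ∣ (suc h) → (∀ {s} → s ∈ S → LeftOf x y D h s) → InConv S (half x y) →
    InConv S (half (x Z.+ + n Z.* D) (y Z.+ + n Z.* + suc h)) → Chain S (x Z.+ + n Z.* D) (y Z.+ + n Z.* + suc h) yₙ → Chain S x y yₙ
  repeat-edge {S} {yₙ} zero x y D h c sup v w ch = subst₂ (λ x y → Chain S x y yₙ) (z x D) (z y (+ suc h)) ch
    where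
    z : ∀ x D → x Z.+ + 0 Z.* D ≡ x
    z = ℤring 2 (λ x D → x :+ # 0 :* D := x)
  repeat-edge {S} {yₙ} (suc n) x y D h c sup v w ch = cons D h c sup v
      (repeat-edge n (x Z.+ D) (y Z.+ + suc h) D h c (λ {s} i → subst₂ (λ x y → LeftOf x y D h s) (o x D) (o y (+ suc h)) (leftOf-shift x y D h 1ℤ s (sup i)))
        (half-between x y D (+ suc h) n v w) (subst₂ (λ x y → InConv S (half x y)) (e x D) (e y (+ suc h)) w) (subst₂ (λ x y → Chain S x y yₙ) (e x D) (e y (+ suc h)) ch))
    where
    o : ∀ x D → x Z.+ 1ℤ Z.* D ≡ x Z.+ D
    o = ℤring 2 (λ x D → x :+ # 1 :* D := x :+ D)
    e : ∀ x D → x Z.+ + suc n Z.* D ≡ x Z.+ D Z.+ + n Z.* D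
    e x D = l x D (+ n)
      where
      l : ∀ x D n → x Z.+ (1ℤ Z.+ n) Z.* D ≡ x Z.+ D Z.+ n Z.* D
      l = ℤring 3 (λ x D n → x :+ (# 1 :+ n) :* D := x :+ D :+ n :* D)

  PrimitivePart : ℤ → ℕ → Set
  PrimitivePart D h = Σ ℕ λ g → Σ ℤ λ D′ → Σ ℕ λ h′ → Cop.Coprime Z.∣ D′ ∣ (suc h′) × D ≡ + suc g Z.* D′ × + suc h ≡ + suc g Z.* + suc h′

  primitive-part : ∀ D h → PrimitivePart D h
  primitive-part D h = go (GCD.gcd Z.∣ D ∣ (suc h)) refl
    where
    G = GCD.gcd Z.∣ D ∣ (suc h)
    go : ∀ g → G ≡ g → PrimitivePart D h
    go zero e with GCD.gcd[m,n]≡0⇒n≡0 Z.∣ D ∣ {suc h} e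
    ... | ()
    go (suc g) e = finish (GCD.gcd[m,n]∣m Z.∣ D ∣ (suc h)) (GCD.gcd[m,n]∣n Z.∣ D ∣ (suc h))
      where
      finish : G Div.∣ Z.∣ D ∣ → G Div.∣ suc h → PrimitivePart D h
      finish (Div.divides p pe) (Div.divides zero ())
      finish (Div.divides p pe) (Div.divides (suc q) qe) = g , D′ D refl , q , cop , De D refl , trans (cong +_ qe) (trans (cong (λ n → + (suc q N.* n)) e) (trans (ℤP.pos-* (suc q) (suc g)) (ℤP.*-comm (+ suc q) (+ suc g))))
        where
        D′ : ∀ E → E ≡ D → ℤ
        D′ (+ _) _ = + p
        D′ -[1+ _ ] _ = Z.- (+ p)
        De : ∀ E (f : E ≡ D) → D ≡ + suc g Z.* D′ E f
        De (+ n) refl = trans (cong +_ (trans pe (cong (p N.*_) e))) (trans (ℤP.pos-* p (suc g)) (ℤP.*-comm (+ p) (+ suc g)))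
        De -[1+ n ] refl = trans (cong (λ m → Z.- (+ m)) (trans pe (cong (p N.*_) e))) (trans (cong Z.-_ (trans (ℤP.pos-* p (suc g)) (ℤP.*-comm (+ p) (+ suc g)))) (ℤP.neg-distribʳ-* (+ suc g) (+ p)))
        abs-D′ : ∀ E (f : E ≡ D) → Z.∣ D′ E f ∣ ≡ p
        abs-D′ (+ _) _ = refl
        abs-D′ -[1+ _ ] _ = ℤP.∣-i∣≡∣i∣ (+ p)
        cop : Cop.Coprime Z.∣ D′ D refl ∣ (suc q)
        cop {d} (u , v) = unit (GCD.gcd-greatest {Z.∣ D ∣} {suc h} {d N.* G} (subst (d N.* G Div.∣_) (sym pe) (Div.*-monoˡ-∣ G (subst (d Div.∣_) (abs-D′ D refl) u))) (subst (d N.* G Div.∣_) (sym qe) (Div.*-monoˡ-∣ G v)))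
          where
          unit : d N.* G Div.∣ G → d ≡ 1
          unit w = Div.∣1⇒≡1 (Div.*-cancelʳ-∣ (suc g) (subst₂ (λ u v → d N.* u Div.∣ v) e (trans e (sym (ℕP.*-identityˡ (suc g)))) w))

  -- The invariant of gift wrapping at the vertex `(X , Y)`: every point at or below it lies on the
  -- left of the line from it to every point above. So whichever higher point is chosen next, the
  -- lower part of the polygon stays on the correct side.
  Turn : List Pt → ℚ → ℚ → Set
  Turn S X Y = ∀ {s t} → s ∈ S → t ∈ S → proj₂ s + proj₂ s ≤ Y → Y < proj₂ t + proj₂ t →
    (proj₁ s + proj₁ s - X) * (proj₂ t + proj₂ t - Y) ≤ (proj₁ t + proj₁ t - X) * (proj₂ s + proj₂ s - Y)

  record NextVertex (S : List Pt) (X Y : ℚ) : Set where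
    constructor next
    field
      w : Pt
      w∈ : w ∈ S
      above : Y < proj₂ w + proj₂ w
      vertex : IsVertex S w
      left : ∀ {s} → s ∈ S → (proj₂ w + proj₂ w - Y) * (proj₁ s + proj₁ s - X) ≤ (proj₁ w + proj₁ w - X) * (proj₂ s + proj₂ s - Y)

  -- One step of gift wrapping: go to the highest point of largest slope.
  next-vertex : ∀ {S X Y} → Turn S X Y → (Σ Pt λ s → s ∈ S × Y < proj₂ s + proj₂ s) → NextVertex S X Y
  next-vertex {S} {X} {Y} turn ne = let (w , i , p , m , tie) = lexmax P P? slope proj₂ S ne in step w i p m tie
    where
    P : Pt → Set
    P s = Y < proj₂ s + proj₂ s
    P? : ∀ s → Dec (P s)
    P? s = Y Q.<? proj₂ s + proj₂ s
    slope′ : ∀ s → Dec (P s) → ℚ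
    slope′ s (yes p) = (proj₁ s + proj₁ s - X) * proj₁ (recip (proj₂ s + proj₂ s - Y) (sdiff p))
    -- Points not above `Y` are excluded by `P`, so this value never decides a comparison.
    slope′ s (no _) = 0ℚ
    slope : Pt → ℚ
    slope s = slope′ s (P? s)
    slope-law : ∀ s → P s → (proj₂ s + proj₂ s - Y) * slope s ≡ proj₁ s + proj₁ s - X
    slope-law s p = go (P? s)
      where
      go : ∀ d → (proj₂ s + proj₂ s - Y) * slope′ s d ≡ proj₁ s + proj₁ s - X
      go (no n) = ⊥-elim (n p)
      go (yes q) = trans (l (proj₂ s + proj₂ s - Y) (proj₁ s + proj₁ s - X) (proj₁ (recip (proj₂ s + proj₂ s - Y) (sdiff q))))
          (trans (cong (λ z → (proj₁ s + proj₁ s - X) * z) (proj₂ (proj₂ (recip (proj₂ s + proj₂ s - Y) (sdiff q))))) (ℚP.*-identityʳ (proj₁ s + proj₁ s - X)))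
        where
        l : ∀ b a r → b * (a * r) ≡ a * (b * r)
        l = ℚring 3 (λ b a r → b *: (a *: r) =: a *: (b *: r))
    step : ∀ w → w ∈ S → P w → (∀ {s} → s ∈ S → P s → slope s ≤ slope w) → (∀ {s} → s ∈ S → P s → slope s ≡ slope w → proj₂ s ≤ proj₂ w) → NextVertex S X Y
    -- The functional with coefficients `b` and `- a` is constant along the new edge and maximal on
    -- it; height breaks ties, so `w` is a vertex, and half-integrality applies to it.
    step w@(wx , wy) i p m tie = next w i p (exposed b (- a) 0ℚ 1ℚ {w} det>0 i dom tied) left
      where
      a = wx + wx - X
      b = wy + wy - Y
      b>0 : 0ℚ < b
      b>0 = sdiff p
      det>0 : 0ℚ < b * 1ℚ - - a * 0ℚ
      det>0 = subst (0ℚ <_) (l b a) b>0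
        where
        l : ∀ b a → b ≡ b * 1ℚ - - a * 0ℚ
        l = ℚring 2 (λ b a → b =: b *: con: 1ℚ -: -: a *: con: 0ℚ)
      left : ∀ {s} → s ∈ S → b * (proj₁ s + proj₁ s - X) ≤ a * (proj₂ s + proj₂ s - Y)
      left {s} j = cases (P? s)
        where
        cases : Dec (P s) → b * (proj₁ s + proj₁ s - X) ≤ a * (proj₂ s + proj₂ s - Y)
        cases (no n) = subst (_≤ a * (proj₂ s + proj₂ s - Y)) (ℚP.*-comm (proj₁ s + proj₁ s - X) b) (turn j i (ℚP.≮⇒≥ n) p)
        cases (yes q) = subst₂ (λ u v → b * u ≤ v * (proj₂ s + proj₂ s - Y)) (slope-law s q) (slope-law w p)
          (bound (ℚP.<⇒≤ b>0 ⊠ ℚP.<⇒≤ (sdiff q) ⊠ diff (m j q)) (l b (proj₂ s + proj₂ s - Y) (slope s) (slope w)))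
          where
          l : ∀ b c σ τ → b * τ * c - b * (c * σ) ≡ b * c * (τ - σ)
          l = ℚring 4 (λ b c σ τ → b *: τ *: c -: b *: (c *: σ) =: b *: c *: (τ -: σ))
      dom : ∀ {s} → s ∈ S → dot b (- a) s ≤ dot b (- a) w
      dom {s} j = cancel≤ {1ℚ + 1ℚ} (0<1 <⊹ ℚP.<⇒≤ 0<1) (bound (diff (left j)) (l X Y wx wy (proj₁ s) (proj₂ s)))
        where
        l : ∀ X Y wx wy sx sy → (1ℚ + 1ℚ) * ((wy + wy - Y) * wx + - (wx + wx - X) * wy) - (1ℚ + 1ℚ) * ((wy + wy - Y) * sx + - (wx + wx - X) * sy) ≡
          (wx + wx - X) * (sy + sy - Y) - (wy + wy - Y) * (sx + sx - X)
        l = ℚring 6 (λ X Y wx wy sx sy → (con: 1ℚ +: con: 1ℚ) *: ((wy +: wy -: Y) *: wx +: -: (wx +: wx -: X) *: wy) -: (con: 1ℚ +: con: 1ℚ) *: ((wy +: wy -: Y) *: sx +: -: (wx +: wx -: X) *: sy) =: (wx +: wx -: X) *: (sy +: sy -: Y) -: (wy +: wy -: Y) *: (sx +: sx -: X))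
      tied : ∀ {s} → s ∈ S → dot b (- a) s ≡ dot b (- a) w → dot 0ℚ 1ℚ s ≤ dot 0ℚ 1ℚ w
      tied {s} j e = subst₂ _≤_ (l₀ (proj₁ s) (proj₂ s)) (l₀ wx wy) (cases (P? s))
        where
        l₀ : ∀ x y → y ≡ 0ℚ * x + 1ℚ * y
        l₀ = ℚring 2 (λ x y → y =: con: 0ℚ *: x +: con: 1ℚ *: y)
        cases : Dec (P s) → proj₂ s ≤ wy
        cases (no n) = cancel≤ {1ℚ + 1ℚ} (0<1 <⊹ ℚP.<⇒≤ 0<1) (subst₂ _≤_ (l (proj₂ s)) (l wy) (ℚP.≤-trans (ℚP.≮⇒≥ n) (ℚP.<⇒≤ p)))
          where
          l : ∀ y → y + y ≡ (1ℚ + 1ℚ) * y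
          l = ℚring 1 (λ y → y +: y =: (con: 1ℚ +: con: 1ℚ) *: y)
        cases (yes q) = tie j q (cancel≡ {b} b>0 (cancel≡ {c} (sdiff q) (eqQ (trans (cong₂ _-_ (l₁ b c (slope s)) (l₁′ b c (slope w))) (trans (cong₂ (λ u v → b * u - c * v) (slope-law s q) (slope-law w p))
            (trans (l₂ X Y wx wy (proj₁ s) (proj₂ s)) (trans (cong (λ z → (1ℚ + 1ℚ) * (z - dot b (- a) w)) e) (l₃ (dot b (- a) w)))))))))
          where
          c = proj₂ s + proj₂ s - Y
          l₁ : ∀ b c σ → c * (b * σ) ≡ b * (c * σ)
          l₁ = ℚring 3 (λ b c σ → c *: (b *: σ) =: b *: (c *: σ))
          l₁′ : ∀ b c σ → c * (b * σ) ≡ c * (b * σ)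
          l₁′ b c σ = refl
          l₂ : ∀ X Y wx wy sx sy → (wy + wy - Y) * (sx + sx - X) - (sy + sy - Y) * (wx + wx - X) ≡
            (1ℚ + 1ℚ) * ((wy + wy - Y) * sx + - (wx + wx - X) * sy - ((wy + wy - Y) * wx + - (wx + wx - X) * wy))
          l₂ = ℚring 6 (λ X Y wx wy sx sy → (wy +: wy -: Y) *: (sx +: sx -: X) -: (sy +: sy -: Y) *: (wx +: wx -: X) =: (con: 1ℚ +: con: 1ℚ) *: ((wy +: wy -: Y) *: sx +: -: (wx +: wx -: X) *: sy -: ((wy +: wy -: Y) *: wx +: -: (wx +: wx -: X) *: wy)))
          l₃ : ∀ z → (1ℚ + 1ℚ) * (z - z) ≡ 0ℚ
          l₃ = ℚring 1 (λ z → (con: 1ℚ +: con: 1ℚ) *: (z -: z) =: con: 0ℚ)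

  -- Multiply by `b` and expand around the old vertex: the edge inequality of each of the two
  -- points, weighted by the vertical distance of the other from the new vertex, gives the new cross
  -- product.
  turn-next : ∀ {S X Y a b} → 0ℚ < b → (∀ {s} → s ∈ S → b * (proj₁ s + proj₁ s - X) ≤ a * (proj₂ s + proj₂ s - Y)) → Turn S (X + a) (Y + b)
  turn-next {S} {X} {Y} {a} {b} b>0 left {s₁ , s₂} {t₁ , t₂} i j p q = cancel≤ {b} b>0
      (bound (diff p ⊠ diff (left j) ⊹ ℚP.<⇒≤ (sdiff q) ⊠ diff (left i)) (l X Y a b s₁ s₂ t₁ t₂))
    where
    l : ∀ X Y a b s₁ s₂ t₁ t₂ → b * ((t₁ + t₁ - (X + a)) * (s₂ + s₂ - (Y + b))) - b * ((s₁ + s₁ - (X + a)) * (t₂ + t₂ - (Y + b))) ≡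
      (Y + b - (s₂ + s₂)) * (a * (t₂ + t₂ - Y) - b * (t₁ + t₁ - X)) + (t₂ + t₂ - (Y + b)) * (a * (s₂ + s₂ - Y) - b * (s₁ + s₁ - X))
    l = ℚring 8 (λ X Y a b s₁ s₂ t₁ t₂ → b *: ((t₁ +: t₁ -: (X +: a)) *: (s₂ +: s₂ -: (Y +: b))) -: b *: ((s₁ +: s₁ -: (X +: a)) *: (t₂ +: t₂ -: (Y +: b))) =: (Y +: b -: (s₂ +: s₂)) *: (a *: (t₂ +: t₂ -: Y) -: b *: (t₁ +: t₁ -: X)) +: (t₂ +: t₂ -: (Y +: b)) *: (a *: (s₂ +: s₂ -: Y) -: b *: (s₁ +: s₁ -: X)))

  double-½ : ∀ x → ½ * x + ½ * x ≡ x
  double-½ = ℚring 1 (λ x → con: ½ *: x +: con: ½ *: x =: x)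

  -- `n` bounds the remaining height `m`, which drops at every new vertex.
  build : ∀ {S yₙ} → HalfIntegral S → (Σ Pt λ s → s ∈ S × proj₂ s + proj₂ s ≡ ofℤ yₙ) → (∀ {s} → s ∈ S → proj₂ s + proj₂ s ≤ ofℤ yₙ) →
    ∀ n m x y → m N.≤ n → y Z.+ + m ≡ yₙ → InConv S (half x y) → Turn S (ofℤ x) (ofℤ y) → Chain S x y yₙ
  build hi top bd n zero x y _ e v turn = chain [] All.[] tt v e
  build {S} {yₙ} hi (s₀ , i₀ , e₀) bd (suc n) (suc m) x y (s≤s le) e v turn =
      let (x′ , y′ , ew) = hi w vertex in step x′ y′ ew
    where
    X = ofℤ x
    Y = ofℤ y
    y<yₙ : Y < ofℤ yₙ
    y<yₙ = ofℤ-< {y} {yₙ} (ZA.≤→< (ZA.bound {d = + m} (Z.+≤+ z≤n) (trans (cong (λ q → q Z.- (y Z.+ 1ℤ)) (sym e)) (l y (+ m)))))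
      where
      l : ∀ y m → y Z.+ (1ℤ Z.+ m) Z.- (y Z.+ 1ℤ) ≡ m
      l = ℤring 2 (λ y m → y :+ (# 1 :+ m) :- (y :+ # 1) := m)
    nv : NextVertex S X Y
    nv = next-vertex turn (s₀ , i₀ , subst (Y <_) (sym e₀) y<yₙ)
    open NextVertex nv
    step : ∀ x′ y′ → w ≡ half x′ y′ → Chain S x y yₙ
    -- An edge stores its height minus one; here this is `y′ - y - 1`.
    step x′ y′ ew = go (Z.∣ y′ Z.- y Z.- 1ℤ ∣) (ℤP.0≤i⇒+∣i∣≡i gap)
      where
      wye : proj₂ w + proj₂ w ≡ ofℤ y′
      wye = trans (cong (λ p → proj₂ p + proj₂ p) ew) (double-½ (ofℤ y′))
      wxe : proj₁ w + proj₁ w ≡ ofℤ x′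
      wxe = trans (cong (λ p → proj₁ p + proj₁ p) ew) (double-½ (ofℤ x′))
      y<y′ : y Z.< y′
      y<y′ = ofℤ-<⁻ {y} {y′} (subst (Y <_) wye above)
      y′≤ : y′ Z.≤ yₙ
      y′≤ = ofℤ-≤⁻ {y′} {yₙ} (subst (_≤ ofℤ yₙ) wye (bd w∈))
      gap : 0ℤ Z.≤ y′ Z.- y Z.- 1ℤ
      gap = subst (0ℤ Z.≤_) (l y y′) (ZA.diff (ZA.<→≤ y<y′))
        where
        l : ∀ y y′ → y′ Z.- (y Z.+ 1ℤ) ≡ y′ Z.- y Z.- 1ℤ
        l = ℤring 2 (λ y y′ → y′ :- (y :+ # 1) := y′ :- y :- # 1)
      go : ∀ h → + h ≡ y′ Z.- y Z.- 1ℤ → Chain S x y yₙ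
      go h he = pp (primitive-part D h)
        where
        D = x′ Z.- x
        H≡ : + suc h ≡ y′ Z.- y
        H≡ = trans (cong (λ q → 1ℤ Z.+ q) he) (l y y′)
          where
          l : ∀ y y′ → 1ℤ Z.+ (y′ Z.- y Z.- 1ℤ) ≡ y′ Z.- y
          l = ℤring 2 (λ y y′ → # 1 :+ (y′ :- y :- # 1) := y′ :- y)
        qa : proj₁ w + proj₁ w - X ≡ ofℤ D
        qa = trans (cong (λ q → q - X) wxe) (sym (ofℤ-- x′ x))
        qb : proj₂ w + proj₂ w - Y ≡ ofℤ (+ suc h)
        qb = trans (cong (λ q → q - Y) wye) (trans (sym (ofℤ-- y′ y)) (cong ofℤ (sym H≡)))
        full : ∀ {s} → s ∈ S → LeftOf x y D h s
        full {s} i = subst₂ (λ a b → b * (proj₁ s + proj₁ s - X) ≤ a * (proj₂ s + proj₂ s - Y)) qa qb (left i)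
        m′ = Z.∣ yₙ Z.- y′ ∣
        m′e : + m′ ≡ yₙ Z.- y′
        m′e = ℤP.0≤i⇒+∣i∣≡i (ZA.diff y′≤)
        m′≤n : m′ N.≤ n
        m′≤n = ℕP.≤-trans (ℤP.drop‿+≤+ (ZA.bound {+ m′} {+ m} {+ h} (Z.+≤+ z≤n) (trans (cong₂ Z._-_ (mm m e) m′e) (trans (l y y′ yₙ) (sym he))))) le
          where
          mm : ∀ m → y Z.+ + suc m ≡ yₙ → + m ≡ yₙ Z.- y Z.- 1ℤ
          mm m e = trans (k y (+ m)) (cong (λ q → q Z.- y Z.- 1ℤ) e)
            where
            k : ∀ y m → m ≡ y Z.+ (1ℤ Z.+ m) Z.- y Z.- 1ℤ
            k = ℤring 2 (λ y m → m := y :+ (# 1 :+ m) :- y :- # 1)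
          l : ∀ y y′ n → n Z.- y Z.- 1ℤ Z.- (n Z.- y′) ≡ y′ Z.- y Z.- 1ℤ
          l = ℤring 3 (λ y y′ n → n :- y :- # 1 :- (n :- y′) := y′ :- y :- # 1)
        rest : Chain S x′ y′ yₙ
        rest = build hi (s₀ , i₀ , e₀) bd n m′ x′ y′ m′≤n (trans (cong (λ q → y′ Z.+ q) m′e) (l y′ yₙ)) (subst (InConv S) ew (conv-gen w∈))
            (subst₂ (Turn S) (trans (cong (λ q → X + q) qa) (trans (cong (λ q → X + q) (ofℤ-- x′ x)) (l′ X (ofℤ x′)))) (trans (cong (λ q → Y + q) (trans qb (cong ofℤ H≡))) (trans (cong (λ q → Y + q) (ofℤ-- y′ y)) (l′ Y (ofℤ y′))))
              (turn-next {S} {X} {Y} {proj₁ w + proj₁ w - X} {proj₂ w + proj₂ w - Y} (sdiff above) left))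
          where
          l : ∀ y n → y Z.+ (n Z.- y) ≡ n
          l = ℤring 2 (λ y n → y :+ (n :- y) := n)
          l′ : ∀ a b → a + (b - a) ≡ b
          l′ = ℚring 2 (λ a b → a +: (b -: a) =: b)
        pp : PrimitivePart D h → Chain S x y yₙ
        pp (g , D′ , h′ , c , De , he′) = repeat-edge (suc g) x y D′ h′ c sup v
            (subst₂ (λ a b → InConv S (half a b)) ex ey (subst (InConv S) ew (conv-gen w∈))) (subst₂ (λ a b → Chain S a b yₙ) ex ey rest)
          where
          ex : x′ ≡ x Z.+ + suc g Z.* D′
          ex = trans (l x x′) (cong (λ q → x Z.+ q) De)
            where
            l : ∀ x x′ → x′ ≡ x Z.+ (x′ Z.- x)
            l = ℤring 2 (λ x x′ → x′ := x :+ (x′ :- x))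
          ey : y′ ≡ y Z.+ + suc g Z.* + suc h′
          ey = trans (l y y′) (trans (cong (λ q → y Z.+ q) (sym H≡)) (cong (λ q → y Z.+ q) he′))
            where
            l : ∀ x x′ → x′ ≡ x Z.+ (x′ Z.- x)
            l = ℤring 2 (λ x x′ → x′ := x :+ (x′ :- x))
          sup : ∀ {s} → s ∈ S → LeftOf x y D′ h′ s
          sup {s} i = cancel≤ {ofℤ (+ suc g)} (0<ofℤsuc g) (subst₂ _≤_ (trans (cong (λ q → q * (proj₁ s + proj₁ s - X)) (trans (cong ofℤ he′) (ofℤ-* (+ suc g) (+ suc h′)))) (ℚP.*-assoc (ofℤ (+ suc g)) (ofℤ (+ suc h′)) (proj₁ s + proj₁ s - X)))
              (trans (cong (λ q → q * (proj₂ s + proj₂ s - Y)) (trans (cong ofℤ De) (ofℤ-* (+ suc g) D′))) (ℚP.*-assoc (ofℤ (+ suc g)) (ofℤ D′) (proj₂ s + proj₂ s - Y))) (full i))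

  record Start (S : List Pt) : Set where
    constructor start
    field
      x y : ℤ
      point : half x y ∈ S
      lowest : ∀ {s} → s ∈ S → ½ * ofℤ y ≤ proj₂ s
      rightmost : ∀ {s} → s ∈ S → proj₂ s ≡ ½ * ofℤ y → proj₁ s ≤ ½ * ofℤ x

  -- The rightmost of the lowest generators is an exposed point, hence a vertex, and so
  -- half-integral.
  find-start : ∀ {S} → HalfIntegral S → (Σ Pt λ s → s ∈ S) → Start S
  find-start {S} hi (s , i) = let (w , j , _ , m , t) = lexmax (λ _ → ⊤) (λ _ → yes tt) (dot 0ℚ (- 1ℚ)) (dot 1ℚ 0ℚ) S (s , i , tt)
                                  (x , y , e) = hi w (exposed 0ℚ (- 1ℚ) 1ℚ 0ℚ {w} 0<1 j (λ k → m k tt) (λ k → t k tt))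
    in finish w j (λ k → m k tt) (λ k → t k tt) x y e
    where
    open import Data.Unit using (⊤)
    finish : ∀ w → w ∈ S → (∀ {s} → s ∈ S → dot 0ℚ (- 1ℚ) s ≤ dot 0ℚ (- 1ℚ) w) → (∀ {s} → s ∈ S → dot 0ℚ (- 1ℚ) s ≡ dot 0ℚ (- 1ℚ) w → dot 1ℚ 0ℚ s ≤ dot 1ℚ 0ℚ w) → ∀ x y → w ≡ half x y → Start S
    finish .(half x y) j m t x y refl = start x y j (λ {s} k → bound (diff (m k)) (l (½ * ofℤ x) (½ * ofℤ y) (proj₁ s) (proj₂ s)))
        λ {s} k e → bound (diff (t k (trans (l₂ (proj₁ s) (proj₂ s)) (trans (cong -_ e) (sym (l₂ (½ * ofℤ x) (½ * ofℤ y))))))) (l₃ (½ * ofℤ x) (½ * ofℤ y) (proj₁ s) (proj₂ s))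
      where
      l : ∀ x y a b → b - y ≡ 0ℚ * x + - 1ℚ * y - (0ℚ * a + - 1ℚ * b)
      l = ℚring 4 (λ x y a b → b -: y =: con: 0ℚ *: x +: -: con: 1ℚ *: y -: (con: 0ℚ *: a +: -: con: 1ℚ *: b))
      l₂ : ∀ a b → 0ℚ * a + - 1ℚ * b ≡ - b
      l₂ = ℚring 2 (λ a b → con: 0ℚ *: a +: -: con: 1ℚ *: b =: -: b)
      l₃ : ∀ x y a b → x - a ≡ 1ℚ * x + 0ℚ * y - (1ℚ * a + 0ℚ * b)
      l₃ = ℚring 4 (λ x y a b → x -: a =: con: 1ℚ *: x +: con: 0ℚ *: y -: (con: 1ℚ *: a +: con: 0ℚ *: b))

  start-cap : ∀ {S} (st : Start S) → Cap S (Start.x st) (Start.y st)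
  start-cap {S} (start x y _ low rt) (a , b) c e = subst₂ _≤_ (l a b) refl (conv-face 0ℚ (- 1ℚ) (- (½ * ofℤ y)) 1ℚ 0ℚ (½ * ofℤ x)
      (λ {s} i → subst (_≤ - (½ * ofℤ y)) (sym (l₂ (proj₁ s) (proj₂ s))) (ℚP.neg-antimono-≤ (low i)))
      (λ {s} i f → subst (_≤ ½ * ofℤ x) (sym (l (proj₁ s) (proj₂ s))) (rt i (ℚP.neg-injective (trans (sym (l₂ (proj₁ s) (proj₂ s))) f)))) c (trans (l₂ a b) (cong -_ e)))
    where
    l : ∀ a b → 1ℚ * a + 0ℚ * b ≡ a
    l = ℚring 2 (λ a b → con: 1ℚ *: a +: con: 0ℚ *: b =: a)
    l₂ : ∀ a b → 0ℚ * a + - 1ℚ * b ≡ - b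
    l₂ = ℚring 2 (λ a b → con: 0ℚ *: a +: -: con: 1ℚ *: b =: -: b)

  -- No point lies below the start, and those in its row lie to its left.
  start-turn : ∀ {S} (st : Start S) → Turn S (ofℤ (Start.x st)) (ofℤ (Start.y st))
  start-turn {S} (start x y _ low rt) {s₁ , s₂} {t₁ , t₂} i j p q = bound (ℚP.<⇒≤ (sdiff q) ⊠ (diff x≤ ⊹ diff x≤))
      (trans (cong (λ z → (t₁ + t₁ - X) * (z + z - Y) - (s₁ + s₁ - X) * (t₂ + t₂ - Y)) s₂≡) (l X Y s₁ t₁ t₂))
    where
    X = ofℤ x
    Y = ofℤ y
    s₂≡ : s₂ ≡ ½ * Y
    s₂≡ = ℚP.≤-antisym (bound (ℚP.<⇒≤ 0<½ ⊠ diff p) (k s₂ Y)) (low i)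
      where
      k : ∀ s Y → ½ * Y - s ≡ ½ * (Y - (s + s))
      k = ℚring 2 (λ s Y → con: ½ *: Y -: s =: con: ½ *: (Y -: (s +: s)))
    x≤ : s₁ ≤ ½ * X
    x≤ = rt i s₂≡
    l : ∀ X Y s₁ t₁ t₂ → (t₁ + t₁ - X) * (½ * Y + ½ * Y - Y) - (s₁ + s₁ - X) * (t₂ + t₂ - Y) ≡ (t₂ + t₂ - Y) * (½ * X - s₁ + (½ * X - s₁))
    l = ℚring 5 (λ X Y s₁ t₁ t₂ → (t₁ +: t₁ -: X) *: (con: ½ *: Y +: con: ½ *: Y -: Y) -: (s₁ +: s₁ -: X) *: (t₂ +: t₂ -: Y) =: (t₂ +: t₂ -: Y) *: (con: ½ *: X -: s₁ +: (con: ½ *: X -: s₁)))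
open HullExistence public

-- Every half-integral polygon is bounded by two chains

module Hulls where
  open Q using (_≤_; _<_; _+_; _*_; _-_; -_)
  open ℚArith
  open import Data.Unit using (⊤; tt)
  private module ZA = ℤArith

  double≤ : ∀ {a b} → a + a ≤ b → a ≤ ½ * b
  double≤ {a} {b} p = bound (ℚP.<⇒≤ 0<½ ⊠ diff p) (l a b)
    where
    l : ∀ a b → ½ * b - a ≡ ½ * (b - (a + a))
    l = ℚring 2 (λ a b → con: ½ *: b -: a =: con: ½ *: (b -: (a +: a)))

  polygon-point : ∀ {S} → IsPolygon S → Σ Pt λ s → s ∈ S
  polygon-point (_ , _ , _ , ((L , al , t , _) , _)) = let (_ , p , _ , _ , _ , i , _) = positive-weight L al (subst (0ℚ <_) (sym t) 0<1) in p , i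

  find-top : ∀ {S} → HalfIntegral S → (Σ Pt λ s → s ∈ S) → Σ ℤ λ yₙ → (Σ Pt λ s → s ∈ S × proj₂ s + proj₂ s ≡ ofℤ yₙ) × (∀ {s} → s ∈ S → proj₂ s + proj₂ s ≤ ofℤ yₙ)
  find-top {S} hi (s , i) = let (w , j , _ , m , t) = lexmax (λ _ → ⊤) (λ _ → yes tt) (dot 0ℚ 1ℚ) (dot (- 1ℚ) 0ℚ) S (s , i , tt)
                                (x , y , e) = hi w (exposed 0ℚ 1ℚ (- 1ℚ) 0ℚ {w} 0<1 j (λ k → m k tt) (λ k → t k tt))
    in y , (w , j , top w y (cong proj₂ e)) , λ {s} k → bound (diff (m k tt) ⊹ diff (m k tt)) (trans (cong (λ q → q - (proj₂ s + proj₂ s)) (sym (top w y (cong proj₂ e)))) (l (proj₁ s) (proj₂ s) (proj₁ w) (proj₂ w)))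
    where
    top : ∀ w y → proj₂ w ≡ ½ * ofℤ y → proj₂ w + proj₂ w ≡ ofℤ y
    top w y e = trans (cong (λ q → q + q) e) (double-½ (ofℤ y))
    l : ∀ a b x y → y + y - (b + b) ≡ 0ℚ * x + 1ℚ * y - (0ℚ * a + 1ℚ * b) + (0ℚ * x + 1ℚ * y - (0ℚ * a + 1ℚ * b))
    l = ℚring 4 (λ a b x y → y +: y -: (b +: b) =: con: 0ℚ *: x +: con: 1ℚ *: y -: (con: 0ℚ *: a +: con: 1ℚ *: b) +: (con: 0ℚ *: x +: con: 1ℚ *: y -: (con: 0ℚ *: a +: con: 1ℚ *: b)))

  right-chain : ∀ {S yₙ} → HalfIntegral S → (st : Start S) → (Σ Pt λ s → s ∈ S × proj₂ s + proj₂ s ≡ ofℤ yₙ) → (∀ {s} → s ∈ S → proj₂ s + proj₂ s ≤ ofℤ yₙ) →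
    Chain S (Start.x st) (Start.y st) yₙ
  right-chain {S} {yₙ} hi st top bd = build hi top bd m m x y ℕP.≤-refl (trans (cong (λ q → y Z.+ q) me) (l y yₙ)) (conv-gen point) (start-turn st)
    where
    open Start st
    y≤ : y Z.≤ yₙ
    y≤ = ofℤ-≤⁻ {y} {yₙ} (subst (_≤ ofℤ yₙ) (double-½ (ofℤ y)) (bd point))
    m = Z.∣ yₙ Z.- y ∣
    me : + m ≡ yₙ Z.- y
    me = ℤP.0≤i⇒+∣i∣≡i (ZA.diff y≤)
    l : ∀ y n → y Z.+ (n Z.- y) ≡ n
    l = ℤring 2 (λ y n → y :+ (n :- y) := n)

  ∈-mirror : ∀ {S s} → s ∈ map mirror S → mirror s ∈ S
  ∈-mirror {S} i with ∈-map⁻ mirror i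
  ... | t , j , refl = subst (_∈ S) (sym (mirror-mirror t)) j

  -- Both chains come from the same construction, applied to `S` and to its mirror image; the
  -- reflection preserves heights, so they begin and end in the same rows.
  hull : ∀ {S} → IsPolygon S → IntegralVertices (dilate (ofℕ 2) S) → Hull S
  hull {S} poly iv = record
    { R = Chain.edges cR ; L = Chain.edges cL ; xR = Start.x st ; xL = Start.x st′ ; y₀ = y
    ; primR = Chain.prim cR ; primL = Chain.prim cL ; supR = Chain.supports cR ; supL = Chain.supports cL
    ; verR = Chain.vertices cR ; verL = Chain.vertices cL ; capR = start-cap st ; capL = subst (Cap (map mirror S) (Start.x st′)) y′≡y (start-cap st′)
    ; heights = heights≡ ; low = Start.lowest st
    ; high = λ {s} i → subst (λ q → proj₂ s ≤ ½ * q) (trans (cong ofℤ (sym (Chain.reaches cR))) (ofℤ-+ y (+ height (Chain.edges cR)))) (double≤ {proj₂ s} (bd i)) }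
    where
    hi = halfIntegral iv
    hi′ = halfIntegral-mirror hi
    st = find-start hi (polygon-point poly)
    st′ = find-start hi′ (mirror (proj₁ (polygon-point poly)) , ∈-map⁺ mirror (proj₂ (polygon-point poly)))
    y = Start.y st
    tp = find-top hi (polygon-point poly)
    yₙ = proj₁ tp
    bd = proj₂ (proj₂ tp)
    y′≡y : Start.y st′ ≡ y
    y′≡y = ofℤ-inj (cancel≡ {½} 0<½ (ℚP.≤-antisym (Start.lowest st′ {mirror (half (Start.x st) y)} (∈-map⁺ mirror (Start.point st)))
                                                   (Start.lowest st (∈-mirror (Start.point st′)))))
    cR : Chain S (Start.x st) y yₙ
    cR = right-chain hi st (proj₁ (proj₂ tp)) bd
    cL : Chain (map mirror S) (Start.x st′) y yₙ
    cL = subst (λ y → Chain (map mirror S) (Start.x st′) y yₙ) y′≡y (right-chain hi′ st′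
        (let (s , i , e) = proj₁ (proj₂ tp) in mirror s , ∈-map⁺ mirror i , e) (λ i → bd (∈-mirror i)))
    heights≡ : height (Chain.edges cL) ≡ height (Chain.edges cR)
    heights≡ = ℤP.+-injective (trans (l y _) (trans (cong (λ q → q Z.- y) (trans (Chain.reaches cL) (sym (Chain.reaches cR)))) (sym (l y _))))
      where
      l : ∀ y h → h ≡ y Z.+ h Z.- y
      l = ℤring 2 (λ y h → h := y :+ h :- y)

  map-mirror² : ∀ S → map mirror (map mirror S) ≡ S
  map-mirror² [] = refl
  map-mirror² (s ∷ S) = cong₂ _∷_ (mirror-mirror s) (map-mirror² S)

  mirror-hull : ∀ {S} → Hull S → Hull (map mirror S)
  mirror-hull {S} P = record
    { R = L ; L = R ; xR = xL ; xL = xR ; y₀ = y₀ ; primR = primL ; primL = primR ; supR = supL ; verR = verL ; capR = capL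
    ; supL = subst (λ T → Supports T R xR y₀) (sym (map-mirror² S)) supR
    ; verL = subst (λ T → Vertices T R xR y₀) (sym (map-mirror² S)) verR
    ; capL = subst (λ T → Cap T xR y₀) (sym (map-mirror² S)) capR
    ; heights = sym heights ; low = λ i → low (∈-mirror i)
    ; high = λ {s} i → subst (λ n → proj₂ s ≤ ½ * (ofℤ y₀ + ofℤ (+ n))) (sym heights) (high (∈-mirror i)) }
    where open Hull P

  mirrorAU : AffUnimod
  mirrorAU = affU (Z.- (+ 1)) (+ 0) (+ 0) (+ 1) (+ 0) (+ 0) (inj₂ refl)

  mirrorAU-law : ∀ p → applyAU mirrorAU p ≡ mirror p
  mirrorAU-law (x , y) = pt≡ (l x y) (l′ x y)
    where
    l : ∀ x y → - 1ℚ * x + 0ℚ * y + 0ℚ ≡ - x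
    l = ℚring 2 (λ x y → -: con: 1ℚ *: x +: con: 0ℚ *: y +: con: 0ℚ =: -: x)
    l′ : ∀ x y → 0ℚ * x + 1ℚ * y + 0ℚ ≡ y
    l′ = ℚring 2 (λ x y → con: 0ℚ *: x +: con: 1ℚ *: y +: con: 0ℚ =: y)

  mirror-eqv : ∀ S → Eqv mirrorAU S (map mirror S)
  mirror-eqv S x = (λ c → subst (InConv (map mirror S)) (sym (mirrorAU-law x)) (conv-mirror⁺ c)) ,
    (λ c → subst (InConv S) (mirror-mirror x) (conv-mirror⁻ (subst (InConv (map mirror S)) (mirrorAU-law x) c)))

  leftOf-half : ∀ x y D h u v → LeftOf x y D h (half u v) ↔ (+ suc h Z.* (u Z.- x) Z.≤ D Z.* (v Z.- y))
  leftOf-half x y D h u v = (λ p → ofℤ-≤⁻ {+ suc h Z.* (u Z.- x)} {D Z.* (v Z.- y)} (subst₂ _≤_ (sym (e (+ suc h) u x)) (sym (e D v y)) p)) ,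
                            (λ p → subst₂ _≤_ (e (+ suc h) u x) (e D v y) (ofℤ-≤ p))
    where
    e : ∀ H u x → ofℤ (H Z.* (u Z.- x)) ≡ ofℤ H * (½ * ofℤ u + ½ * ofℤ u - ofℤ x)
    e H u x = trans (ofℤ-* H (u Z.- x)) (cong (λ q → ofℤ H * q) (trans (ofℤ-- u x) (cong (λ q → q - ofℤ x) (sym (double-½ (ofℤ u))))))

  chain-left : ∀ {S D h es x y u v} → Supports S ((D , h) ∷ es) x y → InConv S (half u v) → + suc h Z.* (u Z.- x) Z.≤ D Z.* (v Z.- y)
  chain-left {D = D} {h} {es} {x} {y} {u} {v} (sup , _) c = proj₁ (leftOf-half x y D h u v) (leftOf-conv x y D h sup (half u v) c)

  chainPts : List Edge → ℤ → ℤ → List ZPt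
  chainPts [] x y = (x , y) ∷ []
  chainPts ((D , h) ∷ es) x y = (x , y) ∷ chainPts es (x Z.+ D) (y Z.+ + suc h)

  halfPt : ZPt → Pt
  halfPt (x , y) = half x y

  vertices-pts : ∀ {T} es x y → (∀ {z} → z ∈ chainPts es x y → InConv T (halfPt z)) → Vertices T es x y
  vertices-pts [] x y h = h (here refl)
  vertices-pts ((D , k) ∷ es) x y h = h (here refl) , vertices-pts es (x Z.+ D) (y Z.+ + suc k) (λ i → h (there i))

  pts-vertices : ∀ {T} es x y → Vertices T es x y → ∀ {z} → z ∈ chainPts es x y → InConv T (halfPt z)
  pts-vertices [] x y v (here refl) = v
  pts-vertices ((D , k) ∷ es) x y (v , vs) (here refl) = v
  pts-vertices ((D , k) ∷ es) x y (v , vs) (there i) = pts-vertices es (x Z.+ D) (y Z.+ + suc k) vs i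

  start-vertex : ∀ {T} es x y → Vertices T es x y → InConv T (half x y)
  start-vertex [] x y v = v
  start-vertex (_ ∷ es) x y (v , _) = v

  end-vertex : ∀ {T} es x y → Vertices T es x y → InConv T (half (endX es x) (topY es y))
  end-vertex [] x y v = v
  end-vertex ((D , h) ∷ es) x y (_ , vs) = end-vertex es (x Z.+ D) (y Z.+ + suc h) vs

  end-cap : ∀ {S} es x y → Supports S es x y → Cap S x y → Cap S (endX es x) (topY es y)
  end-cap [] x y _ c = c
  end-cap ((D , h) ∷ es) x y (sup , sups) c = end-cap es (x Z.+ D) (y Z.+ + suc h) sups (edge-top x y D h sup)

  -- The left end of a row is a point of the row, hence not beyond its right end. For the bottom and
  -- top rows this makes the lengths of the horizontal sides nonnegative.
  cap-sum : ∀ {S x x′ y y′} → y ≡ y′ → Cap S x y → InConv (map mirror S) (half x′ y′) → 0ℤ Z.≤ x Z.+ x′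
  cap-sum {S} {x} {x′} {y} refl cap c = ofℤ-≤⁻ {0ℤ} {x Z.+ x′} (subst (0ℚ ≤_) (trans (l (ofℤ x) (ofℤ x′)) (sym (ofℤ-+ x x′)))
      (diff p ⊹ diff p))
    where
    p : - (½ * ofℤ x′) ≤ ½ * ofℤ x
    p = cap (- (½ * ofℤ x′) , ½ * ofℤ y) (conv-mirror⁻ c) refl
    l : ∀ x x′ → ½ * x - - (½ * x′) + (½ * x - - (½ * x′)) ≡ x + x′
    l = ℚring 2 (λ x x′ → con: ½ *: x -: -: (con: ½ *: x′) +: (con: ½ *: x -: -: (con: ½ *: x′)) =: x +: x′)

  module HullFacts {S : List Pt} (P : Hull S) where
    open Hull P
    open Numbers P

    Qb≥0 : 0ℤ Z.≤ Qb
    Qb≥0 = cap-sum {S} {xR} {xL} {y₀} refl capR (start-vertex L xL y₀ verL)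

    Qt≥0 : 0ℤ Z.≤ Qt
    Qt≥0 = cap-sum {S} {endX R xR} {endX L xL} (trans topR (sym topL)) (end-cap R xR y₀ supR capR) (end-vertex L xL y₀ verL)

    mirrorPt : ZPt → ZPt
    mirrorPt (x , y) = Z.- x , y

    hullPts : List ZPt
    hullPts = chainPts R xR y₀ ++ map mirrorPt (chainPts L xL y₀)

    hullPts-in : ∀ {z} → z ∈ hullPts → InConv S (halfPt z)
    hullPts-in {z} i = [ pts-vertices R xR y₀ verR , left ]′ (∈-++⁻ (chainPts R xR y₀) i)
      where
      left : z ∈ map mirrorPt (chainPts L xL y₀) → InConv S (halfPt z)
      left j with ∈-map⁻ mirrorPt j
      ... | (u , v) , k , refl = subst (InConv S) (half-mirror u v) (conv-mirror⁻ (pts-vertices L xL y₀ verL k))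

    conv-pts : ∀ {T} → (∀ {z} → z ∈ hullPts → InConv T (halfPt z)) → ∀ {p} → InConv S p → InConv T p
    conv-pts {T} h = conv-vertices P (vertices-pts R xR y₀ (λ i → h (∈-++⁺ˡ i)))
      (vertices-pts L xL y₀ (λ {z} i → subst (InConv (map mirror T)) (trans (cong mirror (sym (half-mirror (proj₁ z) (proj₂ z)))) (mirror-mirror (halfPt z)))
        (conv-mirror⁺ {p = halfPt (mirrorPt z)} (h (∈-++⁺ʳ (chainPts R xR y₀) (∈-map⁺ mirrorPt i))))))

    right-row : ∀ {T} → (∀ {z} → z ∈ chainPts R xR y₀ → InConv T (halfPt z)) → ∀ {p} → InConv S p → Σ ℚ λ a → proj₁ p ≤ a × InConv T (a , proj₂ p)
    right-row {T} h {p} c = let (ρ , ρ≥0 , ρ≤ , e) = row-conv P c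
                                r = row-end R xR y₀ supR (vertices-pts R xR y₀ h) capR ρ ρ≥0 ρ≤
      in RowEnd.a r , RowEnd.upper r p c e , subst (λ q → InConv T (RowEnd.a r , q)) (sym e) (RowEnd.inside r)

  length≤height : ∀ es → length es N.≤ height es
  length≤height [] = z≤n
  length≤height ((D , h) ∷ es) = s≤s (ℕP.≤-trans (length≤height es) (ℕP.m≤n+m (height es) h))

  -- By convexity the chain lies to the right of the chord between its ends, so its doubled area is
  -- at least that of the trapezoid of the chord. Each step of the induction cuts off the triangle
  -- at the first edge.
  chord : ∀ {S} es x y → Supports S es x y → Vertices S es x y → + height es Z.* (x Z.+ endX es x) Z.≤ area es x
  chord [] x y _ _ = ℤP.≤-reflexive refl
  chord {S} ((D , h) ∷ es) x y sup@(_ , sups) ver@(_ , vers) = ZA.bound (ZA._⊹_ (ZA.diff tri) (ZA.diff (chord es (x Z.+ D) (y Z.+ + suc h) sups vers)))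
      (l (+ suc h) (+ height es) x D (endX es (x Z.+ D)) (area es (x Z.+ D)) y)
    where
    tri : + suc h Z.* (endX es (x Z.+ D) Z.- x) Z.≤ D Z.* (y Z.+ + suc h Z.+ + height es Z.- y)
    tri = subst (λ t → + suc h Z.* (endX es (x Z.+ D) Z.- x) Z.≤ D Z.* (t Z.- y)) (topY-height es (y Z.+ + suc h))
      (chain-left {es = es} {u = endX es (x Z.+ D)} {topY es (y Z.+ + suc h)} sup (end-vertex ((D , h) ∷ es) x y ver))
    l : ∀ H r x D X A y → H Z.* (x Z.+ (x Z.+ D)) Z.+ A Z.- (H Z.+ r) Z.* (x Z.+ X) ≡ D Z.* (y Z.+ H Z.+ r Z.- y) Z.- H Z.* (X Z.- x) Z.+ (A Z.- r Z.* (x Z.+ D Z.+ X))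
    l = ℤring 7 (λ H r x D X A y → H :* (x :+ (x :+ D)) :+ A :- (H :+ r) :* (x :+ X) := D :* (y :+ H :+ r :- y) :- H :* (X :- x) :+ (A :- r :* (x :+ D :+ X)))
open Hulls public

-- Area bounds, and equality between the two boundary numbers

module Peaks where
  open Z using (_≤_; _<_; _+_; _*_; _-_; -_)
  open ℤArith

  -- The vertex at which `x + m * y`, the height after a later turn, is largest along the chain,
  -- with the area bound from the two chords that meet there.
  record Peak (m : ℤ) (S : List Pt) (es : List Edge) (x y : ℤ) : Set where
    constructor peak
    field
      u v : ℤ
      v-low : y ≤ v
      v-high : v ≤ topY es y
      inside : InConv S (half u v)
      above : ∀ {z} → z ∈ chainPts es x y → proj₁ z + m * proj₂ z ≤ u + m * v
      area-bound : (v - y) * (x + u) + (topY es y - v) * (u + endX es x) ≤ area es x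

  y≤topY : ∀ es y → y ≤ topY es y
  y≤topY es y = subst (y ≤_) (sym (topY-height es y)) (ℤP.i≤i+j y (+ height es))

  -- If the lowest vertex is the peak, the chord bound suffices; otherwise the triangle at the first
  -- edge is added to the bound for the rest of the chain.
  find-peak : ∀ {S} m es x y → Supports S es x y → Vertices S es x y → Peak m S es x y
  find-peak m [] x y _ ver = peak x y ℤP.≤-refl ℤP.≤-refl ver (λ { (here refl) → ℤP.≤-refl }) (ℤP.≤-reflexive (l x y))
    where
    l : ∀ x y → (y - y) * (x + x) + (y - y) * (x + x) ≡ 0ℤ
    l = ℤring 2 (λ x y → (y :- y) :* (x :+ x) :+ (y :- y) :* (x :+ x) := # 0)
  find-peak {S} m ((D , h) ∷ es) x y sup@(_ , sups) ver@(v₀ , vers) = choose (find-peak m es (x + D) (y + + suc h) sups vers)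
    where
    choose : Peak m S es (x + D) (y + + suc h) → Peak m S ((D , h) ∷ es) x y
    choose (peak u v lo hi ins ab ar) = pick ((x + m * y) Z.≤? (u + m * v))
      where
      pick : Dec (x + m * y ≤ u + m * v) → Peak m S ((D , h) ∷ es) x y
      pick (yes p) = peak u v (ℤP.≤-trans (ℤP.i≤i+j y (+ suc h)) lo) hi ins (λ { (here refl) → p ; (there i) → ab i })
          (bound (diff (chain-left {S} {D} {h} {es} {x} {y} {u} {v} sup ins) ⊹ diff ar) (l (+ suc h) x D y u v (topY es (y + + suc h)) (endX es (x + D)) (area es (x + D))))
        where
        l : ∀ H x D y u v t X A → H * (x + (x + D)) + A - ((v - y) * (x + u) + (t - v) * (u + X)) ≡ D * (v - y) - H * (u - x) + (A - ((v - (y + H)) * (x + D + u) + (t - v) * (u + X)))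
        l = ℤring 9 (λ H x D y u v t X A → H :* (x :+ (x :+ D)) :+ A :- ((v :- y) :* (x :+ u) :+ (t :- v) :* (u :+ X)) := D :* (v :- y) :- H :* (u :- x) :+ (A :- ((v :- (y :+ H)) :* (x :+ D :+ u) :+ (t :- v) :* (u :+ X))))
      pick (no n) = peak x y ℤP.≤-refl (y≤topY ((D , h) ∷ es) y) v₀ (λ { (here refl) → ℤP.≤-refl ; (there i) → ℤP.≤-trans (ab i) (ℤP.<⇒≤ (ℤP.≰⇒> n)) })
          (subst (_≤ area ((D , h) ∷ es) x) (trans (cong (λ t → t * (x + X)) (trans (l₁ y (+ height ((D , h) ∷ es))) (cong (λ t → t - y) (sym (topY-height ((D , h) ∷ es) y))))) (l₂ x y (topY ((D , h) ∷ es) y) X)) (chord ((D , h) ∷ es) x y sup ver))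
        where
        X = endX ((D , h) ∷ es) x
        l₁ : ∀ y h → h ≡ y + h - y
        l₁ = ℤring 2 (λ y h → h := y :+ h :- y)
        l₂ : ∀ x y t X → (t - y) * (x + X) ≡ (y - y) * (x + x) + (t - y) * (x + X)
        l₂ = ℤring 4 (λ x y t X → (t :- y) :* (x :+ X) := (y :- y) :* (x :+ x) :+ (t :- y) :* (x :+ X))

  sqℤ : ∀ z → 0ℤ ≤ z * z
  sqℤ z with ℤP.≤-total 0ℤ z
  ... | inj₁ p = p ⊠ p
  ... | inj₂ p = subst (0ℤ ≤_) (l z) (diff p ⊠ diff p)
    where
    l : ∀ z → (0ℤ - z) * (0ℤ - z) ≡ z * z
    l = ℤring 1 (λ z → (# 0 :- z) :* (# 0 :- z) := z :* z)

  -- A hexagon with horizontal sides b + b′ and t + t′, height H and φ-width U + U′, cut along its diagonals.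
  hexagon : ∀ p q p′ q′ b t b′ t′ U U′ s A → let H = p + q in 0ℤ < H → p + q ≡ p′ + q′ → 0ℤ ≤ p → 0ℤ ≤ q → 0ℤ ≤ p′ → 0ℤ ≤ q′ →
    p * (b + U) + q * (U + t) + (p′ * (b′ + U′) + q′ * (U′ + t′)) ≤ A → p + q ≤ U + U′ →
    s - H ≤ + 2 * (b + b′) → s - H ≤ + 2 * (t + t′) → s - H ≤ + 2 * (b + t′) → s - H ≤ + 2 * (t + b′) → H * (H + s) ≤ + 2 * A
  -- All is multiplied by `H`. As `p + q = p′ + q′ = H`, the product of `H` and
  -- `p b + q t + p′ b′ + q′ t′` is the combination of `b + b′`, `t + t′`, `b + t′`, `t + b′` with
  -- weights `p p′`, `q q′`, `p q′`, `q p′`. The weights add up to `H²`, and each of the four sums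
  -- is at least `(s - H) / 2`.
  hexagon p q p′ q′ b t b′ t′ U U′ s A H>0 HH p≥0 q≥0 p′≥0 q′≥0 ar W k₁ k₂ k₃ k₄ = ℤP.*-cancelˡ-≤-pos (H * (H + s)) (+ 2 * A) H ⦃ Z.positive H>0 ⦄
      (bound (2 · (<→0≤ ⊠ diff ar) ⊹ 2 · (<→0≤ ⊠ (<→0≤ ⊠ diff W)) ⊹ (p≥0 ⊠ p′≥0 ⊠ diff k₁) ⊹ (q≥0 ⊠ q′≥0 ⊠ diff k₂) ⊹ (p≥0 ⊠ q′≥0 ⊠ diff k₃) ⊹ (q≥0 ⊠ p′≥0 ⊠ diff k₄))
        (l p q p′ q′ b t b′ t′ U U′ s A HH))
    where
    H = p + q
    <→0≤ : 0ℤ ≤ H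
    <→0≤ = ℤP.<⇒≤ H>0
    l : ∀ p q p′ q′ b t b′ t′ U U′ s A → p + q ≡ p′ + q′ → (p + q) * (+ 2 * A) - (p + q) * ((p + q) * ((p + q) + s)) ≡
      + 2 * ((p + q) * (A - (p * (b + U) + q * (U + t) + (p′ * (b′ + U′) + q′ * (U′ + t′))))) + + 2 * ((p + q) * ((p + q) * (U + U′ - (p + q)))) +
      p * p′ * (+ 2 * (b + b′) - (s - (p + q))) + q * q′ * (+ 2 * (t + t′) - (s - (p + q))) + p * q′ * (+ 2 * (b + t′) - (s - (p + q))) + q * p′ * (+ 2 * (t + b′) - (s - (p + q)))
    l p q p′ q′ b t b′ t′ U U′ s A e = elim q′ (sub e)
      where
      sub : p + q ≡ p′ + q′ → q′ ≡ p + q - p′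
      sub e = trans (k p′ q′) (cong (λ r → r - p′) (sym e))
        where
        k : ∀ p q → q ≡ p + q - p
        k = ℤring 2 (λ p q → q := p :+ q :- p)
      elim : ∀ q′ → q′ ≡ p + q - p′ → (p + q) * (+ 2 * A) - (p + q) * ((p + q) * ((p + q) + s)) ≡
        + 2 * ((p + q) * (A - (p * (b + U) + q * (U + t) + (p′ * (b′ + U′) + q′ * (U′ + t′))))) + + 2 * ((p + q) * ((p + q) * (U + U′ - (p + q)))) +
        p * p′ * (+ 2 * (b + b′) - (s - (p + q))) + q * q′ * (+ 2 * (t + t′) - (s - (p + q))) + p * q′ * (+ 2 * (b + t′) - (s - (p + q))) + q * p′ * (+ 2 * (t + b′) - (s - (p + q)))
      elim _ refl = ℤring 11 (λ p q p′ b t b′ t′ U U′ s A → let q′ = p :+ q :- p′ ; H = p :+ q ; 2: = # 2 in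
        H :* (2: :* A) :- H :* (H :* (H :+ s)) := 2: :* (H :* (A :- (p :* (b :+ U) :+ q :* (U :+ t) :+ (p′ :* (b′ :+ U′) :+ q′ :* (U′ :+ t′))))) :+ 2: :* (H :* (H :* (U :+ U′ :- H))) :+
        p :* p′ :* (2: :* (b :+ b′) :- (s :- H)) :+ q :* q′ :* (2: :* (t :+ t′) :- (s :- H)) :+ p :* q′ :* (2: :* (b :+ t′) :- (s :- H)) :+ q :* p′ :* (2: :* (t :+ b′) :- (s :- H))) p q p′ b t b′ t′ U U′ s A

  sum-zero₂ : ∀ {a b} → 0ℤ ≤ a → 0ℤ ≤ b → a + b ≡ 0ℤ → a ≡ 0ℤ × b ≡ 0ℤ
  sum-zero₂ {a} {b} p q e = ℤP.≤-antisym (subst (a ≤_) e (bound q (l a b))) p , ℤP.≤-antisym (subst (b ≤_) e (bound p (l′ a b))) q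
    where
    l : ∀ a b → a + b - a ≡ b
    l = ℤring 2 (λ a b → a :+ b :- a := b)
    l′ : ∀ a b → a + b - b ≡ a
    l′ = ℤring 2 (λ a b → a :+ b :- b := a)

  record Alternating {S} (P : Hull S) : Set where
    open Hull P
    open Numbers P
    field
      altR : ηs R xR y₀ ≡ + length R
      altL : ηs L xL y₀ ≡ + length L
      bottom : Qb * ev y₀ ≡ Qb
      top : Qt * ev yₙ ≡ Qt

  -- `β - β′` is a sum of four nonnegative defects, one for each chain and each horizontal side;
  -- equality makes all of them vanish.
  alternating-facts : ∀ {S} (P : Hull S) → Numbers.β P ≡ Numbers.β′ P → Alternating P
  alternating-facts P e = record { altR = sym (eqZ (proj₁ z₁)) ; altL = sym (eqZ (proj₂ z₁)) ; bottom = sym (eqZ (proj₁ z₂)) ; top = sym (eqZ (proj₂ z₂)) }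
    where
    open Hull P
    open Numbers P
    open HullFacts P
    ev≤1 : ∀ q z → 0ℤ ≤ q → 0ℤ ≤ q - q * ev z
    ev≤1 q z p with ev-01 z
    ... | inj₁ f rewrite f | ℤP.*-zeroʳ q | ℤP.+-identityʳ q = p
    ... | inj₂ f rewrite f | ℤP.*-identityʳ q = ℤP.≤-reflexive (sym (ℤP.+-inverseʳ q))
    a≥0 = diff (ηs≤length R xR y₀ primR)
    b≥0 = diff (ηs≤length L xL y₀ primL)
    c≥0 = ev≤1 Qb y₀ Qb≥0
    d≥0 = ev≤1 Qt yₙ Qt≥0
    total : + length R - ηs R xR y₀ + (+ length L - ηs L xL y₀) + (Qb - Qb * ev y₀ + (Qt - Qt * ev yₙ)) ≡ 0ℤ
    total = trans (l (+ length R) (ηs R xR y₀) (+ length L) (ηs L xL y₀) Qb (Qb * ev y₀) Qt (Qt * ev yₙ)) (trans (cong (λ q → q - β′) e) (ℤP.+-inverseʳ β′))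
      where
      l : ∀ a a′ b b′ c c′ d d′ → a - a′ + (b - b′) + (c - c′ + (d - d′)) ≡ a + b + (c + d) - (a′ + b′ + (c′ + d′))
      l = ℤring 8 (λ a a′ b b′ c c′ d d′ → a :- a′ :+ (b :- b′) :+ (c :- c′ :+ (d :- d′)) := a :+ b :+ (c :+ d) :- (a′ :+ b′ :+ (c′ :+ d′)))
    z = sum-zero₂ (a≥0 ⊹ b≥0) (c≥0 ⊹ d≥0) total
    z₁ = sum-zero₂ a≥0 b≥0 (proj₁ z)
    z₂ = sum-zero₂ c≥0 d≥0 (proj₂ z)
open Peaks public

-- Straight sides with unit steps

module StraightSides where
  open Z using (_≤_; _<_; _+_; _*_; _-_; -_)
  open ℤArith

  -- Equality in `chord` puts all vertices on the chord, and as many edges as units of height leave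
  -- only edges of height 1; hence all edges are equal.
  straight : ∀ {S} es x y → Supports S es x y → Vertices S es x y → length es ≡ height es → area es x ≤ + height es * (x + endX es x) →
    Σ ℤ λ D → es ≡ replicate (length es) (D , 0)
  straight [] x y _ _ _ _ = 0ℤ , refl
  straight {S} ((D , h) ∷ es) x y sup@(_ , sups) ver@(_ , vers) le ar = go (flat h le) (straight es (x + D) (y + + suc h) sups vers (len h le) rest)
    where
    flat : ∀ h → suc (length es) ≡ suc h N.+ height es → h ≡ 0
    flat zero _ = refl
    flat (suc h) e = ⊥-elim (ℕP.<⇒≱ (s≤s (ℕP.≤-trans (length≤height es) (ℕP.m≤n+m (height es) h))) (ℕP.≤-reflexive (sym (ℕP.suc-injective e))))
    len : ∀ h → suc (length es) ≡ suc h N.+ height es → length es ≡ height es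
    len h e = trans (ℕP.suc-injective e) (cong (N._+ height es) (flat h e))
    tri : 0ℤ ≤ D * (+ suc h + + height es) - + suc h * (endX es (x + D) - x)
    tri = subst (λ q → 0ℤ ≤ D * q - + suc h * (endX es (x + D) - x)) (trans (cong (λ t → t - y) (topY-height es (y + + suc h))) (l y (+ suc h) (+ height es)))
        (diff (chain-left {S} {D} {h} {es} {x} {y} {endX es (x + D)} {topY es (y + + suc h)} sup (end-vertex ((D , h) ∷ es) x y ver)))
      where
      l : ∀ y H r → y + H + r - y ≡ H + r
      l = ℤring 3 (λ y H r → y :+ H :+ r :- y := H :+ r)
    rest≥ : 0ℤ ≤ area es (x + D) - + height es * (x + D + endX es (x + D))
    rest≥ = diff (chord es (x + D) (y + + suc h) sups vers)
    identity : ∀ H r x D X A → (H + r) * (x + X) - (H * (x + (x + D)) + A) ≡ - (D * (H + r) - H * (X - x)) - (A - r * (x + D + X))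
    identity = ℤring 6 (λ H r x D X A → (H :+ r) :* (x :+ X) :- (H :* (x :+ (x :+ D)) :+ A) := :- (D :* (H :+ r) :- H :* (X :- x)) :- (A :- r :* (x :+ D :+ X)))
    rest : area es (x + D) ≤ + height es * (x + D + endX es (x + D))
    rest = bound (tri ⊹ diff ar) (trans (l (area es (x + D)) (+ height es * (x + D + endX es (x + D))) T) (cong (λ q → T + q) (sym (identity (+ suc h) (+ height es) x D (endX es (x + D)) (area es (x + D))))))
      where
      T = D * (+ suc h + + height es) - + suc h * (endX es (x + D) - x)
      l : ∀ A B T → B - A ≡ T + (- T - (A - B))
      l = ℤring 3 (λ A B T → B :- A := T :+ (:- T :- (A :- B)))
    tri0 : D * (+ suc h + + height es) - + suc h * (endX es (x + D) - x) ≡ 0ℤ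
    tri0 = ℤP.≤-antisym (bound (rest≥ ⊹ diff ar) (trans (l T A′) (cong (λ q → A′ + q) (sym (identity (+ suc h) (+ height es) x D (endX es (x + D)) (area es (x + D))))))) tri
      where
      T = D * (+ suc h + + height es) - + suc h * (endX es (x + D) - x)
      A′ = area es (x + D) - + height es * (x + D + endX es (x + D))
      l : ∀ T A → 0ℤ - T ≡ A + (- T - A)
      l = ℤring 2 (λ T A → # 0 :- T := A :+ (:- T :- A))
    endX-replicate : ∀ n D x → endX (replicate n (D , 0)) x ≡ x + + n * D
    endX-replicate zero D x = l x D
      where
      l : ∀ x D → x ≡ x + 0ℤ * D
      l = ℤring 2 (λ x D → x := x :+ # 0 :* D)
    endX-replicate (suc n) D x = trans (endX-replicate n D (x + D)) (l x D (+ n))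
      where
      l : ∀ x D n → x + D + n * D ≡ x + (1ℤ + n) * D
      l = ℤring 3 (λ x D n → x :+ D :+ n :* D := x :+ (# 1 :+ n) :* D)
    go : h ≡ 0 → (Σ ℤ λ D′ → es ≡ replicate (length es) (D′ , 0)) → Σ ℤ λ D″ → (D , h) ∷ es ≡ replicate (suc (length es)) (D″ , 0)
    go refl (D′ , e) = D , cong₂ _∷_ refl (finish (length es) refl e)
      where
      finish : ∀ n → length es ≡ n → es ≡ replicate n (D′ , 0) → es ≡ replicate n (D , 0)
      finish zero _ e = e
      finish (suc n) ln e = trans e (cong (λ d → replicate (suc n) (d , 0)) (sym (*-cancel n (eqZ (trans (l D (+ suc n) D′ x) (trans (cong₂ (λ r X → D * (1ℤ + r) - 1ℤ * (X - x)) (cong +_ (trans (sym ln) (len 0 le))) (trans (sym (endX-replicate (suc n) D′ (x + D))) (cong (λ es → endX es (x + D)) (sym e)))) tri0)))))) 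
        where
        l : ∀ D n D′ x → n * D - n * D′ ≡ D * (1ℤ + n) - 1ℤ * (x + D + n * D′ - x)
        l = ℤring 4 (λ D n D′ x → n :* D :- n :* D′ := D :* (# 1 :+ n) :- # 1 :* (x :+ D :+ n :* D′ :- x))

  half-even : ∀ x y → ev x ≡ 1ℤ → ev y ≡ 1ℤ → IsIntegral (half x y)
  half-even x y p q = let (a , e) = ev≡1 x p ; (b , f) = ev≡1 y q in (a , b) , pt≡ (h x a e) (h y b f)
    where
    h : ∀ x a → x ≡ a + a → ofℤ a ≡ ½ Q.* ofℤ x
    h x a e = sym (trans (cong (λ q → ½ Q.* ofℤ q) e) (trans (cong (λ q → ½ Q.* q) (ℚArith.ofℤ-+ a a)) (l (ofℤ a))))
      where
      l : ∀ a → ½ Q.* (a Q.+ a) ≡ a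
      l = ℚring 1 (λ a → con: ½ *: (a +: a) =: a)

  -- On a straight side with unit steps every odd point is the midpoint of its neighbours, hence not a vertex.
  side-integral : ∀ {S} k D x y → Vertices S (replicate (k N.* 2) (D , 0)) x y → ev x ≡ 1ℤ → ev y ≡ 1ℤ →
    ∀ {z} → z ∈ chainPts (replicate (k N.* 2) (D , 0)) x y → IsVertex S (halfPt z) → IsIntegral (halfPt z)
  side-integral zero D x y _ ex ey (here refl) _ = half-even x y ex ey
  side-integral (suc k) D x y _ ex ey (here refl) _ = half-even x y ex ey
  side-integral {S} (suc k) D x y (v₀ , _ , vs) ex ey (there (here refl)) (_ , ext) = ⊥-elim (absurd 1 (eqdiff same) (l y))
    where
    mid-half : ∀ x D → ½ Q.* ofℤ (x + D) ≡ ½ Q.* (½ Q.* ofℤ x Q.+ ½ Q.* ofℤ (x + D + D))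
    mid-half x D = trans (cong (λ q → ½ Q.* q) (ℚArith.ofℤ-+ x D)) (trans (m (ofℤ x) (ofℤ D)) (cong (λ q → ½ Q.* (½ Q.* ofℤ x Q.+ ½ Q.* q)) (sym (trans (ℚArith.ofℤ-+ (x + D) D) (cong (λ q → q Q.+ ofℤ D) (ℚArith.ofℤ-+ x D))))))
      where
      m : ∀ x D → ½ Q.* (x Q.+ D) ≡ ½ Q.* (½ Q.* x Q.+ ½ Q.* (x Q.+ D Q.+ D))
      m = ℚring 2 (λ x D → con: ½ *: (x +: D) =: con: ½ *: (con: ½ *: x +: con: ½ *: (x +: D +: D)))
    same : y + 1ℤ + 1ℤ ≡ y
    same = sym (ofℤ-inj (ℚArith.cancel≡ {½} ℚArith.0<½ (cong proj₂ (ext (half x y) (half (x + D + D) (y + 1ℤ + 1ℤ)) v₀ (start-vertex (replicate (k N.* 2) (D , 0)) (x + D + D) (y + 1ℤ + 1ℤ) vs) (pt≡ (mid-half x D) (mid-half y 1ℤ))))))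
      where open ℚArith using (ofℤ-inj)
    l : ∀ y → y - (y + 1ℤ + 1ℤ) ≡ -[1+ 1 ]
    l = ℤring 1 (λ y → y :- (y :+ # 1 :+ # 1) := con -[1+ 1 ])
  side-integral {S} (suc k) D x y (_ , _ , vs) ex ey (there (there i)) = side-integral k D (x + D + D) (y + 1ℤ + 1ℤ) vs
      (trans (cong ev (ℤP.+-assoc x D D)) (trans (ev-shift x D) ex)) (trans (cong ev (ℤP.+-assoc y 1ℤ 1ℤ)) (trans (ev-shift y 1ℤ) ey)) i
open StraightSides public

-- Scott's argument: reduction to height 3

module Descent where
  open Z using (_≤_; _<_; _+_; _*_; _-_; -_)
  open ℤArith

  -- The map `f` in doubled coordinates: the linear part is the same, the translation is doubled.
  act : AffUnimod → ZPt → ZPt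
  act f (u , v) = a11 * u + a12 * v + (c1 + c1) , a21 * u + a22 * v + (c2 + c2)
    where open AffUnimod f

  applyAU-half : ∀ f z → applyAU f (halfPt z) ≡ halfPt (act f z)
  applyAU-half f (u , v) = pt≡ (h a11 a12 c1) (h a21 a22 c2)
    where
    open AffUnimod f
    l : ∀ a b c u v → a Q.* (½ Q.* u) Q.+ b Q.* (½ Q.* v) Q.+ c ≡ ½ Q.* (a Q.* u Q.+ b Q.* v Q.+ (c Q.+ c))
    l = ℚring 5 (λ a b c u v → a *: (con: ½ *: u) +: b *: (con: ½ *: v) +: c =: con: ½ *: (a *: u +: b *: v +: (c +: c)))
    h : ∀ a b c → ofℤ a Q.* (½ Q.* ofℤ u) Q.+ ofℤ b Q.* (½ Q.* ofℤ v) Q.+ ofℤ c ≡ ½ Q.* ofℤ (a * u + b * v + (c + c))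
    h a b c = trans (l (ofℤ a) (ofℤ b) (ofℤ c) (ofℤ u) (ofℤ v)) (cong (λ q → ½ Q.* q) (sym (trans (ofℤ-lin+ a u b v (c + c)) (cong (λ q → ofℤ a Q.* ofℤ u Q.+ ofℤ b Q.* ofℤ v Q.+ q) (ℚArith.ofℤ-+ c c)))))

  half-≤ : ∀ {a b} → ½ Q.* ofℤ a Q.≤ ½ Q.* ofℤ b → a ≤ b
  half-≤ {a} {b} p = ℚArith.ofℤ-≤⁻ {a} {b} (ℚArith.cancel≤ {½} ℚArith.0<½ p)

  module _ {S : List Pt} (P : Hull S) where
    open Hull P
    open Numbers P
    open HullFacts P

    y-range : ∀ u v → InConv S (half u v) → y₀ ≤ v × v ≤ yₙ
    y-range u v c = let (ρ , p , q , e) = row-conv P c in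
        half-≤ {y₀} {v} (subst (½ Q.* ofℤ y₀ Q.≤_) (sym e) (ℚArith.bound (ℚP.<⇒≤ ℚArith.0<½ ℚArith.⊠ p) (l₁ (ofℤ y₀) ρ))) ,
        half-≤ {v} {yₙ} (subst₂ Q._≤_ (sym e) (cong (λ q → ½ Q.* q) (sym (ℚArith.ofℤ-+ y₀ (+ height R)))) (ℚArith.bound (ℚP.<⇒≤ ℚArith.0<½ ℚArith.⊠ ℚArith.diff q) (l₂ (ofℤ y₀) ρ (ofℤ (+ height R)))))
      where
      l₁ : ∀ y ρ → ½ Q.* (y Q.+ ρ) Q.- ½ Q.* y ≡ ½ Q.* ρ
      l₁ = ℚring 2 (λ y ρ → con: ½ *: (y +: ρ) -: con: ½ *: y =: con: ½ *: ρ)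
      l₂ : ∀ y ρ h → ½ Q.* (y Q.+ h) Q.- ½ Q.* (y Q.+ ρ) ≡ ½ Q.* (h Q.- ρ)
      l₂ = ℚring 3 (λ y ρ h → con: ½ *: (y +: h) -: con: ½ *: (y +: ρ) =: con: ½ *: (h -: ρ))

    top-vertex : InConv S (half (endX R xR) yₙ)
    top-vertex = subst (λ y → InConv S (half (endX R xR) y)) topR (end-vertex R xR y₀ verR)

    -- The coefficient of `u` is positive, so in each row the functional is largest at the right
    -- end, which is a combination of vertices of the right chain.
    φ-bound : ∀ m {U} → (∀ {z} → z ∈ chainPts R xR y₀ → proj₁ z + m * proj₂ z ≤ U) → ∀ u v → InConv S (half u v) → u + m * v ≤ U
    φ-bound m {U} h u v c = ℚArith.ofℤ-≤⁻ {u + m * v} {U} (subst (Q._≤ ofℤ U) (sym (lin u v)) (ℚArith.cancel≤ {½} ℚArith.0<½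
        (ℚArith.bound (ℚArith.diff (proj₁ (proj₂ rr)) ℚArith.⊹ ℚArith.diff (conv-bound 1ℚ (ofℤ m) (½ Q.* ofℤ U) gen (proj₂ (proj₂ rr)))) (l (ofℤ u) (ofℤ m) (ofℤ v) (ofℤ U) (proj₁ rr)))))
      where
      rr = right-row {map halfPt (chainPts R xR y₀)} (λ i → conv-gen (∈-map⁺ halfPt i)) c
      lin : ∀ u v → ofℤ (u + m * v) ≡ ofℤ u Q.+ ofℤ m Q.* ofℤ v
      lin u v = trans (ℚArith.ofℤ-+ u (m * v)) (cong (λ q → ofℤ u Q.+ q) (ℚArith.ofℤ-* m v))
      gen : ∀ {s} → s ∈ map halfPt (chainPts R xR y₀) → dot 1ℚ (ofℤ m) s Q.≤ ½ Q.* ofℤ U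
      gen i with ∈-map⁻ halfPt i
      ... | (a , b) , j , refl = subst (Q._≤ ½ Q.* ofℤ U) (trans (cong (λ q → ½ Q.* q) (lin a b)) (l′ (ofℤ a) (ofℤ m) (ofℤ b)))
            (ℚArith.bound (ℚP.<⇒≤ ℚArith.0<½ ℚArith.⊠ ℚArith.diff (ℚArith.ofℤ-≤ (h j))) (l″ (ofℤ U) (ofℤ (a + m * b))))
        where
        l′ : ∀ a m b → ½ Q.* (a Q.+ m Q.* b) ≡ 1ℚ Q.* (½ Q.* a) Q.+ m Q.* (½ Q.* b)
        l′ = ℚring 3 (λ a m b → con: ½ *: (a +: m *: b) =: con: 1ℚ *: (con: ½ *: a) +: m *: (con: ½ *: b))
        l″ : ∀ U p → ½ Q.* U Q.- ½ Q.* p ≡ ½ Q.* (U Q.- p)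
        l″ = ℚring 2 (λ U p → con: ½ *: U -: con: ½ *: p =: con: ½ *: (U -: p))
      l : ∀ u m v U a → ½ Q.* U Q.- ½ Q.* (u Q.+ m Q.* v) ≡ a Q.- ½ Q.* u Q.+ (½ Q.* U Q.- (1ℚ Q.* a Q.+ m Q.* (½ Q.* v)))
      l = ℚring 5 (λ u m v U a → con: ½ *: U -: con: ½ *: (u +: m *: v) =: a -: con: ½ *: u +: (con: ½ *: U -: (con: 1ℚ *: a +: m *: (con: ½ *: v))))

    vertex-pt : ∀ {v} → IsVertex S v → Σ ZPt λ z → z ∈ hullPts × v ≡ halfPt z
    vertex-pt {v} (c , ext) = ∈-map⁻ halfPt (vertex∈ {map halfPt hullPts} {v} (to c , λ x y p q → ext x y (from p) (from q)))
      where
      to : ∀ {p} → InConv S p → InConv (map halfPt hullPts) p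
      to = conv-pts (λ i → conv-gen (∈-map⁺ halfPt i))
      from : ∀ {p} → InConv (map halfPt hullPts) p → InConv S p
      from = conv-sub back
        where
        back : ∀ {s} → s ∈ map halfPt hullPts → InConv S s
        back i with ∈-map⁻ halfPt i
        ... | z , j , refl = hullPts-in j

    -- Every edge rises by at least 1, so a chain has at most as many edges as units of height.
    length-bound : β ≤ + 2 * + height R + (Qb + Qt)
    length-bound = ℤP.+-monoˡ-≤ (Qb + Qt) (subst (+ length R + + length L ≤_) (l (+ height R)) (ℤP.+-mono-≤ (Z.+≤+ (length≤height R)) (Z.+≤+ (subst (length L N.≤_) heights (length≤height L)))))
      where
      l : ∀ h → h + h ≡ + 2 * h
      l = ℤring 1 (λ h → h :+ h := # 2 :* h)

    chords : + height R * (Qb + Qt) ≤ a₂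
    chords = subst (_≤ a₂) (trans (cong (λ n → + height R * (xR + endX R xR) + + n * (xL + endX L xL)) heights) (l (+ height R) xR xL (endX R xR) (endX L xL)))
        (ℤP.+-mono-≤ (chord R xR y₀ supR verR) (chord L xL y₀ supL verL))
      where
      l : ∀ h x x′ X X′ → h * (x + X) + h * (x′ + X′) ≡ h * (x + x′ + (X + X′))
      l = ℤring 5 (λ h x x′ X X′ → h :* (x :+ X) :+ h :* (x′ :+ X′) := h :* (x :+ x′ :+ (X :+ X′)))

  -- `a = 4b - 36` removes `i`; with `H = 4 + k` the bounds `H * s ≤ a` and `b ≤ 2H + s` give
  -- `k * s ≤ 8k - 4`.
  basic-bound : ∀ k s a b i → (+ 4 + k) * s ≤ a → a ≡ + 16 * i + + 20 → b ≡ + 4 * i + + 14 → b ≤ + 2 * (+ 4 + k) + s → k * (s - + 8) ≤ - (+ 4)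
  basic-bound k s _ _ i p refl refl q = bound (diff p ⊹ 4 · diff q) (l k s i)
    where
    l : ∀ k s i → - (+ 4) - k * (s - + 8) ≡ + 16 * i + + 20 - (+ 4 + k) * s + + 4 * (+ 2 * (+ 4 + k) + s - (+ 4 * i + + 14))
    l = ℤring 3 (λ k s i → :- (# 4) :- k :* (s :- # 8) := # 16 :* i :+ # 20 :- (# 4 :+ k) :* s :+ # 4 :* (# 2 :* (# 4 :+ k) :+ s :- (# 4 :* i :+ # 14)))

  -- `s ≥ 5 + k` would give `k² - 3k + 4 ≤ 0`, a quadratic without real roots; the square of
  -- `2k - 3` certifies this.
  sides-short : ∀ k s → 0ℤ ≤ k → k * (s - + 8) ≤ - (+ 4) → s ≤ + 4 + k
  sides-short k s k≥0 p with s Z.≤? (+ 4 + k)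
  ... | yes q = q
  ... | no q = ⊥-elim (absurd 6 (4 · diff p ⊹ 4 · (k≥0 ⊠ diff (<→≤ (ℤP.≰⇒> q))) ⊹ sqℤ (+ 2 * k - + 3)) (l k s))
    where
    l : ∀ k s → + 4 * (- (+ 4) - k * (s - + 8)) + + 4 * (k * (s - (+ 4 + k + 1ℤ))) + (+ 2 * k - + 3) * (+ 2 * k - + 3) ≡ -[1+ 6 ]
    l = ℤring 2 (λ k s → # 4 :* (:- (# 4) :- k :* (s :- # 8)) :+ # 4 :* (k :* (s :- (# 4 :+ k :+ # 1))) :+ (# 2 :* k :- # 3) :* (# 2 :* k :- # 3) := con -[1+ 6 ])

  -- With `H = 4 + k` the bound for wide polygons reads `H² - 16H + 72 ≤ (8 - H) * s`. It fails for
  -- `H ≥ 8`; for `H = 5` and `H = 7` it contradicts the bound on `s` from `basic-bound`, which by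
  -- itself excludes `H = 4`; for `H = 6` the two leave only `s = 6`.
  wide-bound : ∀ k s a b i → 0ℤ ≤ s → + k * (s - + 8) ≤ - (+ 4) → (+ 4 + + k) * (+ 4 + + k + s) ≤ + 2 * a → a ≡ + 16 * i + + 20 → b ≡ + 4 * i + + 14 →
    b ≤ + 2 * (+ 4 + + k) + s → k ≡ 2 × s ≡ + 6
  wide-bound k s _ _ i s≥0 p q refl refl r = go k p quad
    where
    quad : (+ 4 + + k) * (+ 4 + + k + s) ≤ + 16 * (+ 4 + + k) + + 8 * s - + 72
    quad = bound (diff q ⊹ 8 · diff r) (l (+ k) s i)
      where
      l : ∀ k s i → + 16 * (+ 4 + k) + + 8 * s - + 72 - (+ 4 + k) * (+ 4 + k + s) ≡ + 2 * (+ 16 * i + + 20) - (+ 4 + k) * (+ 4 + k + s) + + 8 * (+ 2 * (+ 4 + k) + s - (+ 4 * i + + 14))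
      l = ℤring 3 (λ k s i → # 16 :* (# 4 :+ k) :+ # 8 :* s :- # 72 :- (# 4 :+ k) :* (# 4 :+ k :+ s) := # 2 :* (# 16 :* i :+ # 20) :- (# 4 :+ k) :* (# 4 :+ k :+ s) :+ # 8 :* (# 2 :* (# 4 :+ k) :+ s :- (# 4 :* i :+ # 14)))
    go : ∀ k → + k * (s - + 8) ≤ - (+ 4) → (+ 4 + + k) * (+ 4 + + k + s) ≤ + 16 * (+ 4 + + k) + + 8 * s - + 72 → k ≡ 2 × s ≡ + 6
    go 0 p q = ⊥-elim (absurd 3 (diff p) refl)
    go 1 p q = ⊥-elim (absurd 4 (3 · diff p ⊹ diff q) (l s))
      where
      l : ∀ s → + 3 * (- (+ 4) - + 1 * (s - + 8)) + (+ 16 * + 5 + + 8 * s - + 72 - + 5 * (+ 5 + s)) ≡ -[1+ 4 ]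
      l = ℤring 1 (λ s → # 3 :* (:- (# 4) :- # 1 :* (s :- # 8)) :+ (# 16 :* # 5 :+ # 8 :* s :- # 72 :- # 5 :* (# 5 :+ s)) := con -[1+ 4 ])
    go 2 p q = refl , ℤP.≤-antisym (ℤP.*-cancelˡ-≤-pos s (+ 6) (+ 2) (bound (diff p) (l₁ s))) (ℤP.*-cancelˡ-≤-pos (+ 6) s (+ 2) (bound (diff q) (l₂ s)))
      where
      l₁ : ∀ s → + 2 * + 6 - + 2 * s ≡ - (+ 4) - + 2 * (s - + 8)
      l₁ = ℤring 1 (λ s → # 2 :* # 6 :- # 2 :* s := :- (# 4) :- # 2 :* (s :- # 8))
      l₂ : ∀ s → + 2 * s - + 2 * + 6 ≡ + 16 * + 6 + + 8 * s - + 72 - + 6 * (+ 6 + s)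
      l₂ = ℤring 1 (λ s → # 2 :* s :- # 2 :* # 6 := # 16 :* # 6 :+ # 8 :* s :- # 72 :- # 6 :* (# 6 :+ s))
    go 3 p q = ⊥-elim (absurd 6 (diff p ⊹ 3 · diff q) (l s))
      where
      l : ∀ s → - (+ 4) - + 3 * (s - + 8) + + 3 * (+ 16 * + 7 + + 8 * s - + 72 - + 7 * (+ 7 + s)) ≡ -[1+ 6 ]
      l = ℤring 1 (λ s → :- (# 4) :- # 3 :* (s :- # 8) :+ # 3 :* (# 16 :* # 7 :+ # 8 :* s :- # 72 :- # 7 :* (# 7 :+ s)) := con -[1+ 6 ])
    go (suc (suc (suc (suc j)))) _ q = ⊥-elim (absurd 7 (diff q ⊹ sqℤ (+ j) ⊹ j · s≥0) (l (+ j) s))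
      where
      l : ∀ j s → + 16 * (+ 4 + (+ 4 + j)) + + 8 * s - + 72 - (+ 4 + (+ 4 + j)) * (+ 4 + (+ 4 + j) + s) + j * j + j * s ≡ -[1+ 7 ]
      l = ℤring 2 (λ j s → # 16 :* (# 4 :+ (# 4 :+ j)) :+ # 8 :* s :- # 72 :- (# 4 :+ (# 4 :+ j)) :* (# 4 :+ (# 4 :+ j) :+ s) :+ j :* j :+ j :* s := con -[1+ 7 ])

  idAU : AffUnimod
  idAU = affU (+ 1) (+ 0) (+ 0) (+ 1) (+ 0) (+ 0) (inj₁ refl)

  idAU-law : ∀ p → applyAU idAU p ≡ p
  idAU-law (x , y) = pt≡ (l x y) (l′ x y)
    where
    l : ∀ x y → 1ℚ Q.* x Q.+ 0ℚ Q.* y Q.+ 0ℚ ≡ x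
    l = ℚring 2 (λ x y → con: 1ℚ *: x +: con: 0ℚ *: y +: con: 0ℚ =: x)
    l′ : ∀ x y → 0ℚ Q.* x Q.+ 1ℚ Q.* y Q.+ 0ℚ ≡ y
    l′ = ℚring 2 (λ x y → con: 0ℚ *: x +: con: 1ℚ *: y +: con: 0ℚ =: y)

  flipAU : AffUnimod
  flipAU = affU (+ 1) (+ 0) (+ 0) (Z.- (+ 1)) (+ 0) (+ 0) (inj₂ refl)

  -- Makes `x + m * y` the new height.
  turnAU : ℤ → AffUnimod
  turnAU m = affU (+ 0) (+ 1) (+ 1) m (+ 0) (+ 0) (inj₂ refl)

  record Reduced (i : ℕ) (S : List Pt) : Set where
    constructor reduced
    field
      T : List Pt
      f : AffUnimod
      eqv : Eqv f S T
      sp : Special i T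
      P : Hull T
      three : height (Hull.R P) ≡ 3
      even-bottom : ev (Hull.y₀ P) ≡ 1ℤ

  push : ∀ {i S} f → Special i S → Special i (map (applyAU f) S)
  push {S = S} f sp = special-eqv (inverse f) (eqv-sym f (eqv-map f S)) sp

  pull-half : ∀ {S} f z → InConv (map (applyAU f) S) (halfPt (act f z)) → InConv S (halfPt z)
  pull-half {S} f z c = proj₂ (eqv-map f S (halfPt z)) (subst (InConv (map (applyAU f) S)) (sym (applyAU-half f z)) c)

  push-half : ∀ {S} f z → InConv S (halfPt z) → InConv (map (applyAU f) S) (halfPt (act f z))
  push-half {S} f z c = subst (InConv (map (applyAU f) S)) (applyAU-half f z) (proj₁ (eqv-map f S (halfPt z)) c)

  special-hull : ∀ {i S} → Special i S → Hull S
  special-hull sp = hull (Special.polygon sp) (proj₁ (Special.denom sp))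

  -- The hull of the reflected polygon is constructed anew, so the two hulls are compared through
  -- extreme points of each, carried over to the other polygon.
  flip-hull : ∀ {S} (P : Hull S) (P′ : Hull (map (applyAU flipAU) S)) →
    Hull.y₀ P′ ≡ - Numbers.yₙ P × height (Hull.R P′) ≡ height (Hull.R P)
  flip-hull {S} P P′ = bottom , ℤP.+-injective (trans (l Y₀ (+ height R′)) (trans (cong₂ _-_ top bottom) (l₂ y₀ (+ height R))))
    where
    open Hull P using (R; xR; y₀; verR)
    open Hull P′ using () renaming (R to R′; xR to xR′; y₀ to Y₀; verR to verR′)
    Yₙ = Numbers.yₙ P′
    XR = endX R xR
    XR′ = endX R′ xR′
    yₙ = Numbers.yₙ P
    inv : ∀ u v → act flipAU (u , - v) ≡ (u , v)
    inv u v = cong₂ _,_ (l₁ u v) (l₂′ u v)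
      where
      l₁ : ∀ u v → + 1 * u + + 0 * (- v) + (+ 0 + + 0) ≡ u
      l₁ = ℤring 2 (λ u v → # 1 :* u :+ # 0 :* (:- v) :+ (# 0 :+ # 0) := u)
      l₂′ : ∀ u v → + 0 * u + (- (+ 1)) * (- v) + (+ 0 + + 0) ≡ v
      l₂′ = ℤring 2 (λ u v → # 0 :* u :+ (:- (# 1)) :* (:- v) :+ (# 0 :+ # 0) := v)
    pull : ∀ u v → InConv (map (applyAU flipAU) S) (half u v) → InConv S (half u (- v))
    pull u v c = pull-half flipAU (u , - v) (subst (λ z → InConv (map (applyAU flipAU) S) (halfPt z)) (sym (inv u v)) c)
    psh : ∀ u v → InConv S (half u v) → InConv (map (applyAU flipAU) S) (half u (- v))
    psh u v c = subst (λ z → InConv (map (applyAU flipAU) S) (halfPt z)) (trans (cong (λ w → act flipAU (u , w)) (sym (ℤP.neg-involutive v))) (inv u (- v))) (push-half flipAU (u , v) c)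
    neg-≤ : ∀ {a b} → a ≤ - b → b ≤ - a
    neg-≤ {a} {b} p = bound (diff p) (k a b)
      where
      k : ∀ a b → - a - b ≡ - b - a
      k = ℤring 2 (λ a b → :- a :- b := :- b :- a)
    bottom : Y₀ ≡ - yₙ
    bottom = ℤP.≤-antisym (proj₁ (y-range P′ XR (- yₙ) (psh XR yₙ (top-vertex P)))) (subst (- yₙ ≤_) (ℤP.neg-involutive Y₀) (ℤP.neg-mono-≤ (proj₂ (y-range P xR′ (- Y₀) (pull xR′ Y₀ (start-vertex R′ xR′ Y₀ verR′))))))
    top : Yₙ ≡ - y₀
    top = ℤP.≤-antisym (neg-≤ (proj₁ (y-range P XR′ (- Yₙ) (pull XR′ Yₙ (top-vertex P′))))) (proj₂ (y-range P′ xR (- y₀) (psh xR y₀ (start-vertex R xR y₀ verR))))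
    l : ∀ y h → h ≡ y + h - y
    l = ℤring 2 (λ y h → h := y :+ h :- y)
    l₂ : ∀ y h → - y - (- (y + h)) ≡ h
    l₂ = ℤring 2 (λ y h → :- y :- (:- (y :+ h)) := h)

  even-odd : ∀ y → ev (- (y + + 3)) ≡ 1ℤ - ev y
  even-odd y with parity y
  ... | even w refl = trans (cong ev (l w)) (trans (ev-odd (- w - + 2)) (cong (λ q → 1ℤ - q) (sym (ev-even w))))
    where
    l : ∀ w → - (w + w + + 3) ≡ - w - + 2 + (- w - + 2) + 1ℤ
    l = ℤring 1 (λ w → :- (w :+ w :+ # 3) := :- w :- # 2 :+ (:- w :- # 2) :+ # 1)
  ... | odd w refl = trans (cong ev (l w)) (trans (ev-even (- w - + 2)) (cong (λ q → 1ℤ - q) (sym (ev-odd w))))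
    where
    l : ∀ w → - (w + w + 1ℤ + + 3) ≡ - w - + 2 + (- w - + 2)
    l = ℤring 1 (λ w → :- (w :+ w :+ # 1 :+ # 3) := :- w :- # 2 :+ (:- w :- # 2))

  -- The height is odd, so exactly one of the bottom and top rows is a lattice row; a reflection
  -- puts it at the bottom.
  height-three : ∀ {i S} → Special i S → (P : Hull S) → height (Hull.R P) ≡ 3 → Reduced i S
  height-three {i} {S} sp P h3 = cases (ev-01 y₀)
    where
    open Hull P
    cases : ev y₀ ≡ 0ℤ ⊎ ev y₀ ≡ 1ℤ → Reduced i S
    cases (inj₂ e) = reduced S idAU (λ x → subst (InConv S) (sym (idAU-law x)) , subst (InConv S) (idAU-law x)) sp P h3 e
    cases (inj₁ e) = flipped (special-hull (push flipAU sp))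
      where
      flipped : Hull (map (applyAU flipAU) S) → Reduced i S
      flipped P′ = reduced (map (applyAU flipAU) S) flipAU (eqv-map flipAU S) (push flipAU sp) P′ (trans (proj₂ (flip-hull P P′)) h3)
        (trans (cong ev (trans (proj₁ (flip-hull P P′)) (cong (λ n → - (y₀ + + n)) h3))) (trans (even-odd y₀) (cong (λ q → 1ℤ - q) e)))

  module Cases {i : ℕ} {S : List Pt} (i≥1 : 1 N.≤ i) (sp : Special i S) (P : Hull S) where
    open Hull P
    open Numbers P
    open HullFacts P
    open Conditions (special→conditions P (Special.polygon sp) sp)
    open Alternating (alternating-facts P alternating)

    β-value : β ≡ + 4 * + i + + 14
    β-value = trans alternating boundary-number

    1≤i : 1ℤ ≤ + i
    1≤i = Z.+≤+ i≥1

    inner-zero : ∀ es x → height es ≡ 0 ⊎ height es ≡ 1 ⊎ (height es ≡ 2 × ev y₀ ≡ 1ℤ) → innerSum es x y₀ ≡ 0ℤ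
    inner-zero es x (inj₁ e) = cong (λ n → sum (N.pred n) (λ J → ev (+ 1 * y₀ + 1ℤ + + J) * (+ 2 * floorAt 1 1 es x (suc J) + 1ℤ))) e
    inner-zero es x (inj₂ (inj₁ e)) = cong (λ n → sum (N.pred n) (λ J → ev (+ 1 * y₀ + 1ℤ + + J) * (+ 2 * floorAt 1 1 es x (suc J) + 1ℤ))) e
    inner-zero es x (inj₂ (inj₂ (e , f))) = trans (cong (λ n → sum (N.pred n) (λ J → ev (+ 1 * y₀ + 1ℤ + + J) * (+ 2 * floorAt 1 1 es x (suc J) + 1ℤ))) e)
      (trans (ℤP.+-identityʳ _) (cong (λ q → q * (+ 2 * floorAt 1 1 es x 1 + 1ℤ)) (trans (cong ev (l y₀)) (trans (ev-suc y₀) (cong (λ q → 1ℤ - q) f)))))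
      where
      l : ∀ y → + 1 * y + 1ℤ + 0ℤ ≡ y + 1ℤ
      l = ℤring 1 (λ y → # 1 :* y :+ # 1 :+ # 0 := y :+ # 1)

    -- No lattice row lies strictly between bottom and top, but `i` is positive.
    no-interior : height R ≡ 0 ⊎ height R ≡ 1 ⊎ (height R ≡ 2 × ev y₀ ≡ 1ℤ) → ⊥
    no-interior c = absurd 1 (2 · diff 1≤i) (trans (l (+ i)) (cong (λ q → q - + 2) (trans (sym interior-number) (cong₂ _+_ (inner-zero R xR c) (inner-zero L xL (subst (λ n → n ≡ 0 ⊎ n ≡ 1 ⊎ (n ≡ 2 × ev y₀ ≡ 1ℤ)) (sym heights) c))))))
      where
      l : ∀ i → + 2 * (i - 1ℤ) ≡ + 2 * i - + 2
      l = ℤring 1 (λ i → # 2 :* (i :- # 1) := # 2 :* i :- # 2)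

    -- With an odd bottom row both horizontal sides lie in odd rows and degenerate, so `2P` has at
    -- most 4 boundary points, fewer than `4i + 14`.
    not-two : height R ≡ 2 → ⊥
    not-two h2 = cases (ev-01 y₀)
      where
      cases : ev y₀ ≡ 0ℤ ⊎ ev y₀ ≡ 1ℤ → ⊥
      cases (inj₂ e) = no-interior (inj₂ (inj₂ (h2 , e)))
      cases (inj₁ e) = absurd 13 (diff length-bound′ ⊹ 4 · diff 1≤i) (trans (cong₂ (λ b h → + 2 * h + (Qb + Qt) - b + + 4 * (+ i - 1ℤ)) β-value (cong +_ h2)) (trans (cong (λ q → + 2 * + 2 + q - (+ 4 * + i + + 14) + + 4 * (+ i - 1ℤ)) s0) (l (+ i))))
        where
        length-bound′ = length-bound P
        eyₙ : ev yₙ ≡ 0ℤ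
        eyₙ = trans (cong (λ n → ev (y₀ + + n)) h2) (trans (ev-shift y₀ 1ℤ) e)
        s0 : Qb + Qt ≡ 0ℤ
        s0 = cong₂ _+_ (trans (sym bottom) (trans (cong (λ q → Qb * q) e) (ℤP.*-zeroʳ Qb))) (trans (sym top) (trans (cong (λ q → Qt * q) eyₙ) (ℤP.*-zeroʳ Qt)))
        l : ∀ i → + 2 * + 2 + 0ℤ - (+ 4 * i + + 14) + + 4 * (i - 1ℤ) ≡ -[1+ 13 ]
        l = ℤring 1 (λ i → # 2 :* # 2 :+ # 0 :- (# 4 :* i :+ # 14) :+ # 4 :* (i :- # 1) := con -[1+ 13 ])

    s : ℤ
    s = Qb + Qt

    s≥0 : 0ℤ ≤ s
    s≥0 = Qb≥0 ⊹ Qt≥0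

    -- The equality case is an integral triangle: three times the unimodular simplex.
    not-six : height R ≡ 6 → s ≡ + 6 → ⊥
    not-six h6 s6 = proj₂ (Special.denom sp) integral
      where
      a≡ : a₂ ≡ + 4 * β - + 36
      a≡ = trans area-number (trans (l (+ i)) (cong (λ q → + 4 * q - + 36) (sym β-value)))
        where
        l : ∀ i → + 16 * i + + 20 ≡ + 4 * (+ 4 * i + + 14) - + 36
        l = ℤring 1 (λ i → # 16 :* i :+ # 20 := # 4 :* (# 4 :* i :+ # 14) :- # 36)
      nR = + length R
      nL = + length L
      lR : 0ℤ ≤ + 6 - nR
      lR = diff (Z.+≤+ (subst (length R N.≤_) h6 (length≤height R)))
      lL : 0ℤ ≤ + 6 - nL
      lL = diff (Z.+≤+ (subst (length L N.≤_) (trans heights h6) (length≤height L)))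
      cR = chord R xR y₀ supR verR
      cL = chord L xL y₀ supL verL
      CR = + height R * (xR + endX R xR)
      CL = + height L * (xL + endX L xL)
      -- For `H = s = 6` the bounds on the number of edges and on the area leave no room: the
      -- missing edges and the areas beyond the chords, all nonnegative, add up to zero.
      total : + 4 * (+ 6 - nR) + + 4 * (+ 6 - nL) + (area R xR - CR + (area L xL - CL)) ≡ 0ℤ
      total = trans (l₁ nR nL (area R xR) (area L xL) CR CL Qb Qt) (trans (cong₂ (λ p q → p - + 4 * (nR + nL + (Qb + Qt)) - q + + 4 * s + + 48) a≡ CC) (trans (l₂ (+ 4 * β) (+ 6 * s) s) (cong (λ q → + 12 + - (+ 6 * q) + + 4 * q) s6)))
        where
        CC : CR + CL ≡ + 6 * s
        CC = trans (cong₂ (λ h h′ → + h * (xR + endX R xR) + + h′ * (xL + endX L xL)) h6 (trans heights h6)) (k xR xL (endX R xR) (endX L xL))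
          where
          k : ∀ x x′ X X′ → + 6 * (x + X) + + 6 * (x′ + X′) ≡ + 6 * (x + x′ + (X + X′))
          k = ℤring 4 (λ x x′ X X′ → # 6 :* (x :+ X) :+ # 6 :* (x′ :+ X′) := # 6 :* (x :+ x′ :+ (X :+ X′)))
        l₁ : ∀ n m A B C D q t → + 4 * (+ 6 - n) + + 4 * (+ 6 - m) + (A - C + (B - D)) ≡ A + B - + 4 * (n + m + (q + t)) - (C + D) + + 4 * (q + t) + + 48
        l₁ = ℤring 8 (λ n m A B C D q t → # 4 :* (# 6 :- n) :+ # 4 :* (# 6 :- m) :+ (A :- C :+ (B :- D)) := A :+ B :- # 4 :* (n :+ m :+ (q :+ t)) :- (C :+ D) :+ # 4 :* (q :+ t) :+ # 48)
        l₂ : ∀ b c s → b - + 36 - b - c + + 4 * s + + 48 ≡ + 12 + - c + + 4 * s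
        l₂ = ℤring 3 (λ b c s → b :- # 36 :- b :- c :+ # 4 :* s :+ # 48 := # 12 :+ :- c :+ # 4 :* s)
      z = sum-zero₂ (4 · lR ⊹ 4 · lL) (diff cR ⊹ diff cL) total
      zl = sum-zero₂ (4 · lR) (4 · lL) (proj₁ z)
      za = sum-zero₂ (diff cR) (diff cL) (proj₂ z)
      six : ∀ n → + 4 * (+ 6 - + n) ≡ 0ℤ → n ≡ 6
      six n e = ℤP.+-injective (sym (eqZ (*-cancel 3 {+ 6 - + n} {0ℤ} e)))
      straightR : Σ ℤ λ D → R ≡ replicate 6 (D , 0)
      straightR = subst (λ n → Σ ℤ λ D → R ≡ replicate n (D , 0)) (six (length R) (proj₁ zl)) (straight R xR y₀ supR verR (trans (six (length R) (proj₁ zl)) (sym h6)) (ℤP.≤-reflexive (eqZ (proj₁ za))))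
      straightL : Σ ℤ λ D → L ≡ replicate 6 (D , 0)
      straightL = subst (λ n → Σ ℤ λ D → L ≡ replicate n (D , 0)) (six (length L) (proj₂ zl)) (straight L xL y₀ supL verL (trans (six (length L) (proj₂ zl)) (sym (trans heights h6))) (ℤP.≤-reflexive (eqZ (proj₂ za))))
      -- Bottom and top rows have the same parity. Were they odd, both sides would degenerate and
      -- `s` would be 0.
      even-y : ev y₀ ≡ 1ℤ
      even-y = cases (ev-01 y₀)
        where
        cases : ev y₀ ≡ 0ℤ ⊎ ev y₀ ≡ 1ℤ → ev y₀ ≡ 1ℤ
        cases (inj₂ e) = e
        cases (inj₁ e) = ⊥-elim (6≢0 (trans (sym s6) (cong₂ _+_ (trans (sym bottom) (trans (cong (λ q → Qb * q) e) (ℤP.*-zeroʳ Qb))) (trans (sym top) (trans (cong (λ q → Qt * q) (trans (cong (λ n → ev (y₀ + + n)) h6) (trans (ev-shift y₀ (+ 3)) e))) (ℤP.*-zeroʳ Qt))))))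
          where
          6≢0 : + 6 ≢ 0ℤ
          6≢0 ()
      odd-y : ev (y₀ + 1ℤ) ≡ 0ℤ
      odd-y = trans (ev-suc y₀) (cong (λ q → 1ℤ - q) even-y)
      -- The row after the first is odd, so the lattice endpoint of the first edge must be its
      -- start.
      even-x : ∀ {D} es x → es ≡ replicate 6 (D , 0) → Primitive es → ηs es x y₀ ≡ + length es → ev x ≡ 1ℤ
      even-x {D} es x refl (c₁ All.∷ c₂ All.∷ c₃ All.∷ c₄ All.∷ c₅ All.∷ c₆ All.∷ All.[]) alt =
          trans (sym (trans (cong₂ _+_ (trans (cong (λ q → ev x * q) even-y) (ℤP.*-identityʳ (ev x))) (trans (cong (λ q → ev (x + D) * q) odd-y) (ℤP.*-zeroʳ (ev (x + D))))) (ℤP.+-identityʳ (ev x)))) η₁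
        where
        rest : ηs (replicate 5 (D , 0)) (x + D) (y₀ + 1ℤ) ≤ + 5
        rest = ηs≤length (replicate 5 (D , 0)) (x + D) (y₀ + 1ℤ) (c₂ All.∷ c₃ All.∷ c₄ All.∷ c₅ All.∷ c₆ All.∷ All.[])
        η₁ : η x y₀ D 0 ≡ 1ℤ
        η₁ = ℤP.≤-antisym (η≤1 {D} {0} c₁ x y₀) (bound (diff rest) (trans (l (η x y₀ D 0) (ηs (replicate 5 (D , 0)) (x + D) (y₀ + 1ℤ))) (trans (cong (λ q → q - + 6 + (+ 5 - ηs (replicate 5 (D , 0)) (x + D) (y₀ + 1ℤ))) alt) (ℤP.+-identityˡ _))))
          where
          l : ∀ a b → a - 1ℤ ≡ a + b - + 6 + (+ 5 - b)
          l = ℤring 2 (λ a b → a :- # 1 := a :+ b :- # 6 :+ (# 5 :- b))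
      sideR : ∀ {z} → z ∈ chainPts R xR y₀ → IsVertex S (halfPt z) → IsIntegral (halfPt z)
      sideR = go R (proj₂ straightR) verR (even-x R xR (proj₂ straightR) primR altR)
        where
        go : ∀ es → es ≡ replicate 6 (proj₁ straightR , 0) → Vertices S es xR y₀ → ev xR ≡ 1ℤ → ∀ {z} → z ∈ chainPts es xR y₀ → IsVertex S (halfPt z) → IsIntegral (halfPt z)
        go _ refl v e = side-integral 3 (proj₁ straightR) xR y₀ v e even-y
      sideL : ∀ {z} → z ∈ chainPts L xL y₀ → IsVertex (map mirror S) (halfPt z) → IsIntegral (halfPt z)
      sideL = go L (proj₂ straightL) verL (even-x L xL (proj₂ straightL) primL altL)
        where
        go : ∀ es → es ≡ replicate 6 (proj₁ straightL , 0) → Vertices (map mirror S) es xL y₀ → ev xL ≡ 1ℤ → ∀ {z} → z ∈ chainPts es xL y₀ → IsVertex (map mirror S) (halfPt z) → IsIntegral (halfPt z)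
        go _ refl v e = side-integral 3 (proj₁ straightL) xL y₀ v e even-y
      mirror-integral : ∀ p → IsIntegral p → IsIntegral (mirror p)
      mirror-integral _ ((a , b) , refl) = (- a , b) , pt≡ (ℚArith.ofℤ-neg a) refl
      integral : IntegralVertices S
      integral v iv = let (z , i∈ , e) = vertex-pt P iv in subst IsIntegral (sym e) (at z (∈-++⁻ (chainPts R xR y₀) i∈) (subst (IsVertex S) e iv))
        where
        at : ∀ z → z ∈ chainPts R xR y₀ ⊎ z ∈ map mirrorPt (chainPts L xL y₀) → IsVertex S (halfPt z) → IsIntegral (halfPt z)
        at z (inj₁ j) iv = sideR j iv
        at z (inj₂ j) iv = go (∈-map⁻ mirrorPt j) iv
          where
          go : (Σ ZPt λ w → w ∈ chainPts L xL y₀ × z ≡ mirrorPt w) → IsVertex S (halfPt z) → IsIntegral (halfPt z)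
          go ((a , b) , k , refl) iv = subst IsIntegral (half-mirror a b) (mirror-integral (half a b) (sideL k
              (subst (IsVertex (map mirror S)) (trans (cong mirror (sym (half-mirror a b))) (mirror-mirror (half a b))) (vertex-push {F = mirror} {mirror} mirror-affine mirror-mirror mirror-mirror conv-mirror⁺ conv-mirror⁻ iv))))

    module Scott (k : ℕ) (h≡ : height R ≡ 4 N.+ k) where
      H = + 4 + + k
      XR = endX R xR
      XL = endX L xL
      yH : yₙ ≡ y₀ + H
      yH = cong (λ n → y₀ + + n) h≡
      b₁ : + k * (s - + 8) ≤ - (+ 4)
      b₁ = basic-bound (+ k) s a₂ β (+ i) (subst (λ n → + n * s ≤ a₂) h≡ (chords P)) area-number β-value (subst (λ n → β ≤ + 2 * + n + s) h≡ (length-bound P))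
      s≤H : s ≤ H
      s≤H = sides-short (+ k) s (Z.+≤+ z≤n) b₁
      -- The conditions `k₃` and `k₄` on the two diagonals ask for `num - 2H ≤ 2H * m ≤ num`, so `m`
      -- is the floor of `num / (2H)`; `d` encodes the denominator `2H`.
      num = s + H - + 2 * (XR + xL)
      d = 3 N.+ k N.+ suc (3 N.+ k)
      m = fdiv num d
      pR : Peak m S R xR y₀
      pR = find-peak m R xR y₀ supR verR
      pL : Peak (- m) (map mirror S) L xL y₀
      pL = find-peak (- m) L xL y₀ supL verL
      open Peak pR renaming (v-low to lo; v-high to hi; above to aboveR; area-bound to areaR)
      open Peak pL renaming (u to u′; v to v′; v-low to lo′; v-high to hi′; above to aboveL; area-bound to areaL)
      -- `U + U′` is the width of `2P` with respect to the functional `x + m * y`.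
      U = u + m * v
      U′ = u′ + - m * v′
      wide : Dec (H ≤ U + U′)
      wide = H Z.≤? (U + U′)
      final : H ≤ U + U′ → ⊥
      final w = not-six (trans h≡ (cong (4 N.+_) (proj₁ r))) (proj₂ r)
        where
        pq : v - y₀ + (yₙ - v) ≡ H
        pq = trans (l y₀ v yₙ) (trans (cong (λ q → q - y₀) yH) (l₂ y₀ H))
          where
          l : ∀ y v n → v - y + (n - v) ≡ n - y
          l = ℤring 3 (λ y v n → v :- y :+ (n :- v) := n :- y)
          l₂ : ∀ y h → y + h - y ≡ h
          l₂ = ℤring 2 (λ y h → y :+ h :- y := h)
        pq′ : v - y₀ + (yₙ - v) ≡ v′ - y₀ + (yₙ - v′)
        pq′ = l y₀ v v′ yₙ
          where
          l : ∀ y v w n → v - y + (n - v) ≡ w - y + (n - w)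
          l = ℤring 4 (λ y v w n → v :- y :+ (n :- v) := w :- y :+ (n :- w))
        ar : (v - y₀) * (xR + m * y₀ + U) + (yₙ - v) * (U + (XR + m * yₙ)) + ((v′ - y₀) * (xL - m * y₀ + U′) + (yₙ - v′) * (U′ + (XL - m * yₙ))) ≤ a₂
        ar = subst (_≤ a₂) (trans (cong₂ (λ t t′ → (v - y₀) * (xR + u) + (t - v) * (u + XR) + ((v′ - y₀) * (xL + u′) + (t′ - v′) * (u′ + XL))) topR topL) (l m y₀ yₙ u v u′ v′ xR xL XR XL))
            (ℤP.+-mono-≤ areaR areaL)
          where
          l : ∀ m y n u v u′ v′ x x′ X X′ → (v - y) * (x + u) + (n - v) * (u + X) + ((v′ - y) * (x′ + u′) + (n - v′) * (u′ + X′)) ≡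
            (v - y) * (x + m * y + (u + m * v)) + (n - v) * (u + m * v + (X + m * n)) + ((v′ - y) * (x′ - m * y + (u′ + - m * v′)) + (n - v′) * (u′ + - m * v′ + (X′ - m * n)))
          l = ℤring 11 (λ m y n u v u′ v′ x x′ X X′ → (v :- y) :* (x :+ u) :+ (n :- v) :* (u :+ X) :+ ((v′ :- y) :* (x′ :+ u′) :+ (n :- v′) :* (u′ :+ X′)) := (v :- y) :* (x :+ m :* y :+ (u :+ m :* v)) :+ (n :- v) :* (u :+ m :* v :+ (X :+ m :* n)) :+ ((v′ :- y) :* (x′ :- m :* y :+ (u′ :+ :- m :* v′)) :+ (n :- v′) :* (u′ :+ :- m :* v′ :+ (X′ :- m :* n))))
        P≡ : ∀ {A : ℤ → Set} → A H → A (v - y₀ + (yₙ - v))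
        P≡ {A} = subst A (sym pq)
        -- The shear drops out of the length of a horizontal side, and `s ≤ H` makes the left-hand
        -- side nonpositive.
        k₁ : s - H ≤ + 2 * (xR + m * y₀ + (xL - m * y₀))
        k₁ = bound (2 · Qb≥0 ⊹ diff s≤H) (l xR xL m y₀ H s)
          where
          l : ∀ x x′ m y H s → + 2 * (x + m * y + (x′ - m * y)) - (s - H) ≡ + 2 * (x + x′) + (H - s)
          l = ℤring 6 (λ x x′ m y H s → # 2 :* (x :+ m :* y :+ (x′ :- m :* y)) :- (s :- H) := # 2 :* (x :+ x′) :+ (H :- s))
        k₂ : s - H ≤ + 2 * (XR + m * yₙ + (XL - m * yₙ))
        k₂ = bound (2 · Qt≥0 ⊹ diff s≤H) (l XR XL m yₙ H s)
          where
          l : ∀ x x′ m y H s → + 2 * (x + m * y + (x′ - m * y)) - (s - H) ≡ + 2 * (x + x′) + (H - s)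
          l = ℤring 6 (λ x x′ m y H s → # 2 :* (x :+ m :* y :+ (x′ :- m :* y)) :- (s :- H) := # 2 :* (x :+ x′) :+ (H :- s))
        k₃ : s - H ≤ + 2 * (xR + m * y₀ + (XL - m * yₙ))
        k₃ = bound (diff (fdiv-≤ num d)) (trans (cong (λ y → + 2 * (xR + m * y₀ + (XL - m * y)) - (s - H)) yH) (l xR xL XR XL m y₀ H))
          where
          l : ∀ x x′ X X′ m y H → + 2 * (x + m * y + (X′ - m * (y + H))) - (x + x′ + (X + X′) - H) ≡ x + x′ + (X + X′) + H - + 2 * (X + x′) - m * (H + H)
          l = ℤring 7 (λ x x′ X X′ m y H → # 2 :* (x :+ m :* y :+ (X′ :- m :* (y :+ H))) :- (x :+ x′ :+ (X :+ X′) :- H) := x :+ x′ :+ (X :+ X′) :+ H :- # 2 :* (X :+ x′) :- m :* (H :+ H))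
        k₄ : s - H ≤ + 2 * (XR + m * yₙ + (xL - m * y₀))
        k₄ = bound (diff (<→≤ (fdiv-< num d)) ⊹ Z.+≤+ {0} {1} z≤n) (trans (cong (λ y → + 2 * (XR + m * y + (xL - m * y₀)) - (s - H)) yH) (l xR xL XR XL m y₀ H))
          where
          l : ∀ x x′ X X′ m y H → + 2 * (X + m * (y + H) + (x′ - m * y)) - (x + x′ + (X + X′) - H) ≡ (m + 1ℤ) * (H + H) - (x + x′ + (X + X′) + H - + 2 * (X + x′) + 1ℤ) + 1ℤ
          l = ℤring 7 (λ x x′ X X′ m y H → # 2 :* (X :+ m :* (y :+ H) :+ (x′ :- m :* y)) :- (x :+ x′ :+ (X :+ X′) :- H) := (m :+ # 1) :* (H :+ H) :- (x :+ x′ :+ (X :+ X′) :+ H :- # 2 :* (X :+ x′) :+ # 1) :+ # 1)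
        hex : H * (H + s) ≤ + 2 * a₂
        hex = subst (λ q → q * (q + s) ≤ + 2 * a₂) pq (hexagon (v - y₀) (yₙ - v) (v′ - y₀) (yₙ - v′) (xR + m * y₀) (XR + m * yₙ) (xL - m * y₀) (XL - m * yₙ) U U′ s a₂
          (P≡ {λ q → 0ℤ < q} (Z.+<+ (s≤s z≤n))) pq′ (diff lo) (diff (subst (v ≤_) topR hi)) (diff lo′) (diff (subst (v′ ≤_) topL hi′)) ar (P≡ {λ q → q ≤ U + U′} w)
          (P≡ {λ q → s - q ≤ + 2 * (xR + m * y₀ + (xL - m * y₀))} k₁) (P≡ {λ q → s - q ≤ + 2 * (XR + m * yₙ + (XL - m * yₙ))} k₂) (P≡ {λ q → s - q ≤ + 2 * (xR + m * y₀ + (XL - m * yₙ))} k₃) (P≡ {λ q → s - q ≤ + 2 * (XR + m * yₙ + (xL - m * y₀))} k₄))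
        r : k ≡ 2 × s ≡ + 6
        r = wide-bound k s a₂ β (+ i) s≥0 b₁ hex area-number β-value (subst (λ n → β ≤ + 2 * + n + s) h≡ (length-bound P))
      -- The heights of the turned polygon lie between `- U′` and `U`, the bounds for `x + m * y` at
      -- the peaks of the two chains.
      smaller : ¬ (H ≤ U + U′) → (P₂ : Hull (map (applyAU (turnAU m)) S)) → height (Hull.R P₂) N.< height R
      smaller nw P₂ = ℤP.drop‿+<+ (ℤP.≤-<-trans (bound {d = U - yₙ₂ + (U′ - - y₂)} (diff top≤ ⊹ diff bot≤) (l (+ height (Hull.R P₂)) y₂ U U′)) (subst (U + U′ <_) (cong +_ (sym h≡)) (ℤP.≰⇒> nw)))
        where
        y₂ = Hull.y₀ P₂
        yₙ₂ = Numbers.yₙ P₂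
        X₂ = endX (Hull.R P₂) (Hull.xR P₂)
        x₂ = Hull.xR P₂
        inv : ∀ x y → act (turnAU m) (y - m * x , x) ≡ (x , y)
        inv x y = cong₂ _,_ (l₁ m x y) (l₂ m x y)
          where
          l₁ : ∀ m x y → + 0 * (y - m * x) + + 1 * x + (+ 0 + + 0) ≡ x
          l₁ = ℤring 3 (λ m x y → # 0 :* (y :- m :* x) :+ # 1 :* x :+ (# 0 :+ # 0) := x)
          l₂ : ∀ m x y → + 1 * (y - m * x) + m * x + (+ 0 + + 0) ≡ y
          l₂ = ℤring 3 (λ m x y → # 1 :* (y :- m :* x) :+ m :* x :+ (# 0 :+ # 0) := y)
        pull : ∀ x y → InConv (map (applyAU (turnAU m)) S) (half x y) → InConv S (half (y - m * x) x)
        pull x y c = pull-half (turnAU m) (y - m * x , x) (subst (λ z → InConv (map (applyAU (turnAU m)) S) (halfPt z)) (sym (inv x y)) c)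
        φ : ∀ m x y → y - m * x + m * x ≡ y
        φ = ℤring 3 (λ m x y → y :- m :* x :+ m :* x := y)
        φ′ : ∀ m x y → - (y - m * x) + - m * x ≡ - y
        φ′ = ℤring 3 (λ m x y → :- (y :- m :* x) :+ :- m :* x := :- y)
        top≤ : yₙ₂ ≤ U
        top≤ = subst (_≤ U) (φ m X₂ yₙ₂) (φ-bound P m {U} aboveR (yₙ₂ - m * X₂) X₂ (pull X₂ yₙ₂ (top-vertex P₂)))
        bot≤ : - y₂ ≤ U′
        bot≤ = subst (_≤ U′) (φ′ m x₂ y₂) (φ-bound (mirror-hull P) (- m) {U′} aboveL (- (y₂ - m * x₂)) x₂
          (subst (InConv (map mirror S)) (half-mirror (y₂ - m * x₂) x₂) (conv-mirror⁺ {p = half (y₂ - m * x₂) x₂} (pull x₂ y₂ (start-vertex (Hull.R P₂) x₂ y₂ (Hull.verR P₂))))))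
        l : ∀ h y U U′ → U + U′ - h ≡ U - (y + h) + (U′ - - y)
        l = ℤring 4 (λ h y U U′ → U :+ U′ :- h := U :- (y :+ h) :+ (U′ :- :- y))

  Reduced-eqv : ∀ {i S T} f → Eqv f S T → Reduced i T → Reduced i S
  Reduced-eqv f q (reduced T g e sp P h b) = reduced T (compose g f) (eqv-trans g f q e) sp P h b

  -- Scott's argument: either the width in some other direction is smaller than the height, or the area bound leaves only height 3.
  descent : ∀ n {i S} → 1 N.≤ i → Special i S → (P : Hull S) → height (Hull.R P) N.≤ n → Reduced i S
  descent n {i} {S} i≥1 sp P h≤ = dispatch (height (Hull.R P)) refl
    where
    open Cases i≥1 sp P
    dispatch : ∀ h → height (Hull.R P) ≡ h → Reduced i S
    dispatch 0 e = ⊥-elim (no-interior (inj₁ e))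
    dispatch 1 e = ⊥-elim (no-interior (inj₂ (inj₁ e)))
    dispatch 2 e = ⊥-elim (not-two e)
    dispatch 3 e = height-three sp P e
    dispatch (suc (suc (suc (suc k)))) e = by n h≤ wide
      where
      open Scott k e
      by : ∀ n → height (Hull.R P) N.≤ n → Dec (H ≤ U + U′) → Reduced i S
      by _ _ (yes w) = ⊥-elim (final w)
      by zero le (no _) = ⊥-elim (ℕP.<⇒≱ (s≤s z≤n) (subst (N._≤ 0) e le))
      by (suc n) le (no nw) = Reduced-eqv (turnAU m) (eqv-map (turnAU m) S) (again (special-hull (push (turnAU m) sp)))
        where
        again : Hull (map (applyAU (turnAU m)) S) → Reduced i (map (applyAU (turnAU m)) S)
        again P₂ = descent n i≥1 (push (turnAU m) sp) P₂ (ℕP.≤-pred (ℕP.≤-trans (smaller nw P₂) le))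
open Descent public

-- Numerical data of chains of height 3

module Profiles where
  open Z using (_≤_; _<_; _+_; _*_; _-_; -_)
  open ℤArith

  infix 4 _∙_
  infixl 3 _⊞_
  -- Equations are derived like inequalities: a ring identity writes the difference of the two sides
  -- as a combination of terms `k ∙ e`, each of which is zero.
  _∙_ : ∀ k {a b} → a ≡ b → k * (a - b) ≡ 0ℤ
  _∙_ k {a} refl = trans (cong (λ q → k * q) (ℤP.+-inverseʳ a)) (ℤP.*-zeroʳ k)

  _⊞_ : ∀ {a b} → a ≡ 0ℤ → b ≡ 0ℤ → a + b ≡ 0ℤ
  refl ⊞ refl = refl

  lin : ∀ {a b z} → z ≡ 0ℤ → a - b ≡ z → a ≡ b
  lin p e = eqZ (trans e p)

  -- Numerical data of a chain of height 3 starting at height y: its length N and, relative to a line of slope d through its start,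
  -- its end point E, its area A and the contribution J of the interior row y + 2.
  record Profile (es : List Edge) (x y d N E A J : ℤ) : Set where
    constructor profile
    field
      length≡ : + length es ≡ N
      alternates : ηs es x y ≡ + length es
      end : endX es x ≡ x + + 3 * d + E
      area≡ : area es x ≡ + 6 * x + + 9 * d + A
      inner≡ : innerSum es x y ≡ x + + 2 * d + J

  -- Slopes fall upwards by convexity, and `a`, `b`, `k` measure the drops. Parity explains the
  -- doubled terms: in `shapeA` rows 0 and 2 carry lattice points, so the first two steps add up to
  -- an even number; in `shapeB` the chain passes from an odd start to an even vertex, so the first
  -- step is odd. In `shapeC` the number `ρ` is the remainder modulo 3.
  shapeA shapeB shapeC : ℤ → ℤ → ℤ → List Edge
  shapeA a b d = (d + b + (a + a) , 0) ∷ (d + b , 0) ∷ (d , 0) ∷ []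
  shapeB k _ d = (d + d + (k + k + 1ℤ) , 1) ∷ (d , 0) ∷ []
  shapeC ρ _ q = (+ 3 * q + ρ , 2) ∷ []

  -- The chains of height 3 starting on an even row on which every edge has exactly one endpoint with two even doubled coordinates.
  data Shape : ℤ → List Edge → Set where
    three-edges : ∀ w a b d → 0ℤ ≤ a → 0ℤ ≤ b → Shape (w + w) (shapeA a b d)
    two-edges : ∀ w k d → 0ℤ ≤ k → Shape (w + w + 1ℤ) (shapeB k 0ℤ d)
    one-edge : ∀ w ρ q → 1ℤ ≤ ρ → ρ ≤ + 2 → Shape (w + w) (shapeC ρ 0ℤ q)

  module EvenStart (y : ℤ) (ey : ev y ≡ 1ℤ) where
    ev₁ : ev (y + + 1) ≡ 0ℤ
    ev₁ = trans (ev-suc y) (cong (λ q → 1ℤ - q) ey)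
    ev₂ : ev (y + + 2) ≡ 1ℤ
    ev₂ = trans (ev-shift y 1ℤ) ey
    ev₃ : ev (y + + 3) ≡ 0ℤ
    ev₃ = trans (cong ev (sym (ℤP.+-assoc y (+ 1) (+ 2)))) (trans (ev-shift (y + 1ℤ) 1ℤ) ev₁)
    ev₁₁ : ev (y + + 1 + + 1) ≡ 1ℤ
    ev₁₁ = trans (cong ev (ℤP.+-assoc y (+ 1) (+ 1))) ev₂
    ev₁₁₁ : ev (y + + 1 + + 1 + + 1) ≡ 0ℤ
    ev₁₁₁ = trans (ev-suc (y + + 1 + + 1)) (cong (λ q → 1ℤ - q) ev₁₁)
    ev₂₁ : ev (y + + 2 + + 1) ≡ 0ℤ
    ev₂₁ = trans (ev-suc (y + + 2)) (cong (λ q → 1ℤ - q) ev₂)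
    ev₁₂ : ev (y + + 1 + + 2) ≡ 0ℤ
    ev₁₂ = trans (ev-shift (y + + 1) 1ℤ) ev₁

    -- Of the two inner rows only `y + 2` is a lattice row.
    inner-row : ∀ (f : ℕ → ℤ) → sum 2 (λ J → ev (+ 1 * y + 1ℤ + + J) * f J) ≡ f 1
    inner-row f = trans (cong₂ (λ p q → p * f 0 + (q * f 1 + 0ℤ)) (trans (cong ev (l₁ y)) ev₁) (trans (cong ev (l₂ y)) ev₂)) (l₃ (f 0) (f 1))
      where
      l₁ : ∀ y → + 1 * y + 1ℤ + + 0 ≡ y + + 1
      l₁ = ℤring 1 (λ y → # 1 :* y :+ # 1 :+ # 0 := y :+ # 1)
      l₂ : ∀ y → + 1 * y + 1ℤ + + 1 ≡ y + + 2
      l₂ = ℤring 1 (λ y → # 1 :* y :+ # 1 :+ # 1 := y :+ # 2)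
      l₃ : ∀ a b → 0ℤ * a + (1ℤ * b + 0ℤ) ≡ b
      l₃ = ℤring 2 (λ a b → # 0 :* a :+ (# 1 :* b :+ # 0) := b)

    lattice-row-end : ∀ X d → ev X ≡ 1ℤ → + 2 * fdiv (+ 1 * X * + 1 + d * + 0 - + 1) 1 + 1ℤ ≡ X - 1ℤ
    lattice-row-end X d e = trans (cong (λ q → + 2 * fdiv q 1 + 1ℤ) (l X d)) (trans (fdiv-mid-open X 0) (cong (λ q → X - q) e))
      where
      l : ∀ X d → + 1 * X * + 1 + d * + 0 - + 1 ≡ X * + 1 - + 1
      l = ℤring 2 (λ X d → # 1 :* X :* # 1 :+ d :* # 0 :- # 1 := X :* # 1 :- # 1)

    evpt-10 : ∀ {a b a′ b′} → ev a ≡ 1ℤ → ev b ≡ 1ℤ → ev b′ ≡ 0ℤ → evpt a b + evpt a′ b′ ≡ 1ℤ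
    evpt-10 {a′ = a′} p q r = cong₂ _+_ (cong₂ _*_ p q) (trans (cong (ev a′ *_) r) (ℤP.*-zeroʳ (ev a′)))

    evpt-01 : ∀ {a b a′ b′} → ev b ≡ 0ℤ → ev a′ ≡ 1ℤ → ev b′ ≡ 1ℤ → evpt a b + evpt a′ b′ ≡ 1ℤ
    evpt-01 {a} p q r = cong₂ _+_ (trans (cong (ev a *_) p) (ℤP.*-zeroʳ (ev a))) (cong₂ _*_ q r)

    profile-A : ∀ {es x} w a b d → x ≡ w + w → es ≡ shapeA a b d → Profile es x y d (+ 3) (+ 2 * (a + b)) (+ 10 * a + + 8 * b) (+ 2 * (a + b) - 1ℤ)
    profile-A w a b d refl refl = profile refl
        (cong₂ _+_ (evpt-10 {w + w} {y} {w + w + (d + b + (a + a))} {y + + 1} (ev-even w) ey ev₁)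
          (cong₂ _+_ (evpt-01 {w + w + (d + b + (a + a))} {y + + 1} {X} {y + + 1 + + 1} ev₁ evX ev₁₁) (cong (_+ 0ℤ) (evpt-10 {X} {y + + 1 + + 1} {X + d} {y + + 1 + + 1 + + 1} evX ev₁₁ ev₁₁₁))))
        (l₁ w a b d) (l₂ w a b d) (trans (inner-row (λ J → + 2 * floorAt 1 1 (shapeA a b d) (w + w) (suc J) + 1ℤ)) (trans (lattice-row-end X d evX) (l₃ w a b d)))
      where
      X = w + w + (d + b + (a + a)) + (d + b)
      evX : ev X ≡ 1ℤ
      evX = trans (cong ev (l w a b d)) (ev-even (w + d + b + a))
        where
        l : ∀ w a b d → w + w + (d + b + (a + a)) + (d + b) ≡ w + d + b + a + (w + d + b + a)
        l = ℤring 4 (λ w a b d → w :+ w :+ (d :+ b :+ (a :+ a)) :+ (d :+ b) := w :+ d :+ b :+ a :+ (w :+ d :+ b :+ a))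
      l₁ : ∀ w a b d → w + w + (d + b + (a + a)) + (d + b) + d ≡ w + w + + 3 * d + + 2 * (a + b)
      l₁ = ℤring 4 (λ w a b d → w :+ w :+ (d :+ b :+ (a :+ a)) :+ (d :+ b) :+ d := w :+ w :+ # 3 :* d :+ # 2 :* (a :+ b))
      l₂ : ∀ w a b d → + 1 * (w + w + (w + w + (d + b + (a + a)))) + (+ 1 * (w + w + (d + b + (a + a)) + (w + w + (d + b + (a + a)) + (d + b))) +
        (+ 1 * (w + w + (d + b + (a + a)) + (d + b) + (w + w + (d + b + (a + a)) + (d + b) + d)) + 0ℤ)) ≡ + 6 * (w + w) + + 9 * d + (+ 10 * a + + 8 * b)
      l₂ = ℤring 4 (λ w a b d → # 1 :* (w :+ w :+ (w :+ w :+ (d :+ b :+ (a :+ a)))) :+ (# 1 :* (w :+ w :+ (d :+ b :+ (a :+ a)) :+ (w :+ w :+ (d :+ b :+ (a :+ a)) :+ (d :+ b))) :+ (# 1 :* (w :+ w :+ (d :+ b :+ (a :+ a)) :+ (d :+ b) :+ (w :+ w :+ (d :+ b :+ (a :+ a)) :+ (d :+ b) :+ d)) :+ # 0)) := # 6 :* (w :+ w) :+ # 9 :* d :+ (# 10 :* a :+ # 8 :* b))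
      l₃ : ∀ w a b d → w + w + (d + b + (a + a)) + (d + b) - 1ℤ ≡ w + w + + 2 * d + (+ 2 * (a + b) - 1ℤ)
      l₃ = ℤring 4 (λ w a b d → w :+ w :+ (d :+ b :+ (a :+ a)) :+ (d :+ b) :- # 1 := w :+ w :+ # 2 :* d :+ (# 2 :* (a :+ b) :- # 1))

    profile-B : ∀ {es x} w k d → x ≡ w + w + 1ℤ → es ≡ shapeB k 0ℤ d → Profile es x y d (+ 2) (+ 2 * k + 1ℤ) (+ 8 * k + + 4) (+ 2 * k)
    profile-B w k d refl refl = profile refl
        (cong₂ _+_ (cong₂ _+_ (cong (_* ev y) (ev-odd w)) (cong₂ _*_ evX ev₂)) (cong (_+ 0ℤ) (evpt-10 {X} {y + + 2} {X + d} {y + + 2 + + 1} evX ev₂ ev₂₁)))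
        (l₁ w k d) (l₂ w k d) (trans (inner-row (λ J → + 2 * floorAt 1 1 (shapeB k 0ℤ d) (w + w + 1ℤ) (suc J) + 1ℤ)) (trans (lattice-row-end X d evX) (l₃ w k d)))
      where
      X = w + w + 1ℤ + (d + d + (k + k + 1ℤ))
      evX : ev X ≡ 1ℤ
      evX = trans (cong ev (l w k d)) (ev-even (w + d + k + 1ℤ))
        where
        l : ∀ w k d → w + w + 1ℤ + (d + d + (k + k + 1ℤ)) ≡ w + d + k + 1ℤ + (w + d + k + 1ℤ)
        l = ℤring 3 (λ w k d → w :+ w :+ # 1 :+ (d :+ d :+ (k :+ k :+ # 1)) := w :+ d :+ k :+ # 1 :+ (w :+ d :+ k :+ # 1))
      l₁ : ∀ w k d → w + w + 1ℤ + (d + d + (k + k + 1ℤ)) + d ≡ w + w + 1ℤ + + 3 * d + (+ 2 * k + 1ℤ)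
      l₁ = ℤring 3 (λ w k d → w :+ w :+ # 1 :+ (d :+ d :+ (k :+ k :+ # 1)) :+ d := w :+ w :+ # 1 :+ # 3 :* d :+ (# 2 :* k :+ # 1))
      l₂ : ∀ w k d → + 2 * (w + w + 1ℤ + (w + w + 1ℤ + (d + d + (k + k + 1ℤ)))) + (+ 1 * (w + w + 1ℤ + (d + d + (k + k + 1ℤ)) + (w + w + 1ℤ + (d + d + (k + k + 1ℤ)) + d)) + 0ℤ) ≡
        + 6 * (w + w + 1ℤ) + + 9 * d + (+ 8 * k + + 4)
      l₂ = ℤring 3 (λ w k d → # 2 :* (w :+ w :+ # 1 :+ (w :+ w :+ # 1 :+ (d :+ d :+ (k :+ k :+ # 1)))) :+ (# 1 :* (w :+ w :+ # 1 :+ (d :+ d :+ (k :+ k :+ # 1)) :+ (w :+ w :+ # 1 :+ (d :+ d :+ (k :+ k :+ # 1)) :+ d)) :+ # 0) := # 6 :* (w :+ w :+ # 1) :+ # 9 :* d :+ (# 8 :* k :+ # 4))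
      l₃ : ∀ w k d → w + w + 1ℤ + (d + d + (k + k + 1ℤ)) - 1ℤ ≡ w + w + 1ℤ + + 2 * d + + 2 * k
      l₃ = ℤring 3 (λ w k d → w :+ w :+ # 1 :+ (d :+ d :+ (k :+ k :+ # 1)) :- # 1 := w :+ w :+ # 1 :+ # 2 :* d :+ # 2 :* k)

    profile-C : ∀ {es x} w ρ q → 1ℤ ≤ ρ → ρ ≤ + 2 → x ≡ w + w → es ≡ shapeC ρ 0ℤ q → Profile es x y q (+ 1) ρ (+ 3 * ρ) (+ 1)
    profile-C w ρ q lo hi refl refl = profile refl (cong (_+ 0ℤ) (evpt-10 {w + w} {y} {w + w + (+ 3 * q + ρ)} {y + + 3} (ev-even w) ey ev₃)) (l₁ w ρ q) (l₂ w ρ q)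
        (trans (inner-row (λ J → + 2 * floorAt 1 1 (shapeC ρ 0ℤ q) (w + w) (suc J) + 1ℤ))
          -- In row 2 the numerator exceeds `6(w + q)` by `2ρ - 1`, which lies between 1 and 3.
          (trans (cong (λ f → + 2 * f + 1ℤ) (fdiv-unique n 5 (w + q) (bound (2 · diff lo ⊹ Z.+≤+ {0} {1} z≤n) (l₄ w ρ q)) (bound (2 · diff hi ⊹ Z.+≤+ {0} {2} z≤n) (l₅ w ρ q)))) (l₃ w q)))
      where
      n = + 1 * (w + w) * + 3 + (+ 3 * q + ρ) * + 2 - + 1
      l₁ : ∀ w ρ q → w + w + (+ 3 * q + ρ) ≡ w + w + + 3 * q + ρ
      l₁ = ℤring 3 (λ w ρ q → w :+ w :+ (# 3 :* q :+ ρ) := w :+ w :+ # 3 :* q :+ ρ)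
      l₂ : ∀ w ρ q → + 3 * (w + w + (w + w + (+ 3 * q + ρ))) + 0ℤ ≡ + 6 * (w + w) + + 9 * q + + 3 * ρ
      l₂ = ℤring 3 (λ w ρ q → # 3 :* (w :+ w :+ (w :+ w :+ (# 3 :* q :+ ρ))) :+ # 0 := # 6 :* (w :+ w) :+ # 9 :* q :+ # 3 :* ρ)
      l₃ : ∀ w q → + 2 * (w + q) + 1ℤ ≡ w + w + + 2 * q + + 1
      l₃ = ℤring 2 (λ w q → # 2 :* (w :+ q) :+ # 1 := w :+ w :+ # 2 :* q :+ # 1)
      l₄ : ∀ w ρ q → + 1 * (w + w) * + 3 + (+ 3 * q + ρ) * + 2 - + 1 - (w + q) * + 6 ≡ + 2 * (ρ - 1ℤ) + + 1
      l₄ = ℤring 3 (λ w ρ q → # 1 :* (w :+ w) :* # 3 :+ (# 3 :* q :+ ρ) :* # 2 :- # 1 :- (w :+ q) :* # 6 := # 2 :* (ρ :- # 1) :+ # 1)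
      l₅ : ∀ w ρ q → (w + q + 1ℤ) * + 6 - (+ 1 * (w + w) * + 3 + (+ 3 * q + ρ) * + 2 - + 1 + 1ℤ) ≡ + 2 * (+ 2 - ρ) + + 2
      l₅ = ℤring 3 (λ w ρ q → (w :+ q :+ # 1) :* # 6 :- (# 1 :* (w :+ w) :* # 3 :+ (# 3 :* q :+ ρ) :* # 2 :- # 1 :+ # 1) := # 2 :* (# 2 :- ρ) :+ # 2)
open Profiles public

-- The possible shapes of a chain of height 3

module Shapes where
  open Z using (_≤_; _<_; _+_; _*_; _-_; -_)
  open ℤArith

  half-nonneg : ∀ {k} → 0ℤ ≤ k + k → 0ℤ ≤ k
  half-nonneg {k} p with 0ℤ Z.≤? k
  ... | yes q = q
  ... | no q = ⊥-elim (absurd 1 (p ⊹ 2 · diff (<→≤ (ℤP.≰⇒> q))) (l k))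
    where
    l : ∀ k → k + k + + 2 * (0ℤ - (k + 1ℤ)) ≡ -[1+ 1 ]
    l = ℤring 1 (λ k → k :+ k :+ # 2 :* (# 0 :- (k :+ # 1)) := con -[1+ 1 ])

  half-nonneg′ : ∀ {k} → 0ℤ ≤ k + k + 1ℤ → 0ℤ ≤ k
  half-nonneg′ {k} p with 0ℤ Z.≤? k
  ... | yes q = q
  ... | no q = ⊥-elim (absurd 0 (p ⊹ 2 · diff (<→≤ (ℤP.≰⇒> q))) (l k))
    where
    l : ∀ k → k + k + 1ℤ + + 2 * (0ℤ - (k + 1ℤ)) ≡ -[1+ 0 ]
    l = ℤring 1 (λ k → k :+ k :+ # 1 :+ # 2 :* (# 0 :- (k :+ # 1)) := con -[1+ 0 ])

  tight : ∀ {a s n} → a ≤ 1ℤ → s ≤ n → a + s ≡ 1ℤ + n → a ≡ 1ℤ × s ≡ n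
  tight {a} {s} {n} p q e = sym (eqZ (proj₁ z)) , sym (eqZ (proj₂ z))
    where
    l : ∀ a s n → 1ℤ - a + (n - s) ≡ 1ℤ + n - (a + s)
    l = ℤring 3 (λ a s n → # 1 :- a :+ (n :- s) := # 1 :+ n :- (a :+ s))
    z = sum-zero₂ (diff p) (diff q) (trans (l a s n) (trans (cong (λ t → 1ℤ + n - t) e) (ℤP.+-inverseʳ (1ℤ + n))))

  alternates-cons : ∀ D h es x y → Primitive ((D , h) ∷ es) → ηs ((D , h) ∷ es) x y ≡ + length ((D , h) ∷ es) → η x y D h ≡ 1ℤ × ηs es (x + D) (y + + suc h) ≡ + length es
  alternates-cons D h es x y (c All.∷ cs) = tight (η≤1 {D} {h} c x y) (ηs≤length es (x + D) (y + + suc h) cs)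

  module _ (y : ℤ) (ey : ev y ≡ 1ℤ) where
    open EvenStart y ey

    evpt-10⁻ : ∀ {a b a′ b′} → ev b ≡ 1ℤ → ev b′ ≡ 0ℤ → evpt a b + evpt a′ b′ ≡ 1ℤ → ev a ≡ 1ℤ
    evpt-10⁻ {a} {_} {a′} p q e = trans (l (ev a) (ev a′)) (trans (sym (cong₂ (λ s t → ev a * s + ev a′ * t) p q)) e)
      where
      l : ∀ a b → a ≡ a * 1ℤ + b * 0ℤ
      l = ℤring 2 (λ a b → a := a :* # 1 :+ b :* # 0)

    -- The heights of the edges form a composition of 3. In `1 + 2` the second edge joins two odd
    -- rows and has no lattice endpoint. In the other cases the parities of the rows decide which
    -- end of each edge is a lattice point; convexity bounds the slopes where there is more than one
    -- edge.
    shape : ∀ {S} es x → Primitive es → height es ≡ 3 → Supports S es x y → Vertices S es x y → ηs es x y ≡ + length es → Shape x es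
    shape [] x _ () _ _ _
    shape ((d , 2) ∷ []) x (c All.∷ All.[]) refl _ _ al = go (ev≡1 x (evpt-10⁻ {x} {y} {x + d} {y + + 3} ey ev₃ (proj₁ (alternates-cons d 2 [] x y (c All.∷ All.[]) al)))) (fdiv-rem d 2)
      where
      form : ∀ w r → x ≡ w + w → d ≡ + r + fdiv d 2 * + 3 → 1ℤ ≤ + r → + r ≤ + 2 → Shape x ((d , 2) ∷ [])
      form w r e f lo hi = subst₂ Shape (sym e) (cong (λ d → (d , 2) ∷ []) (sym (trans f (l (+ r) (fdiv d 2))))) (one-edge w (+ r) (fdiv d 2) lo hi)
        where
        l : ∀ r q → r + q * + 3 ≡ + 3 * q + r
        l = ℤring 2 (λ r q → r :+ q :* # 3 := # 3 :* q :+ r)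
      go : (Σ ℤ λ w → x ≡ w + w) → (Σ ℕ λ r → r N.< 3 × d ≡ + r + fdiv d 2 * + 3) → Shape x ((d , 2) ∷ [])
      -- A multiple of 3 is not coprime to the height 3.
      go _ (0 , _ , f) = ⊥-elim (3≢1 (c {3} (Div.divides Z.∣ fdiv d 2 ∣ (trans (cong Z.∣_∣ (trans f (ℤP.+-identityˡ (fdiv d 2 * + 3)))) (ℤP.abs-* (fdiv d 2) (+ 3))) , Div.divides 1 refl)))
        where
        3≢1 : 3 ≢ 1
        3≢1 ()
      go (w , e) (1 , _ , f) = form w 1 e f ℤP.≤-refl (Z.+≤+ (s≤s z≤n))
      go (w , e) (2 , _ , f) = form w 2 e f (Z.+≤+ (s≤s z≤n)) ℤP.≤-refl
      go _ (suc (suc (suc _)) , s≤s (s≤s (s≤s ())) , _)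
    shape ((d , 2) ∷ _ ∷ _) x _ () _ _ _
    shape ((d , suc (suc (suc _))) ∷ _) x _ () _ _ _
    shape ((d₁ , 1) ∷ []) x _ () _ _ _
    shape {S} ((d₁ , 1) ∷ (d₂ , 0) ∷ []) x pr@(_ All.∷ cs) refl sup ver al = go (ev≡0 x ex) (ev≡1 X eX)
      where
      X = x + d₁
      al₁ = alternates-cons d₁ 1 ((d₂ , 0) ∷ []) x y pr al
      al₂ = alternates-cons d₂ 0 [] X (y + + 2) cs (proj₂ al₁)
      eX : ev X ≡ 1ℤ
      eX = evpt-10⁻ {X} {y + + 2} {X + d₂} {y + + 2 + + 1} ev₂ ev₂₁ (proj₁ al₂)
      ex : ev x ≡ 0ℤ
      ex = trans (l (ev x)) (cong (λ t → t - 1ℤ) (trans (sym (cong₂ _+_ (cong (λ t → ev x * t) ey) (cong₂ _*_ eX ev₂))) (proj₁ al₁)))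
        where
        l : ∀ a → a ≡ a * 1ℤ + 1ℤ * 1ℤ - 1ℤ
        l = ℤring 1 (λ a → a := a :* # 1 :+ # 1 :* # 1 :- # 1)
      -- The upper end lies on the left of the first edge, which amounts to `2 * d₂ ≤ d₁`.
      convex : + 2 * (x + d₁ + d₂ - x) ≤ d₁ * (y + + 2 + + 1 - y)
      convex = chain-left {S} {d₁} {1} {(d₂ , 0) ∷ []} {x} {y} {x + d₁ + d₂} {y + + 2 + + 1} sup (proj₂ (proj₂ ver))
      go : (Σ ℤ λ w → x ≡ w + w + 1ℤ) → (Σ ℤ λ v → X ≡ v + v) → Shape x ((d₁ , 1) ∷ (d₂ , 0) ∷ [])
      go (w , e) (v , f) = subst₂ Shape (sym e) (cong (λ d → (d , 1) ∷ (d₂ , 0) ∷ []) (sym d₁≡)) (two-edges w k d₂ (half-nonneg′ {k} (subst (0ℤ ≤_) (trans (l₂ x d₁ d₂ y) (trans (cong (λ q → q - (d₂ + d₂)) d₁≡) (l₃ d₂ k))) (diff convex))))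
        where
        k = v - w - 1ℤ - d₂
        d₁≡ : d₁ ≡ d₂ + d₂ + (k + k + 1ℤ)
        d₁≡ = trans (l₀ x d₁) (trans (cong₂ (λ p q → p - q) f e) (l₁ v w d₂))
          where
          l₀ : ∀ x d → d ≡ x + d - x
          l₀ = ℤring 2 (λ x d → d := x :+ d :- x)
          l₁ : ∀ v w d → v + v - (w + w + 1ℤ) ≡ d + d + (v - w - 1ℤ - d + (v - w - 1ℤ - d) + 1ℤ)
          l₁ = ℤring 3 (λ v w d → v :+ v :- (w :+ w :+ # 1) := d :+ d :+ (v :- w :- # 1 :- d :+ (v :- w :- # 1 :- d) :+ # 1))
        l₂ : ∀ x d e y → d * (y + + 2 + + 1 - y) - + 2 * (x + d + e - x) ≡ d - (e + e)
        l₂ = ℤring 4 (λ x d e y → d :* (y :+ # 2 :+ # 1 :- y) :- # 2 :* (x :+ d :+ e :- x) := d :- (e :+ e))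
        l₃ : ∀ d k → d + d + (k + k + 1ℤ) - (d + d) ≡ k + k + 1ℤ
        l₃ = ℤring 2 (λ d k → d :+ d :+ (k :+ k :+ # 1) :- (d :+ d) := k :+ k :+ # 1)
    shape ((d₁ , 1) ∷ (d₂ , 0) ∷ _ ∷ _) x _ () _ _ _
    shape ((d₁ , 1) ∷ (d₂ , suc _) ∷ _) x _ () _ _ _
    shape ((d₁ , 0) ∷ []) x _ () _ _ _
    shape ((d₁ , 0) ∷ (d₂ , 1) ∷ []) x pr@(_ All.∷ cs) refl _ _ al = ⊥-elim (0≢1 (trans (sym zero₂) (proj₁ (alternates-cons d₂ 1 [] (x + d₁) (y + + 1) cs (proj₂ (alternates-cons d₁ 0 ((d₂ , 1) ∷ []) x y pr al))))))
      where
      zero₂ : η (x + d₁) (y + + 1) d₂ 1 ≡ 0ℤ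
      zero₂ = trans (cong₂ (λ p q → ev (x + d₁) * p + ev (x + d₁ + d₂) * q) ev₁ ev₁₂) (l (ev (x + d₁)) (ev (x + d₁ + d₂)))
        where
        l : ∀ a b → a * 0ℤ + b * 0ℤ ≡ 0ℤ
        l = ℤring 2 (λ a b → a :* # 0 :+ b :* # 0 := # 0)
      0≢1 : 0ℤ ≢ 1ℤ
      0≢1 ()
    shape ((d₁ , 0) ∷ (d₂ , 1) ∷ _ ∷ _) x _ () _ _ _
    shape ((d₁ , 0) ∷ (d₂ , suc (suc _)) ∷ _) x _ () _ _ _
    shape ((d₁ , 0) ∷ (d₂ , 0) ∷ []) x _ () _ _ _
    shape {S} ((d₁ , 0) ∷ (d₂ , 0) ∷ (d₃ , 0) ∷ []) x pr@(_ All.∷ cs@(_ All.∷ cs′)) refl sup@(_ , sup′) ver al = go (ev≡1 x ex) (ev≡1 X eX)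
      where
      X = x + d₁ + d₂
      al₁ = alternates-cons d₁ 0 ((d₂ , 0) ∷ (d₃ , 0) ∷ []) x y pr al
      al₂ = alternates-cons d₂ 0 ((d₃ , 0) ∷ []) (x + d₁) (y + + 1) cs (proj₂ al₁)
      al₃ = alternates-cons d₃ 0 [] X (y + + 1 + + 1) cs′ (proj₂ al₂)
      ex : ev x ≡ 1ℤ
      ex = evpt-10⁻ {x} {y} {x + d₁} {y + + 1} ey ev₁ (proj₁ al₁)
      eX : ev X ≡ 1ℤ
      eX = evpt-10⁻ {X} {y + + 1 + + 1} {X + d₃} {y + + 1 + + 1 + + 1} ev₁₁ ev₁₁₁ (proj₁ al₃)
      convex₁ : + 1 * (x + d₁ + d₂ - x) ≤ d₁ * (y + + 1 + + 1 - y)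
      convex₁ = chain-left {S} {d₁} {0} {(d₂ , 0) ∷ (d₃ , 0) ∷ []} {x} {y} {x + d₁ + d₂} {y + + 1 + + 1} sup (proj₁ (proj₂ (proj₂ ver)))
      convex₂ : + 1 * (x + d₁ + d₂ + d₃ - (x + d₁)) ≤ d₂ * (y + + 1 + + 1 + + 1 - (y + + 1))
      convex₂ = chain-left {S} {d₂} {0} {(d₃ , 0) ∷ []} {x + d₁} {y + + 1} {x + d₁ + d₂ + d₃} {y + + 1 + + 1 + + 1} sup′ (proj₂ (proj₂ (proj₂ ver)))
      go : (Σ ℤ λ w → x ≡ w + w) → (Σ ℤ λ v → X ≡ v + v) → Shape x ((d₁ , 0) ∷ (d₂ , 0) ∷ (d₃ , 0) ∷ [])
      go (w , e) (v , f) = subst₂ Shape (sym e) (cong₂ (λ p q → (p , 0) ∷ (q , 0) ∷ (d₃ , 0) ∷ []) (sym d₁≡) (l₄ d₂ d₃))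
          (three-edges w a (d₂ - d₃) d₃ (half-nonneg {a} (subst (0ℤ ≤_) (trans (l₂ x d₁ d₂ y) (trans (cong (λ q → q - d₂) d₁≡) (l₃ d₂ d₃ a))) (diff convex₁))) (subst (0ℤ ≤_) (l₅ x d₁ d₂ d₃ y) (diff convex₂)))
        where
        a = v - w - d₂
        d₁≡ : d₁ ≡ d₃ + (d₂ - d₃) + (a + a)
        d₁≡ = trans (l₀ x d₁ d₂) (trans (cong₂ (λ p q → p - q - d₂) f e) (l₁ v w d₂ d₃))
          where
          l₀ : ∀ x d e → d ≡ x + d + e - x - e
          l₀ = ℤring 3 (λ x d e → d := x :+ d :+ e :- x :- e)
          l₁ : ∀ v w d e → v + v - (w + w) - d ≡ e + (d - e) + (v - w - d + (v - w - d))
          l₁ = ℤring 4 (λ v w d e → v :+ v :- (w :+ w) :- d := e :+ (d :- e) :+ (v :- w :- d :+ (v :- w :- d)))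
        l₂ : ∀ x d e y → d * (y + + 1 + + 1 - y) - + 1 * (x + d + e - x) ≡ d - e
        l₂ = ℤring 4 (λ x d e y → d :* (y :+ # 1 :+ # 1 :- y) :- # 1 :* (x :+ d :+ e :- x) := d :- e)
        l₃ : ∀ d e a → e + (d - e) + (a + a) - d ≡ a + a
        l₃ = ℤring 3 (λ d e a → e :+ (d :- e) :+ (a :+ a) :- d := a :+ a)
        l₄ : ∀ d e → e + (d - e) ≡ d
        l₄ = ℤring 2 (λ d e → e :+ (d :- e) := d)
        l₅ : ∀ x d e f y → e * (y + + 1 + + 1 + + 1 - (y + + 1)) - + 1 * (x + d + e + f - (x + d)) ≡ e - f
        l₅ = ℤring 5 (λ x d e f y → e :* (y :+ # 1 :+ # 1 :+ # 1 :- (y :+ # 1)) :- # 1 :* (x :+ d :+ e :+ f :- (x :+ d)) := e :- f)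
    shape ((d₁ , 0) ∷ (d₂ , 0) ∷ (d₃ , 0) ∷ _ ∷ _) x _ () _ _ _
    shape ((d₁ , 0) ∷ (d₂ , 0) ∷ (d₃ , suc _) ∷ _) x _ () _ _ _
open Shapes public

-- Solving the equations for area, boundary and interior points

module Classification where
  open Z using (_≤_; _<_; _+_; _*_; _-_; -_)
  open ℤArith

  shear : ℤ → List Edge → List Edge
  shear m [] = []
  shear m ((D , h) ∷ es) = (D + m * + suc h , h) ∷ shear m es

  shearAU : ℤ → ℤ → ℤ → AffUnimod
  shearAU m c d = affU 1ℤ m 0ℤ 1ℤ c d (inj₁ (l m))
    where
    l : ∀ m → 1ℤ * 1ℤ - m * 0ℤ ≡ 1ℤ
    l = ℤring 1 (λ m → # 1 :* # 1 :- m :* # 0 := # 1)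

  shear-pts : ∀ m c d es x y x′ y′ → x + m * y + (c + c) ≡ x′ → y + (d + d) ≡ y′ → map (act (shearAU m c d)) (chainPts es x y) ≡ chainPts (shear m es) x′ y′
  shear-pts m c d [] x y _ _ refl refl = cong (λ z → z ∷ []) (cong₂ _,_ (cong (λ q → q + m * y + (c + c)) (ℤP.*-identityˡ x)) (l x y d))
    where
    l : ∀ x y d → 0ℤ * x + 1ℤ * y + (d + d) ≡ y + (d + d)
    l = ℤring 3 (λ x y d → # 0 :* x :+ # 1 :* y :+ (d :+ d) := y :+ (d :+ d))
  shear-pts m c d ((D , h) ∷ es) x y _ _ refl refl = cong₂ _∷_ (cong₂ _,_ (cong (λ q → q + m * y + (c + c)) (ℤP.*-identityˡ x)) (l x y d))
      (shear-pts m c d es (x + D) (y + + suc h) (x + m * y + (c + c) + (D + m * + suc h)) (y + (d + d) + + suc h) (l₁ x D m y (+ suc h) c) (l₂ y (+ suc h) d))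
    where
    l : ∀ x y d → 0ℤ * x + 1ℤ * y + (d + d) ≡ y + (d + d)
    l = ℤring 3 (λ x y d → # 0 :* x :+ # 1 :* y :+ (d :+ d) := y :+ (d :+ d))
    l₁ : ∀ x D m y H c → x + D + m * (y + H) + (c + c) ≡ x + m * y + (c + c) + (D + m * H)
    l₁ = ℤring 6 (λ x D m y H c → x :+ D :+ m :* (y :+ H) :+ (c :+ c) := x :+ m :* y :+ (c :+ c) :+ (D :+ m :* H))
    l₂ : ∀ y H d → y + H + (d + d) ≡ y + (d + d) + H
    l₂ = ℤring 3 (λ y H d → y :+ H :+ (d :+ d) := y :+ (d :+ d) :+ H)

  -- The shear by `m` and the translation by `(c , d)` match the two hulls vertex by vertex; on the
  -- mirrored left chain `m` and `c` change sign. Translations appear doubled because the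
  -- coordinates are.
  record Sheared (R L : List Edge) (x x′ y : ℤ) (R₁ L₁ : List Edge) (x₁ x₁′ y₁ : ℤ) : Set where
    constructor sheared
    field
      m c d : ℤ
      right≡ : shear m R ≡ R₁
      left≡ : shear (- m) L ≡ L₁
      x≡ : x + m * y + (c + c) ≡ x₁
      x′≡ : x′ + - m * y + (- c + - c) ≡ x₁′
      y≡ : y + (d + d) ≡ y₁

  act-mirror : ∀ {S} (P : Hull S) m c d z → act (shearAU m c d) (HullFacts.mirrorPt P z) ≡ HullFacts.mirrorPt P (act (shearAU (- m) (- c) d) z)
  act-mirror P m c d (x , y) = cong₂ _,_ (l₁ m c x y) (l₂ d x y)
    where
    l₁ : ∀ m c x y → 1ℤ * - x + m * y + (c + c) ≡ - (1ℤ * x + - m * y + (- c + - c))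
    l₁ = ℤring 4 (λ m c x y → # 1 :* :- x :+ m :* y :+ (c :+ c) := :- (# 1 :* x :+ :- m :* y :+ (:- c :+ :- c)))
    l₂ : ∀ d x y → 0ℤ * - x + 1ℤ * y + (d + d) ≡ 0ℤ * x + 1ℤ * y + (d + d)
    l₂ = ℤring 3 (λ d x y → # 0 :* :- x :+ # 1 :* y :+ (d :+ d) := # 0 :* x :+ # 1 :* y :+ (d :+ d))

  -- The map carries the chain points of one hull onto those of the other, and by `conv-pts` these
  -- determine the polygons.
  sheared-equiv : ∀ {S T} (P : Hull S) (Q : Hull T) → Sheared (Hull.R P) (Hull.L P) (Hull.xR P) (Hull.xL P) (Hull.y₀ P) (Hull.R Q) (Hull.L Q) (Hull.xR Q) (Hull.xL Q) (Hull.y₀ Q) → AffEquiv S T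
  sheared-equiv {S} {T} P Q (sheared m c d rr ll xx xx′ yy) = toEquiv f (λ p → forth p , back p)
    where
    f = shearAU m c d
    module HP = HullFacts P
    module HQ = HullFacts Q
    mirrored : ∀ zs → map (act f) (map HP.mirrorPt zs) ≡ map HQ.mirrorPt (map (act (shearAU (- m) (- c) d)) zs)
    mirrored [] = refl
    mirrored (z ∷ zs) = cong₂ _∷_ (act-mirror P m c d z) (mirrored zs)
    chain≡ : ∀ m c es x y {es′ x′ y′} → shear m es ≡ es′ → x + m * y + (c + c) ≡ x′ → y + (d + d) ≡ y′ → map (act (shearAU m c d)) (chainPts es x y) ≡ chainPts es′ x′ y′
    chain≡ m c es x y refl e g = shear-pts m c d es x y _ _ e g
    pts≡ : map (act f) HP.hullPts ≡ HQ.hullPts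
    pts≡ = trans (LP.map-++ (act f) (chainPts (Hull.R P) (Hull.xR P) (Hull.y₀ P)) (map HP.mirrorPt (chainPts (Hull.L P) (Hull.xL P) (Hull.y₀ P))))
        (cong₂ _++_ (chain≡ m c (Hull.R P) (Hull.xR P) (Hull.y₀ P) rr xx yy)
          (trans (mirrored (chainPts (Hull.L P) (Hull.xL P) (Hull.y₀ P))) (cong (map HQ.mirrorPt) (chain≡ (- m) (- c) (Hull.L P) (Hull.xL P) (Hull.y₀ P) ll xx′ yy))))
    forth : ∀ p → InConv S p → InConv T (applyAU f p)
    forth p i = conv-image {map halfPt HP.hullPts} {T} {applyAU f} (au-affine f) gen (HP.conv-pts (λ {z} j → conv-gen (∈-map⁺ halfPt {x = z} j)) i)
      where
      gen : ∀ {s} → s ∈ map halfPt HP.hullPts → InConv T (applyAU f s)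
      gen {s} j = at (∈-map⁻ halfPt j)
        where
        at : (Σ ZPt λ z → z ∈ HP.hullPts × s ≡ halfPt z) → InConv T (applyAU f s)
        at (z , k , refl) = subst (InConv T) (sym (applyAU-half f z)) (HQ.hullPts-in (subst (act f z ∈_) pts≡ (∈-map⁺ (act f) k)))
    back : ∀ p → InConv T (applyAU f p) → InConv S p
    back p i = subst (InConv S) (inverseˡ f p) (conv-image {map halfPt HQ.hullPts} {S} {applyAU (inverse f)} (au-affine (inverse f)) gen (HQ.conv-pts (λ {z} j → conv-gen (∈-map⁺ halfPt {x = z} j)) i))
      where
      gen : ∀ {t} → t ∈ map halfPt HQ.hullPts → InConv S (applyAU (inverse f) t)
      gen {t} j = at (∈-map⁻ halfPt j)
        where
        at : (Σ ZPt λ z → z ∈ HQ.hullPts × t ≡ halfPt z) → InConv S (applyAU (inverse f) t)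
        at (z′ , k , refl) = at′ (∈-map⁻ (act f) (subst (z′ ∈_) (sym pts≡) k))
          where
          at′ : (Σ ZPt λ z → z ∈ HP.hullPts × z′ ≡ act f z) → InConv S (applyAU (inverse f) (halfPt z′))
          at′ (z , k′ , refl) = subst (InConv S) (trans (sym (inverseˡ f (halfPt z))) (cong (applyAU (inverse f)) (applyAU-half f z))) (HP.hullPts-in k′)

  -- The conditions on the chains for height 3 and an even bottom row. The top row is then odd, so
  -- the top side degenerates to a point.
  record Balance (I : ℤ) (R L : List Edge) (x x′ y : ℤ) : Set where
    constructor balance
    field
      points : + length R + + length L + (x + x′) ≡ + 4 * I + + 14
      apex : endX R x + endX L x′ ≡ 0ℤ
      area-total : area R x + area L x′ ≡ + 16 * I + + 20
      inner-total : innerSum R x y + innerSum L x′ y ≡ + 2 * I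

  balance-swap : ∀ {I R L x x′ y} → Balance I R L x x′ y → Balance I L R x′ x y
  balance-swap {I} {R} {L} {x} {x′} {y} (balance p a t n) = balance (trans (cong₂ _+_ (ℤP.+-comm (+ length L) (+ length R)) (ℤP.+-comm x′ x)) p)
      (trans (ℤP.+-comm (endX L x′) (endX R x)) a) (trans (ℤP.+-comm (area L x′) (area R x)) t) (trans (ℤP.+-comm (innerSum L x′ y) (innerSum R x y)) n)

  -- Eliminating the widths and slopes leaves two expressions for 2I, which force the slacks of the shapes to vanish.
  record Solved (I x x′ d d′ N E A J : ℤ) : Set where
    constructor solved
    field
      width : x + x′ ≡ + 4 * I + + 14 - N
      slopes : d + d′ ≡ J - E - + 2 * I
      first : + 2 * I ≡ + 14 - N + + 3 * J - + 2 * E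
      second : + 2 * I ≡ + 20 + + 9 * J - + 3 * E - A

  solve-balance : ∀ {I R L x x′ y d d′ N N′ E E′ A A′ J J′} → Profile R x y d N E A J → Profile L x′ y d′ N′ E′ A′ J′ → Balance I R L x x′ y →
    Solved I x x′ d d′ (N + N′) (E + E′) (A + A′) (J + J′)
  solve-balance {I} {R} {L} {x} {x′} {y} {d} {d′} {N} {N′} {E} {E′} {A} {A′} {J} {J′} p p′ (balance g₁ g₂ g₃ g₄) = solved
      (lin (1ℤ ∙ h₁) (l₁ I x x′ N N′)) (lin (1ℤ ∙ h₂ ⊞ (- 1ℤ) ∙ h₄) (l₂ I x x′ d d′ E E′ J J′))
      (lin (1ℤ ∙ h₁ ⊞ + 2 ∙ h₂ ⊞ (- (+ 3)) ∙ h₄) (l₃ I x x′ d d′ N N′ E E′ J J′)) (lin (1ℤ ∙ h₃ ⊞ + 3 ∙ h₂ ⊞ (- (+ 9)) ∙ h₄) (l₄ I x x′ d d′ E E′ A A′ J J′))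
    where
    module p = Profile p
    module p′ = Profile p′
    h₁ : N + N′ + (x + x′) ≡ + 4 * I + + 14
    h₁ = trans (cong (λ q → q + (x + x′)) (sym (cong₂ _+_ p.length≡ p′.length≡))) g₁
    h₂ : x + + 3 * d + E + (x′ + + 3 * d′ + E′) ≡ 0ℤ
    h₂ = trans (sym (cong₂ _+_ p.end p′.end)) g₂
    h₃ : + 6 * x + + 9 * d + A + (+ 6 * x′ + + 9 * d′ + A′) ≡ + 16 * I + + 20
    h₃ = trans (sym (cong₂ _+_ p.area≡ p′.area≡)) g₃
    h₄ : x + + 2 * d + J + (x′ + + 2 * d′ + J′) ≡ + 2 * I
    h₄ = trans (sym (cong₂ _+_ p.inner≡ p′.inner≡)) g₄
    l₁ : ∀ I x x′ N N′ → x + x′ - (+ 4 * I + + 14 - (N + N′)) ≡ 1ℤ * (N + N′ + (x + x′) - (+ 4 * I + + 14))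
    l₁ = ℤring 5 (λ I x x′ N N′ → x :+ x′ :- (# 4 :* I :+ # 14 :- (N :+ N′)) := # 1 :* (N :+ N′ :+ (x :+ x′) :- (# 4 :* I :+ # 14)))
    l₂ : ∀ I x x′ d d′ E E′ J J′ → d + d′ - (J + J′ - (E + E′) - + 2 * I) ≡ 1ℤ * (x + + 3 * d + E + (x′ + + 3 * d′ + E′) - 0ℤ) + - 1ℤ * (x + + 2 * d + J + (x′ + + 2 * d′ + J′) - + 2 * I)
    l₂ = ℤring 9 (λ I x x′ d d′ E E′ J J′ → d :+ d′ :- (J :+ J′ :- (E :+ E′) :- # 2 :* I) := # 1 :* (x :+ # 3 :* d :+ E :+ (x′ :+ # 3 :* d′ :+ E′) :- # 0) :+ :- # 1 :* (x :+ # 2 :* d :+ J :+ (x′ :+ # 2 :* d′ :+ J′) :- # 2 :* I))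
    l₃ : ∀ I x x′ d d′ N N′ E E′ J J′ → + 2 * I - (+ 14 - (N + N′) + + 3 * (J + J′) - + 2 * (E + E′)) ≡
      1ℤ * (N + N′ + (x + x′) - (+ 4 * I + + 14)) + + 2 * (x + + 3 * d + E + (x′ + + 3 * d′ + E′) - 0ℤ) + - (+ 3) * (x + + 2 * d + J + (x′ + + 2 * d′ + J′) - + 2 * I)
    l₃ = ℤring 11 (λ I x x′ d d′ N N′ E E′ J J′ → # 2 :* I :- (# 14 :- (N :+ N′) :+ # 3 :* (J :+ J′) :- # 2 :* (E :+ E′)) := # 1 :* (N :+ N′ :+ (x :+ x′) :- (# 4 :* I :+ # 14)) :+ # 2 :* (x :+ # 3 :* d :+ E :+ (x′ :+ # 3 :* d′ :+ E′) :- # 0) :+ :- (# 3) :* (x :+ # 2 :* d :+ J :+ (x′ :+ # 2 :* d′ :+ J′) :- # 2 :* I))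
    l₄ : ∀ I x x′ d d′ E E′ A A′ J J′ → + 2 * I - (+ 20 + + 9 * (J + J′) - + 3 * (E + E′) - (A + A′)) ≡
      1ℤ * (+ 6 * x + + 9 * d + A + (+ 6 * x′ + + 9 * d′ + A′) - (+ 16 * I + + 20)) + + 3 * (x + + 3 * d + E + (x′ + + 3 * d′ + E′) - 0ℤ) + - (+ 9) * (x + + 2 * d + J + (x′ + + 2 * d′ + J′) - + 2 * I)
    l₄ = ℤring 11 (λ I x x′ d d′ E E′ A A′ J J′ → # 2 :* I :- (# 20 :+ # 9 :* (J :+ J′) :- # 3 :* (E :+ E′) :- (A :+ A′)) := # 1 :* (# 6 :* x :+ # 9 :* d :+ A :+ (# 6 :* x′ :+ # 9 :* d′ :+ A′) :- (# 16 :* I :+ # 20)) :+ # 3 :* (x :+ # 3 :* d :+ E :+ (x′ :+ # 3 :* d′ :+ E′) :- # 0) :+ :- (# 9) :* (x :+ # 2 :* d :+ J :+ (x′ :+ # 2 :* d′ :+ J′) :- # 2 :* I))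

  -- The chains of the polygons of the theorem in doubled coordinates, with apex `(0 , 3)` and
  -- vertical upper left edges.
  famA-R famA-L : ℤ → ℤ → List Edge
  famA-R I a = (- (a + a + + 4) , 0) ∷ (- (+ 2 * I + + 2) , 0) ∷ (- (+ 2 * I + + 2) , 0) ∷ []
  famA-L I a = (a + a , 0) ∷ (0ℤ , 0) ∷ (0ℤ , 0) ∷ []
  famS-R : ℤ → List Edge
  famS-R I = (- (+ 6) , 0) ∷ (- (+ 2 * I + + 2) , 0) ∷ (- (+ 2 * I + + 2) , 0) ∷ []
  famS-L famS3-R : List Edge
  famS-L = (+ 1 , 1) ∷ (0ℤ , 0) ∷ []
  famS3-R = (- (+ 15) , 1) ∷ (- (+ 8) , 0) ∷ []

  data Outcome (I : ℤ) (R L : List Edge) (x x′ y : ℤ) : Set where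
    family-a : ∀ a → 0ℤ ≤ a → a ≤ I - 1ℤ → + 2 * a ≤ I - 1ℤ → Sheared R L x x′ y (famA-R I a) (famA-L I a) (a + a + (+ 4 * I + + 8)) (- (a + a)) 0ℤ → Outcome I R L x x′ y
    family-s : + 2 ≤ I → Sheared R L x x′ y (famS-R I) famS-L (+ 4 * I + + 10) (- (+ 1)) 0ℤ → Outcome I R L x x′ y
    family-s3 : I ≡ + 3 → Sheared R L x x′ y famS3-R famS-L (+ 23) (- (+ 1)) 0ℤ → Outcome I R L x x′ y

  module _ {I u : ℤ} where
    private
      y = u + u

    steps : ∀ {a b c a′ b′ c′ : ℤ} → a ≡ a′ → b ≡ b′ → c ≡ c′ → _≡_ {A = List Edge} ((a , 0) ∷ (b , 0) ∷ (c , 0) ∷ []) ((a′ , 0) ∷ (b′ , 0) ∷ (c′ , 0) ∷ [])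
    steps refl refl refl = refl

    steps₂ : ∀ {a b a′ b′ : ℤ} → a ≡ a′ → b ≡ b′ → _≡_ {A = List Edge} ((a , 1) ∷ (b , 0) ∷ []) ((a′ , 1) ∷ (b′ , 0) ∷ [])
    steps₂ refl refl = refl

    bottom≡ : ∀ u → u + u + (- u + - u) ≡ 0ℤ
    bottom≡ = ℤring 1 (λ u → u :+ u :+ (:- u :+ :- u) := # 0)

    -- The shear `m = d′` makes the upper left edges vertical, and the translation moves them to
    -- abscissa 0 and the bottom row to height 0. `A-B` and `two-B` make the same choice.
    two-A : ∀ w a d w′ a′ d′ → w + w + (w′ + w′) ≡ + 4 * I + + 8 → d + d′ ≡ - (+ 2 * I + + 2) → a + a′ ≡ I - 1ℤ →
      Sheared (shapeA a 0ℤ d) (shapeA a′ 0ℤ d′) (w + w) (w′ + w′) y (famA-R I a′) (famA-L I a′) (a′ + a′ + (+ 4 * I + + 8)) (- (a′ + a′)) 0ℤ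
    two-A w a d w′ a′ d′ W D Σa = sheared d′ (w′ - d′ * u + a′) (- u)
        (steps (lin (1ℤ ∙ D ⊞ + 2 ∙ Σa) (r₁ I a d a′ d′)) (lin (1ℤ ∙ D) (r₂ I d d′)) (lin (1ℤ ∙ D) (r₃ I d d′)))
        (steps (q₁ a′ d′) (q₂ d′) (q₃ d′)) (lin (1ℤ ∙ W) (r₄ I w w′ d′ u a′)) (q₄ w′ d′ u a′) (bottom≡ u)
      where
      r₁ : ∀ I a d a′ d′ → d + 0ℤ + (a + a) + d′ * + 1 - - (a′ + a′ + + 4) ≡ 1ℤ * (d + d′ - - (+ 2 * I + + 2)) + + 2 * (a + a′ - (I - 1ℤ))
      r₁ = ℤring 5 (λ I a d a′ d′ → d :+ # 0 :+ (a :+ a) :+ d′ :* # 1 :- :- (a′ :+ a′ :+ # 4) := # 1 :* (d :+ d′ :- :- (# 2 :* I :+ # 2)) :+ # 2 :* (a :+ a′ :- (I :- # 1)))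
      r₂ : ∀ I d d′ → d + 0ℤ + d′ * + 1 - - (+ 2 * I + + 2) ≡ 1ℤ * (d + d′ - - (+ 2 * I + + 2))
      r₂ = ℤring 3 (λ I d d′ → d :+ # 0 :+ d′ :* # 1 :- :- (# 2 :* I :+ # 2) := # 1 :* (d :+ d′ :- :- (# 2 :* I :+ # 2)))
      r₃ : ∀ I d d′ → d + d′ * + 1 - - (+ 2 * I + + 2) ≡ 1ℤ * (d + d′ - - (+ 2 * I + + 2))
      r₃ = ℤring 3 (λ I d d′ → d :+ d′ :* # 1 :- :- (# 2 :* I :+ # 2) := # 1 :* (d :+ d′ :- :- (# 2 :* I :+ # 2)))
      r₄ : ∀ I w w′ d′ u a′ → w + w + d′ * (u + u) + (w′ - d′ * u + a′ + (w′ - d′ * u + a′)) - (a′ + a′ + (+ 4 * I + + 8)) ≡ 1ℤ * (w + w + (w′ + w′) - (+ 4 * I + + 8))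
      r₄ = ℤring 6 (λ I w w′ d′ u a′ → w :+ w :+ d′ :* (u :+ u) :+ (w′ :- d′ :* u :+ a′ :+ (w′ :- d′ :* u :+ a′)) :- (a′ :+ a′ :+ (# 4 :* I :+ # 8)) := # 1 :* (w :+ w :+ (w′ :+ w′) :- (# 4 :* I :+ # 8)))
      q₁ : ∀ a d → d + 0ℤ + (a + a) + - d * + 1 ≡ a + a
      q₁ = ℤring 2 (λ a d → d :+ # 0 :+ (a :+ a) :+ :- d :* # 1 := a :+ a)
      q₂ : ∀ d → d + 0ℤ + - d * + 1 ≡ 0ℤ
      q₂ = ℤring 1 (λ d → d :+ # 0 :+ :- d :* # 1 := # 0)
      q₃ : ∀ d → d + - d * + 1 ≡ 0ℤ
      q₃ = ℤring 1 (λ d → d :+ :- d :* # 1 := # 0)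
      q₄ : ∀ w d u a → w + w + - d * (u + u) + (- (w - d * u + a) + - (w - d * u + a)) ≡ - (a + a)
      q₄ = ℤring 4 (λ w d u a → w :+ w :+ :- d :* (u :+ u) :+ (:- (w :- d :* u :+ a) :+ :- (w :- d :* u :+ a)) := :- (a :+ a))

    A-B : ∀ w a d w′ d′ → w + w + (w′ + w′ + 1ℤ) ≡ + 4 * I + + 9 → d + d′ ≡ - (+ 2 * I + + 2) → a ≡ I - + 2 →
      Sheared (shapeA a 0ℤ d) (shapeB 0ℤ 0ℤ d′) (w + w) (w′ + w′ + 1ℤ) y (famS-R I) famS-L (+ 4 * I + + 10) (- (+ 1)) 0ℤ
    A-B w a d w′ d′ W D Σa = sheared d′ (w′ + 1ℤ - d′ * u) (- u)
        (steps (lin (1ℤ ∙ D ⊞ + 2 ∙ Σa) (r₁ I a d d′)) (lin (1ℤ ∙ D) (r₂ I d d′)) (lin (1ℤ ∙ D) (r₃ I d d′)))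
        (steps₂ (q₁ d′) (q₂ d′)) (lin (1ℤ ∙ W) (r₄ I w w′ d′ u)) (q₄ w′ d′ u) (bottom≡ u)
      where
      r₁ : ∀ I a d d′ → d + 0ℤ + (a + a) + d′ * + 1 - - (+ 6) ≡ 1ℤ * (d + d′ - - (+ 2 * I + + 2)) + + 2 * (a - (I - + 2))
      r₁ = ℤring 4 (λ I a d d′ → d :+ # 0 :+ (a :+ a) :+ d′ :* # 1 :- :- (# 6) := # 1 :* (d :+ d′ :- :- (# 2 :* I :+ # 2)) :+ # 2 :* (a :- (I :- # 2)))
      r₂ : ∀ I d d′ → d + 0ℤ + d′ * + 1 - - (+ 2 * I + + 2) ≡ 1ℤ * (d + d′ - - (+ 2 * I + + 2))
      r₂ = ℤring 3 (λ I d d′ → d :+ # 0 :+ d′ :* # 1 :- :- (# 2 :* I :+ # 2) := # 1 :* (d :+ d′ :- :- (# 2 :* I :+ # 2)))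
      r₃ : ∀ I d d′ → d + d′ * + 1 - - (+ 2 * I + + 2) ≡ 1ℤ * (d + d′ - - (+ 2 * I + + 2))
      r₃ = ℤring 3 (λ I d d′ → d :+ d′ :* # 1 :- :- (# 2 :* I :+ # 2) := # 1 :* (d :+ d′ :- :- (# 2 :* I :+ # 2)))
      r₄ : ∀ I w w′ d′ u → w + w + d′ * (u + u) + (w′ + 1ℤ - d′ * u + (w′ + 1ℤ - d′ * u)) - (+ 4 * I + + 10) ≡ 1ℤ * (w + w + (w′ + w′ + 1ℤ) - (+ 4 * I + + 9))
      r₄ = ℤring 5 (λ I w w′ d′ u → w :+ w :+ d′ :* (u :+ u) :+ (w′ :+ # 1 :- d′ :* u :+ (w′ :+ # 1 :- d′ :* u)) :- (# 4 :* I :+ # 10) := # 1 :* (w :+ w :+ (w′ :+ w′ :+ # 1) :- (# 4 :* I :+ # 9)))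
      q₁ : ∀ d → d + d + (0ℤ + 0ℤ + 1ℤ) + - d * + 2 ≡ + 1
      q₁ = ℤring 1 (λ d → d :+ d :+ (# 0 :+ # 0 :+ # 1) :+ :- d :* # 2 := # 1)
      q₂ : ∀ d → d + - d * + 1 ≡ 0ℤ
      q₂ = ℤring 1 (λ d → d :+ :- d :* # 1 := # 0)
      q₄ : ∀ w d u → w + w + 1ℤ + - d * (u + u) + (- (w + 1ℤ - d * u) + - (w + 1ℤ - d * u)) ≡ - (+ 1)
      q₄ = ℤring 3 (λ w d u → w :+ w :+ # 1 :+ :- d :* (u :+ u) :+ (:- (w :+ # 1 :- d :* u) :+ :- (w :+ # 1 :- d :* u)) := :- (# 1))

    two-B : ∀ w d w′ d′ → w + w + 1ℤ + (w′ + w′ + 1ℤ) ≡ + 22 → d + d′ ≡ - (+ 8) →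
      Sheared (shapeB 0ℤ 0ℤ d) (shapeB 0ℤ 0ℤ d′) (w + w + 1ℤ) (w′ + w′ + 1ℤ) y famS3-R famS-L (+ 23) (- (+ 1)) 0ℤ
    two-B w d w′ d′ W D = sheared d′ (w′ + 1ℤ - d′ * u) (- u) (steps₂ (lin (+ 2 ∙ D) (r₁ d d′)) (lin (1ℤ ∙ D) (r₃ d d′)))
        (steps₂ (q₁ d′) (q₂ d′)) (lin (1ℤ ∙ W) (r₄ w w′ d′ u)) (q₄ w′ d′ u) (bottom≡ u)
      where
      r₁ : ∀ d d′ → d + d + (0ℤ + 0ℤ + 1ℤ) + d′ * + 2 - - (+ 15) ≡ + 2 * (d + d′ - - (+ 8))
      r₁ = ℤring 2 (λ d d′ → d :+ d :+ (# 0 :+ # 0 :+ # 1) :+ d′ :* # 2 :- :- (# 15) := # 2 :* (d :+ d′ :- :- (# 8)))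
      r₃ : ∀ d d′ → d + d′ * + 1 - - (+ 8) ≡ 1ℤ * (d + d′ - - (+ 8))
      r₃ = ℤring 2 (λ d d′ → d :+ d′ :* # 1 :- :- (# 8) := # 1 :* (d :+ d′ :- :- (# 8)))
      r₄ : ∀ w w′ d′ u → w + w + 1ℤ + d′ * (u + u) + (w′ + 1ℤ - d′ * u + (w′ + 1ℤ - d′ * u)) - + 23 ≡ 1ℤ * (w + w + 1ℤ + (w′ + w′ + 1ℤ) - + 22)
      r₄ = ℤring 4 (λ w w′ d′ u → w :+ w :+ # 1 :+ d′ :* (u :+ u) :+ (w′ :+ # 1 :- d′ :* u :+ (w′ :+ # 1 :- d′ :* u)) :- # 23 := # 1 :* (w :+ w :+ # 1 :+ (w′ :+ w′ :+ # 1) :- # 22))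
      q₁ : ∀ d → d + d + (0ℤ + 0ℤ + 1ℤ) + - d * + 2 ≡ + 1
      q₁ = ℤring 1 (λ d → d :+ d :+ (# 0 :+ # 0 :+ # 1) :+ :- d :* # 2 := # 1)
      q₂ : ∀ d → d + - d * + 1 ≡ 0ℤ
      q₂ = ℤring 1 (λ d → d :+ :- d :* # 1 := # 0)
      q₄ : ∀ w d u → w + w + 1ℤ + - d * (u + u) + (- (w + 1ℤ - d * u) + - (w + 1ℤ - d * u)) ≡ - (+ 1)
      q₄ = ℤring 3 (λ w d u → w :+ w :+ # 1 :+ :- d :* (u :+ u) :+ (:- (w :+ # 1 :- d :* u) :+ :- (w :+ # 1 :- d :* u)) := :- (# 1))

    private
      module E = EvenStart y (ev-even u)

    -- The two expressions for `2I` differ by `2(b + b′)`, so both slacks vanish, and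
    -- `a + a′ = I - 1` remains. Putting the smaller parameter on the left, possibly after a
    -- reflection, gives the condition `2a ≤ I - 1`.
    cases-AA : ∀ w a b d w′ a′ b′ d′ → 0ℤ ≤ a → 0ℤ ≤ b → 0ℤ ≤ a′ → 0ℤ ≤ b′ → let R = shapeA a b d ; L = shapeA a′ b′ d′ ; x = w + w ; x′ = w′ + w′ in
      Balance I R L x x′ y → Outcome I R L x x′ y ⊎ Outcome I L R x′ x y
    cases-AA w a b d w′ a′ b′ d′ a≥0 b≥0 a′≥0 b′≥0 bal = close (*-cancel 1 (lin ((- 1ℤ) ∙ sym first ⊞ (- 1ℤ) ∙ second) (l I a b a′ b′))) (solve-balance (E.profile-A w a b d refl refl) (E.profile-A w′ a′ b′ d′ refl refl) bal) 
      where
      open Solved (solve-balance (E.profile-A w a b d refl refl) (E.profile-A w′ a′ b′ d′ refl refl) bal)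
      l : ∀ I a b a′ b′ → + 2 * (b + b′) - + 2 * 0ℤ ≡ - 1ℤ * (+ 14 - + 6 + + 3 * (+ 2 * (a + b) - 1ℤ + (+ 2 * (a′ + b′) - 1ℤ)) - + 2 * (+ 2 * (a + b) + + 2 * (a′ + b′)) - + 2 * I) +
        - 1ℤ * (+ 2 * I - (+ 20 + + 9 * (+ 2 * (a + b) - 1ℤ + (+ 2 * (a′ + b′) - 1ℤ)) - + 3 * (+ 2 * (a + b) + + 2 * (a′ + b′)) - (+ 10 * a + + 8 * b + (+ 10 * a′ + + 8 * b′))))
      l = ℤring 5 (λ I a b a′ b′ → # 2 :* (b :+ b′) :- # 2 :* # 0 := :- # 1 :* (# 14 :- # 6 :+ # 3 :* (# 2 :* (a :+ b) :- # 1 :+ (# 2 :* (a′ :+ b′) :- # 1)) :- # 2 :* (# 2 :* (a :+ b) :+ # 2 :* (a′ :+ b′)) :- # 2 :* I) :+ :- # 1 :* (# 2 :* I :- (# 20 :+ # 9 :* (# 2 :* (a :+ b) :- # 1 :+ (# 2 :* (a′ :+ b′) :- # 1)) :- # 3 :* (# 2 :* (a :+ b) :+ # 2 :* (a′ :+ b′)) :- (# 10 :* a :+ # 8 :* b :+ (# 10 :* a′ :+ # 8 :* b′)))))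
      close : b + b′ ≡ 0ℤ → Solved I (w + w) (w′ + w′) d d′ (+ 6) (+ 2 * (a + b) + + 2 * (a′ + b′)) (+ 10 * a + + 8 * b + (+ 10 * a′ + + 8 * b′)) (+ 2 * (a + b) - 1ℤ + (+ 2 * (a′ + b′) - 1ℤ)) →
        Outcome I (shapeA a b d) (shapeA a′ b′ d′) (w + w) (w′ + w′) y ⊎ Outcome I (shapeA a′ b′ d′) (shapeA a b d) (w′ + w′) (w + w) y
      close e (solved W D F _) = close′ (proj₁ (sum-zero₂ b≥0 b′≥0 e)) (proj₂ (sum-zero₂ b≥0 b′≥0 e)) W D F
        where
        close′ : ∀ {b b′} → b ≡ 0ℤ → b′ ≡ 0ℤ → w + w + (w′ + w′) ≡ + 4 * I + + 14 - + 6 → d + d′ ≡ + 2 * (a + b) - 1ℤ + (+ 2 * (a′ + b′) - 1ℤ) - (+ 2 * (a + b) + + 2 * (a′ + b′)) - + 2 * I →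
          + 2 * I ≡ + 14 - + 6 + + 3 * (+ 2 * (a + b) - 1ℤ + (+ 2 * (a′ + b′) - 1ℤ)) - + 2 * (+ 2 * (a + b) + + 2 * (a′ + b′)) →
          Outcome I (shapeA a b d) (shapeA a′ b′ d′) (w + w) (w′ + w′) y ⊎ Outcome I (shapeA a′ b′ d′) (shapeA a b d) (w′ + w′) (w + w) y
        close′ refl refl W D F = choose (+ 2 * a′ Z.≤? I - 1ℤ)
          where
          W′ : w + w + (w′ + w′) ≡ + 4 * I + + 8
          W′ = trans W (l₁ I)
            where
            l₁ : ∀ I → + 4 * I + + 14 - + 6 ≡ + 4 * I + + 8
            l₁ = ℤring 1 (λ I → # 4 :* I :+ # 14 :- # 6 := # 4 :* I :+ # 8)
          D′ : d + d′ ≡ - (+ 2 * I + + 2)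
          D′ = trans D (l₂ I a a′)
            where
            l₂ : ∀ I a a′ → + 2 * (a + 0ℤ) - 1ℤ + (+ 2 * (a′ + 0ℤ) - 1ℤ) - (+ 2 * (a + 0ℤ) + + 2 * (a′ + 0ℤ)) - + 2 * I ≡ - (+ 2 * I + + 2)
            l₂ = ℤring 3 (λ I a a′ → # 2 :* (a :+ # 0) :- # 1 :+ (# 2 :* (a′ :+ # 0) :- # 1) :- (# 2 :* (a :+ # 0) :+ # 2 :* (a′ :+ # 0)) :- # 2 :* I := :- (# 2 :* I :+ # 2))
          Σa : a + a′ ≡ I - 1ℤ
          Σa = *-cancel 1 (lin (- 1ℤ ∙ F) (l₃ I a a′))
            where
            l₃ : ∀ I a a′ → + 2 * (a + a′) - + 2 * (I - 1ℤ) ≡ - 1ℤ * (+ 2 * I - (+ 14 - + 6 + + 3 * (+ 2 * (a + 0ℤ) - 1ℤ + (+ 2 * (a′ + 0ℤ) - 1ℤ)) - + 2 * (+ 2 * (a + 0ℤ) + + 2 * (a′ + 0ℤ))))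
            l₃ = ℤring 3 (λ I a a′ → # 2 :* (a :+ a′) :- # 2 :* (I :- # 1) := :- # 1 :* (# 2 :* I :- (# 14 :- # 6 :+ # 3 :* (# 2 :* (a :+ # 0) :- # 1 :+ (# 2 :* (a′ :+ # 0) :- # 1)) :- # 2 :* (# 2 :* (a :+ # 0) :+ # 2 :* (a′ :+ # 0)))))
          summand : ∀ {a a′} → 0ℤ ≤ a → a + a′ ≡ I - 1ℤ → a′ ≤ I - 1ℤ
          summand {a} {a′} p e = subst (a′ ≤_) e (bound p (l₄ a a′))
            where
            l₄ : ∀ a a′ → a + a′ - a′ ≡ a
            l₄ = ℤring 2 (λ a a′ → a :+ a′ :- a′ := a)
          swap : ∀ {p q r} → p + q ≡ r → q + p ≡ r
          swap {p} {q} e = trans (ℤP.+-comm q p) e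
          smaller : ¬ (+ 2 * a′ ≤ I - 1ℤ) → + 2 * a ≤ I - 1ℤ
          smaller n = subst (+ 2 * a ≤_) Σa (bound (diff (ℤP.<⇒≤ (ℤP.≰⇒> (λ p → n (subst (+ 2 * a′ ≤_) Σa p))))) (l₅ a a′))
            where
            l₅ : ∀ a a′ → a + a′ - + 2 * a ≡ + 2 * a′ - (a + a′)
            l₅ = ℤring 2 (λ a a′ → a :+ a′ :- # 2 :* a := # 2 :* a′ :- (a :+ a′))
          choose : Dec (+ 2 * a′ ≤ I - 1ℤ) → Outcome I (shapeA a 0ℤ d) (shapeA a′ 0ℤ d′) (w + w) (w′ + w′) y ⊎ Outcome I (shapeA a′ 0ℤ d′) (shapeA a 0ℤ d) (w′ + w′) (w + w) y
          choose (yes p) = inj₁ (family-a a′ a′≥0 (summand a≥0 Σa) p (two-A w a d w′ a′ d′ W′ D′ Σa))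
          choose (no n) = inj₂ (family-a a a≥0 (summand a′≥0 (swap {a} {a′} Σa)) (smaller n) (two-A w′ a′ d′ w a d (swap {w + w} {w′ + w′} W′) (swap {d} {d′} D′) (swap {a} {a′} Σa)))

    -- Again the slacks `b` and `k` vanish. What remains is `a = I - 2`, so `a ≥ 0` is the origin of
    -- the condition `i > 1`.
    cases-AB : ∀ w a b d w′ k d′ → 0ℤ ≤ a → 0ℤ ≤ b → 0ℤ ≤ k → let R = shapeA a b d ; L = shapeB k 0ℤ d′ ; x = w + w ; x′ = w′ + w′ + 1ℤ in
      Balance I R L x x′ y → Outcome I R L x x′ y
    cases-AB w a b d w′ k d′ a≥0 b≥0 k≥0 bal = close (solve-balance (E.profile-A w a b d refl refl) (E.profile-B w′ k d′ refl refl) bal)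
      where
      l : ∀ I a b k → + 2 * (b + k) - + 2 * 0ℤ ≡ - 1ℤ * (+ 14 - + 5 + + 3 * (+ 2 * (a + b) - 1ℤ + + 2 * k) - + 2 * (+ 2 * (a + b) + (+ 2 * k + 1ℤ)) - + 2 * I) +
        - 1ℤ * (+ 2 * I - (+ 20 + + 9 * (+ 2 * (a + b) - 1ℤ + + 2 * k) - + 3 * (+ 2 * (a + b) + (+ 2 * k + 1ℤ)) - (+ 10 * a + + 8 * b + (+ 8 * k + + 4))))
      l = ℤring 4 (λ I a b k → # 2 :* (b :+ k) :- # 2 :* # 0 := :- # 1 :* (# 14 :- # 5 :+ # 3 :* (# 2 :* (a :+ b) :- # 1 :+ # 2 :* k) :- # 2 :* (# 2 :* (a :+ b) :+ (# 2 :* k :+ # 1)) :- # 2 :* I) :+ :- # 1 :* (# 2 :* I :- (# 20 :+ # 9 :* (# 2 :* (a :+ b) :- # 1 :+ # 2 :* k) :- # 3 :* (# 2 :* (a :+ b) :+ (# 2 :* k :+ # 1)) :- (# 10 :* a :+ # 8 :* b :+ (# 8 :* k :+ # 4)))))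
      close : Solved I (w + w) (w′ + w′ + 1ℤ) d d′ (+ 5) (+ 2 * (a + b) + (+ 2 * k + 1ℤ)) (+ 10 * a + + 8 * b + (+ 8 * k + + 4)) (+ 2 * (a + b) - 1ℤ + + 2 * k) →
        Outcome I (shapeA a b d) (shapeB k 0ℤ d′) (w + w) (w′ + w′ + 1ℤ) y
      close (solved W D F G) = close′ (proj₁ z) (proj₂ z) W D F
        where
        z = sum-zero₂ b≥0 k≥0 (*-cancel 1 (lin ((- 1ℤ) ∙ sym F ⊞ (- 1ℤ) ∙ G) (l I a b k)))
        close′ : ∀ {b k} → b ≡ 0ℤ → k ≡ 0ℤ → w + w + (w′ + w′ + 1ℤ) ≡ + 4 * I + + 14 - + 5 → d + d′ ≡ + 2 * (a + b) - 1ℤ + + 2 * k - (+ 2 * (a + b) + (+ 2 * k + 1ℤ)) - + 2 * I →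
          + 2 * I ≡ + 14 - + 5 + + 3 * (+ 2 * (a + b) - 1ℤ + + 2 * k) - + 2 * (+ 2 * (a + b) + (+ 2 * k + 1ℤ)) → Outcome I (shapeA a b d) (shapeB k 0ℤ d′) (w + w) (w′ + w′ + 1ℤ) y
        close′ refl refl W D F = family-s (bound a≥0 (sym a≡)) (A-B w a d w′ d′ (trans W (l₁ I)) (trans D (l₂ I a)) a≡)
          where
          l₁ : ∀ I → + 4 * I + + 14 - + 5 ≡ + 4 * I + + 9
          l₁ = ℤring 1 (λ I → # 4 :* I :+ # 14 :- # 5 := # 4 :* I :+ # 9)
          l₂ : ∀ I a → + 2 * (a + 0ℤ) - 1ℤ + + 2 * 0ℤ - (+ 2 * (a + 0ℤ) + (+ 2 * 0ℤ + 1ℤ)) - + 2 * I ≡ - (+ 2 * I + + 2)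
          l₂ = ℤring 2 (λ I a → # 2 :* (a :+ # 0) :- # 1 :+ # 2 :* # 0 :- (# 2 :* (a :+ # 0) :+ (# 2 :* # 0 :+ # 1)) :- # 2 :* I := :- (# 2 :* I :+ # 2))
          a≡ : a ≡ I - + 2
          a≡ = *-cancel 1 (lin (- 1ℤ ∙ F) (l₃ I a))
            where
            l₃ : ∀ I a → + 2 * a - + 2 * (I - + 2) ≡ - 1ℤ * (+ 2 * I - (+ 14 - + 5 + + 3 * (+ 2 * (a + 0ℤ) - 1ℤ + + 2 * 0ℤ) - + 2 * (+ 2 * (a + 0ℤ) + (+ 2 * 0ℤ + 1ℤ))))
            l₃ = ℤring 2 (λ I a → # 2 :* a :- # 2 :* (I :- # 2) := :- # 1 :* (# 2 :* I :- (# 14 :- # 5 :+ # 3 :* (# 2 :* (a :+ # 0) :- # 1 :+ # 2 :* # 0) :- # 2 :* (# 2 :* (a :+ # 0) :+ (# 2 :* # 0 :+ # 1)))))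

    -- Both slacks vanish, and with no parameter left the equation for `2I` fixes `I = 3`.
    cases-BB : ∀ w k d w′ k′ d′ → 0ℤ ≤ k → 0ℤ ≤ k′ → let R = shapeB k 0ℤ d ; L = shapeB k′ 0ℤ d′ ; x = w + w + 1ℤ ; x′ = w′ + w′ + 1ℤ in
      Balance I R L x x′ y → Outcome I R L x x′ y
    cases-BB w k d w′ k′ d′ k≥0 k′≥0 bal = close (solve-balance (E.profile-B w k d refl refl) (E.profile-B w′ k′ d′ refl refl) bal)
      where
      l : ∀ I k k′ → + 2 * (k + k′) - + 2 * 0ℤ ≡ - 1ℤ * (+ 14 - + 4 + + 3 * (+ 2 * k + + 2 * k′) - + 2 * (+ 2 * k + 1ℤ + (+ 2 * k′ + 1ℤ)) - + 2 * I) +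
        - 1ℤ * (+ 2 * I - (+ 20 + + 9 * (+ 2 * k + + 2 * k′) - + 3 * (+ 2 * k + 1ℤ + (+ 2 * k′ + 1ℤ)) - (+ 8 * k + + 4 + (+ 8 * k′ + + 4))))
      l = ℤring 3 (λ I k k′ → # 2 :* (k :+ k′) :- # 2 :* # 0 := :- # 1 :* (# 14 :- # 4 :+ # 3 :* (# 2 :* k :+ # 2 :* k′) :- # 2 :* (# 2 :* k :+ # 1 :+ (# 2 :* k′ :+ # 1)) :- # 2 :* I) :+ :- # 1 :* (# 2 :* I :- (# 20 :+ # 9 :* (# 2 :* k :+ # 2 :* k′) :- # 3 :* (# 2 :* k :+ # 1 :+ (# 2 :* k′ :+ # 1)) :- (# 8 :* k :+ # 4 :+ (# 8 :* k′ :+ # 4)))))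
      close : Solved I (w + w + 1ℤ) (w′ + w′ + 1ℤ) d d′ (+ 4) (+ 2 * k + 1ℤ + (+ 2 * k′ + 1ℤ)) (+ 8 * k + + 4 + (+ 8 * k′ + + 4)) (+ 2 * k + + 2 * k′) →
        Outcome I (shapeB k 0ℤ d) (shapeB k′ 0ℤ d′) (w + w + 1ℤ) (w′ + w′ + 1ℤ) y
      close (solved W D F G) = close′ (proj₁ z) (proj₂ z) W D F
        where
        z = sum-zero₂ k≥0 k′≥0 (*-cancel 1 (lin ((- 1ℤ) ∙ sym F ⊞ (- 1ℤ) ∙ G) (l I k k′)))
        close′ : ∀ {k k′} → k ≡ 0ℤ → k′ ≡ 0ℤ → w + w + 1ℤ + (w′ + w′ + 1ℤ) ≡ + 4 * I + + 14 - + 4 → d + d′ ≡ + 2 * k + + 2 * k′ - (+ 2 * k + 1ℤ + (+ 2 * k′ + 1ℤ)) - + 2 * I →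
          + 2 * I ≡ + 14 - + 4 + + 3 * (+ 2 * k + + 2 * k′) - + 2 * (+ 2 * k + 1ℤ + (+ 2 * k′ + 1ℤ)) → Outcome I (shapeB k 0ℤ d) (shapeB k′ 0ℤ d′) (w + w + 1ℤ) (w′ + w′ + 1ℤ) y
        close′ refl refl W D F = family-s3 I≡3 (two-B w d w′ d′ (trans W (cong (λ I → + 4 * I + + 14 - + 4) I≡3)) (trans D (cong (λ I → + 2 * 0ℤ + + 2 * 0ℤ - (+ 2 * 0ℤ + 1ℤ + (+ 2 * 0ℤ + 1ℤ)) - + 2 * I) I≡3)))
          where
          I≡3 : I ≡ + 3
          I≡3 = *-cancel 1 F

    private
      contra : ∀ {N E A J N′ E′ A′ J′} {t : ℤ} n → Solved I N E A J N′ E′ A′ J′ → 0ℤ ≤ t →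
        (+ 14 - N′ + + 3 * J′ - + 2 * E′) - (+ 20 + + 9 * J′ - + 3 * E′ - A′) + t ≡ -[1+ n ] → ⊥
      contra {N′ = N′} {E′} {A′} {J′} {t} n (solved _ _ F G) p e = absurd n p (trans (sym (trans (cong (_+ t) zero₀) (ℤP.+-identityˡ t))) e)
        where
        zero₀ : (+ 14 - N′ + + 3 * J′ - + 2 * E′) - (+ 20 + + 9 * J′ - + 3 * E′ - A′) ≡ 0ℤ
        zero₀ = trans (cong (λ q → q - (+ 20 + + 9 * J′ - + 3 * E′ - A′)) (trans (sym F) G)) (ℤP.+-inverseʳ (+ 20 + + 9 * J′ - + 3 * E′ - A′))

    -- With a single edge on one side the first expression for `2I` stays below the second, as every
    -- remainder `ρ` is at most 2 and the slacks are nonnegative.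
    no-C : ∀ w ρ q {x′ L} → 1ℤ ≤ ρ → ρ ≤ + 2 → Shape x′ L → ¬ Balance I (shapeC ρ 0ℤ q) L (w + w) x′ y
    no-C w ρ q lo hi (three-edges w′ a b d a≥0 b≥0) bal = contra 1 (solve-balance (E.profile-C w ρ q lo hi refl refl) (E.profile-A w′ a b d refl refl) bal) (4 · diff hi ⊹ 2 · b≥0) (l ρ a b)
      where
      l : ∀ ρ a b → (+ 14 - + 4 + + 3 * (+ 1 + (+ 2 * (a + b) - 1ℤ)) - + 2 * (ρ + + 2 * (a + b))) - (+ 20 + + 9 * (+ 1 + (+ 2 * (a + b) - 1ℤ)) - + 3 * (ρ + + 2 * (a + b)) - (+ 3 * ρ + (+ 10 * a + + 8 * b))) + (+ 4 * (+ 2 - ρ) + + 2 * b) ≡ -[1+ 1 ]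
      l = ℤring 3 (λ ρ a b → (# 14 :- # 4 :+ # 3 :* (# 1 :+ (# 2 :* (a :+ b) :- # 1)) :- # 2 :* (ρ :+ # 2 :* (a :+ b))) :- (# 20 :+ # 9 :* (# 1 :+ (# 2 :* (a :+ b) :- # 1)) :- # 3 :* (ρ :+ # 2 :* (a :+ b)) :- (# 3 :* ρ :+ (# 10 :* a :+ # 8 :* b))) :+ (# 4 :* (# 2 :- ρ) :+ # 2 :* b) := con -[1+ 1 ])
    no-C w ρ q lo hi (two-edges w′ k d k≥0) bal = contra 1 (solve-balance (E.profile-C w ρ q lo hi refl refl) (E.profile-B w′ k d refl refl) bal) (4 · diff hi ⊹ 2 · k≥0) (l ρ k)
      where
      l : ∀ ρ k → (+ 14 - + 3 + + 3 * (+ 1 + + 2 * k) - + 2 * (ρ + (+ 2 * k + 1ℤ))) - (+ 20 + + 9 * (+ 1 + + 2 * k) - + 3 * (ρ + (+ 2 * k + 1ℤ)) - (+ 3 * ρ + (+ 8 * k + + 4))) + (+ 4 * (+ 2 - ρ) + + 2 * k) ≡ -[1+ 1 ]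
      l = ℤring 2 (λ ρ k → (# 14 :- # 3 :+ # 3 :* (# 1 :+ # 2 :* k) :- # 2 :* (ρ :+ (# 2 :* k :+ # 1))) :- (# 20 :+ # 9 :* (# 1 :+ # 2 :* k) :- # 3 :* (ρ :+ (# 2 :* k :+ # 1)) :- (# 3 :* ρ :+ (# 8 :* k :+ # 4))) :+ (# 4 :* (# 2 :- ρ) :+ # 2 :* k) := con -[1+ 1 ])
    no-C w ρ q lo hi (one-edge w′ ρ′ q′ lo′ hi′) bal = contra 3 (solve-balance (E.profile-C w ρ q lo hi refl refl) (E.profile-C w′ ρ′ q′ lo′ hi′ refl refl) bal) (4 · diff hi ⊹ 4 · diff hi′) (l ρ ρ′)
      where
      l : ∀ ρ ρ′ → (+ 14 - + 2 + + 3 * (+ 1 + + 1) - + 2 * (ρ + ρ′)) - (+ 20 + + 9 * (+ 1 + + 1) - + 3 * (ρ + ρ′) - (+ 3 * ρ + + 3 * ρ′)) + (+ 4 * (+ 2 - ρ) + + 4 * (+ 2 - ρ′)) ≡ -[1+ 3 ]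
      l = ℤring 2 (λ ρ ρ′ → (# 14 :- # 2 :+ # 3 :* (# 1 :+ # 1) :- # 2 :* (ρ :+ ρ′)) :- (# 20 :+ # 9 :* (# 1 :+ # 1) :- # 3 :* (ρ :+ ρ′) :- (# 3 :* ρ :+ # 3 :* ρ′)) :+ (# 4 :* (# 2 :- ρ) :+ # 4 :* (# 2 :- ρ′)) := con -[1+ 3 ])

    classify-shapes : ∀ {R L x x′} → Shape x R → Shape x′ L → Balance I R L x x′ y → Outcome I R L x x′ y ⊎ Outcome I L R x′ x y
    classify-shapes (three-edges w a b d a≥0 b≥0) (three-edges w′ a′ b′ d′ a′≥0 b′≥0) bal = cases-AA w a b d w′ a′ b′ d′ a≥0 b≥0 a′≥0 b′≥0 bal
    classify-shapes (three-edges w a b d a≥0 b≥0) (two-edges w′ k d′ k≥0) bal = inj₁ (cases-AB w a b d w′ k d′ a≥0 b≥0 k≥0 bal)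
    classify-shapes (two-edges w k d k≥0) (three-edges w′ a b d′ a≥0 b≥0) bal = inj₂ (cases-AB w′ a b d′ w k d a≥0 b≥0 k≥0 (balance-swap bal))
    classify-shapes (two-edges w k d k≥0) (two-edges w′ k′ d′ k′≥0) bal = inj₁ (cases-BB w k d w′ k′ d′ k≥0 k′≥0 bal)
    classify-shapes (one-edge w ρ q lo hi) s bal = ⊥-elim (no-C w ρ q lo hi s bal)
    classify-shapes s@(three-edges _ _ _ _ _ _) (one-edge w ρ q lo hi) bal = ⊥-elim (no-C w ρ q lo hi s (balance-swap bal))
    classify-shapes s@(two-edges _ _ _ _) (one-edge w ρ q lo hi) bal = ⊥-elim (no-C w ρ q lo hi s (balance-swap bal))
open Classification public

-- The polygons of the theorem and their chains

module Families where
  open Z using (_≤_; _<_; _+_; _*_; _-_; -_)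
  open ℤArith
  open import Data.Unit using (⊤; tt)

  mirrorZ : ZPt → ZPt
  mirrorZ (x , y) = - x , y

  IntSupports : List ZPt → List Edge → ℤ → ℤ → Set
  IntSupports Zs [] x y = ⊤
  IntSupports Zs ((D , h) ∷ es) x y = All (λ z → + suc h * (proj₁ z - x) ≤ D * (proj₂ z - y)) Zs × IntSupports Zs es (x + D) (y + + suc h)

  int-supports : ∀ {Zs} es x y → IntSupports Zs es x y → Supports (map halfPt Zs) es x y
  int-supports [] x y _ = tt
  int-supports {Zs} ((D , h) ∷ es) x y (al , als) = here-edge , int-supports es (x + D) (y + + suc h) als
    where
    here-edge : ∀ {s} → s ∈ map halfPt Zs → LeftOf x y D h s
    here-edge i with ∈-map⁻ halfPt i
    ... | (u , v) , j , refl = proj₂ (leftOf-half x y D h u v) (All.lookup al j)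

  map-mirror-half : ∀ Zs → map mirror (map halfPt Zs) ≡ map halfPt (map mirrorZ Zs)
  map-mirror-half [] = refl
  map-mirror-half ((x , y) ∷ Zs) = cong₂ _∷_ (half-mirror x y) (map-mirror-half Zs)

  edge-bottom : ∀ {S} x y D h → (∀ {s} → s ∈ S → LeftOf x y D h s) → Cap S x y
  edge-bottom {S} x y D h sup (a , b) c refl = ℚArith.cancel≤ {H Q.+ H} (ℚArith.0<ofℤsuc h ℚArith.<⊹ ℚP.<⇒≤ (ℚArith.0<ofℤsuc h))
      (ℚArith.bound (ℚArith.diff (leftOf-conv x y D h sup (a , b) c)) (l (ofℤ x) (ofℤ y) H (ofℤ D) a))
    where
    H = ofℤ (+ suc h)
    l : ∀ X Y H d a → (H Q.+ H) Q.* (½ Q.* X) Q.- (H Q.+ H) Q.* a ≡ d Q.* (½ Q.* Y Q.+ ½ Q.* Y Q.- Y) Q.- H Q.* (a Q.+ a Q.- X)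
    l = ℚring 5 (λ X Y H d a → (H +: H) *: (con: ½ *: X) -: (H +: H) *: a =: d *: (con: ½ *: Y +: con: ½ *: Y -: Y) -: H *: (a +: a -: X))

  chain-cap : ∀ {S} es x y → 0 N.< height es → Supports S es x y → Cap S x y
  chain-cap ((D , h) ∷ es) x y _ (sup , _) = edge-bottom x y D h sup

  mid-half : ∀ {S} u v u′ v′ w z → u + u′ ≡ w + w → v + v′ ≡ z + z → InConv S (half u v) → InConv S (half u′ v′) → InConv S (half w z)
  mid-half u v u′ v′ w z e f c d = Cone-subst refl (pt≡ (h u u′ w e) (h v v′ z f)) (mid-conv c d)
    where
    h : ∀ u u′ w → u + u′ ≡ w + w → ½ Q.* (½ Q.* ofℤ u Q.+ ½ Q.* ofℤ u′) ≡ ½ Q.* ofℤ w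
    h u u′ w e = trans (l (ofℤ u) (ofℤ u′)) (trans (cong (λ q → ½ Q.* (½ Q.* q)) (trans (sym (ℚArith.ofℤ-+ u u′)) (trans (cong ofℤ e) (ℚArith.ofℤ-+ w w)))) (l′ (ofℤ w)))
      where
      l : ∀ a b → ½ Q.* (½ Q.* a Q.+ ½ Q.* b) ≡ ½ Q.* (½ Q.* (a Q.+ b))
      l = ℚring 2 (λ a b → con: ½ *: (con: ½ *: a +: con: ½ *: b) =: con: ½ *: (con: ½ *: (a +: b)))
      l′ : ∀ w → ½ Q.* (½ Q.* (w Q.+ w)) ≡ ½ Q.* w
      l′ = ℚring 1 (λ w → con: ½ *: (con: ½ *: (w +: w)) =: con: ½ *: w)

  -- Some chain points are not generators but midpoints of two, such as the point of row 2 on the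
  -- right side of `Z-a` and `Z-s`; they cut long sides into primitive edges.
  data Spanned (Zs : List ZPt) : ZPt → Set where
    given : ∀ {z w} → z ∈ Zs → proj₁ z ≡ proj₁ w → proj₂ z ≡ proj₂ w → Spanned Zs w
    mid : ∀ {z z′ w} → z ∈ Zs → z′ ∈ Zs → proj₁ z + proj₁ z′ ≡ proj₁ w + proj₁ w → proj₂ z + proj₂ z′ ≡ proj₂ w + proj₂ w → Spanned Zs w

  spanned : ∀ {Zs z} → Spanned Zs z → InConv (map halfPt Zs) (halfPt z)
  spanned {Zs} {w} (given {z} i e f) = subst (λ z → InConv (map halfPt Zs) (halfPt z)) (cong₂ _,_ e f) (conv-gen (∈-map⁺ halfPt i))
  spanned {Zs} {w , v} (mid {a , b} {a′ , b′} i j e f) = mid-half a b a′ b′ w v e f (conv-gen (∈-map⁺ halfPt i)) (conv-gen (∈-map⁺ halfPt j))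

  int-hull : ∀ Zs R L xR xL → Primitive R → Primitive L → height R ≡ 3 → height L ≡ 3 →
    IntSupports Zs R xR 0ℤ → IntSupports (map mirrorZ Zs) L xL 0ℤ →
    All (Spanned Zs) (chainPts R xR 0ℤ) → All (Spanned (map mirrorZ Zs)) (chainPts L xL 0ℤ) →
    All (λ z → 0ℤ ≤ proj₂ z × proj₂ z ≤ + 3) Zs → Hull (map halfPt Zs)
  int-hull Zs R L xR xL pR pL hR hL sR sL vR vL strip = record
    { R = R ; L = L ; xR = xR ; xL = xL ; y₀ = 0ℤ ; primR = pR ; primL = pL
    ; supR = int-supports R xR 0ℤ sR ; supL = supL′ ; verR = vertices-pts R xR 0ℤ (λ i → spanned (All.lookup vR i))
    ; verL = subst (λ T → Vertices T L xL 0ℤ) (sym (map-mirror-half Zs)) (vertices-pts L xL 0ℤ (λ i → spanned (All.lookup vL i)))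
    ; capR = chain-cap R xR 0ℤ (subst (0 N.<_) (sym hR) (s≤s z≤n)) (int-supports R xR 0ℤ sR)
    ; capL = chain-cap L xL 0ℤ (subst (0 N.<_) (sym hL) (s≤s z≤n)) supL′
    ; heights = trans hL (sym hR) ; low = low ; high = high }
    where
    supL′ : Supports (map mirror (map halfPt Zs)) L xL 0ℤ
    supL′ = subst (λ T → Supports T L xL 0ℤ) (sym (map-mirror-half Zs)) (int-supports L xL 0ℤ sL)
    half-mono : ∀ {a b} → a ≤ b → ½ Q.* ofℤ a Q.≤ ½ Q.* ofℤ b
    half-mono {a} {b} p = ℚArith.bound (ℚP.<⇒≤ ℚArith.0<½ ℚArith.⊠ ℚArith.diff (ℚArith.ofℤ-≤ p)) (l (ofℤ a) (ofℤ b))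
      where
      l : ∀ a b → ½ Q.* b Q.- ½ Q.* a ≡ ½ Q.* (b Q.- a)
      l = ℚring 2 (λ a b → con: ½ *: b -: con: ½ *: a =: con: ½ *: (b -: a))
    low : ∀ {s} → s ∈ map halfPt Zs → ½ Q.* ofℤ 0ℤ Q.≤ proj₂ s
    low i with ∈-map⁻ halfPt i
    ... | (u , v) , j , refl = half-mono (proj₁ (All.lookup strip j))
    high : ∀ {s} → s ∈ map halfPt Zs → proj₂ s Q.≤ ½ Q.* (ofℤ 0ℤ Q.+ ofℤ (+ height R))
    high {s} i with ∈-map⁻ halfPt i
    ... | (u , v) , j , refl = subst (λ n → ½ Q.* ofℤ v Q.≤ ½ Q.* (ofℤ 0ℤ Q.+ ofℤ (+ n))) (sym hR) (half-mono (proj₂ (All.lookup strip j)))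

  -- The apex `(0 , 3/2)` is the leftmost of the highest generators, hence a vertex, and it is not
  -- integral. Doubling makes every generator integral.
  denom2 : ∀ Zs → (0ℤ , + 3) ∈ Zs → All (λ z → proj₂ z ≤ + 3 × (proj₂ z ≡ + 3 → 0ℤ ≤ proj₁ z)) Zs → Denom2 (map halfPt Zs)
  denom2 Zs apex al = integral₂ , not-integral
    where
    integral₂ : IntegralVertices (dilate (ofℕ 2) (map halfPt Zs))
    integral₂ v iv = go (∈-map⁻ (ofℕ 2 ⊙_) (vertex∈ iv))
      where
      go : (Σ Pt λ s → s ∈ map halfPt Zs × v ≡ ofℕ 2 ⊙ s) → IsIntegral v
      go (s , i , refl) = go′ (∈-map⁻ halfPt i)
        where
        go′ : (Σ ZPt λ z → z ∈ Zs × s ≡ halfPt z) → IsIntegral (ofℕ 2 ⊙ s)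
        go′ (z , _ , refl) = z , sym (⊙⊙ {ofℕ 2} {½} refl (toPt z))
    apex-vertex : IsVertex (map halfPt Zs) (half 0ℤ (+ 3))
    apex-vertex = exposed 0ℚ 1ℚ (Q.- 1ℚ) 0ℚ {half 0ℤ (+ 3)} ℚArith.0<1 (∈-map⁺ halfPt apex) dom tie
      where
      l₁ : ∀ x y → y ≡ 0ℚ Q.* x Q.+ 1ℚ Q.* y
      l₁ = ℚring 2 (λ x y → y =: con: 0ℚ *: x +: con: 1ℚ *: y)
      l₂ : ∀ x y → Q.- x ≡ (Q.- 1ℚ) Q.* x Q.+ 0ℚ Q.* y
      l₂ = ℚring 2 (λ x y → -: x =: (-: con: 1ℚ) *: x +: con: 0ℚ *: y)
      half-mono : ∀ {a b} → a ≤ b → ½ Q.* ofℤ a Q.≤ ½ Q.* ofℤ b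
      half-mono {a} {b} p = ℚArith.bound (ℚP.<⇒≤ ℚArith.0<½ ℚArith.⊠ ℚArith.diff (ℚArith.ofℤ-≤ p)) (l (ofℤ a) (ofℤ b))
        where
        l : ∀ a b → ½ Q.* b Q.- ½ Q.* a ≡ ½ Q.* (b Q.- a)
        l = ℚring 2 (λ a b → con: ½ *: b -: con: ½ *: a =: con: ½ *: (b -: a))
      dom : ∀ {s} → s ∈ map halfPt Zs → dot 0ℚ 1ℚ s Q.≤ dot 0ℚ 1ℚ (half 0ℤ (+ 3))
      dom {s} i = go (∈-map⁻ halfPt i)
        where
        go : (Σ ZPt λ z → z ∈ Zs × s ≡ halfPt z) → dot 0ℚ 1ℚ s Q.≤ dot 0ℚ 1ℚ (half 0ℤ (+ 3))
        go ((u , v) , j , refl) = subst₂ Q._≤_ (l₁ (½ Q.* ofℤ u) (½ Q.* ofℤ v)) (l₁ (½ Q.* ofℤ 0ℤ) (½ Q.* ofℤ (+ 3))) (half-mono {v} {+ 3} (proj₁ (All.lookup al j)))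
      tie : ∀ {s} → s ∈ map halfPt Zs → dot 0ℚ 1ℚ s ≡ dot 0ℚ 1ℚ (half 0ℤ (+ 3)) → dot (Q.- 1ℚ) 0ℚ s Q.≤ dot (Q.- 1ℚ) 0ℚ (half 0ℤ (+ 3))
      tie {s} i e = go (∈-map⁻ halfPt i) e
        where
        go : (Σ ZPt λ z → z ∈ Zs × s ≡ halfPt z) → dot 0ℚ 1ℚ s ≡ dot 0ℚ 1ℚ (half 0ℤ (+ 3)) → dot (Q.- 1ℚ) 0ℚ s Q.≤ dot (Q.- 1ℚ) 0ℚ (half 0ℤ (+ 3))
        go ((u , v) , j , refl) e = subst₂ Q._≤_ (l₂ (½ Q.* ofℤ u) (½ Q.* ofℤ v)) (l₂ (½ Q.* ofℤ 0ℤ) (½ Q.* ofℤ (+ 3)))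
            (ℚP.neg-antimono-≤ (half-mono {0ℤ} {u} (proj₂ (All.lookup al j) (ℚArith.ofℤ-inj {v} {+ 3} (ℚArith.cancel≡ {½} ℚArith.0<½
              (trans (l₁ (½ Q.* ofℤ u) (½ Q.* ofℤ v)) (trans e (sym (l₁ (½ Q.* ofℤ 0ℤ) (½ Q.* ofℤ (+ 3)))))))))))
    not-integral : ¬ IntegralVertices (map halfPt Zs)
    not-integral h = go (h (half 0ℤ (+ 3)) apex-vertex)
      where
      go : IsIntegral (half 0ℤ (+ 3)) → ⊥
      go ((a , b) , e) = 1≢0 (trans (sym (ev-even b)) (cong ev (ℚArith.ofℤ-inj {b + b} {+ 3} (trans (ℚArith.ofℤ-+ b b) (cong₂ Q._+_ (cong proj₂ e) (cong proj₂ e))))))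
        where
        1≢0 : 1ℤ ≢ 0ℤ
        1≢0 ()

  -- the point lists of P-a, P-s and P-s3 in doubled coordinates
  Z-a : ℤ → ℤ → List ZPt
  Z-a I a = (0ℤ , + 3) ∷ (0ℤ , + 1) ∷ (a + a , 0ℤ) ∷ (a + a + (+ 4 * I + + 8) , 0ℤ) ∷ (+ 4 * I + + 4 , + 1) ∷ []

  Z-s : ℤ → List ZPt
  Z-s I = (0ℤ , + 3) ∷ (0ℤ , + 2) ∷ (+ 1 , 0ℤ) ∷ (+ 4 * I + + 10 , 0ℤ) ∷ (+ 4 * I + + 4 , + 1) ∷ []

  Z-s3 : List ZPt
  Z-s3 = (0ℤ , + 3) ∷ (0ℤ , + 2) ∷ (+ 1 , 0ℤ) ∷ (+ 23 , 0ℤ) ∷ (+ 8 , + 2) ∷ []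

  half-double : ∀ n z → + n + + n ≡ z → ofℕ n ≡ ½ Q.* ofℤ z
  half-double n _ refl = sym (trans (cong (λ q → ½ Q.* q) (ℚArith.ofℤ-+ (+ n) (+ n))) (l (ofℕ n)))
    where
    l : ∀ a → ½ Q.* (a Q.+ a) ≡ a
    l = ℚring 1 (λ a → con: ½ *: (a +: a) =: a)

  double-lin : ∀ i c → + (2 N.* i N.+ c) + + (2 N.* i N.+ c) ≡ + 4 * + i + (+ c + + c)
  double-lin i c = trans (cong (λ q → q + + c + (q + + c)) (ℤP.pos-* 2 i)) (l (+ i) (+ c))
    where
    l : ∀ i c → + 2 * i + c + (+ 2 * i + c) ≡ + 4 * i + (c + c)
    l = ℤring 2 (λ i c → # 2 :* i :+ c :+ (# 2 :* i :+ c) := # 4 :* i :+ (c :+ c))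

  P-a≡ : ∀ i a → P-a i a ≡ map halfPt (Z-a (+ i) a)
  P-a≡ i a = cong₂ (λ p q → (0ℚ , + 3 Q./ 2) ∷ (0ℚ , ½) ∷ p ∷ q) (pt≡ a-eq refl) (cong₂ (λ p q → p ∷ q ∷ [])
      (pt≡ (trans (cong₂ Q._+_ a-eq (half-double (2 N.* i N.+ 4) (+ 4 * + i + + 8) (double-lin i 4))) (trans (l (ofℤ (a + a)) (ofℤ (+ 4 * + i + + 8))) (cong (λ q → ½ Q.* q) (sym (ℚArith.ofℤ-+ (a + a) (+ 4 * + i + + 8)))))) refl)
      (pt≡ (half-double (2 N.* i N.+ 2) (+ 4 * + i + + 4) (double-lin i 2)) refl))
    where
    l : ∀ u v → ½ Q.* u Q.+ ½ Q.* v ≡ ½ Q.* (u Q.+ v)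
    l = ℚring 2 (λ u v → con: ½ *: u +: con: ½ *: v =: con: ½ *: (u +: v))
    l₂ : ∀ a → a ≡ ½ Q.* (a Q.+ a)
    l₂ = ℚring 1 (λ a → a =: con: ½ *: (a +: a))
    a-eq : ofℤ a ≡ ½ Q.* ofℤ (a + a)
    a-eq = trans (l₂ (ofℤ a)) (cong (λ q → ½ Q.* q) (sym (ℚArith.ofℤ-+ a a)))

  P-s≡ : ∀ i → P-s i ≡ map halfPt (Z-s (+ i))
  P-s≡ i = cong₂ (λ p q → (0ℚ , + 3 Q./ 2) ∷ (0ℚ , 1ℚ) ∷ (½ , 0ℚ) ∷ p ∷ q ∷ [])
      (pt≡ (half-double (2 N.* i N.+ 5) (+ 4 * + i + + 10) (double-lin i 5)) refl) (pt≡ (half-double (2 N.* i N.+ 2) (+ 4 * + i + + 4) (double-lin i 2)) refl)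

  P-s3≡ : P-s3 ≡ map halfPt Z-s3
  P-s3≡ = refl

  coprime-1 : ∀ D → Cop.Coprime Z.∣ D ∣ 1
  coprime-1 D = Cop.sym (Cop.1-coprimeTo Z.∣ D ∣)

  by0 : ∀ {a b} → b - a ≡ 0ℤ → a ≤ b
  by0 = bound {d = 0ℤ} (Z.+≤+ z≤n)

  module _ (I a : ℤ) (a≥0 : 0ℤ ≤ a) (a≤ : a ≤ I - 1ℤ) where
    private
      Zs = Z-a I a
      z₀ : 0ℤ ≤ I - 1ℤ - a
      z₀ = diff a≤
    -- All slacks are nonnegative combinations of `I - 1 - a`, `a` and constants. The side from
    -- `(4I + 4 , 1)` to the apex and the vertical side are cut in half at row 2.
    hull-a : Hull (map halfPt (Z-a I a))
    hull-a = int-hull Zs (famA-R I a) (famA-L I a) (a + a + (+ 4 * I + + 8)) (- (a + a))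
      (coprime-1 (- (a + a + + 4)) All.∷ coprime-1 (- (+ 2 * I + + 2)) All.∷ coprime-1 (- (+ 2 * I + + 2)) All.∷ All.[])
      (coprime-1 (a + a) All.∷ coprime-1 0ℤ All.∷ coprime-1 0ℤ All.∷ All.[]) refl refl
      ( (bound (4 · z₀) (r₁ I a) All.∷ bound (4 · z₀ ⊹ 4 · a≥0 ⊹ Z.+≤+ {0} {8} z≤n) (r₂ I a) All.∷ bound (4 · z₀ ⊹ 4 · a≥0 ⊹ Z.+≤+ {0} {12} z≤n) (r₃ I a) All.∷ by0 (r₄ I a) All.∷ by0 (r₅ I a) All.∷ All.[])
      , (by0 (r₆ I a) All.∷ bound (4 · z₀ ⊹ 4 · a≥0 ⊹ Z.+≤+ {0} {8} z≤n) (r₇ I a) All.∷ bound (6 · z₀ ⊹ 4 · a≥0 ⊹ Z.+≤+ {0} {12} z≤n) (r₈ I a) All.∷ bound (2 · z₀) (r₉ I a) All.∷ by0 (r₁₀ I a) All.∷ All.[])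
      , (by0 (s₆ I a) All.∷ bound (4 · z₀ ⊹ 4 · a≥0 ⊹ Z.+≤+ {0} {8} z≤n) (s₇ I a) All.∷ bound (6 · z₀ ⊹ 4 · a≥0 ⊹ Z.+≤+ {0} {12} z≤n) (s₈ I a) All.∷ bound (2 · z₀) (s₉ I a) All.∷ by0 (s₁₀ I a) All.∷ All.[]) , tt)
      ( (bound (4 · a≥0) (t₁ a) All.∷ by0 (t₂ a) All.∷ by0 (t₃ a) All.∷ bound (4 · z₀ ⊹ 4 · a≥0 ⊹ Z.+≤+ {0} {12} z≤n) (t₄ I a) All.∷ bound (4 · z₀ ⊹ 4 · a≥0 ⊹ Z.+≤+ {0} {8} z≤n) (t₅ I a) All.∷ All.[])
      , vertical (a + a) 1ℤ , vertical′ , tt)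
      (given (there (there (there (here refl)))) refl refl All.∷ given (there (there (there (there (here refl))))) (p₁ I a) refl All.∷ mid (there (there (there (there (here refl))))) (here refl) (p₂ I a) refl All.∷ given (here refl) (p₃ I a) refl All.∷ All.[])
      (given (there (there (here refl))) refl refl All.∷ given (there (here refl)) (p₄ a) refl All.∷ mid (there (here refl)) (here refl) (p₅ a) refl All.∷ given (here refl) (p₆ a) refl All.∷ All.[])
      ((Z.+≤+ z≤n , ℤP.≤-refl) All.∷ (Z.+≤+ z≤n , Z.+≤+ (s≤s z≤n)) All.∷ (ℤP.≤-refl , Z.+≤+ z≤n) All.∷ (ℤP.≤-refl , Z.+≤+ z≤n) All.∷ (Z.+≤+ z≤n , Z.+≤+ (s≤s z≤n)) All.∷ All.[])
      where
      r₁ : ∀ I a → - (a + a + + 4) * (+ 3 - 0ℤ) - + 1 * (0ℤ - (a + a + (+ 4 * I + + 8))) ≡ + 4 * (I - 1ℤ - a)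
      r₁ = ℤring 2 (λ I a → :- (a :+ a :+ # 4) :* (# 3 :- # 0) :- # 1 :* (# 0 :- (a :+ a :+ (# 4 :* I :+ # 8))) := # 4 :* (I :- # 1 :- a))
      r₂ : ∀ I a → - (a + a + + 4) * (+ 1 - 0ℤ) - + 1 * (0ℤ - (a + a + (+ 4 * I + + 8))) ≡ + 4 * (I - 1ℤ - a) + + 4 * a + + 8
      r₂ = ℤring 2 (λ I a → :- (a :+ a :+ # 4) :* (# 1 :- # 0) :- # 1 :* (# 0 :- (a :+ a :+ (# 4 :* I :+ # 8))) := # 4 :* (I :- # 1 :- a) :+ # 4 :* a :+ # 8)
      r₃ : ∀ I a → - (a + a + + 4) * (0ℤ - 0ℤ) - + 1 * (a + a - (a + a + (+ 4 * I + + 8))) ≡ + 4 * (I - 1ℤ - a) + + 4 * a + + 12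
      r₃ = ℤring 2 (λ I a → :- (a :+ a :+ # 4) :* (# 0 :- # 0) :- # 1 :* (a :+ a :- (a :+ a :+ (# 4 :* I :+ # 8))) := # 4 :* (I :- # 1 :- a) :+ # 4 :* a :+ # 12)
      r₄ : ∀ I a → - (a + a + + 4) * (0ℤ - 0ℤ) - + 1 * (a + a + (+ 4 * I + + 8) - (a + a + (+ 4 * I + + 8))) ≡ 0ℤ
      r₄ = ℤring 2 (λ I a → :- (a :+ a :+ # 4) :* (# 0 :- # 0) :- # 1 :* (a :+ a :+ (# 4 :* I :+ # 8) :- (a :+ a :+ (# 4 :* I :+ # 8))) := # 0)
      r₅ : ∀ I a → - (a + a + + 4) * (+ 1 - 0ℤ) - + 1 * (+ 4 * I + + 4 - (a + a + (+ 4 * I + + 8))) ≡ 0ℤ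
      r₅ = ℤring 2 (λ I a → :- (a :+ a :+ # 4) :* (# 1 :- # 0) :- # 1 :* (# 4 :* I :+ # 4 :- (a :+ a :+ (# 4 :* I :+ # 8))) := # 0)
      r₆ : ∀ I a → - (+ 2 * I + + 2) * (+ 3 - + 1) - + 1 * (0ℤ - (a + a + (+ 4 * I + + 8) + - (a + a + + 4))) ≡ 0ℤ
      r₆ = ℤring 2 (λ I a → :- (# 2 :* I :+ # 2) :* (# 3 :- # 1) :- # 1 :* (# 0 :- (a :+ a :+ (# 4 :* I :+ # 8) :+ :- (a :+ a :+ # 4))) := # 0)
      r₇ : ∀ I a → - (+ 2 * I + + 2) * (+ 1 - + 1) - + 1 * (0ℤ - (a + a + (+ 4 * I + + 8) + - (a + a + + 4))) ≡ + 4 * (I - 1ℤ - a) + + 4 * a + + 8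
      r₇ = ℤring 2 (λ I a → :- (# 2 :* I :+ # 2) :* (# 1 :- # 1) :- # 1 :* (# 0 :- (a :+ a :+ (# 4 :* I :+ # 8) :+ :- (a :+ a :+ # 4))) := # 4 :* (I :- # 1 :- a) :+ # 4 :* a :+ # 8)
      r₈ : ∀ I a → - (+ 2 * I + + 2) * (0ℤ - + 1) - + 1 * (a + a - (a + a + (+ 4 * I + + 8) + - (a + a + + 4))) ≡ + 6 * (I - 1ℤ - a) + + 4 * a + + 12
      r₈ = ℤring 2 (λ I a → :- (# 2 :* I :+ # 2) :* (# 0 :- # 1) :- # 1 :* (a :+ a :- (a :+ a :+ (# 4 :* I :+ # 8) :+ :- (a :+ a :+ # 4))) := # 6 :* (I :- # 1 :- a) :+ # 4 :* a :+ # 12)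
      r₉ : ∀ I a → - (+ 2 * I + + 2) * (0ℤ - + 1) - + 1 * (a + a + (+ 4 * I + + 8) - (a + a + (+ 4 * I + + 8) + - (a + a + + 4))) ≡ + 2 * (I - 1ℤ - a)
      r₉ = ℤring 2 (λ I a → :- (# 2 :* I :+ # 2) :* (# 0 :- # 1) :- # 1 :* (a :+ a :+ (# 4 :* I :+ # 8) :- (a :+ a :+ (# 4 :* I :+ # 8) :+ :- (a :+ a :+ # 4))) := # 2 :* (I :- # 1 :- a))
      r₁₀ : ∀ I a → - (+ 2 * I + + 2) * (+ 1 - + 1) - + 1 * (+ 4 * I + + 4 - (a + a + (+ 4 * I + + 8) + - (a + a + + 4))) ≡ 0ℤ
      r₁₀ = ℤring 2 (λ I a → :- (# 2 :* I :+ # 2) :* (# 1 :- # 1) :- # 1 :* (# 4 :* I :+ # 4 :- (a :+ a :+ (# 4 :* I :+ # 8) :+ :- (a :+ a :+ # 4))) := # 0)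
      s₆ : ∀ I a → - (+ 2 * I + + 2) * (+ 3 - + 2) - + 1 * (0ℤ - (a + a + (+ 4 * I + + 8) + - (a + a + + 4) + - (+ 2 * I + + 2))) ≡ 0ℤ
      s₆ = ℤring 2 (λ I a → :- (# 2 :* I :+ # 2) :* (# 3 :- # 2) :- # 1 :* (# 0 :- (a :+ a :+ (# 4 :* I :+ # 8) :+ :- (a :+ a :+ # 4) :+ :- (# 2 :* I :+ # 2))) := # 0)
      s₇ : ∀ I a → - (+ 2 * I + + 2) * (+ 1 - + 2) - + 1 * (0ℤ - (a + a + (+ 4 * I + + 8) + - (a + a + + 4) + - (+ 2 * I + + 2))) ≡ + 4 * (I - 1ℤ - a) + + 4 * a + + 8
      s₇ = ℤring 2 (λ I a → :- (# 2 :* I :+ # 2) :* (# 1 :- # 2) :- # 1 :* (# 0 :- (a :+ a :+ (# 4 :* I :+ # 8) :+ :- (a :+ a :+ # 4) :+ :- (# 2 :* I :+ # 2))) := # 4 :* (I :- # 1 :- a) :+ # 4 :* a :+ # 8)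
      s₈ : ∀ I a → - (+ 2 * I + + 2) * (0ℤ - + 2) - + 1 * (a + a - (a + a + (+ 4 * I + + 8) + - (a + a + + 4) + - (+ 2 * I + + 2))) ≡ + 6 * (I - 1ℤ - a) + + 4 * a + + 12
      s₈ = ℤring 2 (λ I a → :- (# 2 :* I :+ # 2) :* (# 0 :- # 2) :- # 1 :* (a :+ a :- (a :+ a :+ (# 4 :* I :+ # 8) :+ :- (a :+ a :+ # 4) :+ :- (# 2 :* I :+ # 2))) := # 6 :* (I :- # 1 :- a) :+ # 4 :* a :+ # 12)
      s₉ : ∀ I a → - (+ 2 * I + + 2) * (0ℤ - + 2) - + 1 * (a + a + (+ 4 * I + + 8) - (a + a + (+ 4 * I + + 8) + - (a + a + + 4) + - (+ 2 * I + + 2))) ≡ + 2 * (I - 1ℤ - a)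
      s₉ = ℤring 2 (λ I a → :- (# 2 :* I :+ # 2) :* (# 0 :- # 2) :- # 1 :* (a :+ a :+ (# 4 :* I :+ # 8) :- (a :+ a :+ (# 4 :* I :+ # 8) :+ :- (a :+ a :+ # 4) :+ :- (# 2 :* I :+ # 2))) := # 2 :* (I :- # 1 :- a))
      s₁₀ : ∀ I a → - (+ 2 * I + + 2) * (+ 1 - + 2) - + 1 * (+ 4 * I + + 4 - (a + a + (+ 4 * I + + 8) + - (a + a + + 4) + - (+ 2 * I + + 2))) ≡ 0ℤ
      s₁₀ = ℤring 2 (λ I a → :- (# 2 :* I :+ # 2) :* (# 1 :- # 2) :- # 1 :* (# 4 :* I :+ # 4 :- (a :+ a :+ (# 4 :* I :+ # 8) :+ :- (a :+ a :+ # 4) :+ :- (# 2 :* I :+ # 2))) := # 0)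
      t₁ : ∀ a → (a + a) * (+ 3 - 0ℤ) - + 1 * (- 0ℤ - - (a + a)) ≡ + 4 * a
      t₁ = ℤring 1 (λ a → (a :+ a) :* (# 3 :- # 0) :- # 1 :* (:- # 0 :- :- (a :+ a)) := # 4 :* a)
      t₂ : ∀ a → (a + a) * (+ 1 - 0ℤ) - + 1 * (- 0ℤ - - (a + a)) ≡ 0ℤ
      t₂ = ℤring 1 (λ a → (a :+ a) :* (# 1 :- # 0) :- # 1 :* (:- # 0 :- :- (a :+ a)) := # 0)
      t₃ : ∀ a → (a + a) * (0ℤ - 0ℤ) - + 1 * (- (a + a) - - (a + a)) ≡ 0ℤ
      t₃ = ℤring 1 (λ a → (a :+ a) :* (# 0 :- # 0) :- # 1 :* (:- (a :+ a) :- :- (a :+ a)) := # 0)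
      t₄ : ∀ I a → (a + a) * (0ℤ - 0ℤ) - + 1 * (- (a + a + (+ 4 * I + + 8)) - - (a + a)) ≡ + 4 * (I - 1ℤ - a) + + 4 * a + + 12
      t₄ = ℤring 2 (λ I a → (a :+ a) :* (# 0 :- # 0) :- # 1 :* (:- (a :+ a :+ (# 4 :* I :+ # 8)) :- :- (a :+ a)) := # 4 :* (I :- # 1 :- a) :+ # 4 :* a :+ # 12)
      t₅ : ∀ I a → (a + a) * (+ 1 - 0ℤ) - + 1 * (- (+ 4 * I + + 4) - - (a + a)) ≡ + 4 * (I - 1ℤ - a) + + 4 * a + + 8
      t₅ = ℤring 2 (λ I a → (a :+ a) :* (# 1 :- # 0) :- # 1 :* (:- (# 4 :* I :+ # 4) :- :- (a :+ a)) := # 4 :* (I :- # 1 :- a) :+ # 4 :* a :+ # 8)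
      -- the left side is the line x = 0 above the first edge
      vertical-at : ∀ x y → x ≡ 0ℤ → All (λ z → + 1 * (proj₁ z - x) ≤ 0ℤ * (proj₂ z - y)) (map mirrorZ Zs)
      vertical-at .0ℤ y refl = ℤP.≤-refl All.∷ ℤP.≤-refl All.∷ bound (2 · a≥0) (v₁ a y) All.∷ bound (4 · z₀ ⊹ 6 · a≥0 ⊹ Z.+≤+ {0} {12} z≤n) (v₂ I a y) All.∷ bound (4 · z₀ ⊹ 4 · a≥0 ⊹ Z.+≤+ {0} {8} z≤n) (v₃ I a y) All.∷ All.[]
        where
        v₁ : ∀ a y → 0ℤ * (0ℤ - y) - + 1 * (- (a + a) - 0ℤ) ≡ + 2 * a
        v₁ = ℤring 2 (λ a y → # 0 :* (# 0 :- y) :- # 1 :* (:- (a :+ a) :- # 0) := # 2 :* a)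
        v₂ : ∀ I a y → 0ℤ * (0ℤ - y) - + 1 * (- (a + a + (+ 4 * I + + 8)) - 0ℤ) ≡ + 4 * (I - 1ℤ - a) + + 6 * a + + 12
        v₂ = ℤring 3 (λ I a y → # 0 :* (# 0 :- y) :- # 1 :* (:- (a :+ a :+ (# 4 :* I :+ # 8)) :- # 0) := # 4 :* (I :- # 1 :- a) :+ # 6 :* a :+ # 12)
        v₃ : ∀ I a y → 0ℤ * (+ 1 - y) - + 1 * (- (+ 4 * I + + 4) - 0ℤ) ≡ + 4 * (I - 1ℤ - a) + + 4 * a + + 8
        v₃ = ℤring 3 (λ I a y → # 0 :* (# 1 :- y) :- # 1 :* (:- (# 4 :* I :+ # 4) :- # 0) := # 4 :* (I :- # 1 :- a) :+ # 4 :* a :+ # 8)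
      p₄ : ∀ a → - 0ℤ ≡ - (a + a) + (a + a)
      p₄ = ℤring 1 (λ a → :- # 0 := :- (a :+ a) :+ (a :+ a))
      p₆ : ∀ a → - 0ℤ ≡ - (a + a) + (a + a) + 0ℤ + 0ℤ
      p₆ = ℤring 1 (λ a → :- # 0 := :- (a :+ a) :+ (a :+ a) :+ # 0 :+ # 0)
      vertical : ∀ b y → All (λ z → + 1 * (proj₁ z - (- (a + a) + (a + a))) ≤ 0ℤ * (proj₂ z - y)) (map mirrorZ Zs)
      vertical _ y = vertical-at (- (a + a) + (a + a)) y (sym (p₄ a))
      vertical′ : All (λ z → + 1 * (proj₁ z - (- (a + a) + (a + a) + 0ℤ)) ≤ 0ℤ * (proj₂ z - + 2)) (map mirrorZ Zs)
      vertical′ = vertical-at (- (a + a) + (a + a) + 0ℤ) (+ 2) (trans (ℤP.+-identityʳ (- (a + a) + (a + a))) (sym (p₄ a)))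
      p₁ : ∀ I a → + 4 * I + + 4 ≡ a + a + (+ 4 * I + + 8) + - (a + a + + 4)
      p₁ = ℤring 2 (λ I a → # 4 :* I :+ # 4 := a :+ a :+ (# 4 :* I :+ # 8) :+ :- (a :+ a :+ # 4))
      p₂ : ∀ I a → + 4 * I + + 4 + 0ℤ ≡ a + a + (+ 4 * I + + 8) + - (a + a + + 4) + - (+ 2 * I + + 2) + (a + a + (+ 4 * I + + 8) + - (a + a + + 4) + - (+ 2 * I + + 2))
      p₂ = ℤring 2 (λ I a → # 4 :* I :+ # 4 :+ # 0 := a :+ a :+ (# 4 :* I :+ # 8) :+ :- (a :+ a :+ # 4) :+ :- (# 2 :* I :+ # 2) :+ (a :+ a :+ (# 4 :* I :+ # 8) :+ :- (a :+ a :+ # 4) :+ :- (# 2 :* I :+ # 2)))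
      p₃ : ∀ I a → 0ℤ ≡ a + a + (+ 4 * I + + 8) + - (a + a + + 4) + - (+ 2 * I + + 2) + - (+ 2 * I + + 2)
      p₃ = ℤring 2 (λ I a → # 0 := a :+ a :+ (# 4 :* I :+ # 8) :+ :- (a :+ a :+ # 4) :+ :- (# 2 :* I :+ # 2) :+ :- (# 2 :* I :+ # 2))
      p₅ : ∀ a → 0ℤ + 0ℤ ≡ - (a + a) + (a + a) + 0ℤ + (- (a + a) + (a + a) + 0ℤ)
      p₅ = ℤring 1 (λ a → # 0 :+ # 0 := :- (a :+ a) :+ (a :+ a) :+ # 0 :+ (:- (a :+ a) :+ (a :+ a) :+ # 0))

  coprime-12 : Cop.Coprime 1 2
  coprime-12 = Cop.1-coprimeTo 2

  module _ (I : ℤ) (I≥2 : + 2 ≤ I) where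
    private
      Zs = Z-s I
      z₀ : 0ℤ ≤ I - + 2
      z₀ = diff I≥2
    hull-s : Hull (map halfPt (Z-s I))
    hull-s = int-hull Zs (famS-R I) famS-L (+ 4 * I + + 10) (- (+ 1))
      (coprime-1 (- (+ 6)) All.∷ coprime-1 (- (+ 2 * I + + 2)) All.∷ coprime-1 (- (+ 2 * I + + 2)) All.∷ All.[])
      (coprime-12 All.∷ coprime-1 0ℤ All.∷ All.[]) refl refl
      ( (bound (4 · z₀) (r₁ I) All.∷ bound (4 · z₀ ⊹ Z.+≤+ {0} {6} z≤n) (r₂ I) All.∷ bound (4 · z₀ ⊹ Z.+≤+ {0} {17} z≤n) (r₃ I) All.∷ by0 (r₄ I) All.∷ by0 (r₅ I) All.∷ All.[])
      , upper (+ 1) (+ 4 * I + + 10 + - (+ 6)) (q₁ I) , upper (+ 2) (+ 4 * I + + 10 + - (+ 6) + - (+ 2 * I + + 2)) (q₂ I) , tt)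
      ( (Z.+≤+ (s≤s (s≤s z≤n)) All.∷ ℤP.≤-reflexive refl All.∷ ℤP.≤-reflexive refl All.∷ bound (8 · z₀ ⊹ Z.+≤+ {0} {34} z≤n) (t₁ I) All.∷ bound (8 · z₀ ⊹ Z.+≤+ {0} {23} z≤n) (t₂ I) All.∷ All.[])
      , (ℤP.≤-reflexive refl All.∷ ℤP.≤-reflexive refl All.∷ Z.-≤+ All.∷ bound (4 · z₀ ⊹ Z.+≤+ {0} {18} z≤n) (t₃ I) All.∷ bound (4 · z₀ ⊹ Z.+≤+ {0} {12} z≤n) (t₄ I) All.∷ All.[]) , tt)
      (given (there (there (there (here refl)))) refl refl All.∷ given (there (there (there (there (here refl))))) (p₁ I) refl All.∷ mid (there (there (there (there (here refl))))) (here refl) (p₂ I) refl All.∷ given (here refl) (p₃ I) refl All.∷ All.[])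
      (given (there (there (here refl))) refl refl All.∷ given (there (here refl)) refl refl All.∷ given (here refl) refl refl All.∷ All.[])
      ((Z.+≤+ z≤n , ℤP.≤-refl) All.∷ (Z.+≤+ z≤n , Z.+≤+ (s≤s (s≤s z≤n))) All.∷ (ℤP.≤-refl , Z.+≤+ z≤n) All.∷ (ℤP.≤-refl , Z.+≤+ z≤n) All.∷ (Z.+≤+ z≤n , Z.+≤+ (s≤s z≤n)) All.∷ All.[])
      where
      r₁ : ∀ I → - (+ 6) * (+ 3 - 0ℤ) - + 1 * (0ℤ - (+ 4 * I + + 10)) ≡ + 4 * (I - + 2)
      r₁ = ℤring 1 (λ I → :- (# 6) :* (# 3 :- # 0) :- # 1 :* (# 0 :- (# 4 :* I :+ # 10)) := # 4 :* (I :- # 2))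
      r₂ : ∀ I → - (+ 6) * (+ 2 - 0ℤ) - + 1 * (0ℤ - (+ 4 * I + + 10)) ≡ + 4 * (I - + 2) + + 6
      r₂ = ℤring 1 (λ I → :- (# 6) :* (# 2 :- # 0) :- # 1 :* (# 0 :- (# 4 :* I :+ # 10)) := # 4 :* (I :- # 2) :+ # 6)
      r₃ : ∀ I → - (+ 6) * (0ℤ - 0ℤ) - + 1 * (+ 1 - (+ 4 * I + + 10)) ≡ + 4 * (I - + 2) + + 17
      r₃ = ℤring 1 (λ I → :- (# 6) :* (# 0 :- # 0) :- # 1 :* (# 1 :- (# 4 :* I :+ # 10)) := # 4 :* (I :- # 2) :+ # 17)
      r₄ : ∀ I → - (+ 6) * (0ℤ - 0ℤ) - + 1 * (+ 4 * I + + 10 - (+ 4 * I + + 10)) ≡ 0ℤ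
      r₄ = ℤring 1 (λ I → :- (# 6) :* (# 0 :- # 0) :- # 1 :* (# 4 :* I :+ # 10 :- (# 4 :* I :+ # 10)) := # 0)
      r₅ : ∀ I → - (+ 6) * (+ 1 - 0ℤ) - + 1 * (+ 4 * I + + 4 - (+ 4 * I + + 10)) ≡ 0ℤ
      r₅ = ℤring 1 (λ I → :- (# 6) :* (# 1 :- # 0) :- # 1 :* (# 4 :* I :+ # 4 :- (# 4 :* I :+ # 10)) := # 0)
      q₁ : ∀ I → + 4 * I + + 10 + - (+ 6) ≡ (+ 2 * I + + 2) * (+ 3 - + 1)
      q₁ = ℤring 1 (λ I → # 4 :* I :+ # 10 :+ :- (# 6) := (# 2 :* I :+ # 2) :* (# 3 :- # 1))
      q₂ : ∀ I → + 4 * I + + 10 + - (+ 6) + - (+ 2 * I + + 2) ≡ (+ 2 * I + + 2) * (+ 3 - + 2)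
      q₂ = ℤring 1 (λ I → # 4 :* I :+ # 10 :+ :- (# 6) :+ :- (# 2 :* I :+ # 2) := (# 2 :* I :+ # 2) :* (# 3 :- # 2))
      -- The two upper right edges lie on the line `x = (2I + 2)(3 - y)` through the apex, so their
      -- supporting inequalities are one computation.
      upper : ∀ y x → x ≡ (+ 2 * I + + 2) * (+ 3 - y) → All (λ z → + 1 * (proj₁ z - x) ≤ - (+ 2 * I + + 2) * (proj₂ z - y)) Zs
      upper y _ refl = by0 (u₁ I y) All.∷ bound (2 · z₀ ⊹ Z.+≤+ {0} {6} z≤n) (u₂ I y) All.∷ bound (6 · z₀ ⊹ Z.+≤+ {0} {17} z≤n) (u₃ I y) All.∷ bound (2 · z₀) (u₄ I y) All.∷ by0 (u₅ I y) All.∷ All.[]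
        where
        u₁ : ∀ I y → - (+ 2 * I + + 2) * (+ 3 - y) - + 1 * (0ℤ - (+ 2 * I + + 2) * (+ 3 - y)) ≡ 0ℤ
        u₁ = ℤring 2 (λ I y → :- (# 2 :* I :+ # 2) :* (# 3 :- y) :- # 1 :* (# 0 :- (# 2 :* I :+ # 2) :* (# 3 :- y)) := # 0)
        u₂ : ∀ I y → - (+ 2 * I + + 2) * (+ 2 - y) - + 1 * (0ℤ - (+ 2 * I + + 2) * (+ 3 - y)) ≡ + 2 * (I - + 2) + + 6
        u₂ = ℤring 2 (λ I y → :- (# 2 :* I :+ # 2) :* (# 2 :- y) :- # 1 :* (# 0 :- (# 2 :* I :+ # 2) :* (# 3 :- y)) := # 2 :* (I :- # 2) :+ # 6)
        u₃ : ∀ I y → - (+ 2 * I + + 2) * (0ℤ - y) - + 1 * (+ 1 - (+ 2 * I + + 2) * (+ 3 - y)) ≡ + 6 * (I - + 2) + + 17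
        u₃ = ℤring 2 (λ I y → :- (# 2 :* I :+ # 2) :* (# 0 :- y) :- # 1 :* (# 1 :- (# 2 :* I :+ # 2) :* (# 3 :- y)) := # 6 :* (I :- # 2) :+ # 17)
        u₄ : ∀ I y → - (+ 2 * I + + 2) * (0ℤ - y) - + 1 * (+ 4 * I + + 10 - (+ 2 * I + + 2) * (+ 3 - y)) ≡ + 2 * (I - + 2)
        u₄ = ℤring 2 (λ I y → :- (# 2 :* I :+ # 2) :* (# 0 :- y) :- # 1 :* (# 4 :* I :+ # 10 :- (# 2 :* I :+ # 2) :* (# 3 :- y)) := # 2 :* (I :- # 2))
        u₅ : ∀ I y → - (+ 2 * I + + 2) * (+ 1 - y) - + 1 * (+ 4 * I + + 4 - (+ 2 * I + + 2) * (+ 3 - y)) ≡ 0ℤ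
        u₅ = ℤring 2 (λ I y → :- (# 2 :* I :+ # 2) :* (# 1 :- y) :- # 1 :* (# 4 :* I :+ # 4 :- (# 2 :* I :+ # 2) :* (# 3 :- y)) := # 0)
      t₁ : ∀ I → + 1 * (0ℤ - 0ℤ) - + 2 * (- (+ 4 * I + + 10) - - (+ 1)) ≡ + 8 * (I - + 2) + + 34
      t₁ = ℤring 1 (λ I → # 1 :* (# 0 :- # 0) :- # 2 :* (:- (# 4 :* I :+ # 10) :- :- (# 1)) := # 8 :* (I :- # 2) :+ # 34)
      t₂ : ∀ I → + 1 * (+ 1 - 0ℤ) - + 2 * (- (+ 4 * I + + 4) - - (+ 1)) ≡ + 8 * (I - + 2) + + 23
      t₂ = ℤring 1 (λ I → # 1 :* (# 1 :- # 0) :- # 2 :* (:- (# 4 :* I :+ # 4) :- :- (# 1)) := # 8 :* (I :- # 2) :+ # 23)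
      t₃ : ∀ I → 0ℤ * (0ℤ - + 2) - + 1 * (- (+ 4 * I + + 10) - 0ℤ) ≡ + 4 * (I - + 2) + + 18
      t₃ = ℤring 1 (λ I → # 0 :* (# 0 :- # 2) :- # 1 :* (:- (# 4 :* I :+ # 10) :- # 0) := # 4 :* (I :- # 2) :+ # 18)
      t₄ : ∀ I → 0ℤ * (+ 1 - + 2) - + 1 * (- (+ 4 * I + + 4) - 0ℤ) ≡ + 4 * (I - + 2) + + 12
      t₄ = ℤring 1 (λ I → # 0 :* (# 1 :- # 2) :- # 1 :* (:- (# 4 :* I :+ # 4) :- # 0) := # 4 :* (I :- # 2) :+ # 12)
      p₁ : ∀ I → + 4 * I + + 4 ≡ + 4 * I + + 10 + - (+ 6)
      p₁ = ℤring 1 (λ I → # 4 :* I :+ # 4 := # 4 :* I :+ # 10 :+ :- (# 6))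
      p₂ : ∀ I → + 4 * I + + 4 + 0ℤ ≡ + 4 * I + + 10 + - (+ 6) + - (+ 2 * I + + 2) + (+ 4 * I + + 10 + - (+ 6) + - (+ 2 * I + + 2))
      p₂ = ℤring 1 (λ I → # 4 :* I :+ # 4 :+ # 0 := # 4 :* I :+ # 10 :+ :- (# 6) :+ :- (# 2 :* I :+ # 2) :+ (# 4 :* I :+ # 10 :+ :- (# 6) :+ :- (# 2 :* I :+ # 2)))
      p₃ : ∀ I → 0ℤ ≡ + 4 * I + + 10 + - (+ 6) + - (+ 2 * I + + 2) + - (+ 2 * I + + 2)
      p₃ = ℤring 1 (λ I → # 0 := # 4 :* I :+ # 10 :+ :- (# 6) :+ :- (# 2 :* I :+ # 2) :+ :- (# 2 :* I :+ # 2))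

  hull-s3 : Hull (map halfPt Z-s3)
  hull-s3 = int-hull Z-s3 famS3-R famS-L (+ 23) (- (+ 1)) (cop All.∷ coprime-1 (- (+ 8)) All.∷ All.[]) (coprime-12 All.∷ coprime-1 0ℤ All.∷ All.[]) refl refl
      (from-yes (All.all? (λ z → + 2 * (proj₁ z - + 23) Z.≤? - (+ 15) * (proj₂ z - 0ℤ)) Z-s3) , from-yes (All.all? (λ z → + 1 * (proj₁ z - + 8) Z.≤? - (+ 8) * (proj₂ z - + 2)) Z-s3) , tt)
      (from-yes (All.all? (λ z → + 2 * (proj₁ z - - (+ 1)) Z.≤? + 1 * (proj₂ z - 0ℤ)) (map mirrorZ Z-s3)) , from-yes (All.all? (λ z → + 1 * (proj₁ z - 0ℤ) Z.≤? 0ℤ * (proj₂ z - + 2)) (map mirrorZ Z-s3)) , tt)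
      (given (there (there (there (here refl)))) refl refl All.∷ given (there (there (there (there (here refl))))) refl refl All.∷ given (here refl) refl refl All.∷ All.[])
      (given (there (there (here refl))) refl refl All.∷ given (there (here refl)) refl refl All.∷ given (here refl) refl refl All.∷ All.[])
      ((Z.+≤+ z≤n , ℤP.≤-refl) All.∷ (Z.+≤+ z≤n , Z.+≤+ (s≤s (s≤s z≤n))) All.∷ (ℤP.≤-refl , Z.+≤+ z≤n) All.∷ (ℤP.≤-refl , Z.+≤+ z≤n) All.∷ (Z.+≤+ z≤n , Z.+≤+ (s≤s (s≤s z≤n))) All.∷ All.[])
    where
    open import Relation.Nullary.Decidable using (from-yes)
    cop : Cop.Coprime 15 2
    cop = Cop.gcd≡1⇒coprime refl
open Families public

-- The polygons of the theorem satisfy the conditions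

module Converse where
  open Z using (_≤_; _<_; _+_; _*_; _-_; -_)
  open ℤArith

  make-balance : ∀ {I R L x x′ y d d′ N N′ E E′ A A′ J J′} → Profile R x y d N E A J → Profile L x′ y d′ N′ E′ A′ J′ →
    N + N′ + (x + x′) ≡ + 4 * I + + 14 → x + + 3 * d + E + (x′ + + 3 * d′ + E′) ≡ 0ℤ → + 6 * x + + 9 * d + A + (+ 6 * x′ + + 9 * d′ + A′) ≡ + 16 * I + + 20 →
    x + + 2 * d + J + (x′ + + 2 * d′ + J′) ≡ + 2 * I → Balance I R L x x′ y
  make-balance {x = x} {x′} p p′ h₁ h₂ h₃ h₄ = balance (trans (cong (λ q → q + (x + x′)) (cong₂ _+_ p.length≡ p′.length≡)) h₁) (trans (cong₂ _+_ p.end p′.end) h₂)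
      (trans (cong₂ _+_ p.area≡ p′.area≡) h₃) (trans (cong₂ _+_ p.inner≡ p′.inner≡) h₄)
    where
    module p = Profile p
    module p′ = Profile p′

  -- Both chains alternate, the bottom row is even and the top side has length zero, so `β` and `β′`
  -- coincide.
  balance→special : ∀ {S} (P : Hull S) i {d d′ N N′ E E′ A A′ J J′} → IsPolygon S → Denom2 S → ev (Hull.y₀ P) ≡ 1ℤ →
    Profile (Hull.R P) (Hull.xR P) (Hull.y₀ P) d N E A J → Profile (Hull.L P) (Hull.xL P) (Hull.y₀ P) d′ N′ E′ A′ J′ →
    Balance (+ i) (Hull.R P) (Hull.L P) (Hull.xR P) (Hull.xL P) (Hull.y₀ P) → Special i S
  balance→special P i poly den ey p p′ (balance g₁ g₂ g₃ g₄) = conditions→special P poly {i} den (conditions (trans b (sym b′)) b′ g₃ g₄)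
    where
    open Hull P
    open Numbers P
    module p = Profile p
    module p′ = Profile p′
    b : β ≡ + 4 * + i + + 14
    b = trans (cong (λ q → + length R + + length L + (Qb + q)) g₂) (trans (cong (λ q → + length R + + length L + q) (ℤP.+-identityʳ Qb)) g₁)
    b′ : β′ ≡ + 4 * + i + + 14
    b′ = trans (cong₂ _+_ (cong₂ _+_ p.alternates p′.alternates) (trans (cong₂ (λ e q → Qb * e + q * ev yₙ) ey g₂) (l Qb (ev yₙ)))) g₁
      where
      l : ∀ Q e → Q * 1ℤ + 0ℤ * e ≡ Q
      l = ℤring 2 (λ Q e → Q :* # 1 :+ # 0 :* e := Q)

  0≤0 : 0ℤ ≤ 0ℤ
  0≤0 = ℤP.≤-refl

  special-a : ∀ i a → 0ℤ ≤ a → a ≤ + i - 1ℤ → IsPolygon (map halfPt (Z-a (+ i) a)) → Special i (map halfPt (Z-a (+ i) a))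
  special-a i a a≥0 a≤ poly = balance→special (hull-a (+ i) a a≥0 a≤) i poly
      (denom2 (Z-a (+ i) a) (here refl) ((ℤP.≤-refl , λ _ → 0≤0) All.∷ (Z.+≤+ (s≤s z≤n) , λ ()) All.∷ (Z.+≤+ z≤n , λ ()) All.∷ (Z.+≤+ z≤n , λ ()) All.∷ (Z.+≤+ (s≤s z≤n) , λ ()) All.∷ All.[])) refl
      pR pL (make-balance pR pL (l₁ (+ i) a) (l₂ (+ i) a) (l₃ (+ i) a) (l₄ (+ i) a))
    where
    open EvenStart 0ℤ refl
    -- Both chains have shape A; their parameters `i - 1 - a` and `a` add up to `i - 1`, as found in
    -- `cases-AA`.
    pR = profile-A {famA-R (+ i) a} {a + a + (+ 4 * + i + + 8)} (a + (+ 2 * + i + + 4)) (+ i - 1ℤ - a) 0ℤ (- (+ 2 * + i + + 2)) (k₁ (+ i) a) (cong₂ (λ p q → (p , 0) ∷ (q , 0) ∷ (- (+ 2 * + i + + 2) , 0) ∷ []) (k₂ (+ i) a) (k₃ (+ i)))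
      where
      k₁ : ∀ I a → a + a + (+ 4 * I + + 8) ≡ a + (+ 2 * I + + 4) + (a + (+ 2 * I + + 4))
      k₁ = ℤring 2 (λ I a → a :+ a :+ (# 4 :* I :+ # 8) := a :+ (# 2 :* I :+ # 4) :+ (a :+ (# 2 :* I :+ # 4)))
      k₂ : ∀ I a → - (a + a + + 4) ≡ - (+ 2 * I + + 2) + 0ℤ + (I - 1ℤ - a + (I - 1ℤ - a))
      k₂ = ℤring 2 (λ I a → :- (a :+ a :+ # 4) := :- (# 2 :* I :+ # 2) :+ # 0 :+ (I :- # 1 :- a :+ (I :- # 1 :- a)))
      k₃ : ∀ I → - (+ 2 * I + + 2) ≡ - (+ 2 * I + + 2) + 0ℤ
      k₃ = ℤring 1 (λ I → :- (# 2 :* I :+ # 2) := :- (# 2 :* I :+ # 2) :+ # 0)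
    pL = profile-A {famA-L (+ i) a} { - (a + a)} (- a) a 0ℤ 0ℤ (k₁ a) (cong (λ p → (p , 0) ∷ (0ℤ , 0) ∷ (0ℤ , 0) ∷ []) (k₂ a))
      where
      k₁ : ∀ a → - (a + a) ≡ - a + - a
      k₁ = ℤring 1 (λ a → :- (a :+ a) := :- a :+ :- a)
      k₂ : ∀ a → a + a ≡ 0ℤ + 0ℤ + (a + a)
      k₂ = ℤring 1 (λ a → a :+ a := # 0 :+ # 0 :+ (a :+ a))
    l₁ : ∀ I a → + 3 + + 3 + (a + a + (+ 4 * I + + 8) + - (a + a)) ≡ + 4 * I + + 14
    l₁ = ℤring 2 (λ I a → # 3 :+ # 3 :+ (a :+ a :+ (# 4 :* I :+ # 8) :+ :- (a :+ a)) := # 4 :* I :+ # 14)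
    l₂ : ∀ I a → a + a + (+ 4 * I + + 8) + + 3 * - (+ 2 * I + + 2) + + 2 * (I - 1ℤ - a + 0ℤ) + (- (a + a) + + 3 * 0ℤ + + 2 * (a + 0ℤ)) ≡ 0ℤ
    l₂ = ℤring 2 (λ I a → a :+ a :+ (# 4 :* I :+ # 8) :+ # 3 :* :- (# 2 :* I :+ # 2) :+ # 2 :* (I :- # 1 :- a :+ # 0) :+ (:- (a :+ a) :+ # 3 :* # 0 :+ # 2 :* (a :+ # 0)) := # 0)
    l₃ : ∀ I a → + 6 * (a + a + (+ 4 * I + + 8)) + + 9 * - (+ 2 * I + + 2) + (+ 10 * (I - 1ℤ - a) + + 8 * 0ℤ) + (+ 6 * - (a + a) + + 9 * 0ℤ + (+ 10 * a + + 8 * 0ℤ)) ≡ + 16 * I + + 20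
    l₃ = ℤring 2 (λ I a → # 6 :* (a :+ a :+ (# 4 :* I :+ # 8)) :+ # 9 :* :- (# 2 :* I :+ # 2) :+ (# 10 :* (I :- # 1 :- a) :+ # 8 :* # 0) :+ (# 6 :* :- (a :+ a) :+ # 9 :* # 0 :+ (# 10 :* a :+ # 8 :* # 0)) := # 16 :* I :+ # 20)
    l₄ : ∀ I a → a + a + (+ 4 * I + + 8) + + 2 * - (+ 2 * I + + 2) + (+ 2 * (I - 1ℤ - a + 0ℤ) - 1ℤ) + (- (a + a) + + 2 * 0ℤ + (+ 2 * (a + 0ℤ) - 1ℤ)) ≡ + 2 * I
    l₄ = ℤring 2 (λ I a → a :+ a :+ (# 4 :* I :+ # 8) :+ # 2 :* :- (# 2 :* I :+ # 2) :+ (# 2 :* (I :- # 1 :- a :+ # 0) :- # 1) :+ (:- (a :+ a) :+ # 2 :* # 0 :+ (# 2 :* (a :+ # 0) :- # 1)) := # 2 :* I)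

  module _ where
    open EvenStart 0ℤ refl
    pL-s : Profile famS-L (- (+ 1)) 0ℤ 0ℤ (+ 2) (+ 2 * 0ℤ + 1ℤ) (+ 8 * 0ℤ + + 4) (+ 2 * 0ℤ)
    pL-s = profile-B (- 1ℤ) 0ℤ 0ℤ refl refl

  special-s : ∀ i → + 2 ≤ + i → IsPolygon (map halfPt (Z-s (+ i))) → Special i (map halfPt (Z-s (+ i)))
  special-s i i≥2 poly = balance→special (hull-s (+ i) i≥2) i poly
      (denom2 (Z-s (+ i)) (here refl) ((ℤP.≤-refl , λ _ → 0≤0) All.∷ (Z.+≤+ (s≤s (s≤s z≤n)) , λ ()) All.∷ (Z.+≤+ z≤n , λ ()) All.∷ (Z.+≤+ z≤n , λ ()) All.∷ (Z.+≤+ (s≤s z≤n) , λ ()) All.∷ All.[])) refl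
      pR pL-s (make-balance pR pL-s (l₁ (+ i)) (l₂ (+ i)) (l₃ (+ i)) (l₄ (+ i)))
    where
    open EvenStart 0ℤ refl
    pR = profile-A {famS-R (+ i)} {+ 4 * + i + + 10} (+ 2 * + i + + 5) (+ i - + 2) 0ℤ (- (+ 2 * + i + + 2)) (k₁ (+ i)) (cong₂ (λ p q → (p , 0) ∷ (q , 0) ∷ (- (+ 2 * + i + + 2) , 0) ∷ []) (k₂ (+ i)) (k₃ (+ i)))
      where
      k₁ : ∀ I → + 4 * I + + 10 ≡ + 2 * I + + 5 + (+ 2 * I + + 5)
      k₁ = ℤring 1 (λ I → # 4 :* I :+ # 10 := # 2 :* I :+ # 5 :+ (# 2 :* I :+ # 5))
      k₂ : ∀ I → - (+ 6) ≡ - (+ 2 * I + + 2) + 0ℤ + (I - + 2 + (I - + 2))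
      k₂ = ℤring 1 (λ I → :- (# 6) := :- (# 2 :* I :+ # 2) :+ # 0 :+ (I :- # 2 :+ (I :- # 2)))
      k₃ : ∀ I → - (+ 2 * I + + 2) ≡ - (+ 2 * I + + 2) + 0ℤ
      k₃ = ℤring 1 (λ I → :- (# 2 :* I :+ # 2) := :- (# 2 :* I :+ # 2) :+ # 0)
    l₁ : ∀ I → + 3 + + 2 + (+ 4 * I + + 10 + - (+ 1)) ≡ + 4 * I + + 14
    l₁ = ℤring 1 (λ I → # 3 :+ # 2 :+ (# 4 :* I :+ # 10 :+ :- (# 1)) := # 4 :* I :+ # 14)
    l₂ : ∀ I → + 4 * I + + 10 + + 3 * - (+ 2 * I + + 2) + + 2 * (I - + 2 + 0ℤ) + (- (+ 1) + + 3 * 0ℤ + (+ 2 * 0ℤ + 1ℤ)) ≡ 0ℤ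
    l₂ = ℤring 1 (λ I → # 4 :* I :+ # 10 :+ # 3 :* :- (# 2 :* I :+ # 2) :+ # 2 :* (I :- # 2 :+ # 0) :+ (:- (# 1) :+ # 3 :* # 0 :+ (# 2 :* # 0 :+ # 1)) := # 0)
    l₃ : ∀ I → + 6 * (+ 4 * I + + 10) + + 9 * - (+ 2 * I + + 2) + (+ 10 * (I - + 2) + + 8 * 0ℤ) + (+ 6 * - (+ 1) + + 9 * 0ℤ + (+ 8 * 0ℤ + + 4)) ≡ + 16 * I + + 20
    l₃ = ℤring 1 (λ I → # 6 :* (# 4 :* I :+ # 10) :+ # 9 :* :- (# 2 :* I :+ # 2) :+ (# 10 :* (I :- # 2) :+ # 8 :* # 0) :+ (# 6 :* :- (# 1) :+ # 9 :* # 0 :+ (# 8 :* # 0 :+ # 4)) := # 16 :* I :+ # 20)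
    l₄ : ∀ I → + 4 * I + + 10 + + 2 * - (+ 2 * I + + 2) + (+ 2 * (I - + 2 + 0ℤ) - 1ℤ) + (- (+ 1) + + 2 * 0ℤ + + 2 * 0ℤ) ≡ + 2 * I
    l₄ = ℤring 1 (λ I → # 4 :* I :+ # 10 :+ # 2 :* :- (# 2 :* I :+ # 2) :+ (# 2 :* (I :- # 2 :+ # 0) :- # 1) :+ (:- (# 1) :+ # 2 :* # 0 :+ # 2 :* # 0) := # 2 :* I)

  special-s3 : IsPolygon (map halfPt Z-s3) → Special 3 (map halfPt Z-s3)
  special-s3 poly = balance→special hull-s3 3 poly
      (denom2 Z-s3 (here refl) ((ℤP.≤-refl , λ _ → 0≤0) All.∷ (Z.+≤+ (s≤s (s≤s z≤n)) , λ ()) All.∷ (Z.+≤+ z≤n , λ ()) All.∷ (Z.+≤+ z≤n , λ ()) All.∷ (Z.+≤+ (s≤s (s≤s z≤n)) , λ ()) All.∷ All.[])) refl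
      pR pL-s (make-balance {+ 3} pR pL-s refl refl refl refl)
    where
    open EvenStart 0ℤ refl
    pR : Profile famS3-R (+ 23) 0ℤ (- (+ 8)) (+ 2) (+ 2 * 0ℤ + 1ℤ) (+ 8 * 0ℤ + + 4) (+ 2 * 0ℤ)
    pR = profile-B (+ 11) 0ℤ (- (+ 8)) refl refl

  pull-special : ∀ {i S T} → (IsPolygon T → Special i T) → IsPolygon S → AffEquiv S T → Special i S
  pull-special h (x , ix) e = let (f , q) = fromEquiv e in special-eqv f q (h (applyAU f x , proj₁ (eqv-interior f q x) ix))
open Converse public

-- From the specification to the normal forms

module Direct where
  open Z using (_≤_; _<_; _+_; _*_; _-_; -_)
  open ℤArith

  Normal : ℕ → List Pt → Set
  Normal i S = (Σ ℤ λ a → 0ℤ ≤ a × + 2 * a ≤ + i - + 1 × AffEquiv S (map halfPt (Z-a (+ i) a))) ⊎ (2 N.≤ i × AffEquiv S (map halfPt (Z-s (+ i)))) ⊎ (i ≡ 3 × AffEquiv S (map halfPt Z-s3))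

  normal-pull : ∀ {i S T} → AffEquiv S T → Normal i T → Normal i S
  normal-pull e (inj₁ (a , p , q , g)) = inj₁ (a , p , q , AffEquiv-trans e g)
  normal-pull e (inj₂ (inj₁ (p , g))) = inj₂ (inj₁ (p , AffEquiv-trans e g))
  normal-pull e (inj₂ (inj₂ (p , g))) = inj₂ (inj₂ (p , AffEquiv-trans e g))

  classify : ∀ {I R L x x′ y} → ev y ≡ 1ℤ → Shape x R → Shape x′ L → Balance I R L x x′ y → Outcome I R L x x′ y ⊎ Outcome I L R x′ x y
  classify {I} {R} {L} {x} {x′} {y} e s s′ = go (ev≡1 y e)
    where
    go : (Σ ℤ λ u → y ≡ u + u) → Balance I R L x x′ y → Outcome I R L x x′ y ⊎ Outcome I L R x′ x y
    go (u , refl) b = classify-shapes {I} {u} s s′ b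

  normalize : ∀ {i S} (P : Hull S) → Outcome (+ i) (Hull.R P) (Hull.L P) (Hull.xR P) (Hull.xL P) (Hull.y₀ P) → Normal i S
  normalize {i} P (family-a a a≥0 a≤ 2a≤ m) = inj₁ (a , a≥0 , 2a≤ , sheared-equiv P (hull-a (+ i) a a≥0 a≤) m)
  normalize {i} P (family-s i≥2 m) = inj₂ (inj₁ (ℤP.drop‿+≤+ i≥2 , sheared-equiv P (hull-s (+ i) i≥2) m))
  normalize P (family-s3 i≡3 m) = inj₂ (inj₂ (ℤP.+-injective i≡3 , sheared-equiv P hull-s3 m))

  reduced-normal : ∀ {i S} → Reduced i S → Normal i S
  reduced-normal {i} {S} (reduced T f eqv sp P three even-bottom) = normal-pull (toEquiv f eqv) (both (classify even-bottom
      (shape y₀ even-bottom R xR primR three supR verR altR) (shape y₀ even-bottom L xL primL (trans heights three) supL verL altL)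
      (balance (trans (cong (λ q → + length R + + length L + q) (sym (trans (cong (λ q → Qb + q) Qt≡0) (ℤP.+-identityʳ Qb)))) (trans alternating boundary-number)) Qt≡0 area-number interior-number)))
    where
    open Hull P
    open Numbers P
    open Conditions (special→conditions P (Special.polygon sp) sp)
    open Alternating (alternating-facts P alternating)
    -- The top row has height `y₀ + 3`, hence is odd, so the top side has length zero.
    Qt≡0 : Qt ≡ 0ℤ
    Qt≡0 = trans (sym top) (trans (cong (λ q → Qt * q) (trans (cong (λ n → ev (y₀ + + n)) three) (EvenStart.ev₃ y₀ even-bottom))) (ℤP.*-zeroʳ Qt))
    both : Outcome (+ i) R L xR xL y₀ ⊎ Outcome (+ i) L R xL xR y₀ → Normal i T
    both (inj₁ o) = normalize P o
    -- Here the roles of the chains are exchanged, so the outcome describes the mirror image.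
    both (inj₂ o) = normal-pull (toEquiv mirrorAU (mirror-eqv T)) (normalize (mirror-hull P) o)

  special-normal : ∀ {i S} → 1 N.≤ i → Special i S → Normal i S
  special-normal {i} i≥1 sp = let P = special-hull sp in reduced-normal (descent (height (Hull.R P)) i≥1 sp P ℕP.≤-refl)
open Direct public

theorem7p2 : (i : ℕ) → 1 N.≤ i → (S : List Pt) → IsPolygon S →
  (PseudoIntegral S × Denom2 S × HasCount (InteriorLattice S) i ×
     HasCount (BoundaryLattice S) (2 N.* i N.+ 7))
  ⇔
  ((Σ ℤ λ a → (+ 0 Z.≤ a) × ((+ 2) Z.* a Z.≤ (+ i) Z.- (+ 1)) × AffEquiv S (P-a i a))
   ⊎ (2 N.≤ i × AffEquiv S (P-s i))
   ⊎ (i ≡ 3 × AffEquiv S P-s3))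
theorem7p2 i i≥1 S poly = mk⇔ (λ { (ps , den , inn , bd) → named (special-normal i≥1 (special poly ps den inn bd)) }) (λ h → unpack (realize h))
  where
  Named : Set
  Named = (Σ ℤ λ a → (+ 0 Z.≤ a) × ((+ 2) Z.* a Z.≤ (+ i) Z.- (+ 1)) × AffEquiv S (P-a i a)) ⊎ (2 N.≤ i × AffEquiv S (P-s i)) ⊎ (i ≡ 3 × AffEquiv S P-s3)
  named : Normal i S → Named
  named (inj₁ (a , p , q , e)) = inj₁ (a , p , q , subst (AffEquiv S) (sym (P-a≡ i a)) e)
  named (inj₂ (inj₁ (p , e))) = inj₂ (inj₁ (p , subst (AffEquiv S) (sym (P-s≡ i)) e))
  named (inj₂ (inj₂ (p , e))) = inj₂ (inj₂ (p , subst (AffEquiv S) (sym P-s3≡) e))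
  realize : Named → Special i S
  -- The supporting inequalities of the family need `a ≤ i - 1`, which follows from `2a ≤ i - 1`
  -- because `a` is nonnegative.
  realize (inj₁ (a , p , q , e)) = pull-special (special-a i a p (ℤArith.bound (ℤArith._⊹_ (ℤArith.diff q) p) (l (+ i) a))) poly (subst (AffEquiv S) (P-a≡ i a) e)
    where
    l : ∀ I a → I Z.- 1ℤ Z.- a ≡ I Z.- + 1 Z.- + 2 Z.* a Z.+ a
    l = ℤring 2 (λ I a → I :- # 1 :- a := I :- # 1 :- # 2 :* a :+ a)
  realize (inj₂ (inj₁ (p , e))) = pull-special (special-s i (Z.+≤+ p)) poly (subst (AffEquiv S) (P-s≡ i) e)
  realize (inj₂ (inj₂ (p , e))) = subst (λ i → Special i S) (sym p) (pull-special special-s3 poly (subst (AffEquiv S) P-s3≡ e))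
  unpack : Special i S → PseudoIntegral S × Denom2 S × HasCount (InteriorLattice S) i × HasCount (BoundaryLattice S) (2 N.* i N.+ 7)
  unpack (special _ ps den inn bd) = ps , den , inn , bd
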